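{- Let $k \geq 2$ be an integer, let $d = 2k-1$, and let $P \subset \mathbb{R}^d$ be an empty simplex of dimension $d$ whose $\delta$-polynomial is $\delta_P(t) = 1 + (m-1)t^k$ for some integer $m \geq 2$. Then the dilation $kP$ has a regular unimodular triangulation if and only if $P$ is unimodularly equivalent to the convex hull of $$\left\{\mathbf{0}, \mathbf{e}_1, \ldots, \mathbf{e}_{d-1}, \sum_{i=1}^{k-1}\mathbf{e}_i + (m-1)\sum_{j=k}^{d-1}\mathbf{e}_j + m\mathbf{e}_d\right\}.$$
   Context: An integral convex polytope is one whose vertices lie in $\mathbb{Z}^d$. For an integral convex polytope $P\subset\mathbb{R}^d$ of dimension $d$, its $\delta$-polynomial (Ehrhart $h^*$-polynomial) $\delta_P(t)$ is defined by $\sum_{n\ge 0}|nP\cap\mathbb{Z}^d|t^n = \delta_P(t)/(1-t)^{d+1}$, where $nP=\{n\alpha : \alpha\in P\}$. An integral simplex is empty if its only lattice points are its vertices. Two integral polytopes are unimodularly equivalent if one is mapped onto the other by an affine map $x\mapsto Ux+c$ with $U\in GL_d(\mathbb{Z})$, $c\in\mathbb{Z}^d$. $\mathbf{e}_1,\ldots,\mathbf{e}_d$ are the standard unit vectors and $\mathbf{0}$ the origin. A unimodular triangulation of an integral polytope $Q$ is a triangulation of $Q$ whose vertices are lattice points of $Q$ and each of whose maximal simplices has normalized volume $1$ (i.e., is unimodular); it is regular if it is induced as the projection of the lower faces of the lifted point configuration for some height function on the lattice points of $Q$. -}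

module Defs where

open import Data.Nat as ℕ using (ℕ; zero; suc)
open import Data.Nat.Combinatorics using (_C_)
open import Data.Integer as ℤ using (ℤ; +_; ∣_∣)
open import Data.Rational as ℚ using (ℚ; 0ℚ; 1ℚ)
open import Data.Fin using (Fin; toℕ)
open import Data.Vec using (Vec; []; _∷_; lookup; tabulate; map; zipWith; foldr; removeAt; head; tail; allFin)
open import Data.Vec.Relation.Unary.All using (All)
open import Data.List using (List; length)
open import Data.List.Relation.Unary.Unique.Propositional using (Unique)
open import Data.List.Membership.Propositional using (_∈_)
open import Data.List.Relation.Unary.Any using (Any)
open import Data.Product using (Σ; ∃; _×_; _,_)
open import Relation.Nullary using (¬_; Dec; yes; no)
open import Relation.Binary.PropositionalEquality using (_≡_; _≢_)

ZPt : ℕ → Set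
ZPt d = Vec ℤ d

QPt : ℕ → Set
QPt d = Vec ℚ d

toQ : ℤ → ℚ
toQ z = z ℚ./ 1

toQPt : ∀ {d} → ZPt d → QPt d
toQPt = map toQ

sumℚ : ∀ {n} → Vec ℚ n → ℚ
sumℚ = foldr _ ℚ._+_ 0ℚ

sumℤ : ∀ {n} → Vec ℤ n → ℤ
sumℤ = foldr _ ℤ._+_ (+ 0)

combo : ∀ {d n} → Vec ℚ n → Vec (ZPt d) n → QPt d
combo w V = tabulate λ i → sumℚ (zipWith (λ wj vj → wj ℚ.* toQ (lookup vj i)) w V)

InConv : ∀ {d n} → Vec (ZPt d) n → QPt d → Set
InConv {n = n} V x =
  Σ (Vec ℚ n) λ w → All (λ c → 0ℚ ℚ.≤ c) w × sumℚ w ≡ 1ℚ × combo w V ≡ x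

InConvCommon : ∀ {d n} → Vec (ZPt d) n → Vec (ZPt d) n → QPt d → Set
InConvCommon {n = n} σ τ x =
  Σ (Vec ℚ n) λ w → All (λ c → 0ℚ ℚ.≤ c) w × sumℚ w ≡ 1ℚ × combo w σ ≡ x
    × (∀ j → lookup w j ≢ 0ℚ → ∃ λ j′ → lookup σ j ≡ lookup τ j′)

LatticeIn : ∀ {d n} → Vec (ZPt d) n → ZPt d → Set
LatticeIn V x = InConv V (toQPt x)

dilate : ∀ {d n} → ℕ → Vec (ZPt d) n → Vec (ZPt d) n
dilate c = map (map ((+ c) ℤ.*_))

det : ∀ n → Vec (Vec ℤ n) n → ℤ
det zero [] = + 1
det (suc n) (row ∷ rows) =
  sumℤ (tabulate λ j → sign j ℤ.* lookup row j ℤ.* det n (map (λ r → removeAt r j) rows))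
  where
  sign : Fin (suc n) → ℤ
  sign j with ℕ._%_ (toℕ j) 2
  ... | zero = + 1
  ... | suc _ = ℤ.- (+ 1)

edgeMatrix : ∀ {d} → Vec (ZPt d) (suc d) → Vec (Vec ℤ d) d
edgeMatrix s = map (λ v → zipWith ℤ._-_ v (head s)) (tail s)

FullDimSimplex : ∀ {d} → Vec (ZPt d) (suc d) → Set
FullDimSimplex {d} s = det d (edgeMatrix s) ≢ + 0

Unimodular : ∀ {d} → Vec (ZPt d) (suc d) → Set
Unimodular {d} s = ∣ det d (edgeMatrix s) ∣ ≡ 1

EmptySimplex : ∀ {d} → Vec (ZPt d) (suc d) → Set
EmptySimplex s = ∀ x → LatticeIn s x → ∃ λ j → lookup s j ≡ x

HasCard : ∀ {d} → (ZPt d → Set) → ℕ → Set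
HasCard {d} S N = Σ (List (ZPt d)) λ L →
  Unique L × length L ≡ N × (∀ x → (x ∈ L → S x) × (S x → x ∈ L))

EhrhartFn : ∀ {d} → Vec (ZPt d) (suc d) → (ℕ → ℕ) → Set
EhrhartFn P L = ∀ n → HasCard (LatticeIn (dilate n P)) (L n)

-- coefficient of t^n in (1 - t)^(d+1) · Σ_n L(n) t^n
deltaCoeff : ℕ → (ℕ → ℕ) → ℕ → ℤ
deltaCoeff d L n = sumℤ (tabulate {n = suc n} λ i →
  sgn (toℕ i) ℤ.* + ((suc d) C (toℕ i)) ℤ.* + L (n ℕ.∸ toℕ i))
  where
  sgn : ℕ → ℤ
  sgn i with ℕ._%_ i 2
  ... | zero = + 1
  ... | suc _ = ℤ.- (+ 1)

target : ℕ → ℕ → ℕ → ℤ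
target k m n with n ℕ.≟ 0 | n ℕ.≟ k
... | yes _ | _ = + 1
... | no _ | yes _ = + (m ℕ.∸ 1)
... | no _ | no _ = + 0

DeltaIs1PlusMt^k : ∀ {d} → Vec (ZPt d) (suc d) → ℕ → ℕ → Set
DeltaIs1PlusMt^k {d} P k m =
  Σ (ℕ → ℕ) λ L → EhrhartFn P L × (∀ n → deltaCoeff d L n ≡ target k m n)

IsUnimodTriangulation : ∀ {d n} → Vec (ZPt d) n → List (Vec (ZPt d) (suc d)) → Set
IsUnimodTriangulation {d} V T =
  (∀ {σ} → σ ∈ T → All (LatticeIn V) σ × Unimodular σ)
  × (∀ (x : QPt d) → InConv V x → Any (λ σ → InConv σ x) T)
  × (∀ {σ τ} → σ ∈ T → τ ∈ T → ∀ x → InConv σ x → InConv τ x → InConvCommon σ τ x)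

affine : ∀ {d} → QPt d → ℚ → ZPt d → ℚ
affine a b x = sumℚ (zipWith ℚ._*_ a (toQPt x)) ℚ.+ b

-- T is the regular subdivision induced by heights ω on the lattice points of Q:
-- every maximal cell is a lower facet of the lifted configuration
IsRegular : ∀ {d n} → Vec (ZPt d) n → List (Vec (ZPt d) (suc d)) → Set
IsRegular {d} V T = Σ (ZPt d → ℚ) λ ω → ∀ {σ} → σ ∈ T →
  Σ (QPt d) λ a → Σ ℚ λ b →
    (∀ j → affine a b (lookup σ j) ≡ ω (lookup σ j))
    × (∀ x → LatticeIn V x → ¬ (∃ λ j → lookup σ j ≡ x) → affine a b x ℚ.< ω x)

HasRegUnimodTriangulation : ∀ {d n} → Vec (ZPt d) n → Set
HasRegUnimodTriangulation {d} {n} V = Σ (List (Vec (ZPt d) (suc d))) λ T →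
  IsUnimodTriangulation V T × IsRegular V T

Mat : ℕ → Set
Mat d = Vec (Vec ℤ d) d

matMul : ∀ {d} → Mat d → Mat d → Mat d
matMul A B = map (λ row → tabulate λ j → sumℤ (zipWith ℤ._*_ row (map (λ r → lookup r j) B))) A

idMat : ∀ d → Mat d
idMat d = tabulate λ i → tabulate λ j → idEntry (toℕ i) (toℕ j)
  where
  idEntry : ℕ → ℕ → ℤ
  idEntry i j with i ℕ.≟ j
  ... | yes _ = + 1
  ... | no _ = + 0

affMapQ : ∀ {d} → Mat d → ZPt d → QPt d → QPt d
affMapQ U c x = tabulate λ i →
  sumℚ (zipWith ℚ._*_ (toQPt (lookup U i)) x) ℚ.+ toQ (lookup c i)

UnimodEquiv : ∀ {d n n′} → Vec (ZPt d) n → Vec (ZPt d) n′ → Set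
UnimodEquiv {d} V W = Σ (Mat d) λ U → Σ (Mat d) λ U⁻¹ → Σ (ZPt d) λ c →
  matMul U U⁻¹ ≡ idMat d × matMul U⁻¹ U ≡ idMat d
  × (∀ x → (InConv V x → InConv W (affMapQ U c x)) × (InConv W (affMapQ U c x) → InConv V x))

-- The vertices 0, e_1, …, e_{d-1}, Σ_{i<k} e_i + (m-1) Σ_{k≤j≤d-1} e_j + m e_d
-- (coordinates indexed 1..d in the paper, 0..d-1 here).
specialCoord : ℕ → ℕ → ℕ → ℕ → ℕ → ℤ
specialCoord d k m j i with j ℕ.≟ 0 | j ℕ.≟ d
... | yes _ | _ = + 0
... | no _ | yes _ = lastCoord
  where
  lastCoord : ℤ
  lastCoord with suc i ℕ.<? k | suc i ℕ.<? d
  ... | yes _ | _ = + 1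
  ... | no _ | yes _ = + (m ℕ.∸ 1)
  ... | no _ | no _ = + m
... | no _ | no _ with suc i ℕ.≟ j
...   | yes _ = + 1
...   | no _ = + 0

specialSimplex : ∀ d → ℕ → ℕ → Vec (ZPt d) (suc d)
specialSimplex d k m = tabulate λ j → tabulate λ i → specialCoord d k m (toℕ j) (toℕ i)

{-# OPTIONS --safe #-}
-- By the δ-polynomial, the cone over P has no lattice points other than sums of vertices below height k,
-- and m - 1 others at height k. Hence the lattice modulo the vertices is cyclic of order m, and in each
-- nontrivial class all barycentric coordinates (taken in (1/m)ℤ between 0 and 1) are nonzero and sum to k;
-- any single coordinate determines the class.
--
-- Only if: let w be the heights and F(X) = w(X) + w(-X) for a nontrivial class X. If the i-th coordinates of X₀, X₁, X₂
-- are n/m, (n+1)/m, (n+2)/m, then X₀ + X₂ and 2 X₁ differ by fewer than k carries on either side; comparing the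
-- cells through the corresponding points of kP gives F(X₀) + F(X₂) > 2 F(X₁). So F is strictly convex in every coordinate
-- and symmetric, hence orders the classes by |2n - m| for every coordinate n at the same time, and some class
-- has all its coordinates in {1/m, (m-1)/m}. This presents the lattice as generated by the vertices and
-- (1/m) Σ ± s_j with k signs of each kind, and the special simplex has the same presentation.
--
-- If: let A and B be the sets of indices with positive and negative sign, p_ν = Σ_B s_j + (ν/m)(Σ_A s_j - Σ_B s_j).
-- The joins of the segments [p_n , p_{n+1}], 0 ≤ n < m, with the Freudenthal simplices of k times the faces of P
-- that omit one vertex of A and one of B form a unimodular triangulation of kP. It is regular: the points p_ν
-- get the height ν² minus a large constant, all other lattice points the sum of the squared differences of
-- suffix sums of their coordinates.
module Submission where

-- The supporting function of the cell through X₁ gives an inequality that contains, besides X₀, X₁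
-- and X₂, integral vertices of two cells, whose heights are unknown. Negation exchanges the two
-- sets of carries, so these heights cancel when the inequalities for X and -X are added; hence w(X)
-- + w(-X). The number k enters because two nontrivial classes with nontrivial sum produce exactly k
-- carries. When fewer than k are available, a decomposition of X + k Σ_D s_j into vertices of one
-- cell contains a single vertex in a nontrivial class, and that vertex is X. Squared differences of
-- all pairs of suffix sums serve all faces at once: a vanishing coordinate merely repeats a suffix
-- sum, so the height of a point does not depend on the omitted vertices. The large constant makes
-- the supporting function of a cell fall off steeply in the coordinates of its two omitted
-- vertices. That cells meet in common faces is read off from the heights. Rational points are
-- handled as integer vectors with a positive denominator.

module Triangulations where

  open import Defs
  open import Algebra.Bundles using (module CommutativeMonoid)
  open import Data.Empty using (⊥; ⊥-elim)
  open import Data.Fin as Fin using (Fin; zero; suc; toℕ; fromℕ; inject₁; pinch; punchIn; punchOut)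
  open import Data.Fin.Permutation as Perm using (Permutation; _⟨$⟩ʳ_; _⟨$⟩ˡ_)
  import Data.Fin.Properties as Fin
  open import Data.Integer as ℤ using (ℤ; 0ℤ; 1ℤ; _+_; _*_; _-_; -_; _≤_; _<_; ∣_∣)
  import Data.Integer.DivMod as ℤ
  import Data.Integer.Properties as ℤ
  open import Data.Integer.Tactic.RingSolver using (solve-∀)
  open import Data.List as List using (List; []; _∷_; _++_; length)
  open import Data.List.Membership.Propositional using (_∈_; find; lose)
  open import Data.List.Membership.Propositional.Properties
    using (∈-map⁺; ∈-map⁻; ∈-++⁺ˡ; ∈-++⁺ʳ; ∈-++⁻; ∈-filter⁺; ∈-filter⁻; ∈-tabulate⁺; ∈-tabulate⁻; ∈-cartesianProduct⁺; ∈-cartesianProductWith⁺; ∈-upTo⁺; ∈-allFin)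
  import Data.List.Properties as List
  open import Data.List.Relation.Unary.All as LAll using ([]; _∷_)
  open import Data.List.Relation.Unary.AllPairs using ([]; _∷_)
  open import Data.List.Relation.Unary.Any as Any using (Any; here; there)
  open import Data.List.Relation.Unary.Unique.Propositional using (Unique)
  import Data.List.Relation.Unary.Unique.Propositional.Properties as Unique
  open import Data.Maybe using (nothing)
  open import Data.Nat as ℕ using (ℕ; zero; suc)
  open import Data.Nat.Combinatorics using (nCk+nC[k+1]≡[n+1]C[k+1]; k>n⇒nCk≡0) renaming (_C_ to infixl 6.5 _choose_)
  import Data.Nat.DivMod as ℕ
  import Data.Nat.Properties as ℕ
  open import Data.Product using (∃; _×_; _,_; proj₁; proj₂)
  open import Data.Rational as ℚ using (ℚ; 0ℚ; 1ℚ; ↥_; ↧_; toℚᵘ)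
  import Data.Rational.Properties as ℚ
  open import Data.Rational.Unnormalised as ℚᵘ using (mkℚᵘ; _≃_; *≡*; *≤*)
  import Data.Rational.Unnormalised.Properties as ℚᵘ
  open import Data.Sum using (_⊎_; inj₁; inj₂)
  open import Data.Vec as Vec using (Vec; []; _∷_; lookup; tabulate; map; removeAt; zipWith)
  open import Data.Vec.Functional using () renaming (_∷_ to _◂_)
  import Data.Vec.Properties as Vec
  open import Data.Vec.Properties using (lookup-map; lookup-zipWith; lookup∘tabulate; tabulate-cong; tabulate∘lookup)
  open import Data.Vec.Relation.Unary.All as VAll using (All; []; _∷_)
  open import Function using (_∘_; id)
  open import Level using (0ℓ)
  open import Relation.Binary.PropositionalEquality hiding (J)
  open import Relation.Nullary using (¬_; Dec; yes; no)
  open import Relation.Nullary.Decidable using (¬?; _×-dec_)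
  import Algebra.Properties.Semiring.Sum ℤ.+-*-semiring as Sum
  open import Algebra.Properties.CommutativeSemigroup (CommutativeMonoid.commutativeSemigroup ℚ.+-0-commutativeMonoid) using (interchange)
  import Tactic.RingSolver as RS
  open import Tactic.RingSolver.Core.AlmostCommutativeRing using (AlmostCommutativeRing; fromCommutativeRing)

  -- Finite sums of integers

  -- Sums and determinants are opaque: unfolding them makes unification of integer expressions fail.
  opaque
    ∑ : ∀ {n} → (Fin n → ℤ) → ℤ
    ∑ = Sum.sum

    ∑-empty : {f : Fin 0 → ℤ} → ∑ f ≡ 0ℤ
    ∑-empty = refl

    ∑-suc : ∀ {n} (f : Fin (suc n) → ℤ) → ∑ f ≡ f zero + ∑ (λ i → f (suc i))
    ∑-suc f = refl

    ∑-cong : ∀ {n} {f g : Fin n → ℤ} → (∀ i → f i ≡ g i) → ∑ f ≡ ∑ g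
    ∑-cong = Sum.sum-cong-≗

    ∑-+ : ∀ {n} (f g : Fin n → ℤ) → ∑ (λ i → f i + g i) ≡ ∑ f + ∑ g
    ∑-+ = Sum.∑-distrib-+

    *-∑ : ∀ {n} (a : ℤ) (f : Fin n → ℤ) → a * ∑ f ≡ ∑ (λ i → a * f i)
    *-∑ = Sum.*-distribˡ-sum

    ∑-* : ∀ {n} (a : ℤ) (f : Fin n → ℤ) → ∑ f * a ≡ ∑ (λ i → f i * a)
    ∑-* = Sum.*-distribʳ-sum

    ∑-remove : ∀ {n} (i : Fin (suc n)) (f : Fin (suc n) → ℤ) → ∑ f ≡ f i + ∑ (λ j → f (punchIn i j))
    ∑-remove i f = Sum.sum-remove f

    ∑-swap : ∀ {n p} (f : Fin n → Fin p → ℤ) → ∑ (λ i → ∑ (λ j → f i j)) ≡ ∑ (λ j → ∑ (λ i → f i j))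
    ∑-swap = Sum.∑-comm

    ∑-permute : ∀ {n p} (f : Fin p → ℤ) (π : Permutation n p) → ∑ f ≡ ∑ (λ i → f (π ⟨$⟩ʳ i))
    ∑-permute = Sum.sum-permute


  ∑-zero : ∀ {n} {f : Fin n → ℤ} → (∀ i → f i ≡ 0ℤ) → ∑ f ≡ 0ℤ
  ∑-zero {zero} h = ∑-empty
  ∑-zero {suc n} {f} h = trans (∑-suc f) (cong₂ _+_ (h zero) (∑-zero (λ i → h (suc i))))

  ∑-neg : ∀ {n} (f : Fin n → ℤ) → ∑ (λ i → - f i) ≡ - ∑ f
  ∑-neg f = trans (∑-cong (λ i → sym (ℤ.-1*i≡-i (f i)))) (trans (sym (*-∑ (- 1ℤ) f)) (ℤ.-1*i≡-i (∑ f)))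

  ∑-lin : ∀ {n} (a b : ℤ) (f g : Fin n → ℤ) → ∑ (λ i → a * f i + b * g i) ≡ a * ∑ f + b * ∑ g
  ∑-lin a b f g = trans (∑-+ (λ i → a * f i) (λ i → b * g i)) (sym (cong₂ _+_ (*-∑ a f) (*-∑ b g)))

  ∑-sub : ∀ {n} (f g : Fin n → ℤ) → ∑ (λ i → f i - g i) ≡ ∑ f - ∑ g
  ∑-sub f g = trans (∑-+ f (λ i → - g i)) (cong (λ z → ∑ f + z) (∑-neg g))

  ∑-mono : ∀ {n} {f g : Fin n → ℤ} → (∀ i → f i ≤ g i) → ∑ f ≤ ∑ g
  ∑-mono {zero} h = ℤ.≤-reflexive (trans ∑-empty (sym ∑-empty))
  ∑-mono {suc n} {f} {g} h = subst₂ _≤_ (sym (∑-suc f)) (sym (∑-suc g)) (ℤ.+-mono-≤ (h zero) (∑-mono (λ i → h (suc i))))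

  ∑-nonneg : ∀ {n} {f : Fin n → ℤ} → (∀ i → 0ℤ ≤ f i) → 0ℤ ≤ ∑ f
  ∑-nonneg {n} {f} h = subst (_≤ ∑ f) (∑-zero (λ i → refl)) (∑-mono {f = λ _ → 0ℤ} h)

  term≤∑ : ∀ {n} {f : Fin n → ℤ} → (∀ i → 0ℤ ≤ f i) → ∀ i → f i ≤ ∑ f
  term≤∑ {suc n} {f} h i = subst₂ _≤_ (ℤ.+-identityʳ (f i)) (sym (∑-remove i f)) (ℤ.+-monoʳ-≤ (f i) (∑-nonneg (λ j → h (punchIn i j))))

  ∑≡0⇒≡0 : ∀ {n} {f : Fin n → ℤ} → (∀ i → 0ℤ ≤ f i) → ∑ f ≡ 0ℤ → ∀ i → f i ≡ 0ℤ
  ∑≡0⇒≡0 {f = f} h e i = ℤ.≤-antisym (subst (f i ≤_) e (term≤∑ h i)) (h i)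

  δ : ∀ {n} → Fin n → Fin n → ℤ
  δ zero zero = 1ℤ
  δ zero (suc j) = 0ℤ
  δ (suc i) zero = 0ℤ
  δ (suc i) (suc j) = δ i j

  δ-refl : ∀ {n} (i : Fin n) → δ i i ≡ 1ℤ
  δ-refl zero = refl
  δ-refl (suc i) = δ-refl i

  δ-≢ : ∀ {n} {i j : Fin n} → i ≢ j → δ i j ≡ 0ℤ
  δ-≢ {i = zero} {zero} h = ⊥-elim (h refl)
  δ-≢ {i = zero} {suc j} h = refl
  δ-≢ {i = suc i} {zero} h = refl
  δ-≢ {i = suc i} {suc j} h = δ-≢ (h ∘ cong suc)

  δ-sym : ∀ {n} (i j : Fin n) → δ i j ≡ δ j i
  δ-sym zero zero = refl
  δ-sym zero (suc j) = refl
  δ-sym (suc i) zero = refl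
  δ-sym (suc i) (suc j) = δ-sym i j

  ∑-δ : ∀ {n} (i : Fin n) (f : Fin n → ℤ) → ∑ (λ j → δ i j * f j) ≡ f i
  ∑-δ {suc n} i f = begin
    ∑ (λ j → δ i j * f j) ≡⟨ ∑-remove i (λ j → δ i j * f j) ⟩
    δ i i * f i + ∑ (λ j → δ i (punchIn i j) * f (punchIn i j))
      ≡⟨ cong₂ (λ x y → x * f i + y) (δ-refl i) (∑-zero (λ j → cong (_* f (punchIn i j)) (δ-≢ (Fin.punchInᵢ≢i i j ∘ sym)))) ⟩
    1ℤ * f i + 0ℤ ≡⟨ trans (ℤ.+-identityʳ (1ℤ * f i)) (ℤ.*-identityˡ (f i)) ⟩
    f i ∎
    where open ≡-Reasoning

  ∑-δʳ : ∀ {n} (i : Fin n) (f : Fin n → ℤ) → ∑ (λ j → f j * δ i j) ≡ f i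
  ∑-δʳ i f = trans (∑-cong (λ j → ℤ.*-comm (f j) (δ i j))) (∑-δ i f)

  ∑-δ₁ : ∀ {n} (i : Fin n) → ∑ (δ i) ≡ 1ℤ
  ∑-δ₁ i = trans (∑-cong (λ j → sym (ℤ.*-identityʳ (δ i j)))) (∑-δ i (λ _ → 1ℤ))

  -- Determinants and alternating forms

  Matrix : ℕ → ℕ → Set
  Matrix r c = Fin r → Fin c → ℤ

  sg : ∀ {n} → Fin n → ℤ
  sg zero = 1ℤ
  sg (suc i) = - sg i

  minor : ∀ {n} → Matrix (suc n) (suc n) → Fin (suc n) → Matrix n n
  minor A j i c = A (suc i) (punchIn j c)

  opaque
    dt : ∀ n → Matrix n n → ℤ
    dt zero A = 1ℤ
    dt (suc n) A = ∑ λ j → sg j * A zero j * dt n (minor A j)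

    dt-zero : ∀ {A} → dt zero A ≡ 1ℤ
    dt-zero = refl

    dt-suc : ∀ n A → dt (suc n) A ≡ ∑ λ j → sg j * A zero j * dt n (minor A j)
    dt-suc n A = refl

  _≈_ : ∀ {r c} → Matrix r c → Matrix r c → Set
  A ≈ B = ∀ i j → A i j ≡ B i j

  dt-cong : ∀ n {A B : Matrix n n} → A ≈ B → dt n A ≡ dt n B
  dt-cong zero {A} {B} h = trans dt-zero (sym dt-zero)
  dt-cong (suc n) {A} {B} h = trans (dt-suc n A) (trans (∑-cong λ j →
    cong₂ (λ x y → sg j * x * y) (h zero j) (dt-cong n {minor A j} {minor B j} (λ i c → h (suc i) (punchIn j c)))) (sym (dt-suc n B)))

  -- The number n of rows is kept apart from their length N, because fixing the first row of a form
  -- lowers n but not N; the induction in `φ-mul` runs over such forms.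
  record Alternating {n N : ℕ} (φ : Matrix n N → ℤ) : Set where
    field
      φ-cong : ∀ {A B} → A ≈ B → φ A ≡ φ B
      φ-linear : ∀ i (β γ : ℤ) A B C → (∀ c → A i c ≡ β * B i c + γ * C i c) →
        (∀ j → j ≢ i → ∀ c → A j c ≡ B j c × A j c ≡ C j c) → φ A ≡ β * φ B + γ * φ C
      φ-alt : ∀ A i j → i ≢ j → (∀ c → A i c ≡ A j c) → φ A ≡ 0ℤ
  open Alternating

  dt-linear : ∀ n i (β γ : ℤ) (A B C : Matrix n n) → (∀ c → A i c ≡ β * B i c + γ * C i c) →
    (∀ j → j ≢ i → ∀ c → A j c ≡ B j c × A j c ≡ C j c) → dt n A ≡ β * dt n B + γ * dt n C
  dt-linear (suc n) i β γ A B C e h = begin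
    dt (suc n) A ≡⟨ dt-suc n A ⟩
    ∑ (t A) ≡⟨ ∑-cong (step i e h) ⟩
    ∑ (λ j → β * t B j + γ * t C j) ≡⟨ ∑-lin β γ (t B) (t C) ⟩
    β * ∑ (t B) + γ * ∑ (t C) ≡⟨ sym (cong₂ (λ x y → β * x + γ * y) (dt-suc n B) (dt-suc n C)) ⟩
    β * dt (suc n) B + γ * dt (suc n) C ∎
    where
    open ≡-Reasoning
    t : Matrix (suc n) (suc n) → Fin (suc n) → ℤ
    t X j = sg j * X zero j * dt n (minor X j)
    alg : ∀ s b g x y d → s * (b * x + g * y) * d ≡ b * (s * x * d) + g * (s * y * d)
    alg = solve-∀
    alg' : ∀ s a b g x y → s * a * (b * x + g * y) ≡ b * (s * a * x) + g * (s * a * y)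
    alg' = solve-∀
    step : ∀ i → (∀ c → A i c ≡ β * B i c + γ * C i c) →
      (∀ j → j ≢ i → ∀ c → A j c ≡ B j c × A j c ≡ C j c) → ∀ j → t A j ≡ β * t B j + γ * t C j
    step zero e h j = begin
      sg j * A zero j * dt n (minor A j) ≡⟨ cong (λ z → sg j * z * dt n (minor A j)) (e j) ⟩
      sg j * (β * B zero j + γ * C zero j) * dt n (minor A j) ≡⟨ alg (sg j) β γ (B zero j) (C zero j) (dt n (minor A j)) ⟩
      β * (sg j * B zero j * dt n (minor A j)) + γ * (sg j * C zero j * dt n (minor A j))
        ≡⟨ cong₂ (λ y z → β * (sg j * B zero j * y) + γ * (sg j * C zero j * z))
          (dt-cong n (λ i c → proj₁ (h (suc i) (λ ()) (punchIn j c))))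
          (dt-cong n (λ i c → proj₂ (h (suc i) (λ ()) (punchIn j c)))) ⟩
      β * t B j + γ * t C j ∎
    step (suc i) e h j = begin
      sg j * A zero j * dt n (minor A j)
        ≡⟨ cong (λ z → sg j * A zero j * z) (dt-linear n i β γ (minor A j) (minor B j) (minor C j) (λ c → e (punchIn j c))
           (λ j' ne c → h (suc j') (ne ∘ Fin.suc-injective) (punchIn j c))) ⟩
      sg j * A zero j * (β * dt n (minor B j) + γ * dt n (minor C j))
        ≡⟨ alg' (sg j) (A zero j) β γ (dt n (minor B j)) (dt n (minor C j)) ⟩
      β * (sg j * A zero j * dt n (minor B j)) + γ * (sg j * A zero j * dt n (minor C j))
        ≡⟨ cong₂ (λ y z → β * (sg j * y * dt n (minor B j)) + γ * (sg j * z * dt n (minor C j)))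
           (proj₁ (h zero (λ ()) j)) (proj₂ (h zero (λ ()) j)) ⟩
      β * t B j + γ * t C j ∎

  -- The double Laplace sum over ordered pairs of columns cancels in pairs.
  pair-cancel : ∀ n (u : Fin (suc (suc n)) → ℤ) (F : (Fin n → Fin (suc (suc n))) → ℤ) →
    (∀ {f g} → (∀ x → f x ≡ g x) → F f ≡ F g) →
    ∑ (λ j → ∑ (λ c → sg j * u j * (sg c * u (punchIn j c) * F (punchIn j ∘ punchIn c)))) ≡ 0ℤ
  pair-cancel n u F F-cong = begin
    ∑ (λ j → ∑ (λ c → t j c)) ≡⟨ ∑-suc (λ j → ∑ (λ c → t j c)) ⟩
    ∑ first + ∑ (λ j → ∑ (λ c → t (suc j) c)) ≡⟨ cong (λ z → ∑ first + z) (∑-cong (λ j → ∑-suc (λ c → t (suc j) c))) ⟩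
    ∑ first + ∑ (λ j → t (suc j) zero + ∑ (λ c → t (suc j) (suc c)))
      ≡⟨ cong (λ z → ∑ first + z) (∑-+ (λ j → t (suc j) zero) (λ j → ∑ (λ c → t (suc j) (suc c)))) ⟩
    ∑ first + (∑ (λ j → t (suc j) zero) + ∑ (λ j → ∑ (λ c → t (suc j) (suc c))))
      ≡⟨ cong₂ (λ y z → ∑ first + (y + z)) (trans (∑-cong firstcol) (∑-neg first)) (rest n u F F-cong) ⟩
    ∑ first + (- ∑ first + 0ℤ) ≡⟨ alg₀ (∑ first) ⟩
    0ℤ ∎
    where
    open ≡-Reasoning
    t : Fin (suc (suc n)) → Fin (suc n) → ℤ
    t j c = sg j * u j * (sg c * u (punchIn j c) * F (punchIn j ∘ punchIn c))
    first : Fin (suc n) → ℤ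
    first c = t zero c
    alg₀ : ∀ x → x + (- x + 0ℤ) ≡ 0ℤ
    alg₀ = solve-∀
    alg : ∀ s x y f → - s * x * (1ℤ * y * f) ≡ - (1ℤ * y * (s * x * f))
    alg = solve-∀
    firstcol : ∀ j → t (suc j) zero ≡ - first j
    firstcol j = trans (alg (sg j) (u (suc j)) (u zero) (F (punchIn (suc j) ∘ punchIn zero)))
      (cong (λ z → - (1ℤ * u zero * (sg j * u (suc j) * z))) (F-cong (λ x → refl)))
    rest : ∀ n (u : Fin (suc (suc n)) → ℤ) (F : (Fin n → Fin (suc (suc n))) → ℤ) →
      (∀ {f g} → (∀ x → f x ≡ g x) → F f ≡ F g) →
      ∑ (λ j → ∑ (λ c → - sg j * u (suc j) * (- sg c * u (suc (punchIn j c)) * F (punchIn (suc j) ∘ punchIn (suc c))))) ≡ 0ℤ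
    rest zero u F F-cong = ∑-zero (λ j → ∑-empty)
    rest (suc n) u F F-cong = trans (∑-cong λ j → ∑-cong λ c →
        trans (alg2 (sg j) (u (suc j)) (sg c) (u (suc (punchIn j c))) (F (punchIn (suc j) ∘ punchIn (suc c))))
          (cong (λ z → sg j * u (suc j) * (sg c * u (suc (punchIn j c)) * z))
            (F-cong {punchIn (suc j) ∘ punchIn (suc c)} {up (punchIn j ∘ punchIn c)} (λ { zero → refl ; (suc x) → refl }))))
      (pair-cancel n (u ∘ suc) (λ f → F (up f))
        (λ h → F-cong (λ { zero → refl ; (suc x) → cong suc (h x) })))
      where
      alg2 : ∀ s x r y f → - s * x * (- r * y * f) ≡ s * x * (r * y * f)
      alg2 = solve-∀
      up : ∀ {p} → (Fin n → Fin p) → Fin (suc n) → Fin (suc p)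
      up f zero = zero
      up f (suc x) = suc (f x)

  dt-alt₀₁ : ∀ n (A : Matrix (suc (suc n)) (suc (suc n))) → (∀ c → A zero c ≡ A (suc zero) c) → dt (suc (suc n)) A ≡ 0ℤ
  dt-alt₀₁ n A e = begin
    dt (suc (suc n)) A ≡⟨ dt-suc (suc n) A ⟩
    ∑ (λ j → sg j * A zero j * dt (suc n) (minor A j)) ≡⟨ ∑-cong (λ j → cong (λ z → sg j * A zero j * z) (dt-suc n (minor A j))) ⟩
    ∑ (λ j → sg j * A zero j * ∑ (λ c → sg c * A (suc zero) (punchIn j c) * F (punchIn j ∘ punchIn c)))
      ≡⟨ ∑-cong (λ j → trans (*-∑ (sg j * A zero j) (λ c → sg c * A (suc zero) (punchIn j c) * F (punchIn j ∘ punchIn c)))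
         (∑-cong λ c → cong (λ z → sg j * A zero j * (sg c * z * F (punchIn j ∘ punchIn c))) (sym (e (punchIn j c))))) ⟩
    ∑ (λ j → ∑ (λ c → sg j * A zero j * (sg c * A zero (punchIn j c) * F (punchIn j ∘ punchIn c))))
      ≡⟨ pair-cancel n (A zero) F (λ h → dt-cong n (λ i c → cong (A (suc (suc i))) (h c))) ⟩
    0ℤ ∎
    where
    open ≡-Reasoning
    F : (Fin n → Fin (suc (suc n))) → ℤ
    F f = dt n (λ i c → A (suc (suc i)) (f c))

  η₁ : ∀ {n N} (A : Matrix (suc n) N) → A ≈ (A zero ◂ (A ∘ suc))
  η₁ A zero c = refl
  η₁ A (suc i) c = refl

  η₂ : ∀ {n N} (A : Matrix (suc (suc n)) N) → A ≈ (A zero ◂ (A (suc zero) ◂ (λ i → A (suc (suc i)))))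
  η₂ A zero c = refl
  η₂ A (suc zero) c = refl
  η₂ A (suc (suc i)) c = refl

  -- Polarization: φ vanishes when both leading rows are u + w, and expanding leaves the two mixed
  -- terms. Linearity and vanishing are separate arguments, not an `Alternating`, because for `dt`
  -- the full alternating property is derived from this lemma.
  swap-rows : ∀ {n N} (φ : Matrix (suc (suc n)) N → ℤ) →
    (∀ i (β γ : ℤ) A B C → (∀ c → A i c ≡ β * B i c + γ * C i c) →
        (∀ j → j ≢ i → ∀ c → A j c ≡ B j c × A j c ≡ C j c) → φ A ≡ β * φ B + γ * φ C) →
    (∀ u r → φ (u ◂ (u ◂ r)) ≡ 0ℤ) →
    ∀ u w r → φ (u ◂ (w ◂ r)) ≡ - φ (w ◂ (u ◂ r))
  swap-rows φ lin alt u w r = ℤ.i-j≡0⇒i≡j _ _ (begin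
    φ (u ◂ (w ◂ r)) - - φ (w ◂ (u ◂ r)) ≡⟨ alg (φ (u ◂ (w ◂ r))) (φ (w ◂ (u ◂ r))) ⟩
    1ℤ * (1ℤ * 0ℤ + 1ℤ * φ (u ◂ (w ◂ r))) + 1ℤ * (1ℤ * φ (w ◂ (u ◂ r)) + 1ℤ * 0ℤ)
      ≡⟨ cong₂ (λ x y → 1ℤ * x + 1ℤ * y)
         (trans (cong (λ z → 1ℤ * z + 1ℤ * φ (u ◂ (w ◂ r))) (sym (alt u r))) (sym (second u)))
         (trans (cong (λ z → 1ℤ * φ (w ◂ (u ◂ r)) + 1ℤ * z) (sym (alt w r))) (sym (second w))) ⟩
    1ℤ * φ (u ◂ (s ◂ r)) + 1ℤ * φ (w ◂ (s ◂ r)) ≡⟨ sym (lin zero 1ℤ 1ℤ (s ◂ (s ◂ r)) (u ◂ (s ◂ r)) (w ◂ (s ◂ r)) (λ c → refl)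
        (λ { zero ne c → ⊥-elim (ne refl) ; (suc j) ne c → refl , refl })) ⟩
    φ (s ◂ (s ◂ r)) ≡⟨ alt s r ⟩
    0ℤ ∎)
    where
    open ≡-Reasoning
    s = λ c → 1ℤ * u c + 1ℤ * w c
    alg : ∀ x y → x - - y ≡ 1ℤ * (1ℤ * 0ℤ + 1ℤ * x) + 1ℤ * (1ℤ * y + 1ℤ * 0ℤ)
    alg = solve-∀
    second : ∀ a → φ (a ◂ (s ◂ r)) ≡ 1ℤ * φ (a ◂ (u ◂ r)) + 1ℤ * φ (a ◂ (w ◂ r))
    second a = lin (suc zero) 1ℤ 1ℤ (a ◂ (s ◂ r)) (a ◂ (u ◂ r)) (a ◂ (w ◂ r)) (λ c → refl)
      (λ { zero ne c → refl , refl ; (suc zero) ne c → ⊥-elim (ne refl) ; (suc (suc j)) ne c → refl , refl })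

  dt-minors-zero : ∀ n (A : Matrix (suc n) (suc n)) → (∀ c → dt n (minor A c) ≡ 0ℤ) → dt (suc n) A ≡ 0ℤ
  dt-minors-zero n A h = trans (dt-suc n A) (∑-zero λ c →
    trans (cong (λ z → sg c * A zero c * z) (h c)) (ℤ.*-zeroʳ (sg c * A zero c)))

  -- Exchanging rows 0 and 1 pushes the coincidence into the minors of the expansion along the new
  -- first row, where the induction hypothesis applies.
  dt-alt₀ : ∀ n (A : Matrix (suc n) (suc n)) j → (∀ c → A zero c ≡ A (suc j) c) → dt (suc n) A ≡ 0ℤ
  dt-alt₀ (suc n) A zero e = dt-alt₀₁ n A e
  dt-alt₀ (suc n) A (suc j) e = begin
    dt (suc (suc n)) A ≡⟨ dt-cong (suc (suc n)) (η₂ A) ⟩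
    dt (suc (suc n)) (A zero ◂ (A (suc zero) ◂ (λ i → A (suc (suc i)))))
      ≡⟨ swap-rows (dt (suc (suc n))) (dt-linear (suc (suc n))) (λ u r → dt-alt₀₁ n (u ◂ (u ◂ r)) (λ c → refl))
           (A zero) (A (suc zero)) (λ i → A (suc (suc i))) ⟩
    - dt (suc (suc n)) A' ≡⟨ cong -_ (dt-minors-zero (suc n) A' λ c → dt-alt₀ n (minor A' c) j (λ c' → e (punchIn c c'))) ⟩
    0ℤ ∎
    where
    open ≡-Reasoning
    A' = A (suc zero) ◂ (A zero ◂ (λ i → A (suc (suc i))))

  dt-alt : ∀ n (A : Matrix n n) i j → i ≢ j → (∀ c → A i c ≡ A j c) → dt n A ≡ 0ℤ
  dt-alt (suc n) A zero zero ne e = ⊥-elim (ne refl)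
  dt-alt (suc n) A (suc i) (suc j) ne e = dt-minors-zero n A λ c →
    dt-alt n (minor A c) i j (ne ∘ cong suc) (λ c' → e (punchIn c c'))
  dt-alt (suc n) A zero (suc j) ne e = dt-alt₀ n A j e
  dt-alt (suc n) A (suc j) zero ne e = dt-alt₀ n A j (λ c → sym (e c))

  dt-alternating : ∀ n → Alternating (dt n)
  dt-alternating n = record { φ-cong = dt-cong n ; φ-linear = dt-linear n ; φ-alt = dt-alt n }

  fix-first : ∀ {n N} {φ : Matrix (suc n) N → ℤ} → Alternating φ → ∀ a → Alternating (λ r → φ (a ◂ r))
  fix-first al a = record
    { φ-cong = λ h → φ-cong al (λ { zero c → refl ; (suc i) c → h i c })
    ; φ-linear = λ i β γ A B C e h → φ-linear al (suc i) β γ _ _ _ e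
        (λ { zero ne c → refl , refl ; (suc j) ne c → h j (ne ∘ cong suc) c })
    ; φ-alt = λ A i j ne e → φ-alt al _ (suc i) (suc j) (ne ∘ Fin.suc-injective) e }

  φ-zero-row : ∀ {n N} {φ : Matrix (suc n) N → ℤ} → Alternating φ → ∀ A → (∀ c → A zero c ≡ 0ℤ) → φ A ≡ 0ℤ
  φ-zero-row {φ = φ} al A h = trans (φ-linear al zero 0ℤ 0ℤ A A A (λ c → trans (h c) (alg (A zero c))) (λ j ne c → refl , refl)) (sym (alg (φ A)))
    where
    alg : ∀ x → 0ℤ ≡ 0ℤ * x + 0ℤ * x
    alg = solve-∀

  φ-sum-row : ∀ {n N} {φ : Matrix (suc n) N → ℤ} → Alternating φ → ∀ p (β : Fin p → ℤ) (W : Matrix p N) r →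
    φ ((λ c → ∑ (λ j → β j * W j c)) ◂ r) ≡ ∑ (λ j → β j * φ (W j ◂ r))
  φ-sum-row al zero β W r = trans (φ-zero-row al ((λ c → ∑ (λ j → β j * W j c)) ◂ r) (λ c → ∑-empty)) (sym ∑-empty)
  φ-sum-row {φ = φ} al (suc p) β W r = begin
    φ ((λ c → ∑ (λ j → β j * W j c)) ◂ r)
      ≡⟨ φ-linear al zero (β zero) 1ℤ ((λ c → ∑ (λ j → β j * W j c)) ◂ r) (W zero ◂ r) (w ◂ r)
         (λ c → trans (∑-suc (λ j → β j * W j c)) (cong (λ z → β zero * W zero c + z) (sym (ℤ.*-identityˡ (w c)))))
         (λ { zero ne c → ⊥-elim (ne refl) ; (suc j) ne c → refl , refl }) ⟩
    β zero * φ (W zero ◂ r) + 1ℤ * φ (w ◂ r)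
      ≡⟨ cong (λ z → β zero * φ (W zero ◂ r) + z) (trans (ℤ.*-identityˡ (φ (w ◂ r))) (φ-sum-row al p (β ∘ suc) (W ∘ suc) r)) ⟩
    β zero * φ (W zero ◂ r) + ∑ (λ j → β (suc j) * φ (W (suc j) ◂ r)) ≡⟨ sym (∑-suc (λ j → β j * φ (W j ◂ r))) ⟩
    ∑ (λ j → β j * φ (W j ◂ r)) ∎
    where
    open ≡-Reasoning
    w = λ c → ∑ (λ j → β (suc j) * W (suc j) c)

  -- Linearity splits off one multiple of `a` at a time, and `kill` removes it. It is applied to the
  -- form that arises by fixing `a` as an additional first row; there `kill` is the vanishing on
  -- repeated rows.
  φ-drop : ∀ {n N} {ψ : Matrix n N → ℤ} → Alternating ψ → ∀ (a : Fin N → ℤ) →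
    (∀ A i → (∀ c → A i c ≡ a c) → ψ A ≡ 0ℤ) → ∀ (β : Fin n → ℤ) w →
    ψ (λ i c → β i * a c + w i c) ≡ ψ w
  φ-drop {zero} al a kill β w = φ-cong al (λ ())
  φ-drop {suc n} {ψ = ψ} al a kill β w = begin
    ψ (λ i c → β i * a c + w i c)
      ≡⟨ φ-linear al zero (β zero) 1ℤ (λ i c → β i * a c + w i c) (a ◂ r) (w zero ◂ r)
         (λ c → cong (λ z → β zero * a c + z) (sym (ℤ.*-identityˡ (w zero c))))
         (λ { zero ne c → ⊥-elim (ne refl) ; (suc j) ne c → refl , refl }) ⟩
    β zero * ψ (a ◂ r) + 1ℤ * ψ (w zero ◂ r)
      ≡⟨ cong₂ (λ x y → β zero * x + 1ℤ * y) (kill (a ◂ r) zero (λ c → refl))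
          (φ-drop (fix-first al (w zero)) a (λ A i h → kill (w zero ◂ A) (suc i) h) (β ∘ suc) (w ∘ suc)) ⟩
    β zero * 0ℤ + 1ℤ * ψ (w zero ◂ (w ∘ suc)) ≡⟨ alg (β zero) (ψ (w zero ◂ (w ∘ suc))) ⟩
    ψ (w zero ◂ (w ∘ suc)) ≡⟨ φ-cong al (λ i c → sym (η₁ w i c)) ⟩
    ψ w ∎
    where
    open ≡-Reasoning
    r = λ i c → β (suc i) * a c + w (suc i) c
    alg : ∀ b x → b * 0ℤ + 1ℤ * x ≡ x
    alg = solve-∀

  φ-move : ∀ {n N} {φ : Matrix (suc n) N → ℤ} → Alternating φ → ∀ (A : Matrix (suc n) N) j →
    φ (A j ◂ (A ∘ punchIn j)) ≡ sg j * φ A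
  φ-move {φ = φ} al A zero = trans (φ-cong al (λ i c → sym (η₁ A i c))) (sym (ℤ.*-identityˡ (φ A)))
  φ-move {suc n} {φ = φ} al A (suc j) = begin
    φ (A (suc j) ◂ (A ∘ punchIn (suc j)))
      ≡⟨ φ-cong al (λ { zero c → refl ; (suc zero) c → refl ; (suc (suc i)) c → refl }) ⟩
    φ (A (suc j) ◂ (A zero ◂ (λ i → A (suc (punchIn j i)))))
      ≡⟨ swap-rows φ (φ-linear al) (λ u r → φ-alt al (u ◂ (u ◂ r)) zero (suc zero) (λ ()) (λ c → refl))
           (A (suc j)) (A zero) (λ i → A (suc (punchIn j i))) ⟩
    - φ (A zero ◂ (A (suc j) ◂ (λ i → A (suc (punchIn j i))))) ≡⟨ cong -_ (φ-move (fix-first al (A zero)) (A ∘ suc) j) ⟩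
    - (sg j * φ (A zero ◂ (A ∘ suc))) ≡⟨ cong (λ z → - (sg j * z)) (φ-cong al (λ i c → sym (η₁ A i c))) ⟩
    - (sg j * φ A) ≡⟨ ℤ.neg-distribˡ-* (sg j) (φ A) ⟩
    - sg j * φ A ∎
    where open ≡-Reasoning

  infixl 7 _⊡_
  _⊡_ : ∀ {p q r} → Matrix p q → Matrix q r → Matrix p r
  (B ⊡ A) i c = ∑ (λ j → B i j * A j c)

  -- Expanding the first row of the product gives one term for each row `A j`. In it the multiples
  -- of `A j` in the other rows drop out, which leaves the product of `minor B j` with the remaining
  -- rows of A, and the induction applies to the form with first row fixed. The sum over j is the
  -- Laplace expansion of B.
  φ-mul : ∀ n {N} {φ : Matrix n N → ℤ} → Alternating φ → ∀ (B : Matrix n n) (A : Matrix n N) →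
    φ (B ⊡ A) ≡ dt n B * φ A
  φ-mul zero {φ = φ} al B A = trans (φ-cong al (λ ())) (trans (sym (ℤ.*-identityˡ (φ A))) (cong (_* φ A) (sym dt-zero)))
  φ-mul (suc n) {φ = φ} al B A = begin
    φ (B ⊡ A) ≡⟨ φ-cong al (η₁ (B ⊡ A)) ⟩
    φ ((λ c → ∑ (λ j → B zero j * A j c)) ◂ rows) ≡⟨ φ-sum-row al (suc n) (B zero) A rows ⟩
    ∑ (λ j → B zero j * φ (A j ◂ rows))
      ≡⟨ ∑-cong (λ j → trans (cong (λ z → B zero j * z) (term j)) (alg (B zero j) (dt n (minor B j)) (sg j) (φ A))) ⟩
    ∑ (λ j → sg j * B zero j * dt n (minor B j) * φ A) ≡⟨ sym (∑-* (φ A) (λ j → sg j * B zero j * dt n (minor B j))) ⟩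
    ∑ (λ j → sg j * B zero j * dt n (minor B j)) * φ A ≡⟨ cong (_* φ A) (sym (dt-suc n B)) ⟩
    dt (suc n) B * φ A ∎
    where
    open ≡-Reasoning
    rows = λ i → (B ⊡ A) (suc i)
    alg : ∀ b d s f → b * (d * (s * f)) ≡ s * b * d * f
    alg = solve-∀
    term : ∀ j → φ (A j ◂ rows) ≡ dt n (minor B j) * (sg j * φ A)
    term j = begin
      φ (A j ◂ rows) ≡⟨ φ-cong alj (λ i c → ∑-remove j (λ l → B (suc i) l * A l c)) ⟩
      φ (A j ◂ (λ i c → B (suc i) j * A j c + (minor B j ⊡ (A ∘ punchIn j)) i c))
        ≡⟨ φ-drop alj (A j) (λ A' i h → φ-alt al (A j ◂ A') zero (suc i) (λ ()) (λ c → sym (h c))) (λ i → B (suc i) j) (minor B j ⊡ (A ∘ punchIn j)) ⟩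
      φ (A j ◂ (minor B j ⊡ (A ∘ punchIn j))) ≡⟨ φ-mul n alj (minor B j) (A ∘ punchIn j) ⟩
      dt n (minor B j) * φ (A j ◂ (A ∘ punchIn j)) ≡⟨ cong (λ z → dt n (minor B j) * z) (φ-move al A j) ⟩
      dt n (minor B j) * (sg j * φ A) ∎
      where
      alj = fix-first al (A j)

  -- Translation of `det` into `dt`

  sumℤ-tabulate : ∀ {n} (f : Fin n → ℤ) → sumℤ (tabulate f) ≡ ∑ f
  sumℤ-tabulate {zero} f = sym ∑-empty
  sumℤ-tabulate {suc n} f = trans (cong (λ z → f zero + z) (sumℤ-tabulate (λ i → f (suc i)))) (sym (∑-suc f))

  entries : ∀ {r c} → Vec (Vec ℤ c) r → Matrix r c
  entries M i j = lookup (lookup M i) j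

  lookup-removeAt : ∀ {A : Set} {n} (xs : Vec A (suc n)) i j → lookup (removeAt xs i) j ≡ lookup xs (punchIn i j)
  lookup-removeAt (x ∷ xs) zero j = refl
  lookup-removeAt (x ∷ y ∷ xs) (suc i) zero = refl
  lookup-removeAt (x ∷ y ∷ xs) (suc i) (suc j) = lookup-removeAt (y ∷ xs) i j

  sg-even : ∀ {n} (j : Fin n) → toℕ j ℕ.% 2 ≡ 0 → sg j ≡ 1ℤ
  sg-odd : ∀ {n} (j : Fin n) {r} → toℕ j ℕ.% 2 ≡ suc r → sg j ≡ - 1ℤ
  sg-even zero e = refl
  sg-even (suc (suc j)) e = trans (ℤ.neg-involutive (sg j)) (sg-even j (trans (sym (ℕ.[m+n]%n≡m%n (toℕ j) 2)) (trans (cong (λ z → z ℕ.% 2) (ℕ.+-comm (toℕ j) 2)) e)))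
  sg-odd (suc zero) e = refl
  sg-odd (suc (suc j)) e = trans (ℤ.neg-involutive (sg j)) (sg-odd j (trans (sym (ℕ.[m+n]%n≡m%n (toℕ j) 2)) (trans (cong (λ z → z ℕ.% 2) (ℕ.+-comm (toℕ j) 2)) e)))

  -- Names the summands of `det`, whose sign function is local to its definition.
  laplace-tail : ∀ {n} {x : ℤ} (y : ℤ) (f : Fin n → ℤ) → x ≡ y + sumℤ (tabulate f) → Fin n → ℤ
  laplace-tail y f _ = f

  det-tail : ∀ n (row : Vec ℤ (suc n)) (rows : Vec (Vec ℤ (suc n)) n) → Fin n → ℤ
  det-tail n row rows = laplace-tail {x = det (suc n) (row ∷ rows)} (1ℤ * lookup row zero * det n (map (λ r → removeAt r zero) rows)) _ refl

  det-tail≡ : ∀ n row rows j → det-tail n row rows j ≡ sg (suc j) * lookup row (suc j) * det n (map (λ r → removeAt r (suc j)) rows)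
  det-tail≡ n row rows j with suc (toℕ j) ℕ.% 2 in e
  ... | zero = cong (λ z → z * lookup row (suc j) * det n (map (λ r → removeAt r (suc j)) rows)) (sym (sg-even (suc j) e))
  ... | suc _ = cong (λ z → z * lookup row (suc j) * det n (map (λ r → removeAt r (suc j)) rows)) (sym (sg-odd (suc j) e))

  det≡dt : ∀ n (M : Vec (Vec ℤ n) n) → det n M ≡ dt n (entries M)
  det≡dt zero [] = sym dt-zero
  det≡dt (suc n) (row ∷ rows) = begin
    det (suc n) (row ∷ rows) ≡⟨ cong (λ z → t zero + z) (sumℤ-tabulate (det-tail n row rows)) ⟩
    t zero + ∑ (det-tail n row rows) ≡⟨ cong (λ z → t zero + z) (∑-cong (det-tail≡ n row rows)) ⟩
    t zero + ∑ (λ j → t (suc j)) ≡⟨ sym (∑-suc t) ⟩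
    ∑ t ≡⟨ ∑-cong (λ j → cong (λ z → sg j * lookup row j * z) (trans (det≡dt n (map (λ r → removeAt r j) rows)) (dt-cong n (minor≡ j)))) ⟩
    ∑ (λ j → sg j * lookup row j * dt n (minor (entries (row ∷ rows)) j)) ≡⟨ sym (dt-suc n (entries (row ∷ rows))) ⟩
    dt (suc n) (entries (row ∷ rows)) ∎
    where
    open ≡-Reasoning
    t : Fin (suc n) → ℤ
    t j = sg j * lookup row j * det n (map (λ r → removeAt r j) rows)
    minor≡ : ∀ j i c → lookup (lookup (map (λ r → removeAt r j) rows) i) c ≡ lookup (lookup rows i) (punchIn j c)
    minor≡ j i c = trans (cong (λ r → lookup r c) (lookup-map i (λ r → removeAt r j) rows)) (lookup-removeAt (lookup rows i) j c)

  -- Cramer's rule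

  replace : ∀ {n N} → Matrix n N → Fin n → (Fin N → ℤ) → Matrix n N
  replace A i w j with j Fin.≟ i
  ... | yes _ = w
  ... | no _ = A j

  replace-at : ∀ {n N} (A : Matrix n N) i w c → replace A i w i c ≡ w c
  replace-at A i w c with i Fin.≟ i
  ... | yes _ = refl
  ... | no ne = ⊥-elim (ne refl)

  replace-off : ∀ {n N} (A : Matrix n N) i w j → j ≢ i → ∀ c → replace A i w j c ≡ A j c
  replace-off A i w j ne c with j Fin.≟ i
  ... | yes e = ⊥-elim (ne e)
  ... | no _ = refl

  replace-off₂ : ∀ {n N} (A : Matrix n N) i w w' j → j ≢ i → ∀ c → replace A i w j c ≡ replace A i w' j c
  replace-off₂ A i w w' j ne c = trans (replace-off A i w j ne c) (sym (replace-off A i w' j ne c))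

  dt-replace-linear : ∀ n (A : Matrix n n) i β γ (w u v : Fin n → ℤ) → (∀ c → w c ≡ β * u c + γ * v c) →
    dt n (replace A i w) ≡ β * dt n (replace A i u) + γ * dt n (replace A i v)
  dt-replace-linear n A i β γ w u v h = dt-linear n i β γ (replace A i w) (replace A i u) (replace A i v)
    (λ c → trans (replace-at A i w c) (trans (h c) (sym (cong₂ (λ x y → β * x + γ * y) (replace-at A i u c) (replace-at A i v c)))))
    (λ j ne c → replace-off₂ A i w u j ne c , replace-off₂ A i w v j ne c)

  dt-replace-cong : ∀ n (A : Matrix n n) i {w u : Fin n → ℤ} → (∀ c → w c ≡ u c) → dt n (replace A i w) ≡ dt n (replace A i u)
  dt-replace-cong n A i {w} {u} h = dt-cong n λ j c → go j c
    where
    go : ∀ j c → replace A i w j c ≡ replace A i u j c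
    go j c with j Fin.≟ i
    ... | yes _ = h c
    ... | no _ = refl

  dt-replace-sum : ∀ n (A : Matrix n n) i p (β : Fin p → ℤ) (W : Matrix p n) →
    dt n (replace A i (λ c → ∑ (λ j → β j * W j c))) ≡ ∑ (λ j → β j * dt n (replace A i (W j)))
  dt-replace-sum n A i zero β W = trans
    (dt-replace-linear n A i 0ℤ 0ℤ (λ c → ∑ (λ j → β j * W j c)) (λ _ → 0ℤ) (λ _ → 0ℤ) (λ c → ∑-empty))
    (trans (alg (dt n (replace A i (λ _ → 0ℤ)))) (sym ∑-empty))
    where
    alg : ∀ x → 0ℤ * x + 0ℤ * x ≡ 0ℤ
    alg = solve-∀
  dt-replace-sum n A i (suc p) β W = begin
    dt n (replace A i (λ c → ∑ (λ j → β j * W j c)))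
      ≡⟨ dt-replace-linear n A i (β zero) 1ℤ (λ c → ∑ (λ j → β j * W j c)) (W zero) w
         (λ c → trans (∑-suc (λ j → β j * W j c)) (cong (λ z → β zero * W zero c + z) (sym (ℤ.*-identityˡ (w c))))) ⟩
    β zero * dt n (replace A i (W zero)) + 1ℤ * dt n (replace A i w)
      ≡⟨ cong (λ z → β zero * dt n (replace A i (W zero)) + z) (trans (ℤ.*-identityˡ (dt n (replace A i w))) (dt-replace-sum n A i p (β ∘ suc) (W ∘ suc))) ⟩
    β zero * dt n (replace A i (W zero)) + ∑ (λ j → β (suc j) * dt n (replace A i (W (suc j))))
      ≡⟨ sym (∑-suc (λ j → β j * dt n (replace A i (W j)))) ⟩
    ∑ (λ j → β j * dt n (replace A i (W j))) ∎
    where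
    open ≡-Reasoning
    w = λ c → ∑ (λ j → β (suc j) * W (suc j) c)

  dt-replace-row : ∀ n (A : Matrix n n) i j → dt n (replace A i (A j)) ≡ δ i j * dt n A
  dt-replace-row n A i j with i Fin.≟ j
  ... | yes refl = trans (dt-cong n go) (sym (trans (cong (_* dt n A) (δ-refl i)) (ℤ.*-identityˡ (dt n A))))
    where
    go : ∀ j' c → replace A i (A i) j' c ≡ A j' c
    go j' c with j' Fin.≟ i
    ... | yes refl = refl
    ... | no _ = refl
  ... | no ne = trans (dt-alt n (replace A i (A j)) i j ne (λ c → trans (replace-at A i (A j) c) (sym (replace-off A i (A j) j (ne ∘ sym) c))))
    (sym (trans (cong (_* dt n A) (δ-≢ ne)) (ℤ.*-zeroˡ (dt n A))))

  cramer : ∀ n (A : Matrix n n) (c : Fin n → ℤ) (w : Fin n → ℤ) → (∀ l → w l ≡ ∑ (λ j → c j * A j l)) →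
    ∀ i → dt n (replace A i w) ≡ c i * dt n A
  cramer n A c w h i = begin
    dt n (replace A i w) ≡⟨ dt-replace-cong n A i h ⟩
    dt n (replace A i (λ l → ∑ (λ j → c j * A j l))) ≡⟨ dt-replace-sum n A i n c A ⟩
    ∑ (λ j → c j * dt n (replace A i (A j))) ≡⟨ ∑-cong (λ j → trans (cong (λ z → c j * z) (dt-replace-row n A i j)) (alg (c j) (δ i j) (dt n A))) ⟩
    ∑ (λ j → δ i j * (c j * dt n A)) ≡⟨ ∑-δ i (λ j → c j * dt n A) ⟩
    c i * dt n A ∎
    where
    open ≡-Reasoning
    alg : ∀ a b x → a * (b * x) ≡ b * (a * x)
    alg = solve-∀

  *-cancel-zero : ∀ a b → b ≢ 0ℤ → a * b ≡ 0ℤ → a ≡ 0ℤ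
  *-cancel-zero a b nb e with ℤ.i*j≡0⇒i≡0∨j≡0 a e
  ... | inj₁ p = p
  ... | inj₂ p = ⊥-elim (nb p)

  *-cancelˡ′ : ∀ a {b c} → a ≢ 0ℤ → a * b ≡ a * c → b ≡ c
  *-cancelˡ′ a {b} {c} na e = ℤ.*-cancelˡ-≡ a b c {{ℤ.≢-nonZero na}} e

  rows-independent : ∀ n (A : Matrix n n) → dt n A ≢ 0ℤ → ∀ (c : Fin n → ℤ) → (∀ l → ∑ (λ j → c j * A j l) ≡ 0ℤ) → ∀ i → c i ≡ 0ℤ
  rows-independent n A nz c h i = *-cancel-zero (c i) (dt n A) nz (trans (sym (cramer n A c (λ _ → 0ℤ) (λ l → sym (h l)) i))
    (trans (dt-replace-linear n A i 0ℤ 0ℤ (λ _ → 0ℤ) (λ _ → 0ℤ) (λ _ → 0ℤ) (λ c → refl)) (alg (dt n (replace A i (λ _ → 0ℤ))))))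
    where
    alg : ∀ x → 0ℤ * x + 0ℤ * x ≡ 0ℤ
    alg = solve-∀

  all-or-some : ∀ {n} (f : Fin n → ℤ) → (∀ i → f i ≡ 0ℤ) ⊎ ∃ λ i → f i ≢ 0ℤ
  all-or-some {zero} f = inj₁ λ ()
  all-or-some {suc n} f with f zero ℤ.≟ 0ℤ | all-or-some (f ∘ suc)
  ... | no ne | _ = inj₂ (zero , ne)
  ... | yes e | inj₂ (i , ne) = inj₂ (suc i , ne)
  ... | yes e | inj₁ h = inj₁ λ { zero → e ; (suc i) → h i }

  insert : ∀ {n} → Fin (suc n) → ℤ → (Fin n → ℤ) → Fin (suc n) → ℤ
  insert zero a f zero = a
  insert zero a f (suc j) = f j
  insert {suc n} (suc i) a f zero = f zero
  insert {suc n} (suc i) a f (suc j) = insert i a (f ∘ suc) j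

  insert-at : ∀ {n} (i : Fin (suc n)) a f → insert i a f i ≡ a
  insert-at zero a f = refl
  insert-at {suc n} (suc i) a f = insert-at i a (f ∘ suc)

  insert-punchIn : ∀ {n} (i : Fin (suc n)) a f j → insert i a f (punchIn i j) ≡ f j
  insert-punchIn zero a f j = refl
  insert-punchIn {suc n} (suc i) a f zero = refl
  insert-punchIn {suc n} (suc i) a f (suc j) = insert-punchIn i a (f ∘ suc) j

  -- Elimination without fractions. If the first column has a pivot, the other rows are multiplied
  -- by it before being cleared; a dependence of the shorter rows lifts with its coefficients times
  -- the pivot, so a nonzero coefficient stays nonzero.
  linear-dependence : ∀ n (A : Matrix (suc n) n) → ∃ λ (c : Fin (suc n) → ℤ) → (∃ λ i → c i ≢ 0ℤ) × (∀ l → ∑ (λ j → c j * A j l) ≡ 0ℤ)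
  linear-dependence zero A = (λ _ → 1ℤ) , (zero , λ ()) , λ ()
  linear-dependence (suc n) A with all-or-some (λ i → A i zero)
  ... | inj₁ z = insert zero 0ℤ c , (suc i , ne) , rel
    where
    ih = linear-dependence n (λ j l → A (suc j) (suc l))
    c = proj₁ ih
    i = proj₁ (proj₁ (proj₂ ih))
    ne = proj₂ (proj₁ (proj₂ ih))
    rel : ∀ l → ∑ (λ j → insert zero 0ℤ c j * A j l) ≡ 0ℤ
    rel zero = ∑-zero (λ j → trans (cong (λ z → insert zero 0ℤ c j * z) (z j)) (ℤ.*-zeroʳ (insert zero 0ℤ c j)))
    rel (suc l) = trans (∑-suc (λ j → insert zero 0ℤ c j * A j (suc l))) (trans (cong (λ z → 0ℤ * A zero (suc l) + z) (proj₂ (proj₂ ih) l)) refl)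
  ... | inj₂ (p , np) = c , (punchIn p i , λ e → ne (*-cancel-zero (c' i) (A p zero) np (trans (sym (insert-punchIn p a (λ s → c' s * A p zero) i)) e))) , rel
    where
    open ≡-Reasoning
    A' : Matrix (suc n) n
    A' s l = A p zero * A (punchIn p s) (suc l) - A (punchIn p s) zero * A p (suc l)
    ih = linear-dependence n A'
    c' = proj₁ ih
    i = proj₁ (proj₁ (proj₂ ih))
    ne = proj₂ (proj₁ (proj₂ ih))
    a = - ∑ (λ s → c' s * A (punchIn p s) zero)
    c = insert p a (λ s → c' s * A p zero)
    expand : ∀ l → ∑ (λ j → c j * A j l) ≡ a * A p l + ∑ (λ s → c' s * A p zero * A (punchIn p s) l)
    expand l = trans (∑-remove p (λ j → c j * A j l)) (cong₂ (λ x y → x * A p l + y) (insert-at p a _)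
      (∑-cong (λ s → cong (λ z → z * A (punchIn p s) l) (insert-punchIn p a _ s))))
    alg : ∀ x y z → - x * y + x * y ≡ 0ℤ * z
    alg = solve-∀
    alg1 : ∀ x y z → x * y * z ≡ x * z * y
    alg1 = solve-∀
    alg2 : ∀ s y t → - s * y + t ≡ t - s * y
    alg2 = solve-∀
    alg3 : ∀ c p q r t → c * p * q - c * r * t ≡ c * (p * q - r * t)
    alg3 = solve-∀
    rel : ∀ l → ∑ (λ j → c j * A j l) ≡ 0ℤ
    rel zero = begin
      ∑ (λ j → c j * A j zero) ≡⟨ expand zero ⟩
      a * A p zero + ∑ (λ s → c' s * A p zero * A (punchIn p s) zero)
        ≡⟨ cong (λ z → a * A p zero + z) (trans (∑-cong (λ s → alg1 (c' s) (A p zero) (A (punchIn p s) zero))) (sym (∑-* (A p zero) (λ s → c' s * A (punchIn p s) zero)))) ⟩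
      a * A p zero + ∑ (λ s → c' s * A (punchIn p s) zero) * A p zero ≡⟨ alg (∑ (λ s → c' s * A (punchIn p s) zero)) (A p zero) 0ℤ ⟩
      0ℤ ∎
    rel (suc l) = begin
      ∑ (λ j → c j * A j (suc l)) ≡⟨ expand (suc l) ⟩
      a * A p (suc l) + ∑ (λ s → c' s * A p zero * A (punchIn p s) (suc l))
        ≡⟨ alg2 (∑ (λ s → c' s * A (punchIn p s) zero)) (A p (suc l)) (∑ (λ s → c' s * A p zero * A (punchIn p s) (suc l))) ⟩
      ∑ (λ s → c' s * A p zero * A (punchIn p s) (suc l)) - ∑ (λ s → c' s * A (punchIn p s) zero) * A p (suc l)
        ≡⟨ cong (λ z → ∑ (λ s → c' s * A p zero * A (punchIn p s) (suc l)) - z) (∑-* (A p (suc l)) (λ s → c' s * A (punchIn p s) zero)) ⟩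
      ∑ (λ s → c' s * A p zero * A (punchIn p s) (suc l)) - ∑ (λ s → c' s * A (punchIn p s) zero * A p (suc l))
        ≡⟨ sym (∑-sub (λ s → c' s * A p zero * A (punchIn p s) (suc l)) (λ s → c' s * A (punchIn p s) zero * A p (suc l))) ⟩
      ∑ (λ s → c' s * A p zero * A (punchIn p s) (suc l) - c' s * A (punchIn p s) zero * A p (suc l))
        ≡⟨ ∑-cong (λ s → alg3 (c' s) (A p zero) (A (punchIn p s) (suc l)) (A (punchIn p s) zero) (A p (suc l))) ⟩
      ∑ (λ s → c' s * A' s l) ≡⟨ proj₂ (proj₂ ih) l ⟩
      0ℤ ∎

  -- The n + 1 rows consisting of w and those of A are dependent, and the coefficient `c₀` of w is
  -- nonzero because the rows of A are independent. Cramer's rule identifies the other coefficients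
  -- up to the factor `c₀`, which cancels. This gives the adjugate identity without expansion along
  -- columns.
  rows-span : ∀ n (A : Matrix n n) → dt n A ≢ 0ℤ → ∀ (w : Fin n → ℤ) l → ∑ (λ j → dt n (replace A j w) * A j l) ≡ dt n A * w l
  rows-span n A nz w l = *-cancelˡ′ c₀ c₀≢0 (begin
    c₀ * ∑ (λ j → dt n (replace A j w) * A j l) ≡⟨ *-∑ c₀ (λ j → dt n (replace A j w) * A j l) ⟩
    ∑ (λ j → c₀ * (dt n (replace A j w) * A j l)) ≡⟨ ∑-cong (λ j → trans (alg1 c₀ (dt n (replace A j w)) (A j l)) (trans (cong (λ z → z * A j l) (minors j)) (alg2 (c (suc j)) (dt n A) (A j l)))) ⟩
    ∑ (λ j → - dt n A * (c (suc j) * A j l)) ≡⟨ sym (*-∑ (- dt n A) (λ j → c (suc j) * A j l)) ⟩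
    - dt n A * ∑ (λ j → c (suc j) * A j l) ≡⟨ cong (λ z → - dt n A * z) (sym (rel' l)) ⟩
    - dt n A * (- (c₀ * w l)) ≡⟨ alg3 (dt n A) c₀ (w l) ⟩
    c₀ * (dt n A * w l) ∎)
    where
    open ≡-Reasoning
    W : Matrix (suc n) n
    W zero = w
    W (suc i) = A i
    dep = linear-dependence n W
    c = proj₁ dep
    c₀ = c zero
    rel' : ∀ l → - (c₀ * w l) ≡ ∑ (λ j → c (suc j) * A j l)
    rel' l = sym (alg0 (c₀ * w l) (∑ (λ j → c (suc j) * A j l)) (trans (sym (∑-suc (λ j → c j * W j l))) (proj₂ (proj₂ dep) l)))
      where
      alg0 : ∀ x y → x + y ≡ 0ℤ → y ≡ - x
      alg0 x y e = trans (alg x y) (trans (cong (λ z → - x + z) e) (ℤ.+-identityʳ (- x)))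
        where
        alg : ∀ x y → y ≡ - x + (x + y)
        alg = solve-∀
    c₀≢0 : c₀ ≢ 0ℤ
    c₀≢0 e = absurd (proj₁ (proj₂ dep))
      where
      ci : ∀ i → c (suc i) ≡ 0ℤ
      ci = rows-independent n A nz (λ i → c (suc i)) (λ l → trans (sym (rel' l)) (trans (cong (λ z → - (z * w l)) e) refl))
      absurd : (∃ λ i → c i ≢ 0ℤ) → ⊥
      absurd (zero , ne) = ne e
      absurd (suc i , ne) = ne (ci i)
    minors : ∀ j → c₀ * dt n (replace A j w) ≡ - c (suc j) * dt n A
    minors j = begin
      c₀ * dt n (replace A j w) ≡⟨ alg4 c₀ (dt n (replace A j w)) ⟩
      c₀ * dt n (replace A j w) + 0ℤ * dt n (replace A j w) ≡⟨ sym (dt-replace-linear n A j c₀ 0ℤ (λ l → c₀ * w l) w w (λ l → alg4 c₀ (w l))) ⟩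
      dt n (replace A j (λ l → c₀ * w l)) ≡⟨ cramer n A (λ i → - c (suc i)) (λ l → c₀ * w l) (λ l → trans (sym (ℤ.neg-involutive (c₀ * w l)))
          (trans (cong -_ (rel' l)) (trans (sym (∑-neg (λ j → c (suc j) * A j l))) (∑-cong (λ j → ℤ.neg-distribˡ-* (c (suc j)) (A j l)))))) j ⟩
      - c (suc j) * dt n A ∎
      where
      alg4 : ∀ a b → a * b ≡ a * b + 0ℤ * b
      alg4 = solve-∀
    alg1 : ∀ a b x → a * (b * x) ≡ a * b * x
    alg1 = solve-∀
    alg2 : ∀ a b x → - a * b * x ≡ - b * (a * x)
    alg2 = solve-∀
    alg3 : ∀ a b x → - a * (- (b * x)) ≡ b * (a * x)
    alg3 = solve-∀

  dt-id : ∀ n → dt n δ ≡ 1ℤ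
  dt-id zero = dt-zero
  dt-id (suc n) = begin
    dt (suc n) δ ≡⟨ dt-suc n δ ⟩
    ∑ (λ j → sg j * δ zero j * dt n (minor δ j)) ≡⟨ ∑-cong (λ j → alg (sg j) (δ zero j) (dt n (minor δ j))) ⟩
    ∑ (λ j → δ zero j * (sg j * dt n (minor δ j))) ≡⟨ ∑-δ zero (λ j → sg j * dt n (minor δ j)) ⟩
    1ℤ * dt n δ ≡⟨ trans (ℤ.*-identityˡ (dt n δ)) (dt-id n) ⟩
    1ℤ ∎
    where
    open ≡-Reasoning
    alg : ∀ a b x → a * b * x ≡ b * (a * x)
    alg = solve-∀

  -- The coefficients that produce the unit vectors form an integral left inverse, so the
  -- determinant divides 1.
  generating⇒unimodular : ∀ n (A : Matrix n n) → (∀ (z : Fin n → ℤ) → ∃ λ μ → ∀ l → ∑ (λ i → μ i * A i l) ≡ z l) → ∣ dt n A ∣ ≡ 1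
  generating⇒unimodular n A gen = ℕ.m*n≡1⇒n≡1 ∣ dt n B ∣ ∣ dt n A ∣ (trans (sym (ℤ.abs-* (dt n B) (dt n A))) (cong ∣_∣ (begin
    dt n B * dt n A ≡⟨ sym (φ-mul n (dt-alternating n) B A) ⟩
    dt n (B ⊡ A) ≡⟨ dt-cong n (λ i c → proj₂ (gen (δ i)) c) ⟩
    dt n δ ≡⟨ dt-id n ⟩
    1ℤ ∎)))
    where
    open ≡-Reasoning
    B : Matrix n n
    B i = proj₁ (gen (δ i))


  -- Volume, affine independence and integral barycentric coordinates

  edges : ∀ {d} → Matrix (suc d) d → Matrix d d
  edges v i c = v (suc i) c - v zero c

  entries-edgeMatrix : ∀ {d} (s : Vec (ZPt d) (suc d)) → entries (edgeMatrix s) ≈ edges (entries s)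
  entries-edgeMatrix (x ∷ xs) i c = trans (cong (λ r → lookup r c) (lookup-map i (λ v → zipWith ℤ._-_ v x) xs))
    (lookup-zipWith ℤ._-_ c (lookup xs i) x)

  vol : ∀ {d} → Matrix (suc d) d → ℤ
  vol {d} v = dt d (edges v)

  det≡vol : ∀ {d} (s : Vec (ZPt d) (suc d)) → det d (edgeMatrix s) ≡ vol (entries s)
  det≡vol {d} s = trans (det≡dt d (edgeMatrix s)) (dt-cong d (entries-edgeMatrix s))

  ∑-edges : ∀ {d} (v : Matrix (suc d) d) (c : Fin (suc d) → ℤ) l → ∑ (λ j → c j * v j l) ≡ ∑ c * v zero l + ∑ (λ i → c (suc i) * edges v i l)
  ∑-edges v c l = begin
    ∑ (λ j → c j * v j l) ≡⟨ ∑-suc (λ j → c j * v j l) ⟩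
    c zero * v zero l + ∑ (λ i → c (suc i) * v (suc i) l) ≡⟨ cong (λ z → c zero * v zero l + z) (∑-cong (λ i → alg (c (suc i)) (v (suc i) l) (v zero l))) ⟩
    c zero * v zero l + ∑ (λ i → c (suc i) * v zero l + c (suc i) * edges v i l)
      ≡⟨ cong (λ z → c zero * v zero l + z) (trans (∑-+ (λ i → c (suc i) * v zero l) (λ i → c (suc i) * edges v i l))
         (cong (λ z → z + ∑ (λ i → c (suc i) * edges v i l)) (sym (∑-* (v zero l) (λ i → c (suc i)))))) ⟩
    c zero * v zero l + (∑ (λ i → c (suc i)) * v zero l + ∑ (λ i → c (suc i) * edges v i l))
      ≡⟨ alg' (c zero) (v zero l) (∑ (λ i → c (suc i))) (∑ (λ i → c (suc i) * edges v i l)) ⟩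
    (c zero + ∑ (λ i → c (suc i))) * v zero l + ∑ (λ i → c (suc i) * edges v i l)
      ≡⟨ cong (λ z → z * v zero l + ∑ (λ i → c (suc i) * edges v i l)) (sym (∑-suc c)) ⟩
    ∑ c * v zero l + ∑ (λ i → c (suc i) * edges v i l) ∎
    where
    open ≡-Reasoning
    alg : ∀ c x y → c * x ≡ c * y + c * (x - y)
    alg = solve-∀
    alg' : ∀ a x b y → a * x + (b * x + y) ≡ (a + b) * x + y
    alg' = solve-∀

  AffinelyIndependent : ∀ {n d} → Matrix n d → Set
  AffinelyIndependent v = ∀ c → ∑ c ≡ 0ℤ → (∀ l → ∑ (λ j → c j * v j l) ≡ 0ℤ) → ∀ j → c j ≡ 0ℤ

  vol≢0⇒independent : ∀ {d} (v : Matrix (suc d) d) → vol v ≢ 0ℤ → AffinelyIndependent v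
  vol≢0⇒independent {d} v nz c s h = λ { zero → trans (sym c₀) s ; (suc i) → tail i }
    where
    tail : ∀ i → c (suc i) ≡ 0ℤ
    tail = rows-independent d (edges v) nz (λ i → c (suc i)) (λ l → trans (sym (ℤ.+-identityˡ (∑ (λ i → c (suc i) * edges v i l))))
      (trans (cong (λ z → z * v zero l + ∑ (λ i → c (suc i) * edges v i l)) (sym s)) (trans (sym (∑-edges v c l)) (h l))))
    c₀ : ∑ c ≡ c zero
    c₀ = trans (∑-suc c) (trans (cong (λ z → c zero + z) (∑-zero tail)) (ℤ.+-identityʳ (c zero)))

  sign-fix : ∀ z → ∃ λ s → s * z ≡ ℤ.+ ∣ z ∣
  sign-fix (ℤ.+ n) = 1ℤ , ℤ.*-identityˡ (ℤ.+ n)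
  sign-fix (ℤ.-[1+ n ]) = - 1ℤ , ℤ.-1*i≡-i (ℤ.-[1+ n ])

  -- Cramer's rule for x - h v₀ in terms of the edges at vertex 0; the weight of vertex 0 absorbs
  -- the prescribed sum. The factor `s` makes the denominator positive, so that it can serve as a
  -- modulus.
  vol-span : ∀ {d} (v : Matrix (suc d) d) → vol v ≢ 0ℤ → ∀ (x : Fin d → ℤ) h →
    ∃ λ B → ∑ B ≡ ℤ.+ ∣ vol v ∣ * h × (∀ l → ∑ (λ j → B j * v j l) ≡ ℤ.+ ∣ vol v ∣ * x l)
  vol-span {d} v nz x h = B , total , λ l → begin
    ∑ (λ j → B j * v j l) ≡⟨ ∑-edges v B l ⟩
    ∑ B * v zero l + ∑ (λ i → s * b i * edges v i l)
      ≡⟨ cong₂ (λ y z → y * v zero l + z) total (trans (∑-cong (λ i → alg s (b i) (edges v i l))) (sym (*-∑ s (λ i → b i * edges v i l)))) ⟩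
    D * h * v zero l + s * ∑ (λ i → b i * edges v i l) ≡⟨ cong (λ z → D * h * v zero l + s * z) (rows-span d (edges v) nz w l) ⟩
    D * h * v zero l + s * (vol v * w l) ≡⟨ cong (λ z → D * h * v zero l + z) (trans (alg2 s (vol v) (w l)) (cong (λ z → z * w l) (proj₂ (sign-fix (vol v))))) ⟩
    D * h * v zero l + D * (x l - h * v zero l) ≡⟨ alg3 D h (v zero l) (x l) ⟩
    D * x l ∎
    where
    open ≡-Reasoning
    s = proj₁ (sign-fix (vol v))
    D = ℤ.+ ∣ vol v ∣
    w : Fin d → ℤ
    w l = x l - h * v zero l
    b : Fin d → ℤ
    b i = dt d (replace (edges v) i w)
    B : Fin (suc d) → ℤ
    B zero = D * h - ∑ (λ i → s * b i)
    B (suc i) = s * b i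
    alg0 : ∀ x y → x - y + y ≡ x
    alg0 = solve-∀
    total : ∑ B ≡ D * h
    total = trans (∑-suc B) (alg0 (D * h) (∑ (λ i → s * b i)))
    alg : ∀ a b c → a * b * c ≡ a * (b * c)
    alg = solve-∀
    alg2 : ∀ a b c → a * (b * c) ≡ a * b * c
    alg2 = solve-∀
    alg3 : ∀ D h v x → D * h * v + D * (x - h * v) ≡ D * x
    alg3 = solve-∀

  unimodular-coordinates : ∀ {d} (v : Matrix (suc d) d) → ∣ vol v ∣ ≡ 1 → ∀ (x : Fin d → ℤ) h →
    ∃ λ B → ∑ B ≡ h × (∀ l → ∑ (λ j → B j * v j l) ≡ x l)
  unimodular-coordinates v e x h = B , trans sB (one h) , λ l → trans (hB l) (one (x l))
    where
    nz : vol v ≢ 0ℤ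
    nz z with trans (sym e) (cong ∣_∣ z)
    ... | ()
    sp = vol-span v nz x h
    B = proj₁ sp
    sB = proj₁ (proj₂ sp)
    hB = proj₂ (proj₂ sp)
    one : ∀ y → ℤ.+ ∣ vol v ∣ * y ≡ y
    one y = trans (cong (λ n → ℤ.+ n * y) e) (ℤ.*-identityˡ y)

  generating⇒vol≡1 : ∀ {d} (v : Matrix (suc d) d) →
    (∀ (z : Fin d → ℤ) → ∃ λ μ → ∑ μ ≡ 0ℤ × (∀ l → ∑ (λ j → μ j * v j l) ≡ z l)) → ∣ vol v ∣ ≡ 1
  generating⇒vol≡1 {d} v gen = generating⇒unimodular d (edges v) λ z → let (μ , s , h) = gen z in
    (λ i → μ (suc i)) , λ l → trans (sym (trans (∑-edges v μ l) (trans (cong (λ y → y * v zero l + ∑ (λ i → μ (suc i) * edges v i l)) s)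
      (ℤ.+-identityˡ (∑ (λ i → μ (suc i) * edges v i l)))))) (h l)

  -- Rational points as integer vectors with a denominator

  lookup-ext : ∀ {A : Set} {n} {x y : Vec A n} → (∀ i → lookup x i ≡ lookup y i) → x ≡ y
  lookup-ext {x = x} {y} h = trans (sym (tabulate∘lookup x)) (trans (tabulate-cong h) (tabulate∘lookup y))

  toℚᵘ-toQ : ∀ z → toℚᵘ (toQ z) ≃ mkℚᵘ z 0
  toℚᵘ-toQ z = ℚ.toℚᵘ-fromℚᵘ (mkℚᵘ z 0)

  toQ-+ : ∀ a b → toQ (a + b) ≡ toQ a ℚ.+ toQ b
  toQ-+ a b = ℚ.toℚᵘ-injective (ℚᵘ.≃-trans (toℚᵘ-toQ (a + b)) (ℚᵘ.≃-trans {j = mkℚᵘ a 0 ℚᵘ.+ mkℚᵘ b 0} (*≡* (alg a b))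
    (ℚᵘ.≃-sym (ℚᵘ.≃-trans (ℚ.toℚᵘ-homo-+ (toQ a) (toQ b)) (ℚᵘ.+-cong (toℚᵘ-toQ a) (toℚᵘ-toQ b))))))
    where
    alg : ∀ a b → (a + b) * 1ℤ ≡ (a * 1ℤ + b * 1ℤ) * 1ℤ
    alg = solve-∀

  toQ-* : ∀ a b → toQ (a * b) ≡ toQ a ℚ.* toQ b
  toQ-* a b = ℚ.toℚᵘ-injective (ℚᵘ.≃-trans (toℚᵘ-toQ (a * b)) (ℚᵘ.≃-sym (ℚᵘ.≃-trans (ℚ.toℚᵘ-homo-* (toQ a) (toQ b)) (ℚᵘ.*-cong (toℚᵘ-toQ a) (toℚᵘ-toQ b)))))

  toQ-injective : ∀ {a b} → toQ a ≡ toQ b → a ≡ b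
  toQ-injective {a} {b} e with ℚᵘ.≃-trans (ℚᵘ.≃-sym (toℚᵘ-toQ a)) (ℚᵘ.≃-trans (ℚ.toℚᵘ-cong e) (toℚᵘ-toQ b))
  ... | *≡* h = trans (sym (ℤ.*-identityʳ a)) (trans h (ℤ.*-identityʳ b))

  toQ-mono-≤ : ∀ {a b} → a ≤ b → toQ a ℚ.≤ toQ b
  toQ-mono-≤ {a} {b} h = ℚ.toℚᵘ-cancel-≤ (ℚᵘ.≤-trans (ℚᵘ.≤-reflexive (toℚᵘ-toQ a)) (ℚᵘ.≤-trans (*≤* (subst₂ _≤_ (sym (ℤ.*-identityʳ a)) (sym (ℤ.*-identityʳ b)) h)) (ℚᵘ.≤-reflexive (ℚᵘ.≃-sym (toℚᵘ-toQ b)))))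

  toQ-cancel-≤ : ∀ {a b} → toQ a ℚ.≤ toQ b → a ≤ b
  toQ-cancel-≤ {a} {b} h with ℚᵘ.≤-trans (ℚᵘ.≤-reflexive (ℚᵘ.≃-sym (toℚᵘ-toQ a))) (ℚᵘ.≤-trans (ℚ.toℚᵘ-mono-≤ h) (ℚᵘ.≤-reflexive (toℚᵘ-toQ b)))
  ... | *≤* e = subst₂ _≤_ (ℤ.*-identityʳ a) (ℤ.*-identityʳ b) e

  toQ-mono-< : ∀ {a b} → a < b → toQ a ℚ.< toQ b
  toQ-mono-< {a} {b} h = ℚ.≰⇒> (λ le → ℤ.<⇒≱ h (toQ-cancel-≤ le))

  clear-denominator : ∀ p → toQ (↧ p) ℚ.* p ≡ toQ (↥ p)
  clear-denominator p = ℚ.toℚᵘ-injective (ℚᵘ.≃-trans (ℚ.toℚᵘ-homo-* (toQ (↧ p)) p) (ℚᵘ.≃-trans (ℚᵘ.*-cong (toℚᵘ-toQ (↧ p)) (ℚᵘ.≃-refl {toℚᵘ p}))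
    (ℚᵘ.≃-trans {j = mkℚᵘ (↥ p) 0} (go p) (ℚᵘ.≃-sym (toℚᵘ-toQ (↥ p))))))
    where
    go : ∀ p → mkℚᵘ (↧ p) 0 ℚᵘ.* toℚᵘ p ≃ mkℚᵘ (↥ p) 0
    go (ℚ.mkℚ n d c) = *≡* (trans (ℤ.*-identityʳ (ℤ.+ suc d * n)) (trans (ℤ.*-comm (ℤ.+ suc d) n) (cong (λ z → n * (ℤ.+ suc z)) (sym (ℕ.+-identityʳ d)))))

  ↧-pos : ∀ p → 0ℤ < ↧ p
  ↧-pos p = ℤ.+<+ (ℕ.s≤s ℕ.z≤n)

  toQ-pos : ∀ {q} → 0ℤ < q → ℚ.Positive (toQ q)
  toQ-pos h = ℚ.positive (toQ-mono-< h)

  toQ-cancelˡ : ∀ {q} → 0ℤ < q → ∀ {x y} → toQ q ℚ.* x ≡ toQ q ℚ.* y → x ≡ y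
  toQ-cancelˡ {q} h {x} {y} e = ℚ.≤-antisym (ℚ.*-cancelˡ-≤-pos (toQ q) {{toQ-pos h}} (ℚ.≤-reflexive e)) (ℚ.*-cancelˡ-≤-pos (toQ q) {{toQ-pos h}} (ℚ.≤-reflexive (sym e)))

  ratio : ∀ X q → 0ℤ < q → ∃ λ x → toQ q ℚ.* x ≡ toQ X
  ratio X (ℤ.+ suc n) h = (X ℚ./ suc n) , ℚ.toℚᵘ-injective (ℚᵘ.≃-trans (ℚ.toℚᵘ-homo-* (toQ (ℤ.+ suc n)) (X ℚ./ suc n))
    (ℚᵘ.≃-trans (ℚᵘ.*-cong (toℚᵘ-toQ (ℤ.+ suc n)) (ℚ.toℚᵘ-fromℚᵘ (mkℚᵘ X n)))
    (ℚᵘ.≃-trans {j = mkℚᵘ X 0} (*≡* (trans (ℤ.*-identityʳ (ℤ.+ suc n * X)) (trans (ℤ.*-comm (ℤ.+ suc n) X) (cong (λ z → X * (ℤ.+ suc z)) (sym (ℕ.+-identityʳ n))))))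
    (ℚᵘ.≃-sym (toℚᵘ-toQ X)))))
  ratio X (ℤ.+ zero) (ℤ.+<+ ())

  0<-* : ∀ {a b} → 0ℤ < a → 0ℤ < b → 0ℤ < a * b
  0<-* {a} {b} ha hb = subst (_< a * b) (ℤ.*-zeroˡ b) (ℤ.*-monoʳ-<-pos b {{ℤ.positive hb}} ha)

  0≤-* : ∀ {a b} → 0ℤ ≤ a → 0ℤ ≤ b → 0ℤ ≤ a * b
  0≤-* {a} {b} ha hb = subst (_≤ a * b) (ℤ.*-zeroˡ b) (ℤ.*-monoʳ-≤-nonNeg b {{ℤ.nonNegative hb}} ha)

  -- The equation x = X / q without division. Points of convex hulls are treated below through such
  -- pairs (X , q).
  Represents : ∀ {n} → Vec ℚ n → (Fin n → ℤ) → ℤ → Set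
  Represents x X q = ∀ i → toQ q ℚ.* lookup x i ≡ toQ (X i)

  common-denominator : ∀ {n} (x : Vec ℚ n) → ∃ λ q → 0ℤ < q × ∃ λ X → Represents x X q
  common-denominator [] = 1ℤ , ℤ.+<+ (ℕ.s≤s ℕ.z≤n) , (λ ()) , λ ()
  common-denominator {suc n} (p ∷ x) with common-denominator x
  ... | q , hq , X , h = ↧ p * q , 0<-* (↧-pos p) hq , Y , rep
    where
    open ≡-Reasoning
    Y : Fin (suc n) → ℤ
    Y zero = q * ↥ p
    Y (suc i) = ↧ p * X i
    rep : Represents (p ∷ x) Y (↧ p * q)
    rep zero = begin
      toQ (↧ p * q) ℚ.* p ≡⟨ cong (λ z → z ℚ.* p) (trans (cong toQ (ℤ.*-comm (↧ p) q)) (toQ-* q (↧ p))) ⟩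
      toQ q ℚ.* toQ (↧ p) ℚ.* p ≡⟨ ℚ.*-assoc (toQ q) (toQ (↧ p)) p ⟩
      toQ q ℚ.* (toQ (↧ p) ℚ.* p) ≡⟨ cong (λ z → toQ q ℚ.* z) (clear-denominator p) ⟩
      toQ q ℚ.* toQ (↥ p) ≡⟨ sym (toQ-* q (↥ p)) ⟩
      toQ (q * ↥ p) ∎
    rep (suc i) = begin
      toQ (↧ p * q) ℚ.* lookup x i ≡⟨ cong (λ z → z ℚ.* lookup x i) (toQ-* (↧ p) q) ⟩
      toQ (↧ p) ℚ.* toQ q ℚ.* lookup x i ≡⟨ ℚ.*-assoc (toQ (↧ p)) (toQ q) (lookup x i) ⟩
      toQ (↧ p) ℚ.* (toQ q ℚ.* lookup x i) ≡⟨ cong (λ z → toQ (↧ p) ℚ.* z) (h i) ⟩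
      toQ (↧ p) ℚ.* toQ (X i) ≡⟨ sym (toQ-* (↧ p) (X i)) ⟩
      toQ (↧ p * X i) ∎

  fraction : ∀ {n} (X : Fin n → ℤ) q → 0ℤ < q → ∃ λ (x : Vec ℚ n) → Represents x X q
  fraction X q h = tabulate (λ i → proj₁ (ratio (X i) q h)) , λ i →
    trans (cong (λ z → toQ q ℚ.* z) (lookup∘tabulate (λ i → proj₁ (ratio (X i) q h)) i)) (proj₂ (ratio (X i) q h))

  represents-toQPt : ∀ {n} (x : ZPt n) → Represents (toQPt x) (lookup x) 1ℤ
  represents-toQPt x i = trans (ℚ.*-identityˡ (lookup (toQPt x) i)) (lookup-map i toQ x)

  scale-sum : ∀ {A : Set} {n} (f : ℚ → A → ℚ) (w : Vec ℚ n) (V : Vec A n) r (F : Fin n → ℤ) →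
    (∀ i → toQ r ℚ.* f (lookup w i) (lookup V i) ≡ toQ (F i)) → toQ r ℚ.* sumℚ (zipWith f w V) ≡ toQ (∑ F)
  scale-sum f [] [] r F h = trans (ℚ.*-zeroʳ (toQ r)) (cong toQ (sym ∑-empty))
  scale-sum f (w ∷ ws) (v ∷ vs) r F h = begin
    toQ r ℚ.* (f w v ℚ.+ sumℚ (zipWith f ws vs)) ≡⟨ ℚ.*-distribˡ-+ (toQ r) (f w v) (sumℚ (zipWith f ws vs)) ⟩
    toQ r ℚ.* f w v ℚ.+ toQ r ℚ.* sumℚ (zipWith f ws vs) ≡⟨ cong₂ ℚ._+_ (h zero) (scale-sum f ws vs r (F ∘ suc) (h ∘ suc)) ⟩
    toQ (F zero) ℚ.+ toQ (∑ (F ∘ suc)) ≡⟨ sym (toQ-+ (F zero) (∑ (F ∘ suc))) ⟩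
    toQ (F zero + ∑ (F ∘ suc)) ≡⟨ cong toQ (sym (∑-suc F)) ⟩
    toQ (∑ F) ∎
    where open ≡-Reasoning

  scale-sumℚ : ∀ {n} (w : Vec ℚ n) W r → Represents w W r → toQ r ℚ.* sumℚ w ≡ toQ (∑ W)
  scale-sumℚ w W r h = trans (cong (λ z → toQ r ℚ.* sumℚ z) (sym (zip-fst w))) (scale-sum (λ a _ → a) w w r W h)
    where
    zip-fst : ∀ {n} (w : Vec ℚ n) → zipWith (λ a _ → a) w w ≡ w
    zip-fst [] = refl
    zip-fst (x ∷ w) = cong (x ∷_) (zip-fst w)

  scale-combo : ∀ {d n} (w : Vec ℚ n) (V : Vec (ZPt d) n) W r → Represents w W r → ∀ l →
    toQ r ℚ.* lookup (combo w V) l ≡ toQ (∑ (λ j → W j * entries V j l))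
  scale-combo w V W r h l = trans (cong (λ z → toQ r ℚ.* z) (lookup∘tabulate _ l))
    (scale-sum (λ wj vj → wj ℚ.* toQ (lookup vj l)) w V r (λ j → W j * entries V j l) λ j → begin
      toQ r ℚ.* (lookup w j ℚ.* toQ (entries V j l)) ≡⟨ sym (ℚ.*-assoc (toQ r) (lookup w j) (toQ (entries V j l))) ⟩
      toQ r ℚ.* lookup w j ℚ.* toQ (entries V j l) ≡⟨ cong (λ z → z ℚ.* toQ (entries V j l)) (h j) ⟩
      toQ (W j) ℚ.* toQ (entries V j l) ≡⟨ sym (toQ-* (W j) (entries V j l)) ⟩
      toQ (W j * entries V j l) ∎)
    where open ≡-Reasoning

  -- X / q lies in the convex hull of the rows of v
  record InHull {n d} (v : Matrix n d) (X : Fin d → ℤ) (q : ℤ) : Set where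
    constructor hull
    field
      scale : ℤ
      scale-pos : 0ℤ < scale
      weight : Fin n → ℤ
      weight≥0 : ∀ j → 0ℤ ≤ weight j
      weight-sum : ∑ weight ≡ scale * q
      weight-comb : ∀ l → ∑ (λ j → weight j * v j l) ≡ scale * X l
  open InHull public

  weight-nonneg : ∀ {n} (w : Vec ℚ n) → All (λ c → 0ℚ ℚ.≤ c) w → ∀ i → 0ℚ ℚ.≤ lookup w i
  weight-nonneg (x ∷ w) (p ∷ ps) zero = p
  weight-nonneg (x ∷ w) (p ∷ ps) (suc i) = weight-nonneg w ps i

  nonneg-weight : ∀ {n} (w : Vec ℚ n) → (∀ i → 0ℚ ℚ.≤ lookup w i) → All (λ c → 0ℚ ℚ.≤ c) w
  nonneg-weight [] h = []
  nonneg-weight (x ∷ w) h = h zero ∷ nonneg-weight w (h ∘ suc)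

  nonneg-scaled : ∀ {q x X} → 0ℤ < q → toQ q ℚ.* x ≡ toQ X → 0ℚ ℚ.≤ x → 0ℤ ≤ X
  nonneg-scaled {q} {x} hq e h = toQ-cancel-≤ (subst₂ ℚ._≤_ (ℚ.*-zeroʳ (toQ q)) e (ℚ.*-monoˡ-≤-nonNeg (toQ q) {{ℚ.nonNegative (toQ-mono-≤ (ℤ.<⇒≤ hq))}} h))

  nonneg-unscaled : ∀ {q x X} → 0ℤ < q → toQ q ℚ.* x ≡ toQ X → 0ℤ ≤ X → 0ℚ ℚ.≤ x
  nonneg-unscaled {q} {x} {X} hq e h = ℚ.*-cancelˡ-≤-pos (toQ q) {{toQ-pos hq}} (subst₂ ℚ._≤_ (sym (ℚ.*-zeroʳ (toQ q))) (sym e) (toQ-mono-≤ h))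

  -- The integer weights are the given rational ones times a positive integer.
  conv⇒hull : ∀ {d n} (V : Vec (ZPt d) n) x X q → 0ℤ < q → Represents x X q → (h : InConv V x) →
    ∃ λ (H : InHull (entries V) X q) → Represents (proj₁ h) (weight H) (scale H * q)
  conv⇒hull V x X q hq rx (w , nn , s , c) with common-denominator w
  ... | r , hr , W , hW = hull r hr (λ j → q * W j) (λ j → 0≤-* (ℤ.<⇒≤ hq) (nonneg-scaled hr (hW j) (weight-nonneg w nn j)))
      (trans (sym (*-∑ q W)) (trans (cong (q *_) sumW) (ℤ.*-comm q r)))
      (λ l → begin
        ∑ (λ j → q * W j * entries V j l) ≡⟨ ∑-cong (λ j → ℤ.*-assoc q (W j) (entries V j l)) ⟩
        ∑ (λ j → q * (W j * entries V j l)) ≡⟨ sym (*-∑ q (λ j → W j * entries V j l)) ⟩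
        q * ∑ (λ j → W j * entries V j l) ≡⟨ toQ-injective (begin
          toQ (q * ∑ (λ j → W j * entries V j l)) ≡⟨ toQ-* q (∑ (λ j → W j * entries V j l)) ⟩
          toQ q ℚ.* toQ (∑ (λ j → W j * entries V j l)) ≡⟨ cong (λ z → toQ q ℚ.* z) (sym (scale-combo w V W r hW l)) ⟩
          toQ q ℚ.* (toQ r ℚ.* lookup (combo w V) l) ≡⟨ cong (λ z → toQ q ℚ.* (toQ r ℚ.* lookup z l)) c ⟩
          toQ q ℚ.* (toQ r ℚ.* lookup x l) ≡⟨ swap (toQ q) (toQ r) (lookup x l) ⟩
          toQ r ℚ.* (toQ q ℚ.* lookup x l) ≡⟨ cong (λ z → toQ r ℚ.* z) (rx l) ⟩
          toQ r ℚ.* toQ (X l) ≡⟨ sym (toQ-* r (X l)) ⟩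
          toQ (r * X l) ∎) ⟩
        r * X l ∎)
    , λ j → begin
        toQ (r * q) ℚ.* lookup w j ≡⟨ cong (λ z → z ℚ.* lookup w j) (trans (cong toQ (ℤ.*-comm r q)) (toQ-* q r)) ⟩
        toQ q ℚ.* toQ r ℚ.* lookup w j ≡⟨ ℚ.*-assoc (toQ q) (toQ r) (lookup w j) ⟩
        toQ q ℚ.* (toQ r ℚ.* lookup w j) ≡⟨ cong (λ z → toQ q ℚ.* z) (hW j) ⟩
        toQ q ℚ.* toQ (W j) ≡⟨ sym (toQ-* q (W j)) ⟩
        toQ (q * W j) ∎
    where
    open ≡-Reasoning
    swap : ∀ a b c → a ℚ.* (b ℚ.* c) ≡ b ℚ.* (a ℚ.* c)
    swap a b c = trans (sym (ℚ.*-assoc a b c)) (trans (cong (λ z → z ℚ.* c) (ℚ.*-comm a b)) (ℚ.*-assoc b a c))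
    sumW : ∑ W ≡ r
    sumW = toQ-injective (trans (sym (scale-sumℚ w W r hW)) (trans (cong (λ z → toQ r ℚ.* z) s) (ℚ.*-identityʳ (toQ r))))

  hull⇒conv : ∀ {d n} (V : Vec (ZPt d) n) x X q → 0ℤ < q → Represents x X q → InHull (entries V) X q → InConv V x
  hull⇒conv V x X q hq rx (hull r hr W nn s c) = w , nonneg-weight w (λ i → nonneg-unscaled hrq (hw i) (nn i))
    , toQ-cancelˡ hrq (trans (scale-sumℚ w W (r * q) hw) (trans (cong toQ s) (sym (ℚ.*-identityʳ (toQ (r * q))))))
    , lookup-ext (λ l → toQ-cancelˡ hrq (begin
        toQ (r * q) ℚ.* lookup (combo w V) l ≡⟨ scale-combo w V W (r * q) hw l ⟩
        toQ (∑ (λ j → W j * entries V j l)) ≡⟨ cong toQ (c l) ⟩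
        toQ (r * X l) ≡⟨ toQ-* r (X l) ⟩
        toQ r ℚ.* toQ (X l) ≡⟨ cong (λ z → toQ r ℚ.* z) (sym (rx l)) ⟩
        toQ r ℚ.* (toQ q ℚ.* lookup x l) ≡⟨ sym (ℚ.*-assoc (toQ r) (toQ q) (lookup x l)) ⟩
        toQ r ℚ.* toQ q ℚ.* lookup x l ≡⟨ cong (λ z → z ℚ.* lookup x l) (sym (toQ-* r q)) ⟩
        toQ (r * q) ℚ.* lookup x l ∎))
    where
    open ≡-Reasoning
    hrq = 0<-* hr hq
    w = proj₁ (fraction W (r * q) hrq)
    hw = proj₂ (fraction W (r * q) hrq)

  0<1 : 0ℤ < 1ℤ
  0<1 = ℤ.+<+ (ℕ.s≤s ℕ.z≤n)

  lattice⇒hull : ∀ {d n} (V : Vec (ZPt d) n) x → LatticeIn V x → InHull (entries V) (lookup x) 1ℤ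
  lattice⇒hull V x h = proj₁ (conv⇒hull V (toQPt x) (lookup x) 1ℤ 0<1 (represents-toQPt x) h)

  hull⇒lattice : ∀ {d n} (V : Vec (ZPt d) n) x → InHull (entries V) (lookup x) 1ℤ → LatticeIn V x
  hull⇒lattice V x h = hull⇒conv V (toQPt x) (lookup x) 1ℤ 0<1 (represents-toQPt x) h

  entries-dilate : ∀ {d n} c (V : Vec (ZPt d) n) j l → entries (dilate c V) j l ≡ ℤ.+ c * entries V j l
  entries-dilate c V j l = trans (cong (λ z → lookup z l) (lookup-map j (map (ℤ.+ c *_)) V)) (lookup-map l (ℤ.+ c *_) (lookup V j))

  scale-dot : ∀ {n} (u : Vec ℤ n) (x : Vec ℚ n) X q → Represents x X q →
    toQ q ℚ.* sumℚ (zipWith ℚ._*_ (toQPt u) x) ≡ toQ (∑ (λ c → lookup u c * X c))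
  scale-dot u x X q rx = scale-sum ℚ._*_ (toQPt u) x q (λ c → lookup u c * X c) λ c → begin
    toQ q ℚ.* (lookup (toQPt u) c ℚ.* lookup x c) ≡⟨ cong (λ z → toQ q ℚ.* (z ℚ.* lookup x c)) (lookup-map c toQ u) ⟩
    toQ q ℚ.* (toQ (lookup u c) ℚ.* lookup x c) ≡⟨ swap (toQ q) (toQ (lookup u c)) (lookup x c) ⟩
    toQ (lookup u c) ℚ.* (toQ q ℚ.* lookup x c) ≡⟨ cong (λ z → toQ (lookup u c) ℚ.* z) (rx c) ⟩
    toQ (lookup u c) ℚ.* toQ (X c) ≡⟨ sym (toQ-* (lookup u c) (X c)) ⟩
    toQ (lookup u c * X c) ∎
    where
    open ≡-Reasoning
    swap : ∀ a b c → a ℚ.* (b ℚ.* c) ≡ b ℚ.* (a ℚ.* c)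
    swap a b c = trans (sym (ℚ.*-assoc a b c)) (trans (cong (λ z → z ℚ.* c) (ℚ.*-comm a b)) (ℚ.*-assoc b a c))

  represents-affMapQ : ∀ {d} (U : Mat d) c x X q → Represents x X q →
    Represents (affMapQ U c x) (λ i → ∑ (λ l → entries U i l * X l) + q * lookup c i) q
  represents-affMapQ U c x X q rx i = begin
    toQ q ℚ.* lookup (affMapQ U c x) i ≡⟨ cong (λ z → toQ q ℚ.* z) (lookup∘tabulate _ i) ⟩
    toQ q ℚ.* (sumℚ (zipWith ℚ._*_ (toQPt (lookup U i)) x) ℚ.+ toQ (lookup c i))
      ≡⟨ ℚ.*-distribˡ-+ (toQ q) (sumℚ (zipWith ℚ._*_ (toQPt (lookup U i)) x)) (toQ (lookup c i)) ⟩
    toQ q ℚ.* sumℚ (zipWith ℚ._*_ (toQPt (lookup U i)) x) ℚ.+ toQ q ℚ.* toQ (lookup c i)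
      ≡⟨ cong₂ ℚ._+_ (scale-dot (lookup U i) x X q rx) (sym (toQ-* q (lookup c i))) ⟩
    toQ (∑ (λ l → entries U i l * X l)) ℚ.+ toQ (q * lookup c i) ≡⟨ sym (toQ-+ (∑ (λ l → entries U i l * X l)) (q * lookup c i)) ⟩
    toQ (∑ (λ l → entries U i l * X l) + q * lookup c i) ∎
    where open ≡-Reasoning

  affine-toQ : ∀ {d} (a : ZPt d) b x → affine (toQPt a) (toQ b) x ≡ toQ (∑ (λ c → lookup a c * lookup x c) + b)
  affine-toQ a b x = trans (cong (λ z → z ℚ.+ toQ b) (trans (sym (ℚ.*-identityˡ (sumℚ (zipWith ℚ._*_ (toQPt a) (toQPt x))))) (scale-dot a (toQPt x) (lookup x) 1ℤ (represents-toQPt x))))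
    (sym (toQ-+ (∑ (λ c → lookup a c * lookup x c)) b))

  -- Affine functions on finite families of lattice points

  sumPts : ∀ {d} → List (ZPt d) → Fin d → ℤ
  sumPts [] l = 0ℤ
  sumPts (x ∷ xs) l = lookup x l + sumPts xs l

  sumOf : ∀ {A : Set} → (A → ℚ) → List A → ℚ
  sumOf f [] = 0ℚ
  sumOf f (x ∷ xs) = f x ℚ.+ sumOf f xs


  dotQ : ∀ {d} → QPt d → (Fin d → ℤ) → ℚ
  dotQ a X = sumℚ (zipWith ℚ._*_ a (tabulate (λ l → toQ (X l))))

  dotQ-+ : ∀ {d} (a : QPt d) X Y → dotQ a (λ l → X l + Y l) ≡ dotQ a X ℚ.+ dotQ a Y
  dotQ-+ [] X Y = refl
  dotQ-+ (a ∷ as) X Y = begin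
    a ℚ.* toQ (X zero + Y zero) ℚ.+ dotQ as (λ l → X (suc l) + Y (suc l))
      ≡⟨ cong₂ ℚ._+_ (trans (cong (λ z → a ℚ.* z) (toQ-+ (X zero) (Y zero))) (ℚ.*-distribˡ-+ a (toQ (X zero)) (toQ (Y zero)))) (dotQ-+ as (X ∘ suc) (Y ∘ suc)) ⟩
    (a ℚ.* toQ (X zero) ℚ.+ a ℚ.* toQ (Y zero)) ℚ.+ (dotQ as (X ∘ suc) ℚ.+ dotQ as (Y ∘ suc))
      ≡⟨ interchange (a ℚ.* toQ (X zero)) (a ℚ.* toQ (Y zero)) (dotQ as (X ∘ suc)) (dotQ as (Y ∘ suc)) ⟩
    (a ℚ.* toQ (X zero) ℚ.+ dotQ as (X ∘ suc)) ℚ.+ (a ℚ.* toQ (Y zero) ℚ.+ dotQ as (Y ∘ suc)) ∎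
    where open ≡-Reasoning

  dotQ-zero : ∀ {d} (a : QPt d) → dotQ a (λ _ → 0ℤ) ≡ 0ℚ
  dotQ-zero [] = refl
  dotQ-zero (a ∷ as) = trans (cong₂ ℚ._+_ (ℚ.*-zeroʳ a) (dotQ-zero as)) refl

  affine-sum : ∀ {d} (a : QPt d) b xs → sumOf (affine a b) xs ≡ dotQ a (sumPts xs) ℚ.+ sumOf (λ _ → b) xs
  affine-sum a b [] = sym (trans (ℚ.+-identityʳ _) (dotQ-zero a))
  affine-sum a b (x ∷ xs) = begin
    (sumℚ (zipWith ℚ._*_ a (toQPt x)) ℚ.+ b) ℚ.+ sumOf (affine a b) xs
      ≡⟨ cong₂ ℚ._+_ (cong (λ z → sumℚ (zipWith ℚ._*_ a z) ℚ.+ b) (lookup-ext (λ i → trans (lookup-map i toQ x) (sym (lookup∘tabulate (λ l → toQ (lookup x l)) i))))) (affine-sum a b xs) ⟩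
    (dotQ a (lookup x) ℚ.+ b) ℚ.+ (dotQ a (sumPts xs) ℚ.+ sumOf (λ _ → b) xs) ≡⟨ interchange (dotQ a (lookup x)) b (dotQ a (sumPts xs)) (sumOf (λ _ → b) xs) ⟩
    (dotQ a (lookup x) ℚ.+ dotQ a (sumPts xs)) ℚ.+ (b ℚ.+ sumOf (λ _ → b) xs) ≡⟨ cong (λ z → z ℚ.+ (b ℚ.+ sumOf (λ _ → b) xs)) (sym (dotQ-+ a (lookup x) (sumPts xs))) ⟩
    dotQ a (sumPts (x ∷ xs)) ℚ.+ (b ℚ.+ sumOf (λ _ → b) xs) ∎
    where open ≡-Reasoning

  sumOf-const : ∀ {A B : Set} b (xs : List A) (ys : List B) → List.length xs ≡ List.length ys → sumOf (λ _ → b) xs ≡ sumOf (λ _ → b) ys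
  sumOf-const b [] [] e = refl
  sumOf-const b (x ∷ xs) (y ∷ ys) e = cong (b ℚ.+_) (sumOf-const b xs ys (ℕ.suc-injective e))

  dotQ-cong : ∀ {d} (a : QPt d) {X Y} → (∀ l → X l ≡ Y l) → dotQ a X ≡ dotQ a Y
  dotQ-cong a h = cong (λ z → sumℚ (zipWith ℚ._*_ a z)) (tabulate-cong (λ l → cong toQ (h l)))

  affine-balance : ∀ {d} (a : QPt d) b xs ys → List.length xs ≡ List.length ys → (∀ l → sumPts xs l ≡ sumPts ys l) →
    sumOf (affine a b) xs ≡ sumOf (affine a b) ys
  affine-balance a b xs ys e h = trans (affine-sum a b xs) (trans (cong₂ ℚ._+_ (dotQ-cong a h) (sumOf-const b xs ys e)) (sym (affine-sum a b ys)))

  -- Iterated differences and the coefficients of (1 - t)^r Σ X(n) t^n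

  ∇ : (ℕ → ℤ) → ℕ → ℤ
  ∇ X zero = X zero
  ∇ X (suc n) = X (suc n) - X n

  ∇^ : ℕ → (ℕ → ℤ) → ℕ → ℤ
  ∇^ zero X = X
  ∇^ (suc r) X = ∇ (∇^ r X)

  ∇-cong : ∀ {X Y} → (∀ n → X n ≡ Y n) → ∀ n → ∇ X n ≡ ∇ Y n
  ∇-cong h zero = h zero
  ∇-cong h (suc n) = cong₂ _-_ (h (suc n)) (h n)

  ∇^-cong : ∀ r {X Y} → (∀ n → X n ≡ Y n) → ∀ n → ∇^ r X n ≡ ∇^ r Y n
  ∇^-cong zero h = h
  ∇^-cong (suc r) h = ∇-cong (∇^-cong r h)

  ∇^-sub : ∀ r X Y n → ∇^ r (λ i → X i - Y i) n ≡ ∇^ r X n - ∇^ r Y n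
  ∇^-sub zero X Y n = refl
  ∇^-sub (suc r) X Y zero = ∇^-sub r X Y zero
  ∇^-sub (suc r) X Y (suc n) = trans (cong₂ _-_ (∇^-sub r X Y (suc n)) (∇^-sub r X Y n)) (alg (∇^ r X (suc n)) (∇^ r Y (suc n)) (∇^ r X n) (∇^ r Y n))
    where
    alg : ∀ a b c d → a - b - (c - d) ≡ a - c - (b - d)
    alg = solve-∀

  ∇^-shift : ∀ r X n → ∇^ (suc r) X n ≡ ∇^ r (∇ X) n
  ∇^-shift zero X n = refl
  ∇^-shift (suc r) X n = ∇-cong (∇^-shift r X) n

  -- The factor (1 - t)^r has constant term 1, so multiplication by it preserves the order of a
  -- power series and its lowest coefficient.
  ∇^-vanish : ∀ r Y k → (∀ n → n ℕ.< k → Y n ≡ 0ℤ) → ∇^ r Y k ≡ Y k × (∀ n → n ℕ.< k → ∇^ r Y n ≡ 0ℤ)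
  ∇^-vanish zero Y k h = refl , h
  ∇^-vanish (suc r) Y k h = top k ih , low
    where
    ih = ∇^-vanish r Y k h
    top : ∀ k → ∇^ r Y k ≡ Y k × (∀ n → n ℕ.< k → ∇^ r Y n ≡ 0ℤ) → ∇ (∇^ r Y) k ≡ Y k
    top zero (e , z) = e
    top (suc k) (e , z) = trans (cong₂ _-_ e (z k ℕ.≤-refl)) (ℤ.+-identityʳ (Y (suc k)))
    low : ∀ n → n ℕ.< k → ∇ (∇^ r Y) n ≡ 0ℤ
    low zero lt = proj₂ ih zero lt
    low (suc n) lt = cong₂ _-_ (proj₂ ih (suc n) lt) (proj₂ ih n (ℕ.<-trans (ℕ.n<1+n n) lt))

  ∇^-zero : ∀ r Y k → (∀ n → n ℕ.< k → ∇^ r Y n ≡ 0ℤ) → ∀ n → n ℕ.< k → Y n ≡ 0ℤ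
  ∇^-zero r Y (suc k) h n lt with ℕ.m≤n⇒m<n∨m≡n (ℕ.≤-pred lt)
  ... | inj₁ n<k = ∇^-zero r Y k (λ i l → h i (ℕ.<-trans l (ℕ.n<1+n k))) n n<k
  ... | inj₂ refl = trans (sym (proj₁ (∇^-vanish r Y k (∇^-zero r Y k (λ i l → h i (ℕ.<-trans l (ℕ.n<1+n k))))))) (h k ℕ.≤-refl)

  alt-sum : ℕ → (ℕ → ℤ) → ℕ → ℤ
  alt-sum r X n = ∑ {suc n} (λ i → sg i * ℤ.+ (r choose toℕ i) * X (n ℕ.∸ toℕ i))

  alt-sum≡∇^ : ∀ r X n → alt-sum r X n ≡ ∇^ r X n
  alt-sum≡∇^ zero X n = trans (∑-suc (λ (i : Fin (suc n)) → sg i * ℤ.+ (0 choose toℕ i) * X (n ℕ.∸ toℕ i)))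
    (trans (cong (λ y → 1ℤ * 1ℤ * X n + y) (∑-zero {n} (λ i → trans (cong (λ z → sg (suc i) * ℤ.+ z * X (n ℕ.∸ suc (toℕ i))) (k>n⇒nCk≡0 {0} {suc (toℕ i)} (ℕ.s≤s ℕ.z≤n)))
      (alg (sg (suc i)) (X (n ℕ.∸ suc (toℕ i))))))) (alg2 (X n)))
    where
    alg : ∀ a b → a * 0ℤ * b ≡ 0ℤ
    alg = solve-∀
    alg2 : ∀ a → 1ℤ * 1ℤ * a + 0ℤ ≡ a
    alg2 = solve-∀
  alt-sum≡∇^ (suc r) X n = trans (step n) (∇-cong (alt-sum≡∇^ r X) n)
    where
    open ≡-Reasoning
    C0 : ∀ r → r choose 0 ≡ 1
    C0 r = nC0 r
      where
      nC0 : ∀ r → r choose 0 ≡ 1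
      nC0 zero = refl
      nC0 (suc r) = refl
    step : ∀ n → alt-sum (suc r) X n ≡ ∇ (alt-sum r X) n
    step zero = trans (∑-suc {0} _) (trans (cong₂ (λ x y → 1ℤ * ℤ.+ x * X 0 + y) (trans (C0 (suc r)) (sym (C0 r))) (trans ∑-empty (sym ∑-empty))) (sym (∑-suc {0} (λ i → sg i * ℤ.+ (r choose toℕ i) * X (0 ℕ.∸ toℕ i)))))
    step (suc n) = begin
      alt-sum (suc r) X (suc n) ≡⟨ ∑-suc (λ (i : Fin (suc (suc n))) → sg i * ℤ.+ (suc r choose toℕ i) * X (suc n ℕ.∸ toℕ i)) ⟩
      1ℤ * ℤ.+ (suc r choose 0) * X (suc n) + ∑ (λ (i : Fin (suc n)) → - sg i * ℤ.+ (suc r choose suc (toℕ i)) * X (n ℕ.∸ toℕ i))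
        ≡⟨ cong₂ (λ x y → 1ℤ * ℤ.+ x * X (suc n) + y) (trans (C0 (suc r)) (sym (C0 r)))
           (trans (∑-cong (λ i → trans (cong (λ z → - sg i * ℤ.+ z * X (n ℕ.∸ toℕ i)) (sym (nCk+nC[k+1]≡[n+1]C[k+1] r (toℕ i))))
              (trans (cong (λ z → - sg i * z * X (n ℕ.∸ toℕ i)) (ℤ.pos-+ (r choose toℕ i) (r choose suc (toℕ i)))) (alg (sg i) (ℤ.+ (r choose toℕ i)) (ℤ.+ (r choose suc (toℕ i))) (X (n ℕ.∸ toℕ i))))))
             (∑-sub (λ (i : Fin (suc n)) → b i) a)) ⟩
      1ℤ * ℤ.+ (r choose 0) * X (suc n) + (∑ b - ∑ a) ≡⟨ alg2 (1ℤ * ℤ.+ (r choose 0) * X (suc n)) (∑ b) (∑ a) ⟩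
      (1ℤ * ℤ.+ (r choose 0) * X (suc n) + ∑ b) - ∑ a ≡⟨ cong (λ z → z - ∑ a) (sym (∑-suc (λ (i : Fin (suc (suc n))) → sg i * ℤ.+ (r choose toℕ i) * X (suc n ℕ.∸ toℕ i)))) ⟩
      alt-sum r X (suc n) - alt-sum r X n ∎
      where
      a b : Fin (suc n) → ℤ
      a i = sg i * ℤ.+ (r choose toℕ i) * X (n ℕ.∸ toℕ i)
      b i = - sg i * ℤ.+ (r choose suc (toℕ i)) * X (n ℕ.∸ toℕ i)
      alg : ∀ s p q x → - s * (p + q) * x ≡ - s * q * x - s * p * x
      alg = solve-∀
      alg2 : ∀ x y z → x + (y - z) ≡ (x + y) - z
      alg2 = solve-∀

  -- Same device as for `det-tail`: unification names the summands, whose sign function is local to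
  -- `deltaCoeff`.
  delta-tail : ∀ d L n → Fin n → ℤ
  delta-tail d L n = laplace-tail {x = deltaCoeff d L n} (1ℤ * ℤ.+ (suc d choose 0) * ℤ.+ L n) _ refl

  delta-tail≡ : ∀ d L n i → delta-tail d L n i ≡ sg (suc i) * ℤ.+ (suc d choose suc (toℕ i)) * ℤ.+ L (n ℕ.∸ suc (toℕ i))
  delta-tail≡ d L n i with suc (toℕ i) ℕ.% 2 in e
  ... | zero = cong (λ z → z * ℤ.+ (suc d choose suc (toℕ i)) * ℤ.+ L (n ℕ.∸ suc (toℕ i))) (sym (sg-even (suc i) e))
  ... | suc _ = cong (λ z → z * ℤ.+ (suc d choose suc (toℕ i)) * ℤ.+ L (n ℕ.∸ suc (toℕ i))) (sym (sg-odd (suc i) e))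

  deltaCoeff≡∇^ : ∀ d L n → deltaCoeff d L n ≡ ∇^ (suc d) (λ i → ℤ.+ L i) n
  deltaCoeff≡∇^ d L n = trans (cong (λ z → 1ℤ * ℤ.+ (suc d choose 0) * ℤ.+ L n + z) (trans (sumℤ-tabulate (delta-tail d L n)) (∑-cong (delta-tail≡ d L n))))
    (trans (sym (∑-suc (λ (i : Fin (suc n)) → sg i * ℤ.+ (suc d choose toℕ i) * ℤ.+ L (n ℕ.∸ toℕ i)))) (alt-sum≡∇^ (suc d) (λ i → ℤ.+ L i) n))

  -- The coefficients of 1 / (1 - t)^r, which count the vectors of r natural numbers with sum n.
  multichoose : ℕ → ℕ → ℕ
  multichoose zero zero = 1
  multichoose zero (suc n) = 0
  multichoose (suc r) zero = multichoose r zero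
  multichoose (suc r) (suc n) = multichoose r (suc n) ℕ.+ multichoose (suc r) n

  ∇-multichoose : ∀ r n → ∇ (λ i → ℤ.+ multichoose (suc r) i) n ≡ ℤ.+ multichoose r n
  ∇-multichoose r zero = refl
  ∇-multichoose r (suc n) = trans (cong (λ z → z - ℤ.+ multichoose (suc r) n) (ℤ.pos-+ (multichoose r (suc n)) (multichoose (suc r) n))) (alg (ℤ.+ multichoose r (suc n)) (ℤ.+ multichoose (suc r) n))
    where
    alg : ∀ a b → a + b - b ≡ a
    alg = solve-∀

  ∇^-multichoose : ∀ r n → ∇^ r (λ i → ℤ.+ multichoose r i) n ≡ ℤ.+ multichoose 0 n
  ∇^-multichoose zero n = refl
  ∇^-multichoose (suc r) n = trans (∇^-shift r (λ i → ℤ.+ multichoose (suc r) i) n) (trans (∇^-cong r (∇-multichoose r) n) (∇^-multichoose r n))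

  -- Subtract 1 / (1 - t)^(d+1) from the Ehrhart series. After multiplication by (1 - t)^(d+1) the
  -- difference is (m - 1) t^k, so the difference itself has the same lowest term.
  ehrhart-values : ∀ d L k m → 1 ℕ.≤ k → (∀ n → deltaCoeff d L n ≡ target k m n) →
    (∀ n → n ℕ.< k → L n ≡ multichoose (suc d) n) × L k ≡ multichoose (suc d) k ℕ.+ (m ℕ.∸ 1)
  ehrhart-values d L k m hk h = (λ n lt → ℤ.+-injective (ℤ.i-j≡0⇒i≡j _ _ (Y0 n lt))) , ℤ.+-injective (begin
      ℤ.+ L k ≡⟨ alg (ℤ.+ L k) (ℤ.+ M k) ⟩
      ℤ.+ M k + Y k ≡⟨ cong (λ z → ℤ.+ M k + z) (trans (sym (proj₁ (∇^-vanish (suc d) Y k Y0))) (trans (∇Y k) (at k refl hk))) ⟩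
      ℤ.+ M k + ℤ.+ (m ℕ.∸ 1) ≡⟨ sym (ℤ.pos-+ (M k) (m ℕ.∸ 1)) ⟩
      ℤ.+ (M k ℕ.+ (m ℕ.∸ 1)) ∎)
    where
    open ≡-Reasoning
    M = multichoose (suc d)
    Y : ℕ → ℤ
    Y i = ℤ.+ L i - ℤ.+ M i
    alg : ∀ a b → a ≡ b + (a - b)
    alg = solve-∀
    ∇Y : ∀ n → ∇^ (suc d) Y n ≡ target k m n - ℤ.+ multichoose 0 n
    ∇Y n = trans (∇^-sub (suc d) (λ i → ℤ.+ L i) (λ i → ℤ.+ M i) n) (cong₂ _-_ (trans (sym (deltaCoeff≡∇^ d L n)) (h n)) (∇^-multichoose (suc d) n))
    below : ∀ n → n ℕ.< k → target k m n - ℤ.+ multichoose 0 n ≡ 0ℤ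
    below zero lt = refl
    below (suc n) lt with suc n ℕ.≟ k
    ... | yes e = ⊥-elim (ℕ.<⇒≢ lt e)
    ... | no _ = refl
    at : ∀ n → n ≡ k → 1 ℕ.≤ n → target k m n - ℤ.+ multichoose 0 n ≡ ℤ.+ (m ℕ.∸ 1)
    at (suc n) e le with suc n ℕ.≟ k
    ... | yes _ = ℤ.+-identityʳ _
    ... | no ne = ⊥-elim (ne e)
    Y0 : ∀ n → n ℕ.< k → Y n ≡ 0ℤ
    Y0 = ∇^-zero (suc d) Y k (λ n lt → trans (∇Y n) (below n lt))

  -- Compositions

  bump : ∀ {r} → Vec ℕ (suc r) → Vec ℕ (suc r)
  bump (x ∷ v) = suc x ∷ v

  compositions : (r n : ℕ) → List (Vec ℕ r)
  compositions zero zero = [] ∷ []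
  compositions zero (suc n) = []
  compositions (suc r) zero = List.map (0 ∷_) (compositions r zero)
  compositions (suc r) (suc n) = List.map (0 ∷_) (compositions r (suc n)) ++ List.map bump (compositions (suc r) n)

  length-compositions : ∀ r n → length (compositions r n) ≡ multichoose r n
  length-compositions zero zero = refl
  length-compositions zero (suc n) = refl
  length-compositions (suc r) zero = trans (List.length-map (0 ∷_) (compositions r zero)) (length-compositions r zero)
  length-compositions (suc r) (suc n) = trans (List.length-++ (List.map (0 ∷_) (compositions r (suc n))))
    (cong₂ ℕ._+_ (trans (List.length-map (0 ∷_) (compositions r (suc n))) (length-compositions r (suc n)))
                 (trans (List.length-map bump (compositions (suc r) n)) (length-compositions (suc r) n)))

  ∈-compositions : ∀ {r n} (c : Vec ℕ r) → Vec.sum c ≡ n → c ∈ compositions r n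
  ∈-compositions {n = zero} [] e = here refl
  ∈-compositions {n = zero} (zero ∷ c) e = ∈-map⁺ (0 ∷_) (∈-compositions c e)
  ∈-compositions {n = suc n} (zero ∷ c) e = ∈-++⁺ˡ (∈-map⁺ (0 ∷_) (∈-compositions c e))
  ∈-compositions {suc r} {n = suc n} (suc x ∷ c) e = ∈-++⁺ʳ (List.map (0 ∷_) (compositions r (suc n))) (∈-map⁺ bump (∈-compositions (x ∷ c) (ℕ.suc-injective e)))

  compositions-sum : ∀ {r n} (c : Vec ℕ r) → c ∈ compositions r n → Vec.sum c ≡ n
  compositions-sum {zero} {zero} [] p = refl
  compositions-sum {suc r} {zero} c p with ∈-map⁻ (0 ∷_) p
  ... | c' , q , refl = compositions-sum c' q
  compositions-sum {suc r} {suc n} c p with ∈-++⁻ (List.map (0 ∷_) (compositions r (suc n))) p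
  ... | inj₁ p₁ with ∈-map⁻ (0 ∷_) p₁
  ... | c' , q , refl = compositions-sum c' q
  compositions-sum {suc r} {suc n} c p | inj₂ p₂ with ∈-map⁻ bump p₂
  ... | (x ∷ c') , q , refl = cong suc (compositions-sum (x ∷ c') q)

  ∷-injectiveʳ : ∀ {r x y} {v w : Vec ℕ r} → x ∷ v ≡ y ∷ w → v ≡ w
  ∷-injectiveʳ refl = refl

  bump-injective : ∀ {r} {v w : Vec ℕ (suc r)} → bump v ≡ bump w → v ≡ w
  bump-injective {v = x ∷ v} {y ∷ w} refl = refl

  unique-compositions : ∀ r n → Unique (compositions r n)
  unique-compositions zero zero = [] ∷ []
  unique-compositions zero (suc n) = []
  unique-compositions (suc r) zero = Unique.map⁺ ∷-injectiveʳ (unique-compositions r zero)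
  unique-compositions (suc r) (suc n) = Unique.++⁺ (Unique.map⁺ ∷-injectiveʳ (unique-compositions r (suc n))) (Unique.map⁺ bump-injective (unique-compositions (suc r) n))
    (λ { (p , q) → disjoint p q })
    where
    disjoint : ∀ {c} → c ∈ List.map (0 ∷_) (compositions r (suc n)) → c ∈ List.map bump (compositions (suc r) n) → ⊥
    disjoint p q with ∈-map⁻ (0 ∷_) p | ∈-map⁻ bump q
    ... | c' , _ , refl | (x ∷ c'') , _ , ()

  -- Pigeonhole for lists without repetitions

  module _ {A : Set} where

    remove : ∀ {x : A} {ys} → x ∈ ys → List A
    remove {ys = y ∷ ys} (here _) = ys
    remove {ys = y ∷ ys} (there p) = y ∷ remove p

    length-remove : ∀ {x : A} {ys} (p : x ∈ ys) → length ys ≡ suc (length (remove p))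
    length-remove (here _) = refl
    length-remove (there p) = cong suc (length-remove p)

    ∈-remove : ∀ {x z : A} {ys} (p : x ∈ ys) → z ∈ ys → z ≢ x → z ∈ remove p
    ∈-remove (here refl) (here refl) ne = ⊥-elim (ne refl)
    ∈-remove (here refl) (there q) ne = q
    ∈-remove (there p) (here e) ne = here e
    ∈-remove (there p) (there q) ne = there (∈-remove p q ne)

    unique-⊆-length : ∀ {xs ys : List A} → Unique xs → (∀ {z} → z ∈ xs → z ∈ ys) → length xs ℕ.≤ length ys
    unique-⊆-length {[]} u h = ℕ.z≤n
    unique-⊆-length {x ∷ xs} (x∉ ∷ u) h = subst (suc (length xs) ℕ.≤_) (sym (length-remove (h (here refl))))
      (ℕ.s≤s (unique-⊆-length u (λ q → ∈-remove (h (here refl)) (h (there q)) (λ { refl → LAll.lookup x∉ q refl }))))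

    unique-⊆-full : ∀ {xs ys : List A} → (∀ (a b : A) → Dec (a ≡ b)) → Unique xs → (∀ {z} → z ∈ xs → z ∈ ys) → length ys ℕ.≤ length xs →
      ∀ {z} → z ∈ ys → z ∈ xs
    unique-⊆-full {xs} {ys} _≟_ u h le {z} q with Data.List.Relation.Unary.Any.any? (z ≟_) xs
      where import Data.List.Relation.Unary.Any
    ... | yes p = p
    ... | no z∉ = ⊥-elim (ℕ.<⇒≱ (subst (ℕ._≤ length ys) refl (unique-⊆-length {z ∷ xs} (LAll.tabulate (λ {w} p e → z∉ (subst (_∈ xs) (sym e) p)) ∷ u)
         (λ { (here e) → subst (_∈ ys) (sym e) q ; (there p) → h p }))) le)

    unique-same-length : ∀ {xs ys : List A} → Unique xs → Unique ys → (∀ {z} → z ∈ xs → z ∈ ys) → (∀ {z} → z ∈ ys → z ∈ xs) → length xs ≡ length ys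
    unique-same-length u w f g = ℕ.≤-antisym (unique-⊆-length u f) (unique-⊆-length w g)

  -- Division with remainder

  record DivMod (a D : ℤ) : Set where
    constructor divmod
    field
      quot rem : ℤ
      a≡ : a ≡ rem + quot * D
      0≤rem : 0ℤ ≤ rem
      rem<D : rem < D
  open DivMod public

  abstract
    divMod : ∀ a D → 0ℤ < D → DivMod a D
    divMod a (ℤ.+ suc n) h = divmod (a ℤ./ℕ suc n) (ℤ.+ (a ℤ.%ℕ suc n)) (ℤ.a≡a%ℕn+[a/ℕn]*n a (suc n)) (ℤ.+≤+ ℕ.z≤n) (ℤ.+<+ (ℤ.n%ℕd<d a (suc n)))
    divMod a (ℤ.+ zero) (ℤ.+<+ ())

  multiple-pos : ∀ D q → 0ℤ < D → 0ℤ ≤ q * D → 0ℤ ≤ q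
  multiple-pos D q hD h = ℤ.*-cancelʳ-≤-pos 0ℤ q D {{ℤ.positive hD}} (subst (_≤ q * D) (sym (ℤ.*-zeroˡ D)) h)

  multiple-<1 : ∀ D q → 0ℤ < D → q * D < D → q ≤ 0ℤ
  multiple-<1 D q hD h = ℤ.≮⇒≥ λ 0<q → ℤ.<⇒≱ h (subst (_≤ q * D) (ℤ.*-identityˡ D) (ℤ.*-monoʳ-≤-nonNeg D {{ℤ.nonNegative (ℤ.<⇒≤ hD)}} (ℤ.i<j⇒suc[i]≤j 0<q)))

  small-multiple : ∀ D q r → 0ℤ ≤ r → r < D → r ≡ q * D → r ≡ 0ℤ
  small-multiple D q r h0 h1 e = trans e (trans (cong (_* D) (ℤ.≤-antisym (multiple-<1 D q hD (subst (_< D) e h1)) (multiple-pos D q hD (subst (0ℤ ≤_) e h0)))) (ℤ.*-zeroˡ D))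
    where
    hD : 0ℤ < D
    hD = ℤ.≤-<-trans h0 h1

  sub-bounds : ∀ {a b D} → 0ℤ ≤ a → a < D → 0ℤ ≤ b → b < D → a - b < D
  sub-bounds {a} {b} {D} ha ha' hb hb' = ℤ.≤-<-trans (subst (a - b ≤_) (ℤ.+-identityʳ a) (ℤ.+-monoʳ-≤ a (ℤ.neg-mono-≤ hb))) ha'

  same-residue : ∀ D a b q → 0ℤ ≤ a → a < D → 0ℤ ≤ b → b < D → a - b ≡ q * D → a ≡ b
  same-residue D a b q ha ha' hb hb' e = ℤ.i-j≡0⇒i≡j a b (trans e (trans (cong (_* D) (ℤ.≤-antisym q≤0 0≤q)) (ℤ.*-zeroˡ D)))
    where
    hD = ℤ.≤-<-trans ha ha'
    q≤0 : q ≤ 0ℤ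
    q≤0 = multiple-<1 D q hD (subst (_< D) e (sub-bounds ha ha' hb hb'))
    alg : ∀ a b → b - a ≡ - (a - b)
    alg = solve-∀
    -q≤0 : - q ≤ 0ℤ
    -q≤0 = multiple-<1 D (- q) hD (subst (_< D) (trans (alg a b) (trans (cong -_ e) (ℤ.neg-distribˡ-* q D))) (sub-bounds hb hb' ha ha'))
    0≤q : 0ℤ ≤ q
    0≤q = subst (0ℤ ≤_) (ℤ.neg-involutive q) (ℤ.neg-mono-≤ -q≤0)

  -- Barycentric coordinates with denominator D of the lattice vector (x , h)

  record IsCoord {n d} (v : Matrix n d) (D : ℤ) (x : Fin d → ℤ) (h : ℤ) (b : Fin n → ℤ) : Set where
    constructor coord
    field
      total : ∑ b ≡ D * h
      point : ∀ l → ∑ (λ j → b j * v j l) ≡ D * x l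
  open IsCoord public

  module _ {n d} {v : Matrix n d} {D : ℤ} where

    coord-linear : ∀ {x y h i b c} (β γ : ℤ) → IsCoord v D x h b → IsCoord v D y i c →
      IsCoord v D (λ l → β * x l + γ * y l) (β * h + γ * i) (λ j → β * b j + γ * c j)
    coord-linear {x} {y} {h} {i} {b} {c} β γ (coord s p) (coord t q) = coord
      (trans (∑-lin β γ b c) (trans (cong₂ (λ u w → β * u + γ * w) s t) (alg β γ D h i)))
      λ l → trans (∑-cong (λ j → alg2 β γ (b j) (c j) (v j l))) (trans (∑-lin β γ (λ j → b j * v j l) (λ j → c j * v j l))
        (trans (cong₂ (λ u w → β * u + γ * w) (p l) (q l)) (alg β γ D (x l) (y l))))
      where
      alg : ∀ β γ D h i → β * (D * h) + γ * (D * i) ≡ D * (β * h + γ * i)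
      alg = solve-∀
      alg2 : ∀ β γ b c v → (β * b + γ * c) * v ≡ β * (b * v) + γ * (c * v)
      alg2 = solve-∀

    coord-cong : ∀ {x y h i b c} → IsCoord v D x h b → (∀ l → x l ≡ y l) → h ≡ i → (∀ j → b j ≡ c j) → IsCoord v D y i c
    coord-cong (coord s p) ex eh eb = coord (trans (∑-cong (λ j → sym (eb j))) (trans s (cong (D *_) eh)))
      λ l → trans (∑-cong (λ j → cong (_* v j l) (sym (eb j)))) (trans (p l) (cong (D *_) (ex l)))

    comb : (Fin n → ℤ) → Fin d → ℤ
    comb c l = ∑ (λ j → c j * v j l)

    coord-comb : ∀ c → IsCoord v D (comb c) (∑ c) (λ j → D * c j)
    coord-comb c = coord (sym (*-∑ D c)) λ l → trans (∑-cong (λ j → ℤ.*-assoc D (c j) (v j l))) (sym (*-∑ D (λ j → c j * v j l)))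

    coord-unique : AffinelyIndependent v → ∀ {x y h i b c} → IsCoord v D x h b → IsCoord v D y i c → (∀ l → x l ≡ y l) → h ≡ i → ∀ j → b j ≡ c j
    coord-unique ind {x} {y} {h} {i} {b} {c} (coord s p) (coord t q) ex eh j = ℤ.i-j≡0⇒i≡j (b j) (c j) (ind (λ j → b j - c j)
      (trans (∑-sub b c) (trans (cong₂ _-_ s (trans t (cong (D *_) (sym eh)))) (ℤ.+-inverseʳ (D * h))))
      (λ l → trans (∑-cong (λ j → alg (b j) (c j) (v j l))) (trans (∑-sub (λ j → b j * v j l) (λ j → c j * v j l))
        (trans (cong₂ _-_ (p l) (trans (q l) (cong (D *_) (sym (ex l))))) (ℤ.+-inverseʳ (D * x l))))) j)
      where
      alg : ∀ b c v → (b - c) * v ≡ b * v - c * v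
      alg = solve-∀

    coord-injective : 0ℤ < D → ∀ {x y h i b c} → IsCoord v D x h b → IsCoord v D y i c → (∀ j → b j ≡ c j) → ∀ l → x l ≡ y l
    coord-injective hD {x} {y} (coord s p) (coord t q) e l = *-cancelˡ′ D (λ z → ℤ.<-irrefl (sym z) hD)
      (trans (sym (p l)) (trans (∑-cong (λ j → cong (_* v j l) (e j))) (q l)))

  module _ {n d} {v : Matrix n d} {D : ℤ} (hD : 0ℤ < D) {x h b} (B : IsCoord v D x h b) where

    -- Subtracting each vertex as often as the quotient says leaves a lattice vector whose
    -- coordinates are the remainders: the representative of the class in the half-open fundamental
    -- parallelepiped.
    resid quots : Fin n → ℤ
    resid j = rem (divMod (b j) D hD)
    quots j = quot (divMod (b j) D hD)

    resid≡ : ∀ j → b j ≡ resid j + quots j * D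
    resid≡ j = a≡ (divMod (b j) D hD)

    resid-point : Fin d → ℤ
    resid-point l = 1ℤ * x l + - 1ℤ * comb {v = v} {D} quots l

    resid-height : ℤ
    resid-height = 1ℤ * h + - 1ℤ * ∑ quots

    resid-coord : IsCoord v D resid-point resid-height resid
    resid-coord = coord-cong (coord-linear 1ℤ (- 1ℤ) B (coord-comb quots)) (λ l → refl) refl
      λ j → trans (cong (λ z → 1ℤ * z + - 1ℤ * (D * quots j)) (resid≡ j)) (alg (resid j) (quots j) D)
      where
      alg : ∀ r q D → 1ℤ * (r + q * D) + - 1ℤ * (D * q) ≡ r
      alg = solve-∀

    0≤resid : ∀ j → 0ℤ ≤ resid j
    0≤resid j = 0≤rem (divMod (b j) D hD)

    resid<D : ∀ j → resid j < D
    resid<D j = rem<D (divMod (b j) D hD)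

  -- Membership in a dilated simplex in terms of barycentric coordinates

  module _ {N d} (V : Vec (ZPt d) N) (ind : AffinelyIndependent (entries V)) {D : ℤ} (hD : 0ℤ < D) where

    private v = entries V

    hull⇒coord≥0 : ∀ {X q n b} → IsCoord v D X (ℤ.+ n * q) b → InHull (entries (dilate n V)) X q → ∀ j → 0ℤ ≤ b j
    hull⇒coord≥0 {X} {q} {n} {b} B (hull r hr W W≥0 sW cW) j = multiple-pos r (b j) hr (subst (0ℤ ≤_) (trans (sym (eq j)) (ℤ.*-comm r (b j))) (0≤-* (ℤ.<⇒≤ hD) (0≤-* {ℤ.+ n} {W j} (ℤ.+≤+ ℕ.z≤n) (W≥0 j))))
      where
      alg2 : ∀ D n w v → D * (n * w) * v ≡ D * (w * (n * v))
      alg2 = solve-∀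
      alg3 : ∀ r D n q → r * (D * (n * q)) ≡ D * (n * (r * q))
      alg3 = solve-∀
      alg4 : ∀ r D x → r * (D * x) ≡ D * (r * x)
      alg4 = solve-∀
      open ≡-Reasoning
      B' : IsCoord v D (λ l → r * X l) (ℤ.+ n * (r * q)) (λ j → r * b j)
      B' = coord (trans (sym (*-∑ r b)) (trans (cong (r *_) (total B)) (alg3 r D (ℤ.+ n) q)))
         λ l → trans (∑-cong (λ j → ℤ.*-assoc r (b j) (v j l))) (trans (sym (*-∑ r (λ j → b j * v j l))) (trans (cong (r *_) (point B l)) (alg4 r D (X l))))
      C' : IsCoord v D (λ l → r * X l) (ℤ.+ n * (r * q)) (λ j → D * (ℤ.+ n * W j))
      C' = coord (begin
          ∑ (λ j → D * (ℤ.+ n * W j)) ≡⟨ sym (*-∑ D (λ j → ℤ.+ n * W j)) ⟩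
          D * ∑ (λ j → ℤ.+ n * W j) ≡⟨ cong (D *_) (sym (*-∑ (ℤ.+ n) W)) ⟩
          D * (ℤ.+ n * ∑ W) ≡⟨ cong (λ z → D * (ℤ.+ n * z)) sW ⟩
          D * (ℤ.+ n * (r * q)) ∎)
        λ l → begin
          ∑ (λ j → D * (ℤ.+ n * W j) * v j l) ≡⟨ ∑-cong (λ j → trans (alg2 D (ℤ.+ n) (W j) (v j l)) (cong (λ z → D * (W j * z)) (sym (entries-dilate n V j l)))) ⟩
          ∑ (λ j → D * (W j * entries (dilate n V) j l)) ≡⟨ sym (*-∑ D (λ j → W j * entries (dilate n V) j l)) ⟩
          D * ∑ (λ j → W j * entries (dilate n V) j l) ≡⟨ cong (D *_) (cW l) ⟩
          D * (r * X l) ∎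
      eq : ∀ j → r * b j ≡ D * (ℤ.+ n * W j)
      eq = coord-unique ind B' C' (λ l → refl) refl

    coord≥0⇒hull : ∀ {X q n b} → 0ℤ < ℤ.+ n → IsCoord v D X (ℤ.+ n * q) b → (∀ j → 0ℤ ≤ b j) → InHull (entries (dilate n V)) X q
    coord≥0⇒hull {X} {q} {n} {b} hn B nn = hull (D * ℤ.+ n) (0<-* hD hn) b nn (trans (total B) (alg D (ℤ.+ n) q))
      λ l → begin
        ∑ (λ j → b j * entries (dilate n V) j l) ≡⟨ ∑-cong (λ j → trans (cong (b j *_) (entries-dilate n V j l)) (alg2 (b j) (ℤ.+ n) (v j l))) ⟩
        ∑ (λ j → ℤ.+ n * (b j * v j l)) ≡⟨ sym (*-∑ (ℤ.+ n) (λ j → b j * v j l)) ⟩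
        ℤ.+ n * ∑ (λ j → b j * v j l) ≡⟨ cong (ℤ.+ n *_) (point B l) ⟩
        ℤ.+ n * (D * X l) ≡⟨ alg3 D (ℤ.+ n) (X l) ⟩
        D * ℤ.+ n * X l ∎
      where
      open ≡-Reasoning
      alg : ∀ D n q → D * (n * q) ≡ D * n * q
      alg = solve-∀
      alg2 : ∀ b n v → b * (n * v) ≡ n * (b * v)
      alg2 = solve-∀
      alg3 : ∀ D n x → n * (D * x) ≡ D * n * x
      alg3 = solve-∀

  -- The lattice of a simplex whose residue group is cyclic of order m with every nontrivial
  -- residue of full support and height k
  record CyclicLattice {d} (k m : ℤ) (v : Matrix (suc d) d) : Set where
    field
      m-pos : 0ℤ < m
      independent : AffinelyIndependent v
      coordinates : ∀ x h → ∃ λ b → IsCoord v m x h b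
      reduced : ∀ x h b → IsCoord v m x h b → (∀ j → 0ℤ ≤ b j) → (∀ j → b j < m) → ∀ j₀ → b j₀ ≢ 0ℤ → h ≡ k × (∀ j → b j ≢ 0ℤ)
      generator : ∀ i → ∃ λ x → ∃ λ h → ∃ λ b → IsCoord v m x h b × b i ≡ 1ℤ

  pos-or-zero : ∀ {h} → 0ℤ ≤ h → ∃ λ n → h ≡ ℤ.+ n
  pos-or-zero {ℤ.+ n} _ = n , refl

  to-ℕ : ∀ {r} (c : Fin r → ℤ) → (∀ j → 0ℤ ≤ c j) → ∃ λ (u : Vec ℕ r) → ∀ j → ℤ.+ lookup u j ≡ c j
  to-ℕ {zero} c h = [] , λ ()
  to-ℕ {suc r} c h with pos-or-zero (h zero) | to-ℕ (c ∘ suc) (h ∘ suc)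
  ... | n , e | u , f = (n ∷ u) , λ { zero → sym e ; (suc j) → f j }

  sum-ℕ : ∀ {r} (u : Vec ℕ r) → ℤ.+ Vec.sum u ≡ ∑ (λ j → ℤ.+ lookup u j)
  sum-ℕ [] = sym ∑-empty
  sum-ℕ (x ∷ u) = trans (ℤ.pos-+ x (Vec.sum u)) (trans (cong (ℤ.+ x +_) (sum-ℕ u)) (sym (∑-suc (λ j → ℤ.+ lookup (x ∷ u) j))))

  _≟ᵖ_ : ∀ {d} (x y : ZPt d) → Dec (x ≡ y)
  _≟ᵖ_ = Vec.≡-dec ℤ._≟_

  argmin : ∀ {A : Set} (f : A → ℤ) (xs : List A) → 1 ℕ.≤ length xs → ∃ λ x → x ∈ xs × (∀ {y} → y ∈ xs → f x ≤ f y)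
  argmin f (x ∷ []) le = x , here refl , λ { (here refl) → ℤ.≤-refl }
  argmin f (x ∷ y ∷ ys) le with argmin f (y ∷ ys) (ℕ.s≤s ℕ.z≤n)
  ... | z , z∈ , min with f x ℤ.≤? f z
  ...   | yes p = x , here refl , λ { (here refl) → ℤ.≤-refl ; (there q) → ℤ.≤-trans p (min q) }
  ...   | no ¬p = z , there z∈ , λ { (here refl) → ℤ.<⇒≤ (ℤ.≰⇒> ¬p) ; (there q) → min q }

  +-cancelˡ-≤ : ∀ a b c → a + b ≤ a + c → b ≤ c
  +-cancelˡ-≤ a b c h = ℤ.0≤i-j⇒j≤i (subst (0ℤ ≤_) (alg a b c) (ℤ.i≤j⇒0≤j-i h))
    where
    alg : ∀ a b c → a + c - (a + b) ≡ c - b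
    alg = solve-∀

  unique-map : ∀ {A B : Set} {f : A → B} {xs} → (∀ {a b} → a ∈ xs → b ∈ xs → f a ≡ f b → a ≡ b) → Unique xs → Unique (List.map f xs)
  unique-map {xs = []} inj u = []
  unique-map {f = f} {xs = x ∷ xs} inj (x∉ ∷ u) = LAll.tabulate (λ {w} w∈ e → let (b , b∈ , eq) = ∈-map⁻ f w∈ in
      LAll.lookup x∉ b∈ (inj (here refl) (there b∈) (trans e eq)))
    ∷ unique-map (λ p q → inj (there p) (there q)) u

  n*1 : ∀ h → h * 1ℤ ≡ h
  n*1 = ℤ.*-identityʳ

  -- From the Ehrhart function to the cyclic lattice

  module Ehrhart {d : ℕ} (k m : ℕ) (N≡2k : suc d ≡ k ℕ.+ k) (1≤k : 1 ℕ.≤ k) (2≤m : 2 ℕ.≤ m)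
    (P : Vec (ZPt d) (suc d)) (nondeg : vol (entries P) ≢ 0ℤ)
    (L : ℕ → ℕ) (ehrhart : EhrhartFn P L)
    (L-small : ∀ n → n ℕ.< k → L n ≡ multichoose (suc d) n)
    (L-k : L k ≡ multichoose (suc d) k ℕ.+ (m ℕ.∸ 1)) where

    private
      N = suc d
      v = entries P

    D : ℤ
    D = ℤ.+ ∣ vol v ∣

    hD : 0ℤ < D
    hD = ℤ.≤∧≢⇒< (ℤ.+≤+ ℕ.z≤n) (λ e → nondeg (ℤ.∣i∣≡0⇒i≡0 (ℤ.+-injective (sym e))))

    ind : AffinelyIndependent v
    ind = vol≢0⇒independent v nondeg

    spanD : ∀ x h → ∃ λ b → IsCoord v D x h b
    spanD x h = let (b , s , p) = vol-span v nondeg x h in b , coord s p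

    pt : Vec ℕ N → ZPt d
    pt c = tabulate (comb {v = v} {D} (λ j → ℤ.+ lookup c j))

    pt-coord : ∀ c → IsCoord v D (lookup (pt c)) (ℤ.+ Vec.sum c) (λ j → D * ℤ.+ lookup c j)
    pt-coord c = coord-cong (coord-comb (λ j → ℤ.+ lookup c j)) (λ l → sym (Vec.lookup∘tabulate _ l)) (sym (sum-ℕ c)) (λ j → refl)

    lattice⇒coord≥0 : ∀ {n x b} → LatticeIn (dilate n P) x → IsCoord v D (lookup x) (ℤ.+ n) b → ∀ j → 0ℤ ≤ b j
    lattice⇒coord≥0 {n} {x} h B = hull⇒coord≥0 P ind hD {lookup x} {1ℤ} {n} (coord-cong B (λ l → refl) (sym (n*1 (ℤ.+ n))) (λ j → refl)) (lattice⇒hull (dilate n P) x h)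

    coord≥0⇒lattice : ∀ {n x b} → 1 ℕ.≤ n → IsCoord v D (lookup x) (ℤ.+ n) b → (∀ j → 0ℤ ≤ b j) → LatticeIn (dilate n P) x
    coord≥0⇒lattice {n} {x} 1≤n B h = hull⇒lattice (dilate n P) x (coord≥0⇒hull P ind hD {lookup x} {1ℤ} {n} (ℤ.+<+ 1≤n) (coord-cong B (λ l → refl) (sym (n*1 (ℤ.+ n))) (λ j → refl)) h)

    pt-injective : ∀ {c c'} → Vec.sum c ≡ Vec.sum c' → pt c ≡ pt c' → c ≡ c'
    pt-injective {c} {c'} s e = lookup-ext λ j → ℤ.+-injective (*-cancelˡ′ D (λ z → ℤ.<-irrefl (sym z) hD)
      (coord-unique ind (pt-coord c) (pt-coord c') (λ l → cong (λ z → lookup z l) e) (cong ℤ.+_ s) j))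

    integral : ℕ → List (ZPt d)
    integral n = List.map pt (compositions N n)

    unique-integral : ∀ n → Unique (integral n)
    unique-integral n = unique-map (λ {a} {b} p q → pt-injective (trans (compositions-sum {n = n} a p) (sym (compositions-sum {n = n} b q)))) (unique-compositions N n)

    length-integral : ∀ n → length (integral n) ≡ multichoose N n
    length-integral n = trans (List.length-map pt (compositions N n)) (length-compositions N n)

    points : ℕ → List (ZPt d)
    points n = proj₁ (ehrhart n)

    unique-points : ∀ n → Unique (points n)
    unique-points n = proj₁ (proj₂ (ehrhart n))

    length-points : ∀ n → length (points n) ≡ L n
    length-points n = proj₁ (proj₂ (proj₂ (ehrhart n)))

    ∈-points : ∀ {n x} → LatticeIn (dilate n P) x → x ∈ points n
    ∈-points {n} {x} = proj₂ (proj₂ (proj₂ (proj₂ (ehrhart n))) x)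

    points⇒lattice : ∀ {n x} → x ∈ points n → LatticeIn (dilate n P) x
    points⇒lattice {n} {x} = proj₁ (proj₂ (proj₂ (proj₂ (ehrhart n))) x)

    integral⊆points : ∀ {n x} → 1 ℕ.≤ n → x ∈ integral n → x ∈ points n
    integral⊆points {n} 1≤n x∈ with ∈-map⁻ pt x∈
    ... | c , c∈ , refl = ∈-points (coord≥0⇒lattice 1≤n (coord-cong (pt-coord c) (λ l → refl) (cong ℤ.+_ (compositions-sum c c∈)) (λ j → refl))
      (λ j → 0≤-* {D} {ℤ.+ lookup c j} (ℤ.<⇒≤ hD) (ℤ.+≤+ ℕ.z≤n)))

    integral⇒multiple : ∀ {n x b} → x ∈ integral n → IsCoord v D (lookup x) (ℤ.+ n) b → ∀ j → ∃ λ q → b j ≡ q * D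
    integral⇒multiple {n} x∈ B j with ∈-map⁻ pt x∈
    ... | c , c∈ , refl = ℤ.+ lookup c j , trans (coord-unique ind B (pt-coord c) (λ l → refl) (cong ℤ.+_ (sym (compositions-sum c c∈))) j) (ℤ.*-comm D (ℤ.+ lookup c j))

    multiple⇒integral : ∀ {n x b} (q : Fin N → ℤ) → (∀ j → 0ℤ ≤ b j) → (∀ j → b j ≡ q j * D) → IsCoord v D (lookup x) (ℤ.+ n) b → x ∈ integral n
    multiple⇒integral {n} {x} {b} q b≥0 e B = subst (_∈ integral n) x≡ (∈-map⁺ pt (∈-compositions u sum≡))
      where
      q≥0 : ∀ j → 0ℤ ≤ q j
      q≥0 j = multiple-pos D (q j) hD (subst (0ℤ ≤_) (e j) (b≥0 j))
      u = proj₁ (to-ℕ q q≥0)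
      u≡ = proj₂ (to-ℕ q q≥0)
      b≡ : ∀ j → D * ℤ.+ lookup u j ≡ b j
      b≡ j = trans (cong (D *_) (u≡ j)) (trans (ℤ.*-comm D (q j)) (sym (e j)))
      sum≡ : Vec.sum u ≡ n
      sum≡ = ℤ.+-injective (*-cancelˡ′ D (λ z → ℤ.<-irrefl (sym z) hD) (trans (sym (total (pt-coord u))) (trans (∑-cong b≡) (total B))))
      x≡ : pt u ≡ x
      x≡ = lookup-ext (coord-injective hD (pt-coord u) B b≡)

    -- For n < k there are as many lattice points in nP as sums of n vertices, so by the pigeonhole
    -- principle these sums are all of them, and their coordinates are divisible by D.
    below-k : ∀ n → n ℕ.< k → ∀ {x b} → IsCoord v D x (ℤ.+ n) b → (∀ j → 0ℤ ≤ b j) → ∀ j → ∃ λ q → b j ≡ q * D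
    -- At height 0 nonnegative coordinates with sum 0 vanish; `coord≥0⇒lattice` assumes n ≥ 1, so
    -- this case is treated directly.
    below-k zero n<k B b≥0 j = 0ℤ , trans (∑≡0⇒≡0 b≥0 (trans (total B) (ℤ.*-zeroʳ D)) j) (sym (ℤ.*-zeroˡ D))
    below-k n@(suc _) n<k {x} {b} B b≥0 = integral⇒multiple {n} {tabulate x} (unique-⊆-full _≟ᵖ_ (unique-integral n) (integral⊆points (ℕ.s≤s ℕ.z≤n))
        (ℕ.≤-reflexive (trans (length-points n) (trans (L-small n n<k) (sym (length-integral n))))) (∈-points (coord≥0⇒lattice {n} {tabulate x} (ℕ.s≤s ℕ.z≤n) B' b≥0))) B'
      where
      B' : IsCoord v D (lookup (tabulate x)) (ℤ.+ n) b
      B' = coord-cong B (λ l → sym (Vec.lookup∘tabulate x l)) refl (λ j → refl)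

    height≥k : ∀ {x h b} → IsCoord v D x h b → (∀ j → 0ℤ ≤ b j) → (∀ j → b j < D) → ∀ j₀ → b j₀ ≢ 0ℤ → ℤ.+ k ≤ h
    height≥k {x} {h} {b} B b≥0 b<D j₀ ne = ℤ.≮⇒≥ λ h<k → contra (pos-or-zero 0≤h) h<k
      where
      0≤h : 0ℤ ≤ h
      0≤h = multiple-pos D h hD (subst (0ℤ ≤_) (trans (total B) (ℤ.*-comm D h)) (∑-nonneg b≥0))
      contra : (∃ λ n → h ≡ ℤ.+ n) → h < ℤ.+ k → ⊥
      contra (n , refl) h<k = let (q , e) = below-k n (ℤ.drop‿+<+ h<k) B b≥0 j₀ in ne (small-multiple D q (b j₀) (b≥0 j₀) (b<D j₀) e)

    χ : ℤ → ℤ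
    χ z with z ℤ.≟ 0ℤ
    ... | yes _ = 0ℤ
    ... | no _ = 1ℤ

    χ≤1 : ∀ z → χ z ≤ 1ℤ
    χ≤1 z with z ℤ.≟ 0ℤ
    ... | yes _ = ℤ.+≤+ ℕ.z≤n
    ... | no _ = ℤ.≤-refl

    χ≡1⇒≢0 : ∀ z → χ z ≡ 1ℤ → z ≢ 0ℤ
    χ≡1⇒≢0 z e with z ℤ.≟ 0ℤ
    χ≡1⇒≢0 z () | yes _
    ... | no ne = ne

    ∑1≡ : ∑ {N} (λ _ → 1ℤ) ≡ ℤ.+ N
    ∑1≡ = go N
      where
      go : ∀ n → ∑ {n} (λ _ → 1ℤ) ≡ ℤ.+ n
      go zero = ∑-empty
      go (suc n) = trans (∑-suc {n} (λ _ → 1ℤ)) (cong (1ℤ +_) (go n))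

    N≡ : ℤ.+ N ≡ ℤ.+ k + ℤ.+ k
    N≡ = trans (cong ℤ.+_ N≡2k) (ℤ.pos-+ k k)

    -- Negating a residue changes its height h to |support| - h, and both are at least k.
    residue-full : ∀ {x h b} → IsCoord v D x h b → (∀ j → 0ℤ ≤ b j) → (∀ j → b j < D) → ∀ j₀ → b j₀ ≢ 0ℤ → h ≡ ℤ.+ k × (∀ j → b j ≢ 0ℤ)
    residue-full {x} {h} {b} B b≥0 b<D j₀ ne = ℤ.≤-antisym h≤k k≤h , λ j → χ≡1⇒≢0 (b j) (sym (ℤ.i-j≡0⇒i≡j 1ℤ (χ (b j)) (all-one j)))
      where
      open ℤ.≤-Reasoning
      s = ∑ (λ j → χ (b j))
      b' : Fin N → ℤ
      b' j = 1ℤ * (D * χ (b j)) + - 1ℤ * b j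
      B' : IsCoord v D _ (1ℤ * s + - 1ℤ * h) b'
      B' = coord-linear 1ℤ (- 1ℤ) (coord-comb (λ j → χ (b j))) B
      alg0 : ∀ D → 1ℤ * (D * 0ℤ) + - 1ℤ * 0ℤ ≡ 0ℤ
      alg0 = solve-∀
      alg1 : ∀ D z → 1ℤ * (D * 1ℤ) + - 1ℤ * z ≡ D - z
      alg1 = solve-∀
      bounds : ∀ z → 0ℤ ≤ z → z < D → (0ℤ ≤ 1ℤ * (D * χ z) + - 1ℤ * z) × (1ℤ * (D * χ z) + - 1ℤ * z < D)
      bounds z h0 h1 with z ℤ.≟ 0ℤ
      ... | yes refl = ℤ.≤-reflexive (sym (alg0 D)) , subst (_< D) (sym (alg0 D)) hD
      ... | no nz = subst (0ℤ ≤_) (sym (alg1 D z)) (ℤ.i≤j⇒0≤j-i (ℤ.<⇒≤ h1)) ,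
         subst₂ _<_ (sym (alg1 D z)) (ℤ.+-identityʳ D) (ℤ.+-monoʳ-< D (ℤ.neg-mono-< (ℤ.≤∧≢⇒< h0 (nz ∘ sym))))
      nonzero : ∀ z → z ≢ 0ℤ → z < D → 1ℤ * (D * χ z) + - 1ℤ * z ≢ 0ℤ
      nonzero z nz h1 e with z ℤ.≟ 0ℤ
      ... | yes ez = nz ez
      ... | no _ = ℤ.<-irrefl (sym (ℤ.i-j≡0⇒i≡j D z (trans (sym (alg1 D z)) e))) h1
      k≤h = height≥k B b≥0 b<D j₀ ne
      k≤s-h : ℤ.+ k ≤ 1ℤ * s + - 1ℤ * h
      k≤s-h = height≥k B' (λ j → proj₁ (bounds (b j) (b≥0 j) (b<D j))) (λ j → proj₂ (bounds (b j) (b≥0 j) (b<D j))) j₀ (nonzero (b j₀) ne (b<D j₀))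
      s≤2k : s ≤ ℤ.+ k + ℤ.+ k
      s≤2k = subst (s ≤_) (trans ∑1≡ N≡) (∑-mono (λ j → χ≤1 (b j)))
      alg2 : ∀ s h → 1ℤ * s + - 1ℤ * h + h ≡ s
      alg2 = solve-∀
      k+h≤s : ℤ.+ k + h ≤ s
      k+h≤s = subst (ℤ.+ k + h ≤_) (alg2 s h) (ℤ.+-monoˡ-≤ h k≤s-h)
      h≤k : h ≤ ℤ.+ k
      h≤k = +-cancelˡ-≤ (ℤ.+ k) h (ℤ.+ k) (ℤ.≤-trans k+h≤s s≤2k)
      ∑1-χ≡0 : ∑ (λ j → 1ℤ - χ (b j)) ≡ 0ℤ
      ∑1-χ≡0 = trans (∑-sub (λ _ → 1ℤ) (λ j → χ (b j))) (ℤ.≤-antisym (ℤ.i≤j⇒i-j≤0 (subst (_≤ s) (sym (trans ∑1≡ N≡)) (ℤ.≤-trans (ℤ.+-monoʳ-≤ (ℤ.+ k) k≤h) k+h≤s)))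
         (ℤ.i≤j⇒0≤j-i (∑-mono (λ j → χ≤1 (b j)))))
      all-one : ∀ j → 1ℤ - χ (b j) ≡ 0ℤ
      all-one = ∑≡0⇒≡0 (λ j → ℤ.i≤j⇒0≤j-i (χ≤1 (b j))) ∑1-χ≡0

    nonintegral : List (ZPt d)
    nonintegral = List.filter (λ x → ¬? (Any.any? (x ≟ᵖ_) (integral k))) (points k)

    length-nonintegral : length nonintegral ≡ m ℕ.∸ 1
    length-nonintegral = ℕ.+-cancelˡ-≡ (length (integral k)) (length nonintegral) (m ℕ.∸ 1) (trans (sym (List.length-++ (integral k))) (trans
      (unique-same-length (Unique.++⁺ (unique-integral k) (Unique.filter⁺ (λ x → ¬? (Any.any? (x ≟ᵖ_) (integral k))) (unique-points k))
          (λ (p , q) → proj₂ (∈-filter⁻ (λ x → ¬? (Any.any? (x ≟ᵖ_) (integral k))) {xs = points k} q) p)) (unique-points k) to from)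
      (trans (length-points k) (trans L-k (cong (ℕ._+ (m ℕ.∸ 1)) (sym (length-integral k)))))))
      where
      to : ∀ {z} → z ∈ integral k ++ nonintegral → z ∈ points k
      to p with ∈-++⁻ (integral k) p
      ... | inj₁ q = integral⊆points 1≤k q
      ... | inj₂ q = proj₁ (∈-filter⁻ (λ x → ¬? (Any.any? (x ≟ᵖ_) (integral k))) {xs = points k} q)
      from : ∀ {z} → z ∈ points k → z ∈ integral k ++ nonintegral
      from {z} p with Any.any? (z ≟ᵖ_) (integral k)
      ... | yes q = ∈-++⁺ˡ q
      ... | no nq = ∈-++⁺ʳ (integral k) (∈-filter⁺ (λ x → ¬? (Any.any? (x ≟ᵖ_) (integral k))) p nq)

    unique-nonintegral : Unique nonintegral
    unique-nonintegral = Unique.filter⁺ (λ x → ¬? (Any.any? (x ≟ᵖ_) (integral k))) (unique-points k)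

    InOpenBox : (Fin N → ℤ) → Set
    InOpenBox b = ∀ j → 0ℤ < b j × b j < D

    box⇒nonintegral : ∀ {x b} → IsCoord v D (lookup x) (ℤ.+ k) b → InOpenBox b → x ∈ nonintegral
    box⇒nonintegral {x} {b} B box = ∈-filter⁺ (λ x → ¬? (Any.any? (x ≟ᵖ_) (integral k))) (∈-points (coord≥0⇒lattice 1≤k B (λ j → ℤ.<⇒≤ (proj₁ (box j)))))
      λ x∈ → let (q , e) = integral⇒multiple x∈ B zero in
        ℤ.<-irrefl (sym (small-multiple D q (b zero) (ℤ.<⇒≤ (proj₁ (box zero))) (proj₂ (box zero)) e)) (proj₁ (box zero))

    -- The residue of b is nonzero, as x is not a sum of vertices, and therefore has height k like b
    -- itself. So the quotients, which are nonnegative, sum to 0 and vanish: b is already reduced.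
    nonintegral⇒box : ∀ {x b} → x ∈ nonintegral → IsCoord v D (lookup x) (ℤ.+ k) b → InOpenBox b
    nonintegral⇒box {x} {b} x∈ B = go (all-or-some r)
      where
      x∈points = proj₁ (∈-filter⁻ (λ x → ¬? (Any.any? (x ≟ᵖ_) (integral k))) {xs = points k} x∈)
      x∉integral = proj₂ (∈-filter⁻ (λ x → ¬? (Any.any? (x ≟ᵖ_) (integral k))) {xs = points k} x∈)
      b≥0 = lattice⇒coord≥0 {k} {x} (points⇒lattice x∈points) B
      r = resid hD B
      q = quots hD B
      R = resid-coord hD B
      q≥0 : ∀ j → 0ℤ ≤ q j
      q≥0 j = ℤ.≮⇒≥ λ q<0 → ℤ.<⇒≱ (ℤ.<-≤-trans (resid<D hD B j) ℤ.≤-refl) (ℤ.≤-trans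
         (subst (_≤ - (q j * D)) (ℤ.*-identityˡ D) (subst (1ℤ * D ≤_) (sym (ℤ.neg-distribˡ-* (q j) D)) (ℤ.*-monoʳ-≤-nonNeg D {{ℤ.nonNegative (ℤ.<⇒≤ hD)}} (ℤ.i<j⇒suc[i]≤j (ℤ.neg-mono-< q<0)))))
         (subst₂ _≤_ (ℤ.+-identityˡ (- (q j * D))) (trans (cong (_- q j * D) (resid≡ hD B j)) (alg (r j) (q j * D))) (ℤ.+-monoˡ-≤ (- (q j * D)) (b≥0 j))))
         where
         alg : ∀ a b → a + b - b ≡ a
         alg = solve-∀
      alg2 : ∀ h s → 1ℤ * h + - 1ℤ * s ≡ h → s ≡ 0ℤ
      alg2 h s e = trans (alg h s) (trans (cong (λ z → h - z) e) (ℤ.+-inverseʳ h))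
        where
        alg : ∀ h s → s ≡ h - (1ℤ * h + - 1ℤ * s)
        alg = solve-∀
      go : (∀ j → r j ≡ 0ℤ) ⊎ (∃ λ j → r j ≢ 0ℤ) → InOpenBox b
      go (inj₁ z) = ⊥-elim (x∉integral (multiple⇒integral q b≥0 (λ j → trans (resid≡ hD B j) (trans (cong (_+ q j * D) (z j)) (ℤ.+-identityˡ (q j * D)))) B))
      go (inj₂ (j₀ , ne)) = λ j → subst (0ℤ <_) (sym (b≡r j)) (ℤ.≤∧≢⇒< (0≤resid hD B j) (proj₂ full j ∘ sym)) , subst (_< D) (sym (b≡r j)) (resid<D hD B j)
        where
        full = residue-full R (0≤resid hD B) (resid<D hD B) j₀ ne
        b≡r : ∀ j → b j ≡ r j
        b≡r j = trans (resid≡ hD B j) (trans (cong (λ z → r j + z * D) (∑≡0⇒≡0 q≥0 (alg2 (ℤ.+ k) (∑ q) (proj₁ full)) j)) (trans (cong (r j +_) (ℤ.*-zeroˡ D)) (ℤ.+-identityʳ (r j))))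

  module Ehrhart′ {d : ℕ} (k m : ℕ) (N≡2k : suc d ≡ k ℕ.+ k) (1≤k : 1 ℕ.≤ k) (2≤m : 2 ℕ.≤ m)
    (P : Vec (ZPt d) (suc d)) (nondeg : vol (entries P) ≢ 0ℤ)
    (L : ℕ → ℕ) (ehrhart : EhrhartFn P L)
    (L-small : ∀ n → n ℕ.< k → L n ≡ multichoose (suc d) n)
    (L-k : L k ≡ multichoose (suc d) k ℕ.+ (m ℕ.∸ 1)) where

    open Ehrhart k m N≡2k 1≤k 2≤m P nondeg L ehrhart L-small L-k
    private
      N = suc d
      v = entries P

    coordOf : ZPt d → Fin N → ℤ
    coordOf x = proj₁ (spanD (lookup x) (ℤ.+ k))

    isCoordOf : ∀ x → IsCoord v D (lookup x) (ℤ.+ k) (coordOf x)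
    isCoordOf x = proj₂ (spanD (lookup x) (ℤ.+ k))

    tab-coord : ∀ {x h b} → h ≡ ℤ.+ k → IsCoord v D x h b → IsCoord v D (lookup (tabulate x)) (ℤ.+ k) b
    tab-coord {x} e B = coord-cong B (λ l → sym (Vec.lookup∘tabulate x l)) e (λ j → refl)

    coordOf≡ : ∀ {x b} → IsCoord v D (lookup x) (ℤ.+ k) b → ∀ j → coordOf x j ≡ b j
    coordOf≡ {x} B = coord-unique ind (isCoordOf x) B (λ l → refl) refl

    pos≢0 : ∀ {z} → 0ℤ < z → z ≢ 0ℤ
    pos≢0 h e = ℤ.<-irrefl (sym e) h

    -- The nonintegral point with least i-th coordinate generates the lattice modulo the vertices.
    module Generator (i : Fin N) where

      abstract
        least : ∃ λ x → x ∈ nonintegral × (∀ {y} → y ∈ nonintegral → coordOf x i ≤ coordOf y i)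
        least = argmin (λ x → coordOf x i) nonintegral (subst (1 ℕ.≤_) (sym length-nonintegral) (ℕ.∸-monoˡ-≤ 1 2≤m))

      p : ZPt d
      p = proj₁ least

      b : Fin N → ℤ
      b = coordOf p

      B : IsCoord v D (lookup p) (ℤ.+ k) b
      B = isCoordOf p

      box : InOpenBox b
      box = nonintegral⇒box (proj₁ (proj₂ least)) B

      g : ℤ
      g = b i

      hg : 0ℤ < g
      hg = proj₁ (box i)

      -- Euclidean division by the least coordinate `g`. After subtraction of q times the least
      -- point the i-th coordinate is the remainder, which is below `g`; a nontrivial class would
      -- then contain a nonintegral point with smaller i-th coordinate.
      step′ : ∀ {x h c} → IsCoord v D x h c → ∃ λ q → c i ≡ q * g × (∀ j → ∃ λ t → c j ≡ q * b j + t * D)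
      step′ {x} {h} {c} C = go (all-or-some r)
        where
        dm = divMod (c i) g hg
        q = quot dm
        E = coord-linear 1ℤ (- q) C B
        e : Fin N → ℤ
        e j = 1ℤ * c j + - q * b j
        alg : ∀ r q g → 1ℤ * (r + q * g) + - q * g ≡ r
        alg = solve-∀
        alg2 : ∀ c q b → c ≡ q * b + (1ℤ * c + - q * b)
        alg2 = solve-∀
        eᵢ : e i ≡ rem dm
        eᵢ = trans (cong (λ z → 1ℤ * z + - q * g) (a≡ dm)) (alg (rem dm) q g)
        r = resid hD E
        s = quots hD E
        rem<D' : rem dm < D
        rem<D' = ℤ.<-trans (rem<D dm) (proj₂ (box i))
        go : (∀ j → r j ≡ 0ℤ) ⊎ (∃ λ j → r j ≢ 0ℤ) → ∃ λ q → c i ≡ q * g × (∀ j → ∃ λ t → c j ≡ q * b j + t * D)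
        go (inj₁ z) = q , trans (a≡ dm) (trans (cong (λ z → z + q * g) rem≡0) (ℤ.+-identityˡ (q * g))) , λ j → s j , trans (alg2 (c j) q (b j)) (cong (λ z → q * b j + z) (e≡ j))
          where
          e≡ : ∀ j → e j ≡ s j * D
          e≡ j = trans (resid≡ hD E j) (trans (cong (λ y → y + s j * D) (z j)) (ℤ.+-identityˡ (s j * D)))
          rem≡0 : rem dm ≡ 0ℤ
          rem≡0 = small-multiple D (s i) (rem dm) (0≤rem dm) rem<D' (trans (sym eᵢ) (e≡ i))
        go (inj₂ (j₀ , ne)) = ⊥-elim (ℤ.<⇒≱ (rem<D dm) (subst (g ≤_) (trans (coordOf≡ {tabulate (resid-point hD E)} {r} R i) (sym rem≡)) (proj₂ (proj₂ least) (box⇒nonintegral {tabulate (resid-point hD E)} {r} R (λ j → ℤ.≤∧≢⇒< (0≤resid hD E j) (proj₂ full j ∘ sym) , resid<D hD E j)))))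
          where
          full = residue-full (resid-coord hD E) (0≤resid hD E) (resid<D hD E) j₀ ne
          R = tab-coord (proj₁ full) (resid-coord hD E)
          alg3 : ∀ a b → a + b - a ≡ b
          alg3 = solve-∀
          rem≡ : rem dm ≡ r i
          rem≡ = same-residue D (rem dm) (r i) (s i) (0≤rem dm) rem<D' (0≤resid hD E i) (resid<D hD E i)
            (trans (cong (λ z → z - r i) (trans (sym eᵢ) (resid≡ hD E i))) (alg3 (r i) (s i * D)))

      abstract
        step : ∀ {x h c} → IsCoord v D x h c → ∃ λ q → c i ≡ q * g × (∀ j → ∃ λ t → c j ≡ q * b j + t * D)
        step = step′

      vertex : IsCoord v D (comb {v = v} {D} (δ i)) (∑ (δ i)) (λ j → D * δ i j)
      vertex = coord-comb (δ i)

      -- Vertex i has i-th coordinate D, so `step` exhibits D as a multiple of `g`. The quotient is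
      -- the order of the lattice modulo the vertices and turns out to be m in `M≡m`.
      M : ℤ
      M = proj₁ (step vertex)

      D≡Mg : D ≡ M * g
      D≡Mg = trans (sym (trans (cong (D *_) (δ-refl i)) (ℤ.*-identityʳ D))) (proj₁ (proj₂ (step vertex)))

      hM : 0ℤ < M
      hM = ℤ.≤∧≢⇒< (multiple-pos g M hg (subst (0ℤ ≤_) D≡Mg (ℤ.<⇒≤ hD))) (λ e → pos≢0 hD (trans D≡Mg (trans (cong (_* g) (sym e)) (ℤ.*-zeroˡ g))))

      -- For vertex i, `step` reads D δ i j = M b j + t D. Since D = M g, the factor M cancels.
      g∣b : ∀ j → ∃ λ s → b j ≡ s * g
      g∣b j = let (t , e) = proj₂ (proj₂ (step vertex)) j in
        δ i j - t , *-cancelˡ′ M (pos≢0 hM) (trans (alg2 (D * δ i j) (M * b j) (t * D) e) (trans (cong (λ z → z * δ i j - t * z) D≡Mg) (alg M g (δ i j) t)))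
        where
        alg : ∀ M g δ t → M * g * δ - t * (M * g) ≡ M * ((δ - t) * g)
        alg = solve-∀
        alg2 : ∀ a b c → a ≡ b + c → b ≡ a - c
        alg2 a b c e = trans (alg' b c) (cong (_- c) (sym e))
          where
          alg' : ∀ b c → b ≡ b + c - c
          alg' = solve-∀

      g∣ : ∀ {x h c} → IsCoord v D x h c → ∀ j → ∃ λ s → c j ≡ s * g
      g∣ {c = c} C j = let (q , _ , f) = step C ; (t , e) = f j ; (s , e') = g∣b j in
        q * s + t * M , trans e (trans (cong₂ (λ y z → q * y + t * z) e' D≡Mg) (alg q s t M g))
        where
        alg : ∀ q s t M g → q * (s * g) + t * (M * g) ≡ (q * s + t * M) * g
        alg = solve-∀

      private
        abstract
          positive-suc : ∀ z → 0ℤ < z → ∃ λ n → z ≡ ℤ.+ suc n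
          positive-suc (ℤ.+ suc n) _ = n , refl
          positive-suc (ℤ.+ zero) (ℤ.+<+ ())

        M′ : ℕ
        M′ = proj₁ (positive-suc M hM)

        M≡ : M ≡ ℤ.+ suc M′
        M≡ = proj₂ (positive-suc M hM)

        module Multiple (a : ℤ) (0<a : 0ℤ < a) (a<M : a < M) where
          C = coord-linear a 0ℤ B B
          alg : ∀ a g → a * g + 0ℤ * g ≡ a * g
          alg = solve-∀
          alg3 : ∀ a b → a - (a + b) ≡ - b
          alg3 = solve-∀
          a*g<D : a * g < D
          a*g<D = subst (a * g <_) (sym D≡Mg) (ℤ.*-monoʳ-<-pos g {{ℤ.positive hg}} a<M)
          ag≡ : a * g ≡ resid hD C i
          ag≡ = same-residue D (a * g) (resid hD C i) (quots hD C i) (ℤ.<⇒≤ (0<-* 0<a hg)) a*g<D (0≤resid hD C i) (resid<D hD C i)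
            (trans (cong (_- resid hD C i) (trans (sym (alg a g)) (resid≡ hD C i))) (alg4 (resid hD C i) (quots hD C i * D)))
            where
            alg4 : ∀ a b → a + b - a ≡ b
            alg4 = solve-∀
          full = residue-full (resid-coord hD C) (0≤resid hD C) (resid<D hD C) i (λ e → pos≢0 (0<-* 0<a hg) (trans ag≡ e))
          x : ZPt d
          x = tabulate (resid-point hD C)
          X : IsCoord v D (lookup x) (ℤ.+ k) (resid hD C)
          X = tab-coord (proj₁ full) (resid-coord hD C)
          xᵢ : resid hD C i ≡ a * g
          xᵢ = sym ag≡
          boxX : InOpenBox (resid hD C)
          boxX j = ℤ.≤∧≢⇒< (0≤resid hD C j) (proj₂ full j ∘ sym) , resid<D hD C j

        abstract
          multiple : ∀ a → 0ℤ < a → a < M → ∃ λ (xr : ZPt d × (Fin N → ℤ)) →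
            IsCoord v D (lookup (proj₁ xr)) (ℤ.+ k) (proj₂ xr) × proj₂ xr i ≡ a * g × InOpenBox (proj₂ xr)
          multiple a 0<a a<M = let open Multiple a 0<a a<M in (x , resid hD C) , X , xᵢ , boxX

        index : (a : Fin M′) → 0ℤ < ℤ.+ suc (toℕ a) × ℤ.+ suc (toℕ a) < M
        index a = ℤ.+<+ (ℕ.s≤s ℕ.z≤n) , subst (λ z → ℤ.+ suc (toℕ a) < z) (sym M≡) (ℤ.+<+ (ℕ.s≤s (Fin.toℕ<n a)))

        pos : Fin M′ → ℤ
        pos a = ℤ.+ suc (toℕ a)

        mult = λ (a : Fin M′) → multiple (pos a) (proj₁ (index a)) (proj₂ (index a))

        f : Fin M′ → ZPt d
        f a = proj₁ (proj₁ (mult a))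

        res : Fin M′ → Fin N → ℤ
        res a = proj₂ (proj₁ (mult a))

        fX : ∀ a → IsCoord v D (lookup (f a)) (ℤ.+ k) (res a)
        fX a = proj₁ (proj₂ (mult a))

        fᵢ : ∀ a → res a i ≡ pos a * g
        fᵢ a = proj₁ (proj₂ (proj₂ (mult a)))

        fbox : ∀ a → InOpenBox (res a)
        fbox a = proj₂ (proj₂ (proj₂ (mult a)))

        f-injective : ∀ {a c} → f a ≡ f c → a ≡ c
        f-injective {a} {c} e = Fin.toℕ-injective (ℕ.suc-injective (ℤ.+-injective (ℤ.*-cancelʳ-≡ (ℤ.+ suc (toℕ a)) (ℤ.+ suc (toℕ c)) g {{ℤ.≢-nonZero (pos≢0 hg)}}
          (trans (sym (fᵢ a)) (trans (coord-unique ind (fX a) (fX c) (λ l → cong (λ z → lookup z l) e) refl i) (fᵢ c))))))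

        -- The i-th coordinate of x is q g with 0 < q < M. The difference of x and the q-th multiple
        -- has i-th coordinate 0, so by `step` all its coordinates are multiples of D; both points
        -- lie in the open box and coincide.
        f-surjective : ∀ {x} → x ∈ nonintegral → x ∈ List.tabulate f
        f-surjective {x} x∈ = subst (_∈ List.tabulate f) (sym x≡) (∈-tabulate⁺ {f = f} a)
          where
          C = isCoordOf x
          c = coordOf x
          boxc = nonintegral⇒box x∈ C
          st = step C
          q = proj₁ st
          hq : 0ℤ < q
          hq = ℤ.≤∧≢⇒< (multiple-pos g q hg (subst (0ℤ ≤_) (proj₁ (proj₂ st)) (ℤ.<⇒≤ (proj₁ (boxc i))))) (λ e → pos≢0 (proj₁ (boxc i)) (trans (proj₁ (proj₂ st)) (trans (cong (_* g) (sym e)) (ℤ.*-zeroˡ g))))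
          q<M : q < M
          q<M = ℤ.*-cancelʳ-<-nonNeg g {{ℤ.nonNegative (ℤ.<⇒≤ hg)}} (subst₂ _<_ (proj₁ (proj₂ st)) D≡Mg (proj₂ (boxc i)))
          n = proj₁ (positive-suc q hq)
          q≡ : q ≡ ℤ.+ suc n
          q≡ = proj₂ (positive-suc q hq)
          n<M′ : n ℕ.< M′
          n<M′ = ℕ.≤-pred (ℤ.drop‿+<+ (subst₂ _<_ q≡ M≡ q<M))
          a = Fin.fromℕ< n<M′
          q≡a : q ≡ ℤ.+ suc (toℕ a)
          q≡a = trans q≡ (cong (λ z → ℤ.+ suc z) (sym (Fin.toℕ-fromℕ< n<M′)))
          y = res a
          alg : ∀ a → 1ℤ * a + - 1ℤ * a ≡ 0ℤ
          alg = solve-∀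
          alg2 : ∀ a b → 1ℤ * a + - 1ℤ * b ≡ a - b
          alg2 = solve-∀
          st' = step (coord-linear 1ℤ (- 1ℤ) C (fX a))
          q' = proj₁ st'
          q'≡0 : q' ≡ 0ℤ
          q'≡0 = *-cancel-zero q' g (pos≢0 hg) (trans (sym (proj₁ (proj₂ st'))) (trans (cong (λ z → 1ℤ * c i + - 1ℤ * z) (trans (fᵢ a) (trans (cong (_* g) (sym q≡a)) (sym (proj₁ (proj₂ st)))))) (alg (c i))))
          c≡y : ∀ j → c j ≡ y j
          c≡y j = let (t , e) = proj₂ (proj₂ st') j in same-residue D (c j) (y j) t (ℤ.<⇒≤ (proj₁ (boxc j))) (proj₂ (boxc j)) (ℤ.<⇒≤ (proj₁ (fbox a j))) (proj₂ (fbox a j))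
            (trans (sym (alg2 (c j) (y j))) (trans e (trans (cong (λ z → z * b j + t * D) q'≡0) (trans (cong (_+ t * D) (ℤ.*-zeroˡ (b j))) (ℤ.+-identityˡ (t * D))))))
          x≡ : x ≡ f a
          x≡ = lookup-ext (coord-injective hD C (fX a) c≡y)

      -- The multiples 1, ..., M - 1 of the least point, reduced modulo the vertices, enumerate
      -- `nonintegral` without repetition, and this list has m - 1 elements.
      M≡m : M ≡ ℤ.+ m
      M≡m = trans M≡ (cong ℤ.+_ (trans (cong suc M′≡) (ℕ.m+[n∸m]≡n (ℕ.≤-trans (ℕ.s≤s ℕ.z≤n) 2≤m))))
        where
        M′≡ : M′ ≡ m ℕ.∸ 1
        M′≡ = trans (sym (List.length-tabulate f)) (trans (unique-same-length (Unique.tabulate⁺ f-injective) unique-nonintegral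
          (λ {z} z∈ → let (a , e) = ∈-tabulate⁻ {f = f} z∈ in subst (_∈ nonintegral) (sym e) (box⇒nonintegral {f a} (fX a) (fbox a))) f-surjective) length-nonintegral)

      D≡mg : D ≡ ℤ.+ m * g
      D≡mg = trans D≡Mg (cong (_* g) M≡m)

    private
      module G₀ = Generator zero
      g = G₀.g
      g≢0 = pos≢0 G₀.hg
      m⁺ : 0ℤ < ℤ.+ m
      m⁺ = ℤ.+<+ (ℕ.≤-trans (ℕ.s≤s ℕ.z≤n) 2≤m)

    rescale : ∀ {x h b} → IsCoord v (ℤ.+ m) x h b → IsCoord v D x h (λ j → g * b j)
    rescale {x} {h} {b} (coord s p) = coord (trans (sym (*-∑ g b)) (trans (cong (g *_) s) (trans (alg g (ℤ.+ m) h) (cong (_* h) (sym G₀.D≡mg)))))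
      λ l → trans (∑-cong (λ j → ℤ.*-assoc g (b j) (v j l))) (trans (sym (*-∑ g (λ j → b j * v j l))) (trans (cong (g *_) (p l)) (trans (alg g (ℤ.+ m) (x l)) (cong (_* x l) (sym G₀.D≡mg)))))
      where
      alg : ∀ g m h → g * (m * h) ≡ m * g * h
      alg = solve-∀

    -- All coordinates with denominator D = m g are multiples of g, so the denominator m suffices.
    unscale : ∀ {x h c} → IsCoord v D x h c → ∃ λ b → IsCoord v (ℤ.+ m) x h b × (∀ j → c j ≡ b j * g)
    unscale {x} {h} {c} C = b , coord
       (*-cancelˡ′ g g≢0 (trans (*-∑ g b) (trans (∑-cong c≡) (trans (total C) (trans (cong (_* h) G₀.D≡mg) (alg (ℤ.+ m) g h))))))
       (λ l → *-cancelˡ′ g g≢0 (trans (*-∑ g (λ j → b j * v j l)) (trans (∑-cong (λ j → trans (sym (ℤ.*-assoc g (b j) (v j l))) (cong (_* v j l) (c≡ j))))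
         (trans (point C l) (trans (cong (_* x l) G₀.D≡mg) (alg (ℤ.+ m) g (x l)))))))
       , λ j → proj₂ (G₀.g∣ C j)
      where
      b : Fin N → ℤ
      b j = proj₁ (G₀.g∣ C j)
      c≡ : ∀ j → g * b j ≡ c j
      c≡ j = trans (ℤ.*-comm g (b j)) (sym (proj₂ (G₀.g∣ C j)))
      alg : ∀ m g h → m * g * h ≡ g * (m * h)
      alg = solve-∀

    cyclic : CyclicLattice (ℤ.+ k) (ℤ.+ m) v
    cyclic = record
      { m-pos = m⁺
      ; independent = ind
      ; coordinates = λ x h → let (b , B , _) = unscale (proj₂ (spanD x h)) in b , B
      ; reduced = λ x h b B b≥0 b<m j₀ ne →
          let (e , nz) = residue-full (rescale B) (λ j → 0≤-* (ℤ.<⇒≤ G₀.hg) (b≥0 j))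
                (λ j → subst (g * b j <_) (trans (ℤ.*-comm g (ℤ.+ m)) (sym G₀.D≡mg)) (ℤ.*-monoˡ-<-pos g {{ℤ.positive G₀.hg}} (b<m j))) j₀
                (λ e → ne (*-cancelˡ′ g g≢0 (trans e (sym (ℤ.*-zeroʳ g)))))
          in e , λ j e' → nz j (trans (cong (g *_) e') (ℤ.*-zeroʳ g))
      -- The least coordinate is D / m for every index i, so it equals `g`, and dividing by `g`
      -- turns it into 1.
      ; generator = λ i → let module Gᵢ = Generator i ; (b , B , e) = unscale Gᵢ.B in
          lookup Gᵢ.p , ℤ.+ k , b , B , *-cancelˡ′ g g≢0 (trans (ℤ.*-comm g (b i)) (trans (sym (e i)) (trans
            (*-cancelˡ′ (ℤ.+ m) (pos≢0 m⁺) (trans (sym Gᵢ.D≡mg) G₀.D≡mg)) (sym (ℤ.*-identityʳ g))))) }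

  -- Sums over lists

  sumL : ∀ {A : Set} → (A → ℤ) → List A → ℤ
  sumL f [] = 0ℤ
  sumL f (x ∷ xs) = f x + sumL f xs

  sumL-++ : ∀ {A : Set} (f : A → ℤ) xs ys → sumL f (xs ++ ys) ≡ sumL f xs + sumL f ys
  sumL-++ f [] ys = sym (ℤ.+-identityˡ (sumL f ys))
  sumL-++ f (x ∷ xs) ys = trans (cong (λ z → f x + z) (sumL-++ f xs ys)) (sym (ℤ.+-assoc (f x) (sumL f xs) (sumL f ys)))

  sumL-map : ∀ {A B : Set} (f : B → ℤ) (g : A → B) xs → sumL f (List.map g xs) ≡ sumL (λ x → f (g x)) xs
  sumL-map f g [] = refl
  sumL-map f g (x ∷ xs) = cong (λ z → f (g x) + z) (sumL-map f g xs)

  sumL-replicate : ∀ {A : Set} (f : A → ℤ) n x → sumL f (List.replicate n x) ≡ ℤ.+ n * f x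
  sumL-replicate f zero x = sym (ℤ.*-zeroˡ (f x))
  sumL-replicate f (suc n) x = trans (cong (λ z → f x + z) (sumL-replicate f n x)) (trans (alg (f x) (ℤ.+ n)) (cong (λ z → z * f x) (sym (ℤ.pos-+ 1 n))))
    where
    alg : ∀ a n → a + n * a ≡ (1ℤ + n) * a
    alg = solve-∀

  sumL-remove : ∀ {A : Set} (f : A → ℤ) {x xs} (p : x ∈ xs) → sumL f xs ≡ f x + sumL f (remove p)
  sumL-remove f (here refl) = refl
  sumL-remove f {x} {y ∷ xs} (there p) = trans (cong (λ z → f y + z) (sumL-remove f p)) (alg (f y) (f x) (sumL f (remove p)))
    where
    alg : ∀ a b c → a + (b + c) ≡ b + (a + c)
    alg = solve-∀

  sumL-nonneg : ∀ {A : Set} (f : A → ℤ) xs → (∀ x → 0ℤ ≤ f x) → 0ℤ ≤ sumL f xs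
  sumL-nonneg f [] h = ℤ.≤-refl
  sumL-nonneg f (x ∷ xs) h = ℤ.+-mono-≤ (h x) (sumL-nonneg f xs h)

  sumL-multiple : ∀ {A : Set} (f : A → ℤ) m xs → (∀ {x} → x ∈ xs → ∃ λ q → f x ≡ q * m) → ∃ λ q → sumL f xs ≡ q * m
  sumL-multiple f m [] h = 0ℤ , sym (ℤ.*-zeroˡ m)
  sumL-multiple f m (x ∷ xs) h = let (q , e) = h (here refl) ; (r , e') = sumL-multiple f m xs (λ p → h (there p)) in
    q + r , trans (cong₂ _+_ e e') (sym (ℤ.*-distribʳ-+ m q r))

  sumPts≡ : ∀ {d} (xs : List (ZPt d)) l → sumPts xs l ≡ sumL (λ x → lookup x l) xs
  sumPts≡ [] l = refl
  sumPts≡ (x ∷ xs) l = cong (λ z → lookup x l + z) (sumPts≡ xs l)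

  expand : ∀ {n} → Vec ℕ n → List (Fin n)
  expand [] = []
  expand (x ∷ u) = List.replicate x zero ++ List.map suc (expand u)

  length-expand : ∀ {n} (u : Vec ℕ n) → length (expand u) ≡ Vec.sum u
  length-expand [] = refl
  length-expand (x ∷ u) = trans (List.length-++ (List.replicate x zero)) (cong₂ ℕ._+_ (List.length-replicate x) (trans (List.length-map suc (expand u)) (length-expand u)))

  sumL-expand : ∀ {n} (f : Fin n → ℤ) (u : Vec ℕ n) → sumL f (expand u) ≡ ∑ (λ i → ℤ.+ lookup u i * f i)
  sumL-expand f [] = sym ∑-empty
  sumL-expand f (x ∷ u) = trans (sumL-++ f (List.replicate x zero) (List.map suc (expand u))) (trans (cong₂ _+_ (sumL-replicate f x zero)
    (trans (sumL-map f suc (expand u)) (sumL-expand (λ i → f (suc i)) u))) (sym (∑-suc (λ i → ℤ.+ lookup (x ∷ u) i * f i))))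

  mult : ∀ {n} → List (Fin n) → Fin n → ℤ
  mult js i = sumL (δ i) js

  ∑-mult : ∀ {n} (f : Fin n → ℤ) js → ∑ (λ i → mult js i * f i) ≡ sumL f js
  ∑-mult f [] = ∑-zero (λ i → ℤ.*-zeroˡ (f i))
  ∑-mult f (j ∷ js) = trans (∑-cong (λ i → ℤ.*-distribʳ-+ (f i) (δ i j) (mult js i))) (trans (∑-+ (λ i → δ i j * f i) (λ i → mult js i * f i))
    (cong₂ _+_ (trans (∑-cong (λ i → cong (_* f i) (δ-sym i j))) (∑-δ j f)) (∑-mult f js)))

  sumL-one : ∀ {A : Set} (xs : List A) → sumL (λ _ → 1ℤ) xs ≡ ℤ.+ length xs
  sumL-one [] = refl
  sumL-one (x ∷ xs) = trans (cong (1ℤ +_) (sumL-one xs)) (sym (ℤ.pos-+ 1 (length xs)))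

  δ-nonneg : ∀ {n} (i j : Fin n) → 0ℤ ≤ δ i j
  δ-nonneg zero zero = ℤ.+≤+ ℕ.z≤n
  δ-nonneg zero (suc j) = ℤ.≤-refl
  δ-nonneg (suc i) zero = ℤ.≤-refl
  δ-nonneg (suc i) (suc j) = δ-nonneg i j

  mult-pos⇒∈ : ∀ {n} (i : Fin n) js → 0ℤ < mult js i → i ∈ js
  mult-pos⇒∈ i [] (ℤ.+<+ ())
  mult-pos⇒∈ i (j ∷ js) h with i Fin.≟ j
  ... | yes e = here e
  ... | no ne = there (mult-pos⇒∈ i js (subst (0ℤ <_) (trans (cong (_+ mult js i) (δ-≢ ne)) (ℤ.+-identityˡ (mult js i))) h))

  ∈⇒mult-pos : ∀ {n} (i : Fin n) {js} → i ∈ js → 0ℤ < mult js i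
  ∈⇒mult-pos i {js} p = ℤ.<-≤-trans 0<1 (subst (1ℤ ≤_) (sym (trans (sumL-remove (δ i) p) (cong (_+ mult (remove p) i) (δ-refl i))))
    (subst (_≤ 1ℤ + mult (remove p) i) (ℤ.+-identityʳ 1ℤ) (ℤ.+-monoʳ-≤ 1ℤ (sumL-nonneg (δ i) (remove p) (δ-nonneg i)))))

  -- The difference of the multiplicities is an affine relation between the rows of v, so
  -- independence makes the two lists equal as multisets.
  balanced⇒⊆ : ∀ {n d} (v : Matrix n d) → AffinelyIndependent v → ∀ js is → length js ≡ length is →
    (∀ l → sumL (λ j → v j l) js ≡ sumL (λ j → v j l) is) → ∀ {j} → j ∈ js → j ∈ is
  balanced⇒⊆ v ind js is len eq {j} j∈ = mult-pos⇒∈ j is (subst (0ℤ <_) (ℤ.i-j≡0⇒i≡j (mult js j) (mult is j) (ind (λ i → mult js i - mult is i) tot comb≡ j)) (∈⇒mult-pos j j∈))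
    where
    ones : ∀ (xs : List (Fin _)) → ∑ (mult xs) ≡ ℤ.+ length xs
    ones xs = trans (∑-cong (λ i → sym (ℤ.*-identityʳ (mult xs i)))) (trans (∑-mult (λ _ → 1ℤ) xs) (sumL-one xs))
    tot : ∑ (λ i → mult js i - mult is i) ≡ 0ℤ
    tot = trans (∑-sub (mult js) (mult is)) (trans (cong₂ _-_ (ones js) (trans (ones is) (cong ℤ.+_ (sym len)))) (ℤ.+-inverseʳ (ℤ.+ length js)))
    alg : ∀ a b c → (a - b) * c ≡ a * c - b * c
    alg = solve-∀
    comb≡ : ∀ l → ∑ (λ i → (mult js i - mult is i) * v i l) ≡ 0ℤ
    comb≡ l = trans (∑-cong (λ i → alg (mult js i) (mult is i) (v i l))) (trans (∑-sub (λ i → mult js i * v i l) (λ i → mult is i * v i l))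
      (trans (cong₂ _-_ (∑-mult (λ i → v i l) js) (trans (∑-mult (λ i → v i l) is) (sym (eq l)))) (ℤ.+-inverseʳ (sumL (λ j → v j l) js))))

  ∑-one : ∀ n → ∑ {n} (λ _ → 1ℤ) ≡ ℤ.+ n
  ∑-one zero = ∑-empty
  ∑-one (suc n) = trans (∑-suc {n} (λ _ → 1ℤ)) (trans (cong (1ℤ +_) (∑-one n)) (sym (ℤ.pos-+ 1 n)))

  pos≢0 : ∀ {z} → 0ℤ < z → z ≢ 0ℤ
  pos≢0 h e = ℤ.<-irrefl (sym e) h

  -- Nontrivial classes of the lattice modulo the vertices

  module Classes {d : ℕ} (k m : ℕ) (N≡2k : suc d ≡ k ℕ.+ k) (1≤k : 1 ℕ.≤ k)
    (P : Vec (ZPt d) (suc d)) (cyc : CyclicLattice (ℤ.+ k) (ℤ.+ m) (entries P)) where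

    open CyclicLattice cyc

    private
      N = suc d
      v = entries P
      K = ℤ.+ k
      M = ℤ.+ m

    N≡K+K : ℤ.+ N ≡ K + K
    N≡K+K = trans (cong ℤ.+_ N≡2k) (ℤ.pos-+ k k)

    hK : 0ℤ < K
    hK = ℤ.+<+ 1≤k

    InBox : (Fin N → ℤ) → Set
    InBox b = ∀ j → 0ℤ < b j × b j < M

    -- Stands for a nontrivial class: by `reduced`, the reduced representative of such a class has
    -- height k and no vanishing coordinate, so it is a lattice point in the interior of kP.
    record Interior : Set where
      field
        pt : ZPt d
        res : Fin N → ℤ
        isCoord : IsCoord v M (lookup pt) K res
        inBox : InBox res
    open Interior public

    lattice⇒≥0 : ∀ {x b} → LatticeIn (dilate k P) x → IsCoord v M (lookup x) K b → ∀ j → 0ℤ ≤ b j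
    lattice⇒≥0 {x} h B = hull⇒coord≥0 P independent m-pos {lookup x} {1ℤ} {k} (coord-cong B (λ l → refl) (sym (ℤ.*-identityʳ K)) (λ j → refl)) (lattice⇒hull (dilate k P) x h)

    ≥0⇒lattice : ∀ {x b} → IsCoord v M (lookup x) K b → (∀ j → 0ℤ ≤ b j) → LatticeIn (dilate k P) x
    ≥0⇒lattice {x} B h = hull⇒lattice (dilate k P) x (coord≥0⇒hull P independent m-pos {lookup x} {1ℤ} {k} (ℤ.+<+ 1≤k) (coord-cong B (λ l → refl) (sym (ℤ.*-identityʳ K)) (λ j → refl)) h)

    interior⇒lattice : ∀ X → LatticeIn (dilate k P) (pt X)
    interior⇒lattice X = ≥0⇒lattice (isCoord X) (λ j → ℤ.<⇒≤ (proj₁ (inBox X j)))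

    interior-unique : ∀ X Y → (∀ j → res X j ≡ res Y j) → pt X ≡ pt Y
    interior-unique X Y e = lookup-ext (coord-injective m-pos (isCoord X) (isCoord Y) e)

    mkInterior : ∀ {x b} → IsCoord v M x K b → InBox b → ∃ λ X → ∀ j → res X j ≡ b j
    mkInterior {x} {b} B box = record { pt = tabulate x ; res = b ; isCoord = coord-cong B (λ l → sym (Vec.lookup∘tabulate x l)) refl (λ j → refl) ; inBox = box } , λ j → refl

    Multiple : (Fin N → ℤ) → Set
    Multiple b = ∀ j → ∃ λ q → b j ≡ q * M

    resid-cases : ∀ {x h b} (B : IsCoord v M x h b) → Multiple b ⊎ (∃ λ X → ∀ j → ∃ λ q → b j ≡ res X j + q * M)
    resid-cases {b = b} B with all-or-some (resid m-pos B)
    ... | inj₁ z = inj₁ λ j → quots m-pos B j , trans (resid≡ m-pos B j) (trans (cong (λ y → y + quots m-pos B j * M) (z j)) (ℤ.+-identityˡ (quots m-pos B j * M)))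
    ... | inj₂ (j₀ , ne) = inj₂ (proj₁ XR , λ j → quots m-pos B j , trans (resid≡ m-pos B j) (cong (λ y → y + quots m-pos B j * M) (sym (proj₂ XR j))))
      where
      full = reduced (resid-point m-pos B) (resid-height m-pos B) (resid m-pos B) (resid-coord m-pos B) (0≤resid m-pos B) (resid<D m-pos B) j₀ ne
      XR = mkInterior (coord-cong (resid-coord m-pos B) (λ l → refl) (proj₁ full) (λ j → refl)) (λ j → ℤ.≤∧≢⇒< (0≤resid m-pos B j) (proj₂ full j ∘ sym) , resid<D m-pos B j)

    box⇒¬multiple : ∀ {b} → InBox b → ¬ Multiple b
    box⇒¬multiple {b} box mul = let (q , e) = mul zero in pos≢0 (proj₁ (box zero)) (small-multiple M q (b zero) (ℤ.<⇒≤ (proj₁ (box zero))) (proj₂ (box zero)) e)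

    -- The difference X - Y has i-th coordinate 0, while a nontrivial class has no coordinate
    -- divisible by m. So the difference is trivial, and all coordinates agree modulo m.
    interior-determined : ∀ X Y i → res X i ≡ res Y i → ∀ j → res X j ≡ res Y j
    interior-determined X Y i e = go (resid-cases C)
      where
      C = coord-linear 1ℤ (- 1ℤ) (isCoord X) (isCoord Y)
      alg : ∀ a b → a - b ≡ 1ℤ * a + - 1ℤ * b
      alg = solve-∀
      alg2 : ∀ a → 1ℤ * a + - 1ℤ * a ≡ 0ℤ
      alg2 = solve-∀
      alg3 : ∀ r q M → r ≡ (r + q * M) + - q * M
      alg3 = solve-∀
      go : _ → ∀ j → res X j ≡ res Y j
      go (inj₁ mul) j = let (q , e') = mul j in same-residue M (res X j) (res Y j) q (ℤ.<⇒≤ (proj₁ (inBox X j))) (proj₂ (inBox X j)) (ℤ.<⇒≤ (proj₁ (inBox Y j))) (proj₂ (inBox Y j)) (trans (alg (res X j) (res Y j)) e')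
      go (inj₂ (Z , h)) = ⊥-elim (pos≢0 (proj₁ (inBox Z i)) (let (q , e') = h i in small-multiple M (- q) (res Z i) (ℤ.<⇒≤ (proj₁ (inBox Z i))) (proj₂ (inBox Z i))
         (trans (alg3 (res Z i) q M) (trans (cong (λ z → z + - q * M) (trans (sym e') (trans (cong (λ z → 1ℤ * z + - 1ℤ * res Y i) e) (alg2 (res Y i))))) (ℤ.+-identityˡ (- q * M))))))

    -- Replacing each coordinate r by m - r changes the height k to N - k, which is k again because
    -- N = 2k.
    negate : Interior → Interior
    negate X = proj₁ (mkInterior {b = λ j → M - res X j} (coord-cong (coord-linear 1ℤ (- 1ℤ) (coord-comb (λ _ → 1ℤ)) (isCoord X)) (λ l → refl) h≡ (λ j → alg M (res X j)))
      (λ j → subst (0ℤ <_) refl (ℤ.≤∧≢⇒< (ℤ.i≤j⇒0≤j-i (ℤ.<⇒≤ (proj₂ (inBox X j)))) (λ e → ℤ.<-irrefl (sym (ℤ.i-j≡0⇒i≡j M (res X j) (sym e))) (proj₂ (inBox X j)))) ,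
         subst (M - res X j <_) (ℤ.+-identityʳ M) (ℤ.+-monoʳ-< M (ℤ.neg-mono-< (proj₁ (inBox X j))))))
      where
      alg : ∀ M r → 1ℤ * (M * 1ℤ) + - 1ℤ * r ≡ M - r
      alg = solve-∀
      alg2 : ∀ K → 1ℤ * (K + K) + - 1ℤ * K ≡ K
      alg2 = solve-∀
      h≡ : 1ℤ * ∑ {N} (λ _ → 1ℤ) + - 1ℤ * K ≡ K
      h≡ = trans (cong (λ z → 1ℤ * z + - 1ℤ * K) (trans (∑-one N) N≡K+K)) (alg2 K)

    withCoord : ∀ i n → 0ℤ < n → n < M → ∃ λ X → res X i ≡ n
    withCoord i n 0<n n<M = go (resid-cases C)
      where
      gen = generator i
      B = proj₁ (proj₂ (proj₂ (proj₂ gen)))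
      b = proj₁ (proj₂ (proj₂ gen))
      bᵢ : b i ≡ 1ℤ
      bᵢ = proj₂ (proj₂ (proj₂ (proj₂ gen)))
      C = coord-linear n 0ℤ B B
      alg : ∀ n b → n * 1ℤ + 0ℤ * b ≡ n
      alg = solve-∀
      alg2 : ∀ r q → r + q - r ≡ q
      alg2 = solve-∀
      cᵢ : n * b i + 0ℤ * b i ≡ n
      cᵢ = trans (cong (λ z → n * z + 0ℤ * b i) bᵢ) (alg n (b i))
      go : _ → ∃ λ X → res X i ≡ n
      go (inj₁ mul) = let (q , e) = mul i in ⊥-elim (pos≢0 0<n (small-multiple M q n (ℤ.<⇒≤ 0<n) n<M (trans (sym cᵢ) e)))
      go (inj₂ (X , h)) = let (q , e) = h i in X , sym (same-residue M n (res X i) q (ℤ.<⇒≤ 0<n) n<M (ℤ.<⇒≤ (proj₁ (inBox X i))) (proj₂ (inBox X i))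
         (trans (cong (λ z → z - res X i) (trans (sym cᵢ) e)) (alg2 (res X i) (q * M))))

    -- If the class is nontrivial, its representative X has height k as well; the quotients are
    -- nonnegative with sum 0, so b equals `res X`.
    lattice-cases : ∀ {x b} → LatticeIn (dilate k P) x → IsCoord v M (lookup x) K b → Multiple b ⊎ InBox b
    lattice-cases {x} {b} lat B = go (resid-cases B)
      where
      b≥0 = lattice⇒≥0 {x} lat B
      go : _ → Multiple b ⊎ InBox b
      go (inj₁ mul) = inj₁ mul
      go (inj₂ (X , h)) = inj₂ λ j → subst (λ z → 0ℤ < z × z < M) (sym (b≡ j)) (inBox X j)
        where
        q : Fin N → ℤ
        q j = proj₁ (h j)
        q≥0 : ∀ j → 0ℤ ≤ q j
        q≥0 j = ℤ.≮⇒≥ λ q<0 → ℤ.<⇒≱ (proj₂ (inBox X j)) (ℤ.≤-trans (subst (_≤ - q j * M) (ℤ.*-identityˡ M) (ℤ.*-monoʳ-≤-nonNeg M (ℤ.i<j⇒suc[i]≤j (ℤ.neg-mono-< q<0))))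
           (subst₂ _≤_ (ℤ.+-identityˡ (- q j * M)) (trans (cong (λ z → z + - q j * M) (proj₂ (h j))) (alg (res X j) (q j) M)) (ℤ.+-monoˡ-≤ (- q j * M) (b≥0 j))))
           where
           alg : ∀ r q M → r + q * M + - q * M ≡ r
           alg = solve-∀
        ∑q≡0 : ∑ q ≡ 0ℤ
        ∑q≡0 = *-cancelˡ′ M (pos≢0 m-pos) (trans (alg (∑ (res X)) (M * ∑ q) (M * K) (trans (cong (λ z → ∑ (res X) + z) (*-∑ M q)) (trans (sym (∑-+ (res X) (λ j → M * q j)))
              (trans (∑-cong (λ j → trans (cong (λ z → res X j + z) (ℤ.*-comm M (q j))) (sym (proj₂ (h j))))) (total B)))) (total (isCoord X))) (sym (ℤ.*-zeroʳ M)))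
          where
          alg : ∀ a b c → a + b ≡ c → a ≡ c → b ≡ 0ℤ
          alg a b c e e' = trans (alg' a b) (trans (cong₂ _-_ e e') (ℤ.+-inverseʳ c))
            where
            alg' : ∀ a b → b ≡ a + b - a
            alg' = solve-∀
        b≡ : ∀ j → b j ≡ res X j
        b≡ j = trans (proj₂ (h j)) (trans (cong (λ z → res X j + z * M) (∑≡0⇒≡0 q≥0 ∑q≡0 j)) (trans (cong (λ z → res X j + z) (ℤ.*-zeroˡ M)) (ℤ.+-identityʳ (res X j))))

  Indicator : ∀ {n} → (Fin n → ℤ) → Set
  Indicator D = ∀ j → D j ≡ 0ℤ ⊎ D j ≡ 1ℤ

  lookup-All : ∀ {A : Set} {Q : A → Set} {n} {xs : Vec A n} → VAll.All Q xs → ∀ i → Q (lookup xs i)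
  lookup-All (p VAll.∷ ps) zero = p
  lookup-All (p VAll.∷ ps) (suc i) = lookup-All ps i

  all-or-any : ∀ {A : Set} {Q R : A → Set} → (∀ x → Q x ⊎ R x) → ∀ xs → (∀ {x} → x ∈ xs → Q x) ⊎ (∃ λ x → x ∈ xs × R x)
  all-or-any c [] = inj₁ λ ()
  all-or-any c (x ∷ xs) with c x | all-or-any c xs
  ... | inj₂ r | _ = inj₂ (x , here refl , r)
  ... | inj₁ q | inj₂ (y , p , r) = inj₂ (y , there p , r)
  ... | inj₁ q | inj₁ h = inj₁ λ { (here refl) → q ; (there p) → h p }

  -- Cells through an interior point and integral vertices

  module Join {d : ℕ} (k m : ℕ) (N≡2k : suc d ≡ k ℕ.+ k) (1≤k : 1 ℕ.≤ k)
    (P : Vec (ZPt d) (suc d)) (cyc : CyclicLattice (ℤ.+ k) (ℤ.+ m) (entries P))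
    (T : List (Vec (ZPt d) (suc d))) (tri : IsUnimodTriangulation (dilate k P) T) where

    open CyclicLattice cyc
    open Classes k m N≡2k 1≤k P cyc

    private
      N = suc d
      v = entries P
      K = ℤ.+ k
      M = ℤ.+ m

    unimodular : ∀ {σ} → σ ∈ T → ∣ vol (entries σ) ∣ ≡ 1
    unimodular {σ} σ∈ = trans (cong ∣_∣ (sym (det≡vol σ))) (proj₂ (proj₁ tri σ∈))

    vertex-lattice : ∀ {σ} → σ ∈ T → ∀ s → LatticeIn (dilate k P) (lookup σ s)
    vertex-lattice {σ} σ∈ s = lookup-All (proj₁ (proj₁ tri σ∈)) s

    cell-independent : ∀ {σ} → σ ∈ T → AffinelyIndependent (entries σ)
    cell-independent {σ} σ∈ = vol≢0⇒independent (entries σ) (λ e → contra (trans (sym (unimodular σ∈)) (cong ∣_∣ e)))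
      where
      contra : 1 ≡ 0 → ⊥
      contra ()

    private module Decompose (Z : Fin d → ℤ) (t : ℕ) (inZ : InHull (entries (dilate k P)) Z (1ℤ + ℤ.+ t)) where
      open ≡-Reasoning
      H = 1ℤ + ℤ.+ t
      hH : 0ℤ < H
      hH = subst (0ℤ <_) (ℤ.pos-+ 1 t) (ℤ.+<+ (ℕ.s≤s ℕ.z≤n))
      x = proj₁ (fraction Z H hH)
      rx = proj₂ (fraction Z H hH)
      inP : InConv (dilate k P) x
      inP = hull⇒conv (dilate k P) x Z H hH rx inZ
      found = find (proj₁ (proj₂ tri) x inP)
      σ = proj₁ found
      σ∈T = proj₁ (proj₂ found)
      hσ = proj₁ (conv⇒hull σ x Z H hH rx (proj₂ (proj₂ found)))
      uc = unimodular-coordinates (entries σ) (unimodular σ∈T) Z H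
      B = proj₁ uc
      r = scale hσ
      W = weight hσ
      rB≡W : ∀ s → r * B s ≡ W s
      rB≡W s = ℤ.i-j≡0⇒i≡j (r * B s) (W s) (cell-independent σ∈T (λ s → r * B s - W s)
        (trans (∑-sub (λ s → r * B s) W) (trans (cong₂ _-_ (trans (sym (*-∑ r B)) (cong (r *_) (proj₁ (proj₂ uc)))) (weight-sum hσ)) (ℤ.+-inverseʳ (r * H))))
        (λ l → trans (∑-cong (λ s → alg (r) (B s) (W s) (entries σ s l))) (trans (∑-sub (λ s → r * (B s * entries σ s l)) (λ s → W s * entries σ s l))
          (trans (cong₂ _-_ (trans (sym (*-∑ r (λ s → B s * entries σ s l))) (cong (r *_) (proj₂ (proj₂ uc) l))) (weight-comb hσ l)) (ℤ.+-inverseʳ (r * Z l))))) s)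
        where
        alg : ∀ r b w x → (r * b - w) * x ≡ r * (b * x) - w * x
        alg = solve-∀
      B≥0 : ∀ s → 0ℤ ≤ B s
      B≥0 s = multiple-pos r (B s) (scale-pos hσ) (subst (0ℤ ≤_) (trans (sym (rB≡W s)) (ℤ.*-comm r (B s))) (weight≥0 hσ s))
      U = to-ℕ B B≥0
      u = proj₁ U
      js = expand u
      len-js : length js ≡ suc t
      len-js = ℤ.+-injective (begin
        ℤ.+ length js ≡⟨ cong ℤ.+_ (length-expand u) ⟩
        ℤ.+ Vec.sum u ≡⟨ sum-ℕ u ⟩
        ∑ (λ s → ℤ.+ lookup u s) ≡⟨ ∑-cong (proj₂ U) ⟩
        ∑ B ≡⟨ proj₁ (proj₂ uc) ⟩
        1ℤ + ℤ.+ t ≡⟨ sym (ℤ.pos-+ 1 t) ⟩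
        ℤ.+ suc t ∎)
      sum-js : ∀ l → sumL (λ s → entries σ s l) js ≡ Z l
      sum-js l = trans (sumL-expand (λ s → entries σ s l) u) (trans (∑-cong (λ s → cong (_* entries σ s l) (proj₂ U s))) (proj₂ (proj₂ uc) l))

    abstract
      -- Take the cell that contains Z / (1 + t). As it is unimodular, Z has integral coordinates
      -- with sum 1 + t with respect to its vertices; these are proportional to convex weights,
      -- hence nonnegative, and can be read as multiplicities.
      decompose : ∀ Z t → InHull (entries (dilate k P)) Z (1ℤ + ℤ.+ t) →
        ∃ λ σ → σ ∈ T × ∃ λ js → length js ≡ suc t × (∀ l → sumL (λ s → entries σ s l) js ≡ Z l)
      decompose Z t inZ = let open Decompose Z t inZ in σ , σ∈T , js , len-js , sum-js

    -- X + k Σ_D v is the sum of X and |D| integral vertices of a single cell.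
    record JoinData (X : Interior) (D : Fin N → ℤ) (t : ℕ) : Set where
      field
        σ : Vec (ZPt d) (suc d)
        σ∈T : σ ∈ T
        apex : Fin (suc d)
        apex≡ : lookup σ apex ≡ pt X
        rest : List (Fin (suc d))
        rest-length : length rest ≡ t
        rest-sum : ∀ l → sumL (λ s → entries σ s l) rest ≡ comb {v = v} {M} (λ j → K * D j) l
        rest-integral : ∀ {s} → s ∈ rest → ∀ Y → lookup σ s ≢ pt Y

    private module Proof (X : Interior) (D : Fin N → ℤ) (t : ℕ) (D01 : Indicator D) (∑D : ∑ D ≡ ℤ.+ t) (t<k : t ℕ.< k) where
      open ≡-Reasoning
      H = 1ℤ + ℤ.+ t
      E = coord-linear {v = v} {M} 1ℤ 1ℤ (isCoord X) (coord-comb (λ j → K * D j))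
      Z : Fin d → ℤ
      Z l = 1ℤ * lookup (pt X) l + 1ℤ * comb {v = v} {M} (λ j → K * D j) l
      e : Fin N → ℤ
      e j = 1ℤ * res X j + 1ℤ * (M * (K * D j))
      alg-h : ∀ K t → 1ℤ * K + 1ℤ * (K * t) ≡ K * (1ℤ + t)
      alg-h = solve-∀
      -- X contributes the height k and every vertex in D the height k, so Z lies in the (1 +
      -- t)-fold dilate of kP.
      E' : IsCoord v M Z (K * H) e
      E' = coord-cong E (λ l → refl) (trans (cong (λ z → 1ℤ * K + 1ℤ * z) (trans (sym (*-∑ K D)) (cong (K *_) ∑D))) (alg-h K (ℤ.+ t))) (λ j → refl)
      D≥0 : ∀ j → 0ℤ ≤ D j
      D≥0 j with D01 j
      ... | inj₁ z = ℤ.≤-reflexive (sym z)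
      ... | inj₂ o = subst (0ℤ ≤_) (sym o) (ℤ.+≤+ ℕ.z≤n)
      alg-e : ∀ r x → 1ℤ * r + 1ℤ * x ≡ r + x
      alg-e = solve-∀
      e≥0 : ∀ j → 0ℤ ≤ e j
      e≥0 j = subst (0ℤ ≤_) (sym (alg-e (res X j) (M * (K * D j)))) (ℤ.+-mono-≤ (ℤ.<⇒≤ (proj₁ (inBox X j))) (0≤-* {M} {K * D j} (ℤ.+≤+ ℕ.z≤n) (0≤-* {K} {D j} (ℤ.+≤+ ℕ.z≤n) (D≥0 j))))
      dec = decompose Z t (coord≥0⇒hull P independent m-pos {Z} {H} {k} hK E' e≥0)
      σ = proj₁ dec
      σ∈T = proj₁ (proj₂ dec)
      js = proj₁ (proj₂ (proj₂ dec))
      len-js : length js ≡ suc t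
      len-js = proj₁ (proj₂ (proj₂ (proj₂ dec)))
      sum-js : ∀ l → sumL (λ s → entries σ s l) js ≡ Z l
      sum-js = proj₂ (proj₂ (proj₂ (proj₂ dec)))
      β : Fin (suc d) → Fin N → ℤ
      β s = proj₁ (coordinates (lookup (lookup σ s)) K)
      βc : ∀ s → IsCoord v M (lookup (lookup σ s)) K (β s)
      βc s = proj₂ (coordinates (lookup (lookup σ s)) K)
      β≥0 : ∀ s j → 0ℤ ≤ β s j
      β≥0 s = lattice⇒≥0 {lookup σ s} (vertex-lattice σ∈T s) (βc s)
      β-cases : ∀ s → Multiple (β s) ⊎ InBox (β s)
      β-cases s = lattice-cases {lookup σ s} (vertex-lattice σ∈T s) (βc s)
      sum-coord : ∀ xs → IsCoord v M (λ l → sumL (λ s → entries σ s l) xs) (K * ℤ.+ length xs) (λ j → sumL (λ s → β s j) xs)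
      sum-coord [] = coord-cong (coord-comb (λ _ → 0ℤ)) (λ l → ∑-zero (λ j → ℤ.*-zeroˡ (v j l))) (trans (∑-zero {N} (λ j → refl)) (sym (ℤ.*-zeroʳ K))) (λ j → ℤ.*-zeroʳ M)
      sum-coord (s ∷ xs) = coord-cong (coord-linear 1ℤ 1ℤ (βc s) (sum-coord xs)) (λ l → alg-e (entries σ s l) (sumL (λ s → entries σ s l) xs))
         (trans (alg-h K (ℤ.+ length xs)) (cong (K *_) (sym (ℤ.pos-+ 1 (length xs))))) (λ j → alg-e (β s j) (sumL (λ s → β s j) xs))
      sum-β : ∀ j → sumL (λ s → β s j) js ≡ e j
      sum-β = coord-unique independent (sum-coord js) E' sum-js (cong (K *_) (trans (cong ℤ.+_ len-js) (ℤ.pos-+ 1 t)))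
      -- Since t < k ≤ N, the set D misses some index, and there the coordinate of Z is that of X.
      outside : ∃ λ j → D j ≡ 0ℤ
      outside = go (all-or-some (λ j → 1ℤ - D j))
        where
        go : _ → ∃ λ j → D j ≡ 0ℤ
        go (inj₂ (j , ne)) with D01 j
        ... | inj₁ z = j , z
        ... | inj₂ o = ⊥-elim (ne (cong (λ z → 1ℤ - z) o))
        go (inj₁ z) = ⊥-elim (ℕ.<⇒≢ (ℕ.<-≤-trans t<k (ℕ.m≤m+n k k)) (ℤ.+-injective (trans (sym ∑D) (trans (∑-cong (λ j → sym (ℤ.i-j≡0⇒i≡j 1ℤ (D j) (z j)))) (trans (∑-one N) (cong ℤ.+_ N≡2k))))))
      j₁ = proj₁ outside
      e₁ : e j₁ ≡ res X j₁
      e₁ = trans (cong (λ z → 1ℤ * res X j₁ + 1ℤ * (M * (K * z))) (proj₂ outside)) (alg (res X j₁) M K)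
        where
        alg : ∀ r M K → 1ℤ * r + 1ℤ * (M * (K * 0ℤ)) ≡ r
        alg = solve-∀
      -- If all summands were integral, the coordinate of X at `j₁` would be a multiple of m.
      some-box : ∃ λ s → s ∈ js × InBox (β s)
      some-box = go (all-or-any β-cases js)
        where
        go : _ → ∃ λ s → s ∈ js × InBox (β s)
        go (inj₂ p) = p
        go (inj₁ h) = ⊥-elim (let (q , eq) = sumL-multiple (λ s → β s j₁) M js (λ p → h p j₁) in
          pos≢0 (proj₁ (inBox X j₁)) (small-multiple M q (res X j₁) (ℤ.<⇒≤ (proj₁ (inBox X j₁))) (proj₂ (inBox X j₁)) (trans (sym e₁) (trans (sym (sum-β j₁)) eq))))
      s₀ = proj₁ some-box
      s₀∈ = proj₁ (proj₂ some-box)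
      box₀ = proj₂ (proj₂ some-box)
      rest = remove s₀∈
      split₀ : ∀ j → β s₀ j + sumL (λ s → β s j) rest ≡ e j
      split₀ j = trans (sym (sumL-remove (λ s → β s j) s₀∈)) (sum-β j)
      -- A second interior summand would produce k carries, all of them inside D.
      no-second : ∀ {s} → s ∈ rest → InBox (β s) → ⊥
      no-second {s₁} s₁∈ box₁ = go (all-or-some ρ)
        where
        C = coord-linear 1ℤ 1ℤ (βc s₀) (βc s₁)
        c : Fin N → ℤ
        c j = 1ℤ * β s₀ j + 1ℤ * β s₁ j
        ρ = resid m-pos C
        κ = quots m-pos C
        rest₁≥0 : ∀ j → 0ℤ ≤ sumL (λ s → β s j) (remove s₁∈)
        rest₁≥0 j = sumL-nonneg (λ s → β s j) (remove s₁∈) (λ s → β≥0 s j)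
        c≤e : ∀ j → c j ≤ e j
        c≤e j = subst₂ _≤_ (trans (ℤ.+-identityʳ (β s₀ j + β s₁ j)) (sym (alg-e (β s₀ j) (β s₁ j)))) (trans (ℤ.+-assoc (β s₀ j) (β s₁ j) _) (trans (cong (β s₀ j +_) (sym (sumL-remove (λ s → β s j) s₁∈))) (split₀ j)))
          (ℤ.+-monoʳ-≤ (β s₀ j + β s₁ j) (rest₁≥0 j))
        c<2M : ∀ j → c j < M + M
        c<2M j = subst (_< M + M) (sym (alg-e (β s₀ j) (β s₁ j))) (ℤ.+-mono-< (proj₂ (box₀ j)) (proj₂ (box₁ j)))
        0<c : ∀ j → 0ℤ < c j
        0<c j = subst (0ℤ <_) (sym (alg-e (β s₀ j) (β s₁ j))) (ℤ.+-mono-< (proj₁ (box₀ j)) (proj₁ (box₁ j)))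
        c<M : ∀ j → D j ≡ 0ℤ → c j < M
        c<M j z = ℤ.≤-<-trans (c≤e j) (subst (_< M) (sym (trans (cong (λ y → 1ℤ * res X j + 1ℤ * (M * (K * y))) z) (alg (res X j) M K))) (proj₂ (inBox X j)))
          where
          alg : ∀ r M K → 1ℤ * r + 1ℤ * (M * (K * 0ℤ)) ≡ r
          alg = solve-∀
        κM≤c : ∀ j → κ j * M ≤ c j
        κM≤c j = subst₂ _≤_ (ℤ.+-identityˡ (κ j * M)) (sym (resid≡ m-pos C j)) (ℤ.+-monoˡ-≤ (κ j * M) (0≤resid m-pos C j))
        κ≤D : ∀ j → κ j ≤ D j
        κ≤D j = by (D01 j)
          where
          alg : ∀ q M → q * M + - M ≡ (q - 1ℤ) * M
          alg = solve-∀
          alg2 : ∀ M → M + M + - M ≡ M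
          alg2 = solve-∀
          by : D j ≡ 0ℤ ⊎ D j ≡ 1ℤ → κ j ≤ D j
          by (inj₁ z) = subst (κ j ≤_) (sym z) (multiple-<1 M (κ j) m-pos (ℤ.≤-<-trans (κM≤c j) (c<M j z)))
          by (inj₂ o) = subst (κ j ≤_) (sym o) (ℤ.i-j≤0⇒i≤j (multiple-<1 M (κ j - 1ℤ) m-pos
                (subst₂ _<_ (alg (κ j) M) (alg2 M) (ℤ.+-monoˡ-< (- M) (ℤ.≤-<-trans (κM≤c j) (c<2M j))))))
        go : (∀ j → ρ j ≡ 0ℤ) ⊎ (∃ λ j → ρ j ≢ 0ℤ) → ⊥
        go (inj₁ z) = pos≢0 (0<c j₁) (small-multiple M (κ j₁) (c j₁) (ℤ.<⇒≤ (0<c j₁)) (c<M j₁ (proj₂ outside)) (trans (resid≡ m-pos C j₁) (trans (cong (λ y → y + κ j₁ * M) (z j₁)) (ℤ.+-identityˡ (κ j₁ * M)))))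
        go (inj₂ (j , ne)) = ℕ.<⇒≱ t<k (ℤ.drop‿+≤+ (subst₂ _≤_ ∑κ≡K ∑D (∑-mono κ≤D)))
          where
          full = reduced (resid-point m-pos C) (resid-height m-pos C) ρ (resid-coord m-pos C) (0≤resid m-pos C) (resid<D m-pos C) j ne
          alg : ∀ K q → q ≡ K + K - (1ℤ * (1ℤ * K + 1ℤ * K) + - 1ℤ * q)
          alg = solve-∀
          alg2 : ∀ K → K + K - K ≡ K
          alg2 = solve-∀
          ∑κ≡K : ∑ κ ≡ K
          ∑κ≡K = trans (alg K (∑ κ)) (trans (cong (λ z → K + K - z) (proj₁ full)) (alg2 K))
      rest-multiple : ∀ {s} → s ∈ rest → Multiple (β s)
      rest-multiple {s} p = by (β-cases s)
        where
        by : Multiple (β s) ⊎ InBox (β s) → Multiple (β s)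
        by (inj₁ mul) = mul
        by (inj₂ box) = ⊥-elim (no-second p box)
      β₀≡ : ∀ j → β s₀ j ≡ res X j
      β₀≡ j = let (q , eq) = sumL-multiple (λ s → β s j) M rest (λ p → rest-multiple p j) in
        same-residue M (β s₀ j) (res X j) (K * D j - q) (ℤ.<⇒≤ (proj₁ (box₀ j))) (proj₂ (box₀ j)) (ℤ.<⇒≤ (proj₁ (inBox X j))) (proj₂ (inBox X j))
          (alg (β s₀ j) (res X j) M (K * D j) q (trans (cong (λ z → β s₀ j + z) (sym eq)) (split₀ j)))
        where
        alg : ∀ b r M x q → b + q * M ≡ 1ℤ * r + 1ℤ * (M * x) → b - r ≡ (x - q) * M
        alg b r M x q h = trans (alg1 b r (q * M)) (trans (cong (λ z → z - q * M - r) h) (alg2 r M x q))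
          where
          alg1 : ∀ b r y → b - r ≡ b + y - y - r
          alg1 = solve-∀
          alg2 : ∀ r M x q → 1ℤ * r + 1ℤ * (M * x) - q * M - r ≡ (x - q) * M
          alg2 = solve-∀
      apex≡ : lookup σ s₀ ≡ pt X
      apex≡ = lookup-ext (coord-injective m-pos (βc s₀) (isCoord X) β₀≡)
      rest-sum : ∀ l → sumL (λ s → entries σ s l) rest ≡ comb {v = v} {M} (λ j → K * D j) l
      rest-sum l = alg (lookup (pt X) l) (sumL (λ s → entries σ s l) rest) (comb {v = v} {M} (λ j → K * D j) l)
        (trans (cong (λ z → lookup z l + sumL (λ s → entries σ s l) rest) (sym apex≡)) (trans (sym (sumL-remove (λ s → entries σ s l) s₀∈)) (sum-js l)))
        where
        alg : ∀ x r c → x + r ≡ 1ℤ * x + 1ℤ * c → r ≡ c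
        alg x r c h = trans (alg1 x r) (trans (cong (λ z → z - x) h) (alg2 x c))
          where
          alg1 : ∀ x r → r ≡ x + r - x
          alg1 = solve-∀
          alg2 : ∀ x c → 1ℤ * x + 1ℤ * c - x ≡ c
          alg2 = solve-∀
      rest-integral : ∀ {s} → s ∈ rest → ∀ Y → lookup σ s ≢ pt Y
      rest-integral {s} s∈ Y eq = box⇒¬multiple (inBox Y) λ j → proj₁ (rest-multiple s∈ j) , trans (same j) (proj₂ (rest-multiple s∈ j))
        where
        same : ∀ j → res Y j ≡ β s j
        same = coord-unique independent (isCoord Y) (βc s) (λ l → cong (λ z → lookup z l) (sym eq)) refl

      rest-length : length rest ≡ t
      rest-length = ℕ.suc-injective (trans (sym (length-remove s₀∈)) len-js)

      joinData : JoinData X D t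
      joinData = record
        { σ = σ ; σ∈T = σ∈T ; apex = s₀ ; apex≡ = apex≡ ; rest = rest
        ; rest-length = rest-length ; rest-sum = rest-sum ; rest-integral = rest-integral }

    join : ∀ X D t → Indicator D → ∑ D ≡ ℤ.+ t → t ℕ.< k → JoinData X D t
    join = Proof.joinData

  -- Inequalities between rational sums

  ℚ-ring : AlmostCommutativeRing 0ℓ 0ℓ
  ℚ-ring = fromCommutativeRing ℚ.+-*-commutativeRing (λ _ → nothing)

  sumOf-++ : ∀ {A : Set} (f : A → ℚ) xs ys → sumOf f (xs ++ ys) ≡ sumOf f xs ℚ.+ sumOf f ys
  sumOf-++ f [] ys = sym (ℚ.+-identityˡ (sumOf f ys))
  sumOf-++ f (x ∷ xs) ys = trans (cong (λ z → f x ℚ.+ z) (sumOf-++ f xs ys)) (sym (ℚ.+-assoc (f x) (sumOf f xs) (sumOf f ys)))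

  sumOf-map : ∀ {A B : Set} (f : B → ℚ) (g : A → B) xs → sumOf f (List.map g xs) ≡ sumOf (λ x → f (g x)) xs
  sumOf-map f g [] = refl
  sumOf-map f g (x ∷ xs) = cong (λ z → f (g x) ℚ.+ z) (sumOf-map f g xs)

  sumOf-replicate : ∀ {A : Set} (f : A → ℚ) n x → sumOf f (List.replicate n x) ≡ toQ (ℤ.+ n) ℚ.* f x
  sumOf-replicate f zero x = sym (ℚ.*-zeroˡ (f x))
  sumOf-replicate f (suc n) x = begin
    f x ℚ.+ sumOf f (List.replicate n x) ≡⟨ cong₂ ℚ._+_ (sym (ℚ.*-identityˡ (f x))) (sumOf-replicate f n x) ⟩
    1ℚ ℚ.* f x ℚ.+ toQ (ℤ.+ n) ℚ.* f x ≡⟨ sym (ℚ.*-distribʳ-+ (f x) 1ℚ (toQ (ℤ.+ n))) ⟩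
    (1ℚ ℚ.+ toQ (ℤ.+ n)) ℚ.* f x ≡⟨ cong (λ z → z ℚ.* f x) (trans (sym (toQ-+ 1ℤ (ℤ.+ n))) (cong toQ (sym (ℤ.pos-+ 1 n)))) ⟩
    toQ (ℤ.+ suc n) ℚ.* f x ∎
    where open ≡-Reasoning

  sumOf-cong : ∀ {A : Set} {f g : A → ℚ} xs → (∀ {x} → x ∈ xs → f x ≡ g x) → sumOf f xs ≡ sumOf g xs
  sumOf-cong [] h = refl
  sumOf-cong (x ∷ xs) h = cong₂ ℚ._+_ (h (here refl)) (sumOf-cong xs (λ p → h (there p)))

  sumOf-mono : ∀ {A : Set} {f g : A → ℚ} xs → (∀ {x} → x ∈ xs → f x ℚ.≤ g x) → sumOf f xs ℚ.≤ sumOf g xs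
  sumOf-mono [] h = ℚ.≤-refl
  sumOf-mono (x ∷ xs) h = ℚ.+-mono-≤ (h (here refl)) (sumOf-mono xs (λ p → h (there p)))

  sumOf-strict : ∀ {A : Set} {f g : A → ℚ} {y xs} → y ∈ xs → f y ℚ.< g y → (∀ {x} → x ∈ xs → f x ℚ.≤ g x) → sumOf f xs ℚ.< sumOf g xs
  sumOf-strict {xs = x ∷ xs} (here refl) lt h = ℚ.+-mono-<-≤ lt (sumOf-mono xs (λ p → h (there p)))
  sumOf-strict {xs = x ∷ xs} (there p) lt h = ℚ.+-mono-≤-< (h (here refl)) (sumOf-strict p lt (λ p → h (there p)))

  +-cancelʳ-<ℚ : ∀ a b c → a ℚ.+ c ℚ.< b ℚ.+ c → a ℚ.< b
  +-cancelʳ-<ℚ a b c h = subst₂ ℚ._<_ (alg a c) (alg b c) (ℚ.+-monoˡ-< (ℚ.- c) h)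
    where
    alg : ∀ a c → (a ℚ.+ c) ℚ.+ ℚ.- c ≡ a
    alg a c = trans (ℚ.+-assoc a c (ℚ.- c)) (trans (cong (λ z → a ℚ.+ z) (ℚ.+-inverseʳ c)) (ℚ.+-identityʳ a))

  -- The sums `s` and `s'` stand on opposite sides of the two inequalities and cancel on addition.
  cross-sum : ∀ a b a' b' c c' s s' → c ℚ.+ s ℚ.< a ℚ.+ (b ℚ.+ s') → c' ℚ.+ s' ℚ.< a' ℚ.+ (b' ℚ.+ s) → c ℚ.+ c' ℚ.< (a ℚ.+ a') ℚ.+ (b ℚ.+ b')
  cross-sum a b a' b' c c' s s' h h' = +-cancelʳ-<ℚ (c ℚ.+ c') ((a ℚ.+ a') ℚ.+ (b ℚ.+ b')) (s ℚ.+ s') (subst₂ ℚ._<_ (alg1 c s c' s') (alg2 a b s' a' b' s) (ℚ.+-mono-< h h'))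
    where
    alg1 : ∀ c s c' s' → (c ℚ.+ s) ℚ.+ (c' ℚ.+ s') ≡ (c ℚ.+ c') ℚ.+ (s ℚ.+ s')
    alg1 = RS.solve-∀ ℚ-ring
    alg2 : ∀ a b s' a' b' s → (a ℚ.+ (b ℚ.+ s')) ℚ.+ (a' ℚ.+ (b' ℚ.+ s)) ≡ ((a ℚ.+ a') ℚ.+ (b ℚ.+ b')) ℚ.+ (s ℚ.+ s')
    alg2 = RS.solve-∀ ℚ-ring

  isOne : ℤ → ℤ
  isOne (ℤ.+ 1) = 1ℤ
  isOne _ = 0ℤ

  isOne-01 : ∀ z → isOne z ≡ 0ℤ ⊎ isOne z ≡ 1ℤ
  isOne-01 (ℤ.+ 0) = inj₁ refl
  isOne-01 (ℤ.+ 1) = inj₂ refl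
  isOne-01 (ℤ.+ suc (suc n)) = inj₁ refl
  isOne-01 (ℤ.-[1+ n ]) = inj₁ refl

  parts : ∀ z → - (1ℤ + 1ℤ) < z → z < 1ℤ + 1ℤ → z ≡ isOne z - isOne (- z) × isOne z + isOne (- z) ≤ 1ℤ
  parts (ℤ.+ 0) _ _ = refl , ℤ.+≤+ ℕ.z≤n
  parts (ℤ.+ 1) _ _ = refl , ℤ.≤-refl
  parts (ℤ.+ suc (suc n)) _ (ℤ.+<+ (ℕ.s≤s (ℕ.s≤s ())))
  parts (ℤ.-[1+ 0 ]) _ _ = refl , ℤ.≤-refl
  parts (ℤ.-[1+ suc n ]) (ℤ.-<- (ℕ.s≤s ())) _

  -- Strict convexity of the symmetrized heights

  module Convexity {d : ℕ} (k m : ℕ) (N≡2k : suc d ≡ k ℕ.+ k) (1≤k : 1 ℕ.≤ k)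
    (P : Vec (ZPt d) (suc d)) (cyc : CyclicLattice (ℤ.+ k) (ℤ.+ m) (entries P))
    (T : List (Vec (ZPt d) (suc d))) (tri : IsUnimodTriangulation (dilate k P) T) (reg : IsRegular (dilate k P) T) where

    open CyclicLattice cyc
    open Classes k m N≡2k 1≤k P cyc
    open Join k m N≡2k 1≤k P cyc T tri

    private
      N = suc d
      v = entries P
      K = ℤ.+ k
      M = ℤ.+ m

    ω : ZPt d → ℚ
    ω = proj₁ reg

    f : Interior → ℚ
    f X = ω (pt X)

    restSum : ∀ {X D t} → JoinData X D t → ℚ
    restSum J = sumOf (λ s → ω (lookup (JoinData.σ J) s)) (JoinData.rest J)

    module _ {X₀ X₁ X₂ Y : Interior} {D D' : Fin N → ℤ} {t : ℕ}
      (rel : ∀ j → res X₀ j + res X₂ j + M * D' j ≡ res X₁ j + res X₁ j + M * D j)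
      (ne : pt X₀ ≢ pt X₁) (J : JoinData X₁ D t) (J' : JoinData Y D' t) where

      private
        open JoinData J
        open JoinData J' using () renaming (σ to σ'; σ∈T to σ'∈T; rest to rest'; rest-length to rest'-length; rest-sum to rest'-sum)

        a = proj₁ (proj₂ reg σ∈T)
        b = proj₁ (proj₂ (proj₂ reg σ∈T))
        on-cell : ∀ s → affine a b (lookup σ s) ≡ ω (lookup σ s)
        on-cell = proj₁ (proj₂ (proj₂ (proj₂ reg σ∈T)))
        off-cell : ∀ x → LatticeIn (dilate k P) x → ¬ (∃ λ s → lookup σ s ≡ x) → affine a b x ℚ.< ω x
        off-cell = proj₂ (proj₂ (proj₂ (proj₂ reg σ∈T)))

        tail' : List (ZPt d)
        tail' = List.map (lookup σ') rest'

        -- The relation `rel` is used k times, because the integral vertices supplied by `JoinData`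
        -- add up to k Σ_D s_j and not to Σ_D s_j.
        ys : List (ZPt d)
        ys = List.replicate k (pt X₀) ++ (List.replicate k (pt X₂) ++ tail')

        is : List (Fin (suc d))
        is = List.replicate (k ℕ.+ k) apex ++ rest

        len-ys : length ys ≡ (k ℕ.+ k) ℕ.+ t
        len-ys = trans (List.length-++ (List.replicate k (pt X₀))) (trans (cong₂ ℕ._+_ (List.length-replicate k) (trans (List.length-++ (List.replicate k (pt X₂)))
          (cong₂ ℕ._+_ (List.length-replicate k) (trans (List.length-map (lookup σ') rest') rest'-length)))) (sym (ℕ.+-assoc k k t)))

        len-is : length is ≡ (k ℕ.+ k) ℕ.+ t
        len-is = trans (List.length-++ (List.replicate (k ℕ.+ k) apex)) (cong₂ ℕ._+_ (List.length-replicate (k ℕ.+ k)) rest-length)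

        PA PB : Fin d → ℤ
        PA l = 1ℤ * (K * lookup (pt X₀) l + K * lookup (pt X₂) l) + 1ℤ * comb {v = v} {M} (λ j → K * D' j) l
        PB l = 1ℤ * (K * lookup (pt X₁) l + K * lookup (pt X₁) l) + 1ℤ * comb {v = v} {M} (λ j → K * D j) l

        sum-ys : ∀ l → sumPts ys l ≡ PA l
        sum-ys l = trans (sumPts≡ ys l) (trans (sumL-++ (λ x → lookup x l) (List.replicate k (pt X₀)) _) (trans (cong₂ _+_ (sumL-replicate (λ x → lookup x l) k (pt X₀))
          (trans (sumL-++ (λ x → lookup x l) (List.replicate k (pt X₂)) tail') (cong₂ _+_ (sumL-replicate (λ x → lookup x l) k (pt X₂)) (trans (sumL-map (λ x → lookup x l) (lookup σ') rest') (rest'-sum l)))))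
          (alg (K * lookup (pt X₀) l) (K * lookup (pt X₂) l) (comb {v = v} {M} (λ j → K * D' j) l))))
          where
          alg : ∀ a b c → a + (b + c) ≡ 1ℤ * (a + b) + 1ℤ * c
          alg = solve-∀

        sum-is : ∀ l → sumL (λ s → entries σ s l) is ≡ PB l
        sum-is l = trans (sumL-++ (λ s → entries σ s l) (List.replicate (k ℕ.+ k) apex) rest) (trans (cong₂ _+_
           (trans (sumL-replicate (λ s → entries σ s l) (k ℕ.+ k) apex) (cong₂ (λ x y → x * lookup y l) (ℤ.pos-+ k k) apex≡)) (rest-sum l))
           (alg K (lookup (pt X₁) l) (comb {v = v} {M} (λ j → K * D j) l)))
          where
          alg : ∀ K x c → (K + K) * x + c ≡ 1ℤ * (K * x + K * x) + 1ℤ * c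
          alg = solve-∀

        PA≡PB : ∀ l → PA l ≡ PB l
        PA≡PB = coord-injective m-pos (coord-linear 1ℤ 1ℤ (coord-linear K K (isCoord X₀) (isCoord X₂)) (coord-comb (λ j → K * D' j)))
            (coord-linear 1ℤ 1ℤ (coord-linear K K (isCoord X₁) (isCoord X₁)) (coord-comb (λ j → K * D j)))
            (λ j → trans (alg K (res X₀ j) (res X₂ j) M (D' j)) (trans (cong (K *_) (rel j)) (sym (alg K (res X₁ j) (res X₁ j) M (D j)))))
          where
          alg : ∀ K a b M x → 1ℤ * (K * a + K * b) + 1ℤ * (M * (K * x)) ≡ K * (a + b + M * x)
          alg = solve-∀

        zs : List (ZPt d)
        zs = List.map (lookup σ) is

        in-cell? : ∀ x → (∃ λ s → lookup σ s ≡ x) ⊎ ¬ (∃ λ s → lookup σ s ≡ x)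
        in-cell? x = by (Fin.any? (λ s → lookup σ s ≟ᵖ x))
          where
          by : Dec (∃ λ s → lookup σ s ≡ x) → (∃ λ s → lookup σ s ≡ x) ⊎ ¬ (∃ λ s → lookup σ s ≡ x)
          by (yes p) = inj₁ p
          by (no p) = inj₂ p

        replicate-∈ : ∀ {A : Set} {x y : A} n → y ∈ List.replicate n x → y ≡ x
        replicate-∈ (suc n) (here e) = e
        replicate-∈ (suc n) (there p) = replicate-∈ n p

        ys-lattice : ∀ {y} → y ∈ ys → LatticeIn (dilate k P) y
        ys-lattice {y} p = by₁ (∈-++⁻ (List.replicate k (pt X₀)) p)
          where
          by₃ : ∃ (λ s → s ∈ rest' × y ≡ lookup σ' s) → LatticeIn (dilate k P) y
          by₃ (s , _ , e) = subst (LatticeIn (dilate k P)) (sym e) (vertex-lattice σ'∈T s)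
          by₂ : y ∈ List.replicate k (pt X₂) ⊎ y ∈ tail' → LatticeIn (dilate k P) y
          by₂ (inj₁ q) = subst (LatticeIn (dilate k P)) (sym (replicate-∈ k q)) (interior⇒lattice X₂)
          by₂ (inj₂ q) = by₃ (∈-map⁻ (lookup σ') q)
          by₁ : y ∈ List.replicate k (pt X₀) ⊎ y ∈ List.replicate k (pt X₂) ++ tail' → LatticeIn (dilate k P) y
          by₁ (inj₁ q) = subst (LatticeIn (dilate k P)) (sym (replicate-∈ k q)) (interior⇒lattice X₀)
          by₁ (inj₂ q) = by₂ (∈-++⁻ (List.replicate k (pt X₂)) q)

        supports : ∀ {y} → y ∈ ys → affine a b y ℚ.≤ ω y
        supports {y} p = by (in-cell? y)
          where
          by : (∃ λ s → lookup σ s ≡ y) ⊎ ¬ (∃ λ s → lookup σ s ≡ y) → affine a b y ℚ.≤ ω y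
          by (inj₁ (s , e)) = ℚ.≤-reflexive (subst (λ z → affine a b z ≡ ω z) e (on-cell s))
          by (inj₂ n) = ℚ.<⇒≤ (off-cell y (ys-lattice p) n)

        indices : ∀ xs → (∀ {x} → x ∈ xs → ∃ λ s → lookup σ s ≡ x) → ∃ λ js → List.map (lookup σ) js ≡ xs
        indices [] h = [] , refl
        indices (x ∷ xs) h = let (s , e) = h (here refl) ; (js , e') = indices xs (λ p → h (there p)) in s ∷ js , cong₂ List._∷_ e e'

        -- By affine independence `ys` would then be the same multiset of vertices as `is`; but X₀
        -- differs from X₁ and, being in a nontrivial class, from the integral vertices in `rest`.
        not-all-in : (∀ {y} → y ∈ ys → ∃ λ s → lookup σ s ≡ y) → ⊥
        not-all-in h = by (∈-map⁻ (lookup σ) (subst (pt X₀ ∈_) (sym (proj₂ ix)) X₀∈))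
          where
          ix = indices ys h
          js = proj₁ ix
          X₀∈ : pt X₀ ∈ ys
          X₀∈ = ∈-++⁺ˡ (head k 1≤k)
            where
            head : ∀ n → 1 ℕ.≤ n → pt X₀ ∈ List.replicate n (pt X₀)
            head (suc n) _ = here refl
          sums : ∀ l → sumL (λ s → entries σ s l) js ≡ sumL (λ s → entries σ s l) is
          sums l = trans (sym (sumL-map (λ x → lookup x l) (lookup σ) js)) (trans (cong (sumL (λ x → lookup x l)) (proj₂ ix)) (trans (sym (sumPts≡ ys l)) (trans (sum-ys l) (trans (PA≡PB l) (sym (sum-is l))))))
          lens : length js ≡ length is
          lens = trans (sym (List.length-map (lookup σ) js)) (trans (cong length (proj₂ ix)) (trans len-ys (sym len-is)))
          by₂ : ∀ {s} → pt X₀ ≡ lookup σ s → s ∈ List.replicate (k ℕ.+ k) apex ⊎ s ∈ rest → ⊥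
          by₂ e (inj₁ q) = ne (trans e (trans (cong (lookup σ) (replicate-∈ (k ℕ.+ k) q)) apex≡))
          by₂ e (inj₂ q) = rest-integral q X₀ (sym e)
          by : ∃ (λ s → s ∈ js × pt X₀ ≡ lookup σ s) → ⊥
          by (s , s∈ , e) = by₂ e (∈-++⁻ (List.replicate (k ℕ.+ k) apex) (balanced⇒⊆ (entries σ) (cell-independent σ∈T) js is lens sums s∈))

        strict : sumOf (affine a b) ys ℚ.< sumOf ω ys
        strict = by (all-or-any in-cell? ys)
          where
          by : (∀ {y} → y ∈ ys → ∃ λ s → lookup σ s ≡ y) ⊎ (∃ λ y → y ∈ ys × ¬ (∃ λ s → lookup σ s ≡ y)) → sumOf (affine a b) ys ℚ.< sumOf ω ys
          by (inj₁ h) = ⊥-elim (not-all-in h)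
          by (inj₂ (y , y∈ , n)) = sumOf-strict y∈ (off-cell y (ys-lattice y∈) n) supports

        sum-zs : sumOf (affine a b) zs ≡ sumOf ω zs
        sum-zs = trans (sumOf-map (affine a b) (lookup σ) is) (trans (sumOf-cong is (λ {s} _ → on-cell s)) (sym (sumOf-map ω (lookup σ) is)))

        balance : sumOf (affine a b) ys ≡ sumOf (affine a b) zs
        balance = affine-balance a b ys zs (trans len-ys (trans (sym len-is) (sym (List.length-map (lookup σ) is))))
          (λ l → trans (sum-ys l) (trans (PA≡PB l) (trans (sym (sum-is l)) (trans (sym (sumL-map (λ x → lookup x l) (lookup σ) is)) (sym (sumPts≡ zs l))))))

        ω-ys : sumOf ω ys ≡ toQ K ℚ.* f X₀ ℚ.+ (toQ K ℚ.* f X₂ ℚ.+ restSum J')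
        ω-ys = trans (sumOf-++ ω (List.replicate k (pt X₀)) (List.replicate k (pt X₂) ++ tail')) (cong₂ ℚ._+_ (sumOf-replicate ω k (pt X₀))
          (trans (sumOf-++ ω (List.replicate k (pt X₂)) tail') (cong₂ ℚ._+_ (sumOf-replicate ω k (pt X₂)) (sumOf-map ω (lookup σ') rest'))))

        ω-zs : sumOf ω zs ≡ toQ (K + K) ℚ.* f X₁ ℚ.+ restSum J
        ω-zs = trans (sumOf-map ω (lookup σ) is) (trans (sumOf-++ (λ s → ω (lookup σ s)) (List.replicate (k ℕ.+ k) apex) rest)
          (cong (λ z → z ℚ.+ restSum J) (trans (sumOf-replicate (λ s → ω (lookup σ s)) (k ℕ.+ k) apex) (cong₂ (λ x y → toQ x ℚ.* ω y) (ℤ.pos-+ k k) apex≡))))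

      -- The lists `ys` and `zs` have the same length and the same vector sum, so the supporting
      -- function of the cell through X₁ has the same sum on both. All of `zs` lies in that cell,
      -- where the function equals ω; on `ys` it is at most ω, and somewhere strictly smaller.
      height-inequality : toQ (K + K) ℚ.* f X₁ ℚ.+ restSum J ℚ.< toQ K ℚ.* f X₀ ℚ.+ (toQ K ℚ.* f X₂ ℚ.+ restSum J')
      height-inequality = subst₂ ℚ._<_ (trans balance (trans sum-zs ω-zs)) ω-ys strict

    F : Interior → ℚ
    F X = f X ℚ.+ f (negate X)

    F-cong : ∀ X Y → (∀ j → res X j ≡ res Y j) → F X ≡ F Y
    F-cong X Y e = cong₂ ℚ._+_ (cong ω (interior-unique X Y e)) (cong ω (interior-unique (negate X) (negate Y) (λ j → cong (λ z → M - z) (e j))))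

    F-negate : ∀ X → F (negate X) ≡ F X
    F-negate X = trans (cong (λ z → f (negate X) ℚ.+ z) (cong ω (interior-unique (negate (negate X)) X (λ j → alg M (res X j))))) (ℚ.+-comm (f (negate X)) (f X))
      where
      alg : ∀ M r → M - (M - r) ≡ r
      alg = solve-∀

    -- The carries of X₀ + X₂ against 2 X₁ sit in D, those of 2 X₁ against X₀ + X₂ in D'; neither
    -- contains i, so both have fewer than k elements, and the two inequalities for
    -- X and -X have the same integral summands.
    module _ (i : Fin N) (X₀ X₁ X₂ : Interior) (e₁ : res X₁ i ≡ res X₀ i + 1ℤ) (e₂ : res X₂ i ≡ res X₀ i + (1ℤ + 1ℤ)) where

      private
        c : Fin N → ℤ
        c j = 1ℤ * (1ℤ * res X₀ j + 1ℤ * res X₂ j) + - (1ℤ + 1ℤ) * res X₁ j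
        C : IsCoord v M _ (1ℤ * (1ℤ * K + 1ℤ * K) + - (1ℤ + 1ℤ) * K) c
        C = coord-linear 1ℤ (- (1ℤ + 1ℤ)) (coord-linear 1ℤ 1ℤ (isCoord X₀) (isCoord X₂)) (isCoord X₁)
        cᵢ : c i ≡ 0ℤ
        cᵢ = trans (cong₂ (λ y z → 1ℤ * (1ℤ * res X₀ i + 1ℤ * z) + - (1ℤ + 1ℤ) * y) e₁ e₂) (alg (res X₀ i))
          where
          alg : ∀ r → 1ℤ * (1ℤ * r + 1ℤ * (r + (1ℤ + 1ℤ))) + - (1ℤ + 1ℤ) * (r + 1ℤ) ≡ 0ℤ
          alg = solve-∀
        mul : Multiple c
        mul = by (resid-cases C)
          where
          alg3 : ∀ r q M → r ≡ (r + q * M) + - q * M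
          alg3 = solve-∀
          by : _ → Multiple c
          by (inj₁ h) = h
          by (inj₂ (Z , h)) = ⊥-elim (pos≢0 (proj₁ (inBox Z i)) (small-multiple M (- proj₁ (h i)) (res Z i) (ℤ.<⇒≤ (proj₁ (inBox Z i))) (proj₂ (inBox Z i))
            (trans (alg3 (res Z i) (proj₁ (h i)) M) (trans (cong (λ z → z + - proj₁ (h i) * M) (trans (sym (proj₂ (h i))) cᵢ)) (ℤ.+-identityˡ (- proj₁ (h i) * M))))))
        q : Fin N → ℤ
        q j = proj₁ (mul j)
        c≡ : ∀ j → c j ≡ q j * M
        c≡ j = proj₂ (mul j)
        alg-c : ∀ a b r → 1ℤ * (1ℤ * a + 1ℤ * b) + - (1ℤ + 1ℤ) * r ≡ a + b - (r + r)
        alg-c = solve-∀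
        cancel : ∀ a b → a * M < b * M → a < b
        cancel a b = ℤ.*-cancelʳ-<-nonNeg {a} {b} M
        2M : ∀ M → M + M ≡ (1ℤ + 1ℤ) * M
        2M = solve-∀
        -2M : ∀ M → - (M + M) ≡ - (1ℤ + 1ℤ) * M
        -2M = solve-∀
        R : Interior → Fin N → ℤ
        R = res
        c<2M : ∀ j → c j < M + M
        c<2M j = subst (_< M + M) (sym (alg-c (res X₀ j) (res X₂ j) (res X₁ j))) (ℤ.<-trans (subst (res X₀ j + res X₂ j - (res X₁ j + res X₁ j) <_) (ℤ.+-identityʳ (res X₀ j + res X₂ j))
          (ℤ.+-monoʳ-< (res X₀ j + res X₂ j) (ℤ.neg-mono-< (ℤ.+-mono-< (proj₁ (inBox X₁ j)) (proj₁ (inBox X₁ j)))))) (ℤ.+-mono-< (proj₂ (inBox X₀ j)) (proj₂ (inBox X₂ j))))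
        -2M<c : ∀ j → - (M + M) < c j
        -2M<c j = subst (- (M + M) <_) (sym (alg-c (res X₀ j) (res X₂ j) (res X₁ j))) (ℤ.<-trans (ℤ.neg-mono-< (ℤ.+-mono-< (proj₂ (inBox X₁ j)) (proj₂ (inBox X₁ j))))
          (subst (_< res X₀ j + res X₂ j - (res X₁ j + res X₁ j)) (ℤ.+-identityˡ (- (res X₁ j + res X₁ j))) (ℤ.+-monoˡ-< (- (res X₁ j + res X₁ j)) (ℤ.+-mono-< (proj₁ (inBox X₀ j)) (proj₁ (inBox X₂ j))))))
        q<2 : ∀ j → q j < 1ℤ + 1ℤ
        q<2 j = cancel (q j) (1ℤ + 1ℤ) (subst₂ _<_ (c≡ j) (2M M) (c<2M j))
        -2<q : ∀ j → - (1ℤ + 1ℤ) < q j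
        -2<q j = cancel (- (1ℤ + 1ℤ)) (q j) (subst₂ _<_ (-2M M) (c≡ j) (-2M<c j))
        D D' : Fin N → ℤ
        D j = isOne (q j)
        D' j = isOne (- q j)
        q≡ : ∀ j → q j ≡ D j - D' j
        q≡ j = proj₁ (parts (q j) (-2<q j) (q<2 j))
        D+D'≤1 : ∀ j → D j + D' j ≤ 1ℤ
        D+D'≤1 j = proj₂ (parts (q j) (-2<q j) (q<2 j))
        D≥0 : ∀ z → 0ℤ ≤ isOne z
        D≥0 z = by (isOne-01 z)
          where
          by : isOne z ≡ 0ℤ ⊎ isOne z ≡ 1ℤ → 0ℤ ≤ isOne z
          by (inj₁ e) = ℤ.≤-reflexive (sym e)
          by (inj₂ e) = subst (0ℤ ≤_) (sym e) (ℤ.+≤+ ℕ.z≤n)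
        ∑q≡0 : ∑ q ≡ 0ℤ
        ∑q≡0 = *-cancel-zero (∑ q) M (pos≢0 m-pos) (trans (∑-* M q) (trans (∑-cong (λ j → sym (c≡ j))) (trans (total C) (alg M K))))
          where
          alg : ∀ M K → M * (1ℤ * (1ℤ * K + 1ℤ * K) + - (1ℤ + 1ℤ) * K) ≡ 0ℤ
          alg = solve-∀
        ∑D≡∑D' : ∑ D ≡ ∑ D'
        ∑D≡∑D' = ℤ.i-j≡0⇒i≡j (∑ D) (∑ D') (trans (sym (∑-sub D D')) (trans (∑-cong (λ j → sym (q≡ j))) ∑q≡0))
        qᵢ≡0 : q i ≡ 0ℤ
        qᵢ≡0 = *-cancel-zero (q i) M (pos≢0 m-pos) (trans (sym (c≡ i)) cᵢ)
        t-data : ∃ λ t → ∑ D ≡ ℤ.+ t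
        t-data = pos-or-zero (∑-nonneg (λ j → D≥0 (q j)))
        t = proj₁ t-data
        ∑D = proj₂ t-data
        -- The terms 1 - D j - D' j are nonnegative with sum 2k - 2 |D|, and the term at i is 1.
        bound : 1ℤ ≤ (K + K) - (∑ D + ∑ D)
        bound = subst₂ _≤_ (cong (λ z → 1ℤ - (isOne z + isOne (- z))) qᵢ≡0)
          (trans (∑-sub (λ _ → 1ℤ) (λ j → D j + D' j)) (cong₂ _-_ (trans (∑-one N) N≡K+K) (trans (∑-+ D D') (cong (λ z → ∑ D + z) (sym ∑D≡∑D')))))
          (term≤∑ (λ j → ℤ.i≤j⇒0≤j-i (D+D'≤1 j)) i)
        t<k : t ℕ.< k
        t<k = ℕ.≰⇒> λ k≤t → ℤ.<⇒≱ (ℤ.<-≤-trans 0<1 bound) (ℤ.i≤j⇒i-j≤0 (ℤ.+-mono-≤ (subst (K ≤_) (sym ∑D) (ℤ.+≤+ k≤t)) (subst (K ≤_) (sym ∑D) (ℤ.+≤+ k≤t))))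
        J : JoinData X₁ D t
        J = join X₁ D t (λ j → isOne-01 (q j)) ∑D t<k
        J' : JoinData (negate X₁) D' t
        J' = join (negate X₁) D' t (λ j → isOne-01 (- q j)) (trans (sym ∑D≡∑D') ∑D) t<k
        rel₀ : ∀ j → res X₀ j + res X₂ j - (res X₁ j + res X₁ j) ≡ (D j - D' j) * M
        rel₀ j = trans (sym (alg-c (res X₀ j) (res X₂ j) (res X₁ j))) (trans (c≡ j) (cong (_* M) (q≡ j)))
        rel : ∀ j → res X₀ j + res X₂ j + M * D' j ≡ res X₁ j + res X₁ j + M * D j
        rel j = alg (res X₀ j + res X₂ j) (res X₁ j + res X₁ j) M (D j) (D' j) (rel₀ j)
          where
          alg : ∀ a b M x y → a - b ≡ (x - y) * M → a + M * y ≡ b + M * x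
          alg a b M x y h = trans (alg1 a b M y) (trans (cong (λ z → z + b + M * y) h) (alg2 b M x y))
            where
            alg1 : ∀ a b M y → a + M * y ≡ a - b + b + M * y
            alg1 = solve-∀
            alg2 : ∀ b M x y → (x - y) * M + b + M * y ≡ b + M * x
            alg2 = solve-∀
        rel' : ∀ j → (M - res X₀ j) + (M - res X₂ j) + M * D j ≡ (M - res X₁ j) + (M - res X₁ j) + M * D' j
        rel' j = trans (alg1 M (res X₀ j) (res X₂ j) (D j) (D' j)) (trans (cong (λ z → M + M + M * D j + M * D' j - z) (rel j)) (alg2 M (res X₁ j) (D j) (D' j)))
          where
          alg1 : ∀ M a b x y → (M - a) + (M - b) + M * x ≡ M + M + M * x + M * y - (a + b + M * y)
          alg1 = solve-∀
          alg2 : ∀ M r x y → M + M + M * x + M * y - (r + r + M * x) ≡ (M - r) + (M - r) + M * y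
          alg2 = solve-∀
        distinct : pt X₀ ≢ pt X₁
        distinct e = one≢zero (trans (alg (res X₀ i)) (trans (cong (λ z → z - res X₀ i) (trans (sym e₁) (sym (coord-unique independent (isCoord X₀) (isCoord X₁) (λ l → cong (λ z → lookup z l) e) refl i)))) (ℤ.+-inverseʳ (res X₀ i))))
          where
          alg : ∀ r → 1ℤ ≡ r + 1ℤ - r
          alg = solve-∀
          one≢zero : 1ℤ ≢ 0ℤ
          one≢zero ()
        distinct' : pt (negate X₀) ≢ pt (negate X₁)
        distinct' e = distinct (interior-unique X₀ X₁ (λ j → alg M (res X₀ j) (res X₁ j) (coord-unique independent (isCoord (negate X₀)) (isCoord (negate X₁)) (λ l → cong (λ z → lookup z l) e) refl j)))
          where
          alg : ∀ M a b → M - a ≡ M - b → a ≡ b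
          alg M a b h = trans (alg1 M a) (trans (cong (λ z → M - z) h) (sym (alg1 M b)))
            where
            alg1 : ∀ M a → a ≡ M - (M - a)
            alg1 = solve-∀

      -- The inequality for X has the integral vertices of `J` on its smaller side and those of `J'`
      -- on its larger side. For -X the roles are exchanged, so both contributions cancel, and the
      -- common factor k can be removed.
      F-convex : F X₁ ℚ.+ F X₁ ℚ.< F X₀ ℚ.+ F X₂
      F-convex = ℚ.*-cancelˡ-<-nonNeg (toQ K) {{ℚ.nonNegative (toQ-mono-≤ {0ℤ} {K} (ℤ.+≤+ ℕ.z≤n))}}
        (subst₂ ℚ._<_ (trans (cong (λ z → z ℚ.* f X₁ ℚ.+ z ℚ.* f (negate X₁)) (toQ-+ K K)) (alg1 (toQ K) (f X₁) (f (negate X₁))))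
          (alg2 (toQ K) (f X₀) (f (negate X₀)) (f X₂) (f (negate X₂)))
          (cross-sum (toQ K ℚ.* f X₀) (toQ K ℚ.* f X₂) (toQ K ℚ.* f (negate X₀)) (toQ K ℚ.* f (negate X₂)) (toQ (K + K) ℚ.* f X₁) (toQ (K + K) ℚ.* f (negate X₁)) (restSum J) (restSum J')
            (height-inequality {X₀} {X₁} {X₂} rel distinct J J') (height-inequality {negate X₀} {negate X₁} {negate X₂} rel' distinct' J' J)))
        where
        alg1 : ∀ K a b → (K ℚ.+ K) ℚ.* a ℚ.+ (K ℚ.+ K) ℚ.* b ≡ K ℚ.* ((a ℚ.+ b) ℚ.+ (a ℚ.+ b))
        alg1 = RS.solve-∀ ℚ-ring
        alg2 : ∀ K a b c e → (K ℚ.* a ℚ.+ K ℚ.* b) ℚ.+ (K ℚ.* c ℚ.+ K ℚ.* e) ≡ K ℚ.* ((a ℚ.+ b) ℚ.+ (c ℚ.+ e))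
        alg2 = RS.solve-∀ ℚ-ring

  double-<ℚ : ∀ x y → x ℚ.+ x ℚ.< y ℚ.+ y → x ℚ.< y
  double-<ℚ x y h = ℚ.≰⇒> (λ y≤x → ℚ.<-irrefl refl (ℚ.<-≤-trans h (ℚ.+-mono-≤ y≤x y≤x)))

  -- Symmetric strictly convex sequences

  module SymmetricConvex (m : ℕ) (G : ℕ → ℚ)
    (convex : ∀ n → 1 ℕ.≤ n → 2 ℕ.+ n ℕ.< m → G (1 ℕ.+ n) ℚ.+ G (1 ℕ.+ n) ℚ.< G n ℚ.+ G (2 ℕ.+ n))
    (symmetric : ∀ n n' → 1 ℕ.≤ n → 1 ℕ.≤ n' → n ℕ.+ n' ≡ m → G n ≡ G n') where

    -- The slopes of a strictly convex sequence increase; the inequalities of consecutive triples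
    -- telescope.
    slopes : ∀ a j → 1 ℕ.≤ a → 2 ℕ.+ (a ℕ.+ j) ℕ.< m → G (1 ℕ.+ a) ℚ.+ G (1 ℕ.+ (a ℕ.+ j)) ℚ.< G a ℚ.+ G (2 ℕ.+ (a ℕ.+ j))
    slopes a zero 1≤a lt = subst (λ z → G (1 ℕ.+ a) ℚ.+ G (1 ℕ.+ z) ℚ.< G a ℚ.+ G (2 ℕ.+ z)) (sym (ℕ.+-identityʳ a)) (convex a 1≤a (subst (λ z → 2 ℕ.+ z ℕ.< m) (ℕ.+-identityʳ a) lt))
    slopes a (suc j) 1≤a lt = subst (λ z → G (1 ℕ.+ a) ℚ.+ G (1 ℕ.+ z) ℚ.< G a ℚ.+ G (2 ℕ.+ z)) (sym (ℕ.+-suc a j))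
      (+-cancelʳ-<ℚ _ _ (G (1 ℕ.+ b) ℚ.+ G (2 ℕ.+ b)) (subst₂ ℚ._<_ (alg1 (G (1 ℕ.+ a)) (G (1 ℕ.+ b)) (G (2 ℕ.+ b))) (alg2 (G a) (G (2 ℕ.+ b)) (G (1 ℕ.+ b)) (G (3 ℕ.+ b)))
        (ℚ.+-mono-< (slopes a j 1≤a (ℕ.<-trans (ℕ.n<1+n _) lt')) (convex (1 ℕ.+ b) (ℕ.s≤s ℕ.z≤n) lt'))))
      where
      b = a ℕ.+ j
      lt' : 3 ℕ.+ b ℕ.< m
      lt' = subst (λ z → 2 ℕ.+ z ℕ.< m) (ℕ.+-suc a j) lt
      alg1 : ∀ p q r → (p ℚ.+ q) ℚ.+ (r ℚ.+ r) ≡ (p ℚ.+ r) ℚ.+ (q ℚ.+ r)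
      alg1 = RS.solve-∀ ℚ-ring
      alg2 : ∀ p r q s → (p ℚ.+ r) ℚ.+ (q ℚ.+ s) ≡ (p ℚ.+ s) ℚ.+ (q ℚ.+ r)
      alg2 = RS.solve-∀ ℚ-ring

    -- Compare the slope at n with the one at the mirror image. For j = m - 2(n + 1) the mirror
    -- images of n + 1 and n are n + 1 + j and n + 2 + j, so by symmetry `slopes` becomes the
    -- doubled inequality.
    step-down : ∀ n → 1 ℕ.≤ n → suc n ℕ.+ suc n ℕ.≤ m → G (suc n) ℚ.< G n
    step-down n 1≤n le = double-<ℚ (G (suc n)) (G n) (subst₂ (λ x y → G (suc n) ℚ.+ x ℚ.< G n ℚ.+ y)
        (sym (symmetric (suc n) (1 ℕ.+ (n ℕ.+ j)) (ℕ.s≤s ℕ.z≤n) (ℕ.s≤s ℕ.z≤n) e1)) (sym (symmetric n (2 ℕ.+ (n ℕ.+ j)) 1≤n (ℕ.s≤s ℕ.z≤n) e2)) (slopes n j 1≤n lt))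
      where
      j = m ℕ.∸ (suc n ℕ.+ suc n)
      e0 : (suc n ℕ.+ suc n) ℕ.+ j ≡ m
      e0 = ℕ.m+[n∸m]≡n le
      e1 : suc n ℕ.+ (1 ℕ.+ (n ℕ.+ j)) ≡ m
      e1 = trans (sym (ℕ.+-assoc (suc n) (suc n) j)) e0
      e2 : n ℕ.+ (2 ℕ.+ (n ℕ.+ j)) ≡ m
      e2 = trans (ℕ.+-suc n (1 ℕ.+ (n ℕ.+ j))) e1
      lt : 2 ℕ.+ (n ℕ.+ j) ℕ.< m
      lt = subst (2 ℕ.+ (n ℕ.+ j) ℕ.<_) e2 (ℕ.+-monoˡ-≤ (2 ℕ.+ (n ℕ.+ j)) 1≤n)

    decreasing : ∀ n j → 1 ℕ.≤ n → (suc n ℕ.+ j) ℕ.+ (suc n ℕ.+ j) ℕ.≤ m → G (suc n ℕ.+ j) ℚ.< G n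
    decreasing n zero 1≤n le = subst (λ z → G z ℚ.< G n) (sym (ℕ.+-identityʳ (suc n))) (step-down n 1≤n (subst (λ z → z ℕ.+ z ℕ.≤ m) (ℕ.+-identityʳ (suc n)) le))
    decreasing n (suc j) 1≤n le = ℚ.<-trans (subst (λ z → G z ℚ.< G (suc n ℕ.+ j)) (sym (ℕ.+-suc (suc n) j)) (step-down (suc n ℕ.+ j) (ℕ.s≤s ℕ.z≤n) le'))
      (decreasing n j 1≤n (ℕ.≤-trans (ℕ.+-mono-≤ (ℕ.n≤1+n (suc n ℕ.+ j)) (ℕ.n≤1+n (suc n ℕ.+ j))) le'))
      where
      le' : suc (suc n ℕ.+ j) ℕ.+ suc (suc n ℕ.+ j) ℕ.≤ m
      le' = subst (λ z → z ℕ.+ z ℕ.≤ m) (ℕ.+-suc (suc n) j) le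

  parity : ∀ n → ∃ λ u → n ≡ u ℕ.+ u ⊎ n ≡ suc (u ℕ.+ u)
  parity zero = 0 , inj₁ refl
  parity (suc n) with parity n
  ... | u , inj₁ e = u , inj₂ (cong suc e)
  ... | u , inj₂ e = suc u , inj₁ (trans (cong suc e) (cong suc (sym (ℕ.+-suc u u))))

  -- A class with all coordinates 1 or -1 modulo m

  module Extremal {d : ℕ} (k m : ℕ) (N≡2k : suc d ≡ k ℕ.+ k) (1≤k : 1 ℕ.≤ k) (2≤m : 2 ℕ.≤ m)
    (P : Vec (ZPt d) (suc d)) (cyc : CyclicLattice (ℤ.+ k) (ℤ.+ m) (entries P))
    (T : List (Vec (ZPt d) (suc d))) (tri : IsUnimodTriangulation (dilate k P) T) (reg : IsRegular (dilate k P) T) where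

    open CyclicLattice cyc
    open Classes k m N≡2k 1≤k P cyc
    open Convexity k m N≡2k 1≤k P cyc T tri reg

    private
      N = suc d
      v = entries P
      K = ℤ.+ k
      M = ℤ.+ m

    resℕ : ∀ X j → ∃ λ r → res X j ≡ ℤ.+ r × 1 ℕ.≤ r × r ℕ.< m
    resℕ X j = by (pos-or-zero (ℤ.<⇒≤ (proj₁ (inBox X j))))
      where
      by : (∃ λ n → res X j ≡ ℤ.+ n) → ∃ λ r → res X j ≡ ℤ.+ r × 1 ℕ.≤ r × r ℕ.< m
      by (n , e) = n , e , ℤ.drop‿+<+ (subst (0ℤ <_) e (proj₁ (inBox X j))) , ℤ.drop‿+<+ (subst (_< M) e (proj₂ (inBox X j)))

    choose : ∀ (i : Fin N) n → 1 ℕ.≤ n → n ℕ.< m → ∃ λ X → res X i ≡ ℤ.+ n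
    choose i n 1≤n n<m = withCoord i (ℤ.+ n) (ℤ.+<+ 1≤n) (ℤ.+<+ n<m)

    G′ : (i : Fin N) (n : ℕ) → Dec (1 ℕ.≤ n) → Dec (n ℕ.< m) → ℚ
    G′ i n (yes p) (yes q) = F (proj₁ (choose i n p q))
    -- A filler: no class has its i-th coordinate outside the range 0 < n < m.
    G′ i n _ _ = 0ℚ

    G : Fin N → ℕ → ℚ
    G i n = G′ i n (1 ℕ.≤? n) (n ℕ.<? m)

    G≡F : ∀ i n X → res X i ≡ ℤ.+ n → G i n ≡ F X
    G≡F i n X e = by (1 ℕ.≤? n) (n ℕ.<? m)
      where
      by : ∀ a b → G′ i n a b ≡ F X
      by (yes p) (yes q) = F-cong (proj₁ (choose i n p q)) X (interior-determined (proj₁ (choose i n p q)) X i (trans (proj₂ (choose i n p q)) (sym e)))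
      by (no ¬p) _ = ⊥-elim (¬p (ℤ.drop‿+<+ (subst (0ℤ <_) e (proj₁ (inBox X i)))))
      by (yes _) (no ¬q) = ⊥-elim (¬q (ℤ.drop‿+<+ (subst (_< M) e (proj₂ (inBox X i)))))

    negate-res : ∀ X i n n' → n ℕ.+ n' ≡ m → res X i ≡ ℤ.+ n → res (negate X) i ≡ ℤ.+ n'
    negate-res X i n n' s e = trans (cong₂ (λ x y → x - y) (trans (cong ℤ.+_ (sym s)) (ℤ.pos-+ n n')) e) (alg (ℤ.+ n) (ℤ.+ n'))
      where
      alg : ∀ a b → a + b - a ≡ b
      alg = solve-∀

    module _ (i : Fin N) where
      G-convex : ∀ n → 1 ℕ.≤ n → 2 ℕ.+ n ℕ.< m → G i (1 ℕ.+ n) ℚ.+ G i (1 ℕ.+ n) ℚ.< G i n ℚ.+ G i (2 ℕ.+ n)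
      G-convex n 1≤n lt = subst₂ ℚ._<_ (sym (cong₂ ℚ._+_ (G≡F i (1 ℕ.+ n) X₁ e₁) (G≡F i (1 ℕ.+ n) X₁ e₁))) (sym (cong₂ ℚ._+_ (G≡F i n X₀ e₀) (G≡F i (2 ℕ.+ n) X₂ e₂)))
        (F-convex i X₀ X₁ X₂ (trans e₁ (trans (cong ℤ.+_ (ℕ.+-comm 1 n)) (trans (ℤ.pos-+ n 1) (cong (_+ 1ℤ) (sym e₀))))) (trans e₂ (trans (cong ℤ.+_ (ℕ.+-comm 2 n)) (trans (ℤ.pos-+ n 2) (cong (_+ (1ℤ + 1ℤ)) (sym e₀))))))
        where
        c₀ = choose i n 1≤n (ℕ.<-trans (ℕ.m≤n+m (suc n) 1) lt)
        c₁ = choose i (1 ℕ.+ n) (ℕ.s≤s ℕ.z≤n) (ℕ.<-trans (ℕ.n<1+n (1 ℕ.+ n)) lt)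
        c₂ = choose i (2 ℕ.+ n) (ℕ.s≤s ℕ.z≤n) lt
        X₀ = proj₁ c₀
        X₁ = proj₁ c₁
        X₂ = proj₁ c₂
        e₀ = proj₂ c₀
        e₁ = proj₂ c₁
        e₂ = proj₂ c₂

      G-symmetric : ∀ n n' → 1 ℕ.≤ n → 1 ℕ.≤ n' → n ℕ.+ n' ≡ m → G i n ≡ G i n'
      G-symmetric n n' 1≤n 1≤n' s = trans (G≡F i n X e) (trans (sym (F-negate X)) (sym (G≡F i n' (negate X) (negate-res X i n n' s e))))
        where
        c = choose i n 1≤n (subst (n ℕ.<_) s (subst (ℕ._≤ n ℕ.+ n') (ℕ.+-comm n 1) (ℕ.+-monoʳ-≤ n 1≤n')))
        X = proj₁ c
        e = proj₂ c

      open SymmetricConvex m (G i) G-convex G-symmetric public using (decreasing)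

    -- The class of 2X has i-th coordinate 0 modulo m and is therefore trivial. So each 2 `res X j`
    -- is a multiple of m strictly between 0 and 2m.
    torsion : ∀ X i j → res X i + res X i ≡ M → res X j + res X j ≡ M
    torsion X i j e = by (resid-cases C)
      where
      C = coord-linear 1ℤ 1ℤ (isCoord X) (isCoord X)
      alg : ∀ r → 1ℤ * r + 1ℤ * r ≡ r + r
      alg = solve-∀
      alg2 : ∀ r q M → r ≡ (r + q * M) - q * M
      alg2 = solve-∀
      alg3 : ∀ q M → M - q * M ≡ (1ℤ - q) * M
      alg3 = solve-∀
      by : Multiple (λ j → 1ℤ * res X j + 1ℤ * res X j) ⊎ (∃ λ Z → ∀ j → ∃ λ q → 1ℤ * res X j + 1ℤ * res X j ≡ res Z j + q * M) → res X j + res X j ≡ M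
      by (inj₂ (Z , h)) = ⊥-elim (pos≢0 (proj₁ (inBox Z i)) (small-multiple M (1ℤ - proj₁ (h i)) (res Z i) (ℤ.<⇒≤ (proj₁ (inBox Z i))) (proj₂ (inBox Z i))
        (trans (alg2 (res Z i) (proj₁ (h i)) M) (trans (cong (λ z → z - proj₁ (h i) * M) (trans (sym (proj₂ (h i))) (trans (alg (res X i)) e))) (alg3 (proj₁ (h i)) M)))))
      by (inj₁ mul) = trans e' (trans (cong (_* M) q≡1) (ℤ.*-identityˡ M))
        where
        q = proj₁ (mul j)
        e' : res X j + res X j ≡ q * M
        e' = trans (sym (alg (res X j))) (proj₂ (mul j))
        alg4 : ∀ q M → q * M - M ≡ (q - 1ℤ) * M
        alg4 = solve-∀
        alg5 : ∀ M → M + M - M ≡ M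
        alg5 = solve-∀
        alg6 : ∀ q M → M - q * M ≡ (1ℤ - q) * M
        alg6 = solve-∀
        q≤1 : q ≤ 1ℤ
        q≤1 = ℤ.i-j≤0⇒i≤j (multiple-<1 M (q - 1ℤ) m-pos (subst₂ _<_ (trans (cong (_- M) e') (alg4 q M)) (alg5 M) (ℤ.+-monoˡ-< (- M) (ℤ.+-mono-< (proj₂ (inBox X j)) (proj₂ (inBox X j))))))
        1≤q : 1ℤ ≤ q
        1≤q = ℤ.i-j≤0⇒i≤j (multiple-<1 M (1ℤ - q) m-pos (subst₂ _<_ (trans (cong (λ z → M - z) e') (alg6 q M)) (ℤ.+-identityʳ M) (ℤ.+-monoʳ-< M (ℤ.neg-mono-< (ℤ.+-mono-< (proj₁ (inBox X j)) (proj₁ (inBox X j)))))))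
        q≡1 : q ≡ 1ℤ
        q≡1 = ℤ.≤-antisym q≤1 1≤q

    -- n is the admissible value closest to m / 2, excluding m / 2 itself
    module Central (n : ℕ) (1≤n : 1 ℕ.≤ n) (2n<m : n ℕ.+ n ℕ.< m) (closest : ∀ a → n ℕ.< a → a ℕ.+ a ℕ.≤ m → a ℕ.+ a ≡ m) where

      near : ∀ X i {r} → res X i ≡ ℤ.+ r → r ℕ.+ r ℕ.≤ m → r ℕ.+ r ≢ m → r ≡ n ⊎ G i n ℚ.< F X
      near X i {r} e le ne = by (ℕ.<-cmp r n)
        where
        open import Relation.Binary.Definitions using (Tri; tri<; tri≈; tri>)
        by : Tri (r ℕ.< n) (r ≡ n) (n ℕ.< r) → r ≡ n ⊎ G i n ℚ.< F X
        by (tri≈ _ eq _) = inj₁ eq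
        by (tri> _ _ gt) = ⊥-elim (ne (closest r gt le))
        by (tri< lt _ _) = inj₂ (subst₂ ℚ._<_ (cong (G i) n≡) (G≡F i r X e)
            (decreasing i r (n ℕ.∸ suc r) (ℤ.drop‿+<+ (subst (0ℤ <_) e (proj₁ (inBox X i)))) (subst (λ z → z ℕ.+ z ℕ.≤ m) (sym n≡) (ℕ.<⇒≤ 2n<m))))
          where
          n≡ : suc r ℕ.+ (n ℕ.∸ suc r) ≡ n
          n≡ = ℕ.m+[n∸m]≡n lt

      -- Up to replacing X by -X, which does not change F, the i-th coordinate is less than m / 2;
      -- on this side F decreases up to the value n.
      minimal : ∀ X i → res X i + res X i ≢ M → (res X i ≡ ℤ.+ n ⊎ res (negate X) i ≡ ℤ.+ n) ⊎ G i n ℚ.< F X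
      minimal X i ne = by (ℕ.≤-total (r ℕ.+ r) m)
        where
        rd = resℕ X i
        r = proj₁ rd
        e = proj₁ (proj₂ rd)
        r<m = proj₂ (proj₂ (proj₂ rd))
        2r≢m : r ℕ.+ r ≢ m
        2r≢m h = ne (trans (cong₂ _+_ e e) (trans (sym (ℤ.pos-+ r r)) (cong ℤ.+_ h)))
        r' = m ℕ.∸ r
        s : r ℕ.+ r' ≡ m
        s = ℕ.m+[n∸m]≡n (ℕ.<⇒≤ r<m)
        e' : res (negate X) i ≡ ℤ.+ r'
        e' = negate-res X i r r' s e
        by : r ℕ.+ r ℕ.≤ m ⊎ m ℕ.≤ r ℕ.+ r → (res X i ≡ ℤ.+ n ⊎ res (negate X) i ≡ ℤ.+ n) ⊎ G i n ℚ.< F X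
        by (inj₁ le) = by₁ (near X i e le 2r≢m)
          where
          by₁ : r ≡ n ⊎ G i n ℚ.< F X → (res X i ≡ ℤ.+ n ⊎ res (negate X) i ≡ ℤ.+ n) ⊎ G i n ℚ.< F X
          by₁ (inj₁ h) = inj₁ (inj₁ (trans e (cong ℤ.+_ h)))
          by₁ (inj₂ h) = inj₂ h
        by (inj₂ ge) = by₁ (near (negate X) i e' (subst (r' ℕ.+ r' ℕ.≤_) s (ℕ.+-monoˡ-≤ r' r'≤r)) (λ h → 2r≢m (trans (cong₂ ℕ._+_ (r≡r' h) (r≡r' h)) h)))
          where
          r'≤r : r' ℕ.≤ r
          r'≤r = ℕ.+-cancelˡ-≤ r r' r (subst (ℕ._≤ r ℕ.+ r) (sym s) ge)
          r≡r' : r' ℕ.+ r' ≡ m → r ≡ r'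
          r≡r' h = ℕ.+-cancelʳ-≡ r' r r' (trans s (sym h))
          by₁ : r' ≡ n ⊎ G i n ℚ.< F (negate X) → (res X i ≡ ℤ.+ n ⊎ res (negate X) i ≡ ℤ.+ n) ⊎ G i n ℚ.< F X
          by₁ (inj₁ h) = inj₁ (inj₂ (trans e' (cong ℤ.+_ h)))
          by₁ (inj₂ h) = inj₂ (subst (G i n ℚ.<_) (F-negate X) h)

      n<m : n ℕ.< m
      n<m = ℕ.≤-<-trans (ℕ.m≤m+n n n) 2n<m

      C₀ = choose zero n 1≤n n<m

      X* : Interior
      X* = proj₁ C₀

      not-torsion : ∀ X j → res X j ≡ ℤ.+ n → ∀ i → res X i + res X i ≢ M
      not-torsion X j e i h = ℕ.<-irrefl (ℤ.+-injective (trans (ℤ.pos-+ n n) (trans (sym (cong₂ _+_ e e)) (torsion X i j h)))) 2n<m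

      -- Let Y have i-th coordinate n. If X* did not have i-th coordinate n up to sign, then F Y < F
      -- X* by minimality in coordinate i. But X* has coordinate n at index 0, and minimality in
      -- that coordinate excludes F Y < F X*.
      X*-values : ∀ i → res X* i ≡ ℤ.+ n ⊎ res X* i ≡ M - ℤ.+ n
      X*-values i = by (minimal X* i (not-torsion X* zero (proj₂ C₀) i))
        where
        c = choose i n 1≤n n<m
        Y = proj₁ c
        alg : ∀ M r → r ≡ M - (M - r)
        alg = solve-∀
        by₂ : (res Y zero ≡ ℤ.+ n ⊎ res (negate Y) zero ≡ ℤ.+ n) ⊎ G zero n ℚ.< F Y → F Y ℚ.< F X* → ⊥
        by₂ (inj₁ (inj₁ h)) lt = ℚ.<-irrefl (F-cong Y X* (interior-determined Y X* zero (trans h (sym (proj₂ C₀))))) lt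
        by₂ (inj₁ (inj₂ h)) lt = ℚ.<-irrefl (trans (sym (F-negate Y)) (F-cong (negate Y) X* (interior-determined (negate Y) X* zero (trans h (sym (proj₂ C₀)))))) lt
        by₂ (inj₂ h) lt = ℚ.<-asym lt (subst (ℚ._< F Y) (G≡F zero n X* (proj₂ C₀)) h)
        by : (res X* i ≡ ℤ.+ n ⊎ res (negate X*) i ≡ ℤ.+ n) ⊎ G i n ℚ.< F X* → res X* i ≡ ℤ.+ n ⊎ res X* i ≡ M - ℤ.+ n
        by (inj₁ (inj₁ h)) = inj₁ h
        by (inj₁ (inj₂ h)) = inj₂ (trans (alg M (res X* i)) (cong (λ z → M - z) h))
        by (inj₂ h) = ⊥-elim (by₂ (minimal Y zero (not-torsion Y i (proj₂ c) zero)) (subst (ℚ._< F X*) (G≡F i n Y (proj₂ c)) h))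

    Signs : Interior → Set
    Signs X = ∀ j → res X j ≡ 1ℤ ⊎ res X j ≡ M - 1ℤ

    1<M : 1ℤ < M
    1<M = ℤ.+<+ 2≤m

    0<M-1 : 0ℤ < M - 1ℤ
    0<M-1 = subst (_< M - 1ℤ) (ℤ.+-inverseʳ 1ℤ) (ℤ.+-monoˡ-< (- 1ℤ) 1<M)

    M-1<M : M - 1ℤ < M
    M-1<M = subst (M - 1ℤ <_) (ℤ.+-identityʳ M) (ℤ.+-monoʳ-< M { - 1ℤ} {0ℤ} ℤ.-<+)

    -- The class of X + Y has the residue 1 or m - 1 at every index. As m ≥ 2, neither is 0, so the
    -- class is nontrivial and its representative has these coordinates.
    sum-signs : ∀ X Y → (∀ j → res X j + res Y j ≡ M + 1ℤ ⊎ res X j + res Y j ≡ M - 1ℤ) → ∃ Signs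
    sum-signs X Y s = by (resid-cases C)
      where
      C = coord-linear 1ℤ 1ℤ (isCoord X) (isCoord Y)
      c : Fin N → ℤ
      c j = 1ℤ * res X j + 1ℤ * res Y j
      alg : ∀ a b → 1ℤ * a + 1ℤ * b ≡ a + b
      alg = solve-∀
      alg1 : ∀ M q → M + 1ℤ ≡ q * M → 1ℤ ≡ (q - 1ℤ) * M
      alg1 M q h = trans (a1 M) (trans (cong (_- M) h) (a2 M q))
        where
        a1 : ∀ M → 1ℤ ≡ M + 1ℤ - M
        a1 = solve-∀
        a2 : ∀ M q → q * M - M ≡ (q - 1ℤ) * M
        a2 = solve-∀
      alg2 : ∀ M r q → M + 1ℤ ≡ r + q * M → 1ℤ - r ≡ (q - 1ℤ) * M
      alg2 M r q h = trans (a1 M r) (trans (cong (λ z → z - M - r) h) (a2 M r q))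
        where
        a1 : ∀ M r → 1ℤ - r ≡ M + 1ℤ - M - r
        a1 = solve-∀
        a2 : ∀ M r q → r + q * M - M - r ≡ (q - 1ℤ) * M
        a2 = solve-∀
      alg3 : ∀ x r y → x ≡ r + y → x - r ≡ y
      alg3 x r y h = trans (cong (_- r) h) (a r y)
        where
        a : ∀ r y → r + y - r ≡ y
        a = solve-∀
      by : Multiple c ⊎ (∃ λ Z → ∀ j → ∃ λ q → c j ≡ res Z j + q * M) → ∃ Signs
      by (inj₁ mul) = ⊥-elim (by₁ (s zero))
        where
        q = proj₁ (mul zero)
        e = proj₂ (mul zero)
        by₁ : res X zero + res Y zero ≡ M + 1ℤ ⊎ res X zero + res Y zero ≡ M - 1ℤ → ⊥
        by₁ (inj₁ h) = pos≢0 0<1 (small-multiple M (q - 1ℤ) 1ℤ (ℤ.+≤+ ℕ.z≤n) 1<M (alg1 M q (trans (sym h) (trans (sym (alg (res X zero) (res Y zero))) e))))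
        by₁ (inj₂ h) = pos≢0 0<M-1 (small-multiple M q (M - 1ℤ) (ℤ.<⇒≤ 0<M-1) M-1<M (trans (sym h) (trans (sym (alg (res X zero) (res Y zero))) e)))
      by (inj₂ (Z , h)) = Z , λ j → by₂ j (s j)
        where
        by₂ : ∀ j → res X j + res Y j ≡ M + 1ℤ ⊎ res X j + res Y j ≡ M - 1ℤ → res Z j ≡ 1ℤ ⊎ res Z j ≡ M - 1ℤ
        by₂ j (inj₁ p) = inj₁ (sym (same-residue M 1ℤ (res Z j) (proj₁ (h j) - 1ℤ) (ℤ.+≤+ ℕ.z≤n) 1<M (ℤ.<⇒≤ (proj₁ (inBox Z j))) (proj₂ (inBox Z j))
          (alg2 M (res Z j) (proj₁ (h j)) (trans (sym p) (trans (sym (alg (res X j) (res Y j))) (proj₂ (h j)))))))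
        by₂ j (inj₂ p) = inj₂ (sym (same-residue M (M - 1ℤ) (res Z j) (proj₁ (h j)) (ℤ.<⇒≤ 0<M-1) M-1<M (ℤ.<⇒≤ (proj₁ (inBox Z j))) (proj₂ (inBox Z j))
          (alg3 (M - 1ℤ) (res Z j) (proj₁ (h j) * M) (trans (sym p) (trans (sym (alg (res X j) (res Y j))) (proj₂ (h j)))))))

    -- X* has coordinates n and m - n with n just below m / 2. For odd m = 2n + 1 its double has
    -- coordinates 2n = m - 1 and 2(m - n) = m + 1. For even m = 2n + 2 the class of order two, with
    -- all coordinates n + 1, is added to the same effect. For m = 2 the only possible coordinate is
    -- 1.
    signs : ∃ Signs
    signs = by (parity m)
      where
      +suc : ∀ u → ℤ.+ suc u ≡ 1ℤ + ℤ.+ u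
      +suc u = ℤ.pos-+ 1 u
      by : (∃ λ u → m ≡ u ℕ.+ u ⊎ m ≡ suc (u ℕ.+ u)) → ∃ Signs
      by (zero , inj₁ e) = ⊥-elim (ℕ.<⇒≢ (ℕ.≤-trans (ℕ.s≤s ℕ.z≤n) 2≤m) (sym e))
      by (zero , inj₂ e) = ⊥-elim (ℕ.<⇒≢ 2≤m (sym e))
      by (1 , inj₁ e) = X , λ j → inj₁ (one (res X j) (proj₁ (inBox X j)) (subst (λ z → res X j < ℤ.+ z) e (proj₂ (inBox X j))))
        where
        X = proj₁ (choose zero 1 ℕ.≤-refl 2≤m)
        one : ∀ z → 0ℤ < z → z < ℤ.+ 2 → z ≡ 1ℤ
        one (ℤ.+ 0) (ℤ.+<+ ()) _
        one (ℤ.+ 1) _ _ = refl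
        one (ℤ.+ suc (suc n)) _ (ℤ.+<+ (ℕ.s≤s (ℕ.s≤s ())))
      by (suc (suc u) , inj₁ e) = sum-signs X* H (λ j → val j (X*-values j))
        where
        n = suc u
        e' : m ≡ suc n ℕ.+ suc n
        e' = e
        open Central n (ℕ.s≤s ℕ.z≤n) (subst (n ℕ.+ n ℕ.<_) (sym e') (ℕ.+-mono-< (ℕ.n<1+n n) (ℕ.n<1+n n)))
          (λ a lt le → ℕ.≤-antisym le (subst (ℕ._≤ a ℕ.+ a) (sym e') (ℕ.+-mono-≤ lt lt)))
        M≡ : M ≡ (1ℤ + ℤ.+ n) + (1ℤ + ℤ.+ n)
        M≡ = trans (cong ℤ.+_ e') (trans (ℤ.pos-+ (suc n) (suc n)) (cong₂ _+_ (+suc n) (+suc n)))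
        hd = choose zero (suc n) (ℕ.s≤s ℕ.z≤n) (subst (suc n ℕ.<_) (sym e') (ℕ.m<m+n (suc n) (ℕ.s≤s ℕ.z≤n)))
        H = proj₁ hd
        H≡ : ∀ j → res H j + res H j ≡ M
        H≡ j = torsion H zero j (trans (cong₂ _+_ (proj₂ hd) (proj₂ hd)) (trans (sym (ℤ.pos-+ (suc n) (suc n))) (cong ℤ.+_ (sym e'))))
        half : ∀ a b → a + a ≡ b + b → a ≡ b
        half a b h = *-cancelˡ′ (1ℤ + 1ℤ) (λ ()) (trans (dbl a) (trans h (sym (dbl b))))
          where
          dbl : ∀ a → (1ℤ + 1ℤ) * a ≡ a + a
          dbl = solve-∀
        Hj : ∀ j → res H j ≡ 1ℤ + ℤ.+ n
        Hj j = half (res H j) (1ℤ + ℤ.+ n) (trans (H≡ j) M≡)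
        val : ∀ j → res X* j ≡ ℤ.+ n ⊎ res X* j ≡ M - ℤ.+ n → res X* j + res H j ≡ M + 1ℤ ⊎ res X* j + res H j ≡ M - 1ℤ
        val j (inj₁ p) = inj₂ (trans (cong₂ _+_ p (Hj j)) (trans (alg (ℤ.+ n)) (cong (_- 1ℤ) (sym M≡))))
          where
          alg : ∀ n → n + (1ℤ + n) ≡ (1ℤ + n) + (1ℤ + n) - 1ℤ
          alg = solve-∀
        val j (inj₂ p) = inj₁ (trans (cong₂ _+_ p (Hj j)) (alg M (ℤ.+ n)))
          where
          alg : ∀ M n → M - n + (1ℤ + n) ≡ M + 1ℤ
          alg = solve-∀
      by (suc u , inj₂ e) = sum-signs X* X* (λ j → val j (X*-values j))
        where
        n = suc u
        open Central n (ℕ.s≤s ℕ.z≤n) (subst (n ℕ.+ n ℕ.<_) (sym e) (ℕ.n<1+n (n ℕ.+ n)))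
          (λ a lt le → ⊥-elim (ℕ.<⇒≱ (subst (ℕ._< a ℕ.+ a) (sym e) (ℕ.≤-trans (subst (suc (suc (n ℕ.+ n)) ℕ.≤_) (cong suc (sym (ℕ.+-suc n n))) ℕ.≤-refl) (ℕ.+-mono-≤ lt lt))) le))
        M≡ : M ≡ 1ℤ + (ℤ.+ n + ℤ.+ n)
        M≡ = trans (cong ℤ.+_ e) (trans (+suc (n ℕ.+ n)) (cong (1ℤ +_) (ℤ.pos-+ n n)))
        val : ∀ j → res X* j ≡ ℤ.+ n ⊎ res X* j ≡ M - ℤ.+ n → res X* j + res X* j ≡ M + 1ℤ ⊎ res X* j + res X* j ≡ M - 1ℤ
        val j (inj₁ p) = inj₂ (trans (cong₂ _+_ p p) (trans (alg (ℤ.+ n)) (cong (_- 1ℤ) (sym M≡))))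
          where
          alg : ∀ n → n + n ≡ 1ℤ + (n + n) - 1ℤ
          alg = solve-∀
        val j (inj₂ p) = inj₁ (trans (cong₂ _+_ p p) (trans (alg M (ℤ.+ n)) (trans (cong (λ z → M + (z - (ℤ.+ n + ℤ.+ n))) M≡) (alg2 M (ℤ.+ n)))))
          where
          alg : ∀ M n → M - n + (M - n) ≡ M + (M - (n + n))
          alg = solve-∀
          alg2 : ∀ M n → M + (1ℤ + (n + n) - (n + n)) ≡ M + 1ℤ
          alg2 = solve-∀

  -- Lattices presented by signs

  -- The lattice generated by the vertices s and by diff = (Σ ε_j s_j) / m
  record SignLattice {d} (m : ℤ) (s : Matrix (suc d) d) (ε : Fin (suc d) → ℤ) : Set where
    field
      diff : Fin d → ℤ
      diff-eq : ∀ l → ∑ (λ j → ε j * s j l) ≡ m * diff l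
      affine-independent : AffinelyIndependent s
      generates : ∀ (x : Fin d → ℤ) (h : ℤ) → ∃ λ c → ∃ λ n → ∑ c ≡ h × (∀ l → ∑ (λ j → c j * s j l) + n * diff l ≡ x l)

  Sign± : ℤ → Set
  Sign± z = z ≡ 1ℤ ⊎ z ≡ - 1ℤ

  -- Match g 0 with an equal value of f and recurse. If there is none, f is constantly - g 0; then
  -- the terms g 0 (g j - f j) are nonnegative with sum 0, although the one at 0 equals 2.
  sign-permutation : ∀ n (f g : Fin n → ℤ) → (∀ j → Sign± (f j)) → (∀ j → Sign± (g j)) → ∑ f ≡ ∑ g →
    ∃ λ (π : Permutation n n) → ∀ j → f (π ⟨$⟩ʳ j) ≡ g j
  sign-permutation zero f g f± g± e = Perm.id , λ ()
  sign-permutation (suc n) f g f± g± e = by (Fin.any? (λ i → f i ℤ.≟ g zero))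
    where
    by : Dec (∃ λ i → f i ≡ g zero) → ∃ λ (π : Permutation (suc n) (suc n)) → ∀ j → f (π ⟨$⟩ʳ j) ≡ g j
    by (yes (i , fᵢ)) = Perm.insert zero i (proj₁ ih) , λ { zero → fᵢ ; (suc j) → proj₂ ih j }
      where
      alg : ∀ a b c → a + b ≡ a + c → b ≡ c
      alg a b c h = trans (a1 a b) (trans (cong (λ z → z - a) h) (sym (a1 a c)))
        where
        a1 : ∀ a b → b ≡ a + b - a
        a1 = solve-∀
      ih = sign-permutation n (λ j → f (punchIn i j)) (λ j → g (suc j)) (λ j → f± (punchIn i j)) (λ j → g± (suc j))
        (alg (f i) _ _ (trans (sym (∑-remove i f)) (trans e (trans (∑-suc g) (cong (λ z → z + ∑ (λ j → g (suc j))) (sym fᵢ))))))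
    by (no none) = ⊥-elim (two (g± zero) (∑≡0⇒≡0 h≥0 ∑h zero))
      where
      g₀ = g zero
      f≡ : ∀ i → f i ≡ - g₀
      f≡ i = opposite (f i) g₀ (f± i) (g± zero) (λ h → none (i , h))
        where
        opposite : ∀ x y → Sign± x → Sign± y → x ≢ y → x ≡ - y
        opposite x y (inj₁ p) (inj₁ q) ne = ⊥-elim (ne (trans p (sym q)))
        opposite x y (inj₁ p) (inj₂ q) ne = trans p (cong -_ (sym q))
        opposite x y (inj₂ p) (inj₁ q) ne = trans p (cong -_ (sym q))
        opposite x y (inj₂ p) (inj₂ q) ne = ⊥-elim (ne (trans p (sym q)))
      h : Fin (suc n) → ℤ
      h j = g₀ * (g j - f j)
      h≡ : ∀ j → h j ≡ g₀ * (g j + g₀)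
      h≡ j = trans (cong (λ z → g₀ * (g j - z)) (f≡ j)) (cong (λ z → g₀ * (g j + z)) (ℤ.neg-involutive g₀))
      prod : ∀ x y → Sign± x → Sign± y → 0ℤ ≤ x * (y + x)
      prod x y (inj₁ refl) (inj₁ refl) = ℤ.+≤+ ℕ.z≤n
      prod x y (inj₁ refl) (inj₂ refl) = ℤ.≤-refl
      prod x y (inj₂ refl) (inj₁ refl) = ℤ.≤-refl
      prod x y (inj₂ refl) (inj₂ refl) = ℤ.+≤+ ℕ.z≤n
      h≥0 : ∀ j → 0ℤ ≤ h j
      h≥0 j = subst (0ℤ ≤_) (sym (h≡ j)) (prod g₀ (g j) (g± zero) (g± j))
      ∑h : ∑ h ≡ 0ℤ
      ∑h = trans (sym (*-∑ g₀ (λ j → g j - f j))) (trans (cong (λ z → g₀ * z) (trans (∑-sub g f) (trans (cong (λ z → ∑ g - z) e) (ℤ.+-inverseʳ (∑ g))))) (ℤ.*-zeroʳ g₀))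
      two : Sign± g₀ → h zero ≢ 0ℤ
      two s e' = contra g₀ s (trans (sym (h≡ zero)) e')
        where
        contra : ∀ x → Sign± x → x * (x + x) ≢ 0ℤ
        contra x (inj₁ refl) ()
        contra x (inj₂ refl) ()

  permute-∑ : ∀ {n} (π : Permutation n n) (c : Fin n → ℤ) (f : Fin n → ℤ) → ∑ (λ j → c j * f (π ⟨$⟩ʳ j)) ≡ ∑ (λ j → c (π ⟨$⟩ˡ j) * f j)
  permute-∑ π c f = sym (trans (∑-permute (λ j → c (π ⟨$⟩ˡ j) * f j) π) (∑-cong (λ j → cong (λ z → c z * f (π ⟨$⟩ʳ j)) (Perm.inverseˡ π))))

  ∑-permuteˡ : ∀ {n} (π : Permutation n n) (c : Fin n → ℤ) → ∑ (λ j → c (π ⟨$⟩ˡ j)) ≡ ∑ c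
  ∑-permuteˡ π c = trans (∑-permute (λ j → c (π ⟨$⟩ˡ j)) π) (∑-cong (λ j → cong c (Perm.inverseˡ π)))

  permute-signLattice : ∀ {d m} {s : Matrix (suc d) d} {ε} (π : Permutation (suc d) (suc d)) → SignLattice m s ε →
    SignLattice m (λ j → s (π ⟨$⟩ʳ j)) (λ j → ε (π ⟨$⟩ʳ j))
  permute-signLattice {s = s} {ε} π S = record
    { diff = diff
    ; diff-eq = λ l → trans (sym (∑-permute (λ j → ε j * s j l) π)) (diff-eq l)
    ; affine-independent = λ c ∑c h j → trans (cong c (sym (Perm.inverseˡ π))) (affine-independent (λ j → c (π ⟨$⟩ˡ j)) (trans (∑-permuteˡ π c) ∑c)
        (λ l → trans (sym (permute-∑ π c (λ j → s j l))) (h l)) (π ⟨$⟩ʳ j))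
    ; generates = λ x h → let (c , n , ∑c , e) = generates x h in
        (λ j → c (π ⟨$⟩ʳ j)) , n , trans (sym (∑-permute c π)) ∑c , λ l → trans (cong (λ z → z + n * diff l) (sym (∑-permute (λ j → c j * s j l) π))) (e l) }
    where open SignLattice S

  module FromSigns {d : ℕ} (k m : ℕ) (N≡2k : suc d ≡ k ℕ.+ k) (1≤k : 1 ℕ.≤ k)
    (P : Vec (ZPt d) (suc d)) (cyc : CyclicLattice (ℤ.+ k) (ℤ.+ m) (entries P)) where

    open CyclicLattice cyc
    open Classes k m N≡2k 1≤k P cyc
    private
      N = suc d
      v = entries P
      K = ℤ.+ k
      M = ℤ.+ m

    -- Removing q j copies of vertex j from X leaves the lattice vector `diff` of height 0 with
    -- coordinates ε. As ε 0 squares to 1, subtracting b 0 ε 0 times `diff` makes coordinate 0 of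
    -- any lattice vector vanish, and the remaining class is trivial.
    signLattice : ∀ X (ε : Fin N → ℤ) → (∀ j → Sign± (ε j)) → ∑ ε ≡ 0ℤ → (∀ j → ∃ λ q → res X j ≡ ε j + q * M) → SignLattice M v ε
    signLattice X ε ε± ∑ε h = record
      { diff = diff
      ; diff-eq = λ l → point E l
      ; affine-independent = independent
      ; generates = λ x t → Gen.q' x t , Gen.n x t , Gen.∑q' x t , Gen.rep x t }
      where
      q : Fin N → ℤ
      q j = proj₁ (h j)
      E₀ = coord-linear {v = v} {M} 1ℤ (- 1ℤ) (isCoord X) (coord-comb q)
      diff : Fin d → ℤ
      diff l = 1ℤ * lookup (pt X) l + - 1ℤ * comb {v = v} {M} q l
      alg : ∀ e q M → 1ℤ * (e + q * M) + - 1ℤ * (M * q) ≡ e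
      alg = solve-∀
      ε≡ : ∀ j → 1ℤ * res X j + - 1ℤ * (M * q j) ≡ ε j
      ε≡ j = trans (cong (λ z → 1ℤ * z + - 1ℤ * (M * q j)) (proj₂ (h j))) (alg (ε j) (q j) M)
      h≡0 : 1ℤ * K + - 1ℤ * ∑ q ≡ 0ℤ
      h≡0 = *-cancelˡ′ M (pos≢0 m-pos) (trans (sym (total E₀)) (trans (∑-cong ε≡) (trans ∑ε (sym (ℤ.*-zeroʳ M)))))
      E : IsCoord v M diff 0ℤ ε
      E = coord-cong E₀ (λ l → refl) h≡0 ε≡
      square : ∀ z → Sign± z → z * z ≡ 1ℤ
      square z (inj₁ refl) = refl
      square z (inj₂ refl) = refl
      module Gen (x : Fin d → ℤ) (t : ℤ) where
        b = proj₁ (coordinates x t)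
        B = proj₂ (coordinates x t)
        n = b zero * ε zero
        c : Fin N → ℤ
        c j = 1ℤ * b j + - n * ε j
        C : IsCoord v M (λ l → 1ℤ * x l + - n * diff l) (1ℤ * t + - n * 0ℤ) c
        C = coord-linear 1ℤ (- n) B E
        alg1 : ∀ b e → 1ℤ * b + - (b * e) * e ≡ b - b * (e * e)
        alg1 = solve-∀
        alg2 : ∀ b → b - b * 1ℤ ≡ 0ℤ
        alg2 = solve-∀
        c₀ : c zero ≡ 0ℤ
        c₀ = trans (alg1 (b zero) (ε zero)) (trans (cong (λ z → b zero - b zero * z) (square (ε zero) (ε± zero))) (alg2 (b zero)))
        mul : Multiple c
        mul = by (resid-cases C)
          where
          alg3 : ∀ r q M → r ≡ (r + q * M) + - q * M
          alg3 = solve-∀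
          by : Multiple c ⊎ (∃ λ Z → ∀ j → ∃ λ q → c j ≡ res Z j + q * M) → Multiple c
          by (inj₁ p) = p
          by (inj₂ (Z , f)) = ⊥-elim (pos≢0 (proj₁ (inBox Z zero)) (small-multiple M (- proj₁ (f zero)) (res Z zero) (ℤ.<⇒≤ (proj₁ (inBox Z zero))) (proj₂ (inBox Z zero))
            (trans (alg3 (res Z zero) (proj₁ (f zero)) M) (trans (cong (λ z → z + - proj₁ (f zero) * M) (trans (sym (proj₂ (f zero))) c₀)) (ℤ.+-identityˡ (- proj₁ (f zero) * M))))))
        q' : Fin N → ℤ
        q' j = proj₁ (mul j)
        c≡ : ∀ j → M * q' j ≡ c j
        c≡ j = trans (ℤ.*-comm M (q' j)) (sym (proj₂ (mul j)))
        alg4 : ∀ t n → 1ℤ * t + - n * 0ℤ ≡ t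
        alg4 = solve-∀
        ∑q' : ∑ q' ≡ t
        ∑q' = *-cancelˡ′ M (pos≢0 m-pos) (trans (*-∑ M q') (trans (∑-cong c≡) (trans (total C) (cong (M *_) (alg4 t n)))))
        rep : ∀ l → ∑ (λ j → q' j * v j l) + n * diff l ≡ x l
        rep l = trans (cong (λ z → z + n * diff l) (*-cancelˡ′ M (pos≢0 m-pos) (trans (*-∑ M (λ j → q' j * v j l)) (trans (∑-cong (λ j → trans (sym (ℤ.*-assoc M (q' j) (v j l))) (cong (λ z → z * v j l) (c≡ j)))) (point C l)))))
          (alg5 (x l) n (diff l))
          where
          alg5 : ∀ x n y → 1ℤ * x + - n * y + n * y ≡ x
          alg5 = solve-∀

  -- Linear maps

  apply : ∀ {d} → Matrix d d → (Fin d → ℤ) → Fin d → ℤ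
  apply A x i = ∑ (λ c → A i c * x c)

  apply-linear : ∀ {d} (A : Matrix d d) p (w : Fin p → ℤ) (X : Matrix p d) i → apply A (λ c → ∑ (λ j → w j * X j c)) i ≡ ∑ (λ j → w j * apply A (X j) i)
  apply-linear A p w X i = begin
    ∑ (λ c → A i c * ∑ (λ j → w j * X j c)) ≡⟨ ∑-cong (λ c → *-∑ (A i c) (λ j → w j * X j c)) ⟩
    ∑ (λ c → ∑ (λ j → A i c * (w j * X j c))) ≡⟨ ∑-swap (λ c j → A i c * (w j * X j c)) ⟩
    ∑ (λ j → ∑ (λ c → A i c * (w j * X j c))) ≡⟨ ∑-cong (λ j → trans (∑-cong (λ c → alg (A i c) (w j) (X j c))) (sym (*-∑ (w j) (λ c → A i c * X j c)))) ⟩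
    ∑ (λ j → w j * apply A (X j) i) ∎
    where
    open ≡-Reasoning
    alg : ∀ a b c → a * (b * c) ≡ b * (a * c)
    alg = solve-∀

  apply-cong : ∀ {d} (A : Matrix d d) {x y : Fin d → ℤ} → (∀ c → x c ≡ y c) → ∀ i → apply A x i ≡ apply A y i
  apply-cong A h i = ∑-cong (λ c → cong (λ z → A i c * z) (h c))

  apply-lin₂ : ∀ {d} (A : Matrix d d) β γ (x y : Fin d → ℤ) i → apply A (λ c → β * x c + γ * y c) i ≡ β * apply A x i + γ * apply A y i
  apply-lin₂ A β γ x y i = trans (∑-cong (λ c → alg (A i c) β γ (x c) (y c))) (∑-lin β γ (λ c → A i c * x c) (λ c → A i c * y c))
    where
    alg : ∀ a b g x y → a * (b * x + g * y) ≡ b * (a * x) + g * (a * y)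
    alg = solve-∀

  apply-⊡ : ∀ {d} (A B : Matrix d d) x i → apply (A ⊡ B) x i ≡ apply A (apply B x) i
  apply-⊡ A B x i = begin
    ∑ (λ c → ∑ (λ j → A i j * B j c) * x c) ≡⟨ ∑-cong (λ c → ∑-* (x c) (λ j → A i j * B j c)) ⟩
    ∑ (λ c → ∑ (λ j → A i j * B j c * x c)) ≡⟨ ∑-swap (λ c j → A i j * B j c * x c) ⟩
    ∑ (λ j → ∑ (λ c → A i j * B j c * x c)) ≡⟨ ∑-cong (λ j → trans (∑-cong (λ c → ℤ.*-assoc (A i j) (B j c) (x c))) (sym (*-∑ (A i j) (λ c → B j c * x c)))) ⟩
    ∑ (λ j → A i j * apply B x j) ∎
    where open ≡-Reasoning

  apply-id : ∀ {d} {A : Matrix d d} → A ≈ δ → ∀ x i → apply A x i ≡ x i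
  apply-id h x i = trans (∑-cong (λ c → cong (λ z → z * x c) (h i c))) (∑-δ i x)

  fromEntries : ∀ {r c} → Matrix r c → Vec (Vec ℤ c) r
  fromEntries A = tabulate (λ i → tabulate (A i))

  entries-fromEntries : ∀ {r c} (A : Matrix r c) → entries (fromEntries A) ≈ A
  entries-fromEntries A i j = trans (cong (λ r → lookup r j) (Vec.lookup∘tabulate (λ i → tabulate (A i)) i)) (Vec.lookup∘tabulate (A i) j)

  entries-injective : ∀ {r c} {A B : Vec (Vec ℤ c) r} → entries A ≈ entries B → A ≡ B
  entries-injective h = lookup-ext (λ i → lookup-ext (λ j → h i j))

  sumℤ-dot : ∀ {n} (u w : Vec ℤ n) → sumℤ (Vec.zipWith _*_ u w) ≡ ∑ (λ l → lookup u l * lookup w l)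
  sumℤ-dot [] [] = sym ∑-empty
  sumℤ-dot (a ∷ u) (b ∷ w) = trans (cong (λ z → a * b + z) (sumℤ-dot u w)) (sym (∑-suc (λ l → lookup (a ∷ u) l * lookup (b ∷ w) l)))

  entries-matMul : ∀ {d} (A B : Mat d) → entries (matMul A B) ≈ (entries A ⊡ entries B)
  entries-matMul A B i j = trans (cong (λ r → lookup r j) (Vec.lookup-map i _ A)) (trans (Vec.lookup∘tabulate _ j)
    (trans (sumℤ-dot (lookup A i) (Vec.map (λ r → lookup r j) B)) (∑-cong (λ l → cong (λ z → entries A i l * z) (Vec.lookup-map l (λ r → lookup r j) B)))))

  -- Names the entries of `idMat`, whose entry function is local to its definition.
  entry-function : ∀ {d} {I : Mat d} (f : Fin d → Fin d → ℤ) → I ≡ tabulate (λ i → tabulate (f i)) → Fin d → Fin d → ℤ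
  entry-function f _ = f

  id-entry : ∀ d → Fin d → Fin d → ℤ
  id-entry d = entry-function {I = idMat d} _ refl

  id-entry≡δ : ∀ d i j → id-entry d i j ≡ δ i j
  id-entry≡δ d i j with toℕ i ℕ.≟ toℕ j
  ... | yes e = sym (trans (cong (λ z → δ z j) (Fin.toℕ-injective e)) (δ-refl j))
  ... | no ne = sym (δ-≢ (λ e → ne (cong toℕ e)))

  entries-idMat : ∀ d → entries (idMat d) ≈ δ
  entries-idMat d i j = trans (entries-fromEntries (id-entry d) i j) (id-entry≡δ d i j)

  module _ {d : ℕ} {m : ℤ} (m≢0 : m ≢ 0ℤ) where

    -- Multiplied by m, a relation becomes an affine relation between the vertices alone, with
    -- coefficients m c j + n ε j. These vanish by independence, and they are the same for both sign
    -- lattices.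
    relation-transfer : ∀ {s s' : Matrix (suc d) d} {ε} (S : SignLattice m s ε) (S' : SignLattice m s' ε) → ∑ ε ≡ 0ℤ → ∀ c n → ∑ c ≡ 0ℤ →
      (∀ l → ∑ (λ j → c j * s j l) + n * SignLattice.diff S l ≡ 0ℤ) → ∀ l → ∑ (λ j → c j * s' j l) + n * SignLattice.diff S' l ≡ 0ℤ
    relation-transfer {s} {s'} {ε} S S' ∑ε c n ∑c h l = *-cancelˡ′ m m≢0 (trans (rescaled s' S' l) (trans (∑-zero (λ j → trans (cong (λ z → z * s' j l) (zero-coeff j)) (ℤ.*-zeroˡ (s' j l)))) (sym (ℤ.*-zeroʳ m))))
      where
      open ≡-Reasoning
      alg : ∀ m c s n e → m * (c * s) + n * (e * s) ≡ (m * c + n * e) * s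
      alg = solve-∀
      alg2 : ∀ m a n x → m * (a + n * x) ≡ m * a + n * (m * x)
      alg2 = solve-∀
      rescaled : ∀ (t : Matrix (suc d) d) (R : SignLattice m t ε) l → m * (∑ (λ j → c j * t j l) + n * SignLattice.diff R l) ≡ ∑ (λ j → (m * c j + n * ε j) * t j l)
      rescaled t R l = begin
        m * (∑ (λ j → c j * t j l) + n * SignLattice.diff R l) ≡⟨ alg2 m (∑ (λ j → c j * t j l)) n (SignLattice.diff R l) ⟩
        m * ∑ (λ j → c j * t j l) + n * (m * SignLattice.diff R l) ≡⟨ cong (λ z → m * ∑ (λ j → c j * t j l) + n * z) (sym (SignLattice.diff-eq R l)) ⟩
        m * ∑ (λ j → c j * t j l) + n * ∑ (λ j → ε j * t j l) ≡⟨ sym (∑-lin m n (λ j → c j * t j l) (λ j → ε j * t j l)) ⟩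
        ∑ (λ j → m * (c j * t j l) + n * (ε j * t j l)) ≡⟨ ∑-cong (λ j → alg m (c j) (t j l) n (ε j)) ⟩
        ∑ (λ j → (m * c j + n * ε j) * t j l) ∎
      zero-coeff : ∀ j → m * c j + n * ε j ≡ 0ℤ
      zero-coeff = SignLattice.affine-independent S (λ j → m * c j + n * ε j) (trans (∑-lin m n c ε) (trans (cong₂ (λ x y → m * x + n * y) ∑c ∑ε) (cong₂ _+_ (ℤ.*-zeroʳ m) (ℤ.*-zeroʳ n))))
        (λ l → trans (sym (rescaled s S l)) (trans (cong (λ z → m * z) (h l)) (ℤ.*-zeroʳ m)))

    module Transfer {s s' : Matrix (suc d) d} {ε : Fin (suc d) → ℤ} (S : SignLattice m s ε) (S' : SignLattice m s' ε) (∑ε : ∑ ε ≡ 0ℤ) where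
      private
        module S = SignLattice S
        module S' = SignLattice S'

      Represents′ : (Fin d → ℤ) → (Fin (suc d) → ℤ) → ℤ → Set
      Represents′ x c n = ∑ c ≡ 0ℤ × (∀ l → ∑ (λ j → c j * s j l) + n * S.diff l ≡ x l)

      image : (Fin (suc d) → ℤ) → ℤ → Fin d → ℤ
      image c n l = ∑ (λ j → c j * s' j l) + n * S'.diff l

      -- The linear map that carries edges of s to edges of s' and `S.diff` to `S'.diff`. Its
      -- columns come from one chosen representation of each unit vector; by `matrix-image` the
      -- choice is immaterial.
      matrix : Matrix d d
      matrix i a = let (c , n , _) = S.generates (δ a) 0ℤ in image c n i

      -- Combining the representations of the unit vectors gives a second representation of x; the
      -- difference of the two is a relation, and relations transfer.
      matrix-image : ∀ {x c n} → Represents′ x c n → ∀ i → apply matrix x i ≡ image c n i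
      matrix-image {x} {c} {n} (∑c , h) i = trans lhs (alg-eq (relation-transfer S S' ∑ε c̃ ñ ∑c̃ rel i))
        where
        open ≡-Reasoning
        C : Fin d → Fin (suc d) → ℤ
        C a = proj₁ (S.generates (δ a) 0ℤ)
        n' : Fin d → ℤ
        n' a = proj₁ (proj₂ (S.generates (δ a) 0ℤ))
        ∑C : ∀ a → ∑ (C a) ≡ 0ℤ
        ∑C a = proj₁ (proj₂ (proj₂ (S.generates (δ a) 0ℤ)))
        hC : ∀ a l → ∑ (λ j → C a j * s j l) + n' a * S.diff l ≡ δ a l
        hC a = proj₂ (proj₂ (proj₂ (S.generates (δ a) 0ℤ)))
        cx : Fin (suc d) → ℤ
        cx j = ∑ (λ a → x a * C a j)
        nx = ∑ (λ a → x a * n' a)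
        c̃ : Fin (suc d) → ℤ
        c̃ j = cx j - c j
        ñ = nx - n
        combine : ∀ (t : Matrix (suc d) d) (D : Fin d → ℤ) l → ∑ (λ a → x a * (∑ (λ j → C a j * t j l) + n' a * D l)) ≡ ∑ (λ j → cx j * t j l) + nx * D l
        combine t D l = begin
          ∑ (λ a → x a * (∑ (λ j → C a j * t j l) + n' a * D l)) ≡⟨ ∑-cong (λ a → trans (alg1 (x a) (∑ (λ j → C a j * t j l)) (n' a) (D l)) (cong (λ z → z + x a * n' a * D l) (*-∑ (x a) (λ j → C a j * t j l)))) ⟩
          ∑ (λ a → ∑ (λ j → x a * (C a j * t j l)) + x a * n' a * D l) ≡⟨ ∑-+ (λ a → ∑ (λ j → x a * (C a j * t j l))) (λ a → x a * n' a * D l) ⟩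
          ∑ (λ a → ∑ (λ j → x a * (C a j * t j l))) + ∑ (λ a → x a * n' a * D l)
            ≡⟨ cong₂ _+_ (trans (∑-swap (λ a j → x a * (C a j * t j l))) (∑-cong (λ j → trans (∑-cong (λ a → sym (ℤ.*-assoc (x a) (C a j) (t j l)))) (sym (∑-* (t j l) (λ a → x a * C a j))))))
               (sym (∑-* (D l) (λ a → x a * n' a))) ⟩
          ∑ (λ j → cx j * t j l) + nx * D l ∎
          where
          alg1 : ∀ x a n y → x * (a + n * y) ≡ x * a + x * n * y
          alg1 = solve-∀
        lhs : apply matrix x i ≡ ∑ (λ j → cx j * s' j i) + nx * S'.diff i
        lhs = trans (∑-cong (λ a → ℤ.*-comm (matrix i a) (x a))) (combine s' S'.diff i)
        split : ∀ (t : Matrix (suc d) d) (D : Fin d → ℤ) l → ∑ (λ j → c̃ j * t j l) + ñ * D l ≡ (∑ (λ j → cx j * t j l) + nx * D l) - (∑ (λ j → c j * t j l) + n * D l)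
        split t D l = trans (cong (λ z → z + ñ * D l) (trans (∑-cong (λ j → alg (cx j) (c j) (t j l))) (∑-sub (λ j → cx j * t j l) (λ j → c j * t j l))))
          (alg2 (∑ (λ j → cx j * t j l)) (∑ (λ j → c j * t j l)) nx n (D l))
          where
          alg : ∀ a b c → (a - b) * c ≡ a * c - b * c
          alg = solve-∀
          alg2 : ∀ a b x y z → a - b + (x - y) * z ≡ a + x * z - (b + y * z)
          alg2 = solve-∀
        ∑c̃ : ∑ c̃ ≡ 0ℤ
        ∑c̃ = trans (∑-sub cx c) (cong₂ _-_ (trans (∑-swap (λ j a → x a * C a j)) (∑-zero (λ a → trans (sym (*-∑ (x a) (C a))) (trans (cong (λ z → x a * z) (∑C a)) (ℤ.*-zeroʳ (x a)))))) ∑c)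
        rel : ∀ l → ∑ (λ j → c̃ j * s j l) + ñ * S.diff l ≡ 0ℤ
        rel l = trans (split s S.diff l) (trans (cong₂ _-_ (trans (sym (combine s S.diff l)) (trans (∑-cong (λ a → trans (cong (λ z → x a * z) (hC a l)) (cong (λ z → x a * z) (δ-sym a l)))) (∑-δʳ l x))) (h l)) (ℤ.+-inverseʳ (x l)))
        alg-eq : ∑ (λ j → c̃ j * s' j i) + ñ * S'.diff i ≡ 0ℤ → ∑ (λ j → cx j * s' j i) + nx * S'.diff i ≡ image c n i
        alg-eq z = ℤ.i-j≡0⇒i≡j _ _ (trans (sym (split s' S'.diff i)) z)

      edge-image : ∀ i j l → apply matrix (λ l → s j l - s i l) l ≡ s' j l - s' i l
      edge-image i j l = trans (matrix-image {λ l → s j l - s i l} {c} {0ℤ} rep l) (trans (cong (λ z → z + 0ℤ * S'.diff l) (edge s' l)) (alg (s' j l - s' i l) (S'.diff l)))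
        where
        c : Fin (suc d) → ℤ
        c a = δ j a - δ i a
        alg : ∀ a b → a + 0ℤ * b ≡ a
        alg = solve-∀
        alg1 : ∀ a b c → (a - b) * c ≡ a * c - b * c
        alg1 = solve-∀
        edge : ∀ (t : Matrix (suc d) d) l → ∑ (λ a → c a * t a l) ≡ t j l - t i l
        edge t l = trans (∑-cong (λ a → alg1 (δ j a) (δ i a) (t a l))) (trans (∑-sub (λ a → δ j a * t a l) (λ a → δ i a * t a l)) (cong₂ _-_ (∑-δ j (λ a → t a l)) (∑-δ i (λ a → t a l))))
        rep : Represents′ (λ l → s j l - s i l) c 0ℤ
        rep = trans (∑-sub (δ j) (δ i)) (cong₂ _-_ (∑-δ₁ j) (∑-δ₁ i)) , λ l → trans (cong (λ z → z + 0ℤ * S.diff l) (edge s l)) (alg (s j l - s i l) (S.diff l))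

    transfer-inverse : ∀ {s s' : Matrix (suc d) d} {ε} (S : SignLattice m s ε) (S' : SignLattice m s' ε) (∑ε : ∑ ε ≡ 0ℤ) →
      (Transfer.matrix S S' ∑ε ⊡ Transfer.matrix S' S ∑ε) ≈ δ
    transfer-inverse S S' ∑ε i a = let (c , n , ∑c , h) = SignLattice.generates S' (δ a) 0ℤ in
      trans (Transfer.matrix-image S S' ∑ε {λ l → Transfer.matrix S' S ∑ε l a} {c} {n} (∑c , λ l → refl) i) (trans (h i) (δ-sym a i))

  -- Convex hulls under affine maps

  hull-cong : ∀ {n d} {v w : Matrix n d} {X Y : Fin d → ℤ} {q} → v ≈ w → (∀ l → X l ≡ Y l) → InHull v X q → InHull w Y q
  hull-cong e f (hull r hr W nn s c) = hull r hr W nn s (λ l → trans (∑-cong (λ j → cong (λ z → W j * z) (sym (e j l)))) (trans (c l) (cong (λ z → r * z) (f l))))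

  hull-map : ∀ {n d} {v v' : Matrix n d} (A : Matrix d d) (c : Fin d → ℤ) (π : Permutation n n) →
    (∀ j i → apply A (v (π ⟨$⟩ʳ j)) i + c i ≡ v' j i) → ∀ {X q} → InHull v X q → InHull v' (λ i → apply A X i + q * c i) q
  hull-map {v = v} {v'} A c π h {X} {q} (hull r hr W nn sW cW) = hull r hr (λ j → W (π ⟨$⟩ʳ j)) (λ j → nn (π ⟨$⟩ʳ j)) (trans (sym (∑-permute W π)) sW) λ i → begin
    ∑ (λ j → W (π ⟨$⟩ʳ j) * v' j i) ≡⟨ ∑-cong (λ j → trans (cong (λ z → W (π ⟨$⟩ʳ j) * z) (sym (h j i))) (ℤ.*-distribˡ-+ (W (π ⟨$⟩ʳ j)) (apply A (v (π ⟨$⟩ʳ j)) i) (c i))) ⟩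
    ∑ (λ j → W (π ⟨$⟩ʳ j) * apply A (v (π ⟨$⟩ʳ j)) i + W (π ⟨$⟩ʳ j) * c i) ≡⟨ ∑-+ (λ j → W (π ⟨$⟩ʳ j) * apply A (v (π ⟨$⟩ʳ j)) i) (λ j → W (π ⟨$⟩ʳ j) * c i) ⟩
    ∑ (λ j → W (π ⟨$⟩ʳ j) * apply A (v (π ⟨$⟩ʳ j)) i) + ∑ (λ j → W (π ⟨$⟩ʳ j) * c i)
      ≡⟨ cong₂ _+_ (sym (∑-permute (λ j → W j * apply A (v j) i) π)) (trans (sym (∑-permute (λ j → W j * c i) π)) (sym (∑-* (c i) W))) ⟩
    ∑ (λ j → W j * apply A (v j) i) + ∑ W * c i ≡⟨ cong₂ (λ x y → x + y * c i) (sym (apply-linear A _ W v i)) sW ⟩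
    apply A (λ l → ∑ (λ j → W j * v j l)) i + r * q * c i ≡⟨ cong (λ z → z + r * q * c i) (trans (apply-cong A cW i) (trans (∑-cong (λ l → alg (A i l) r (X l))) (sym (*-∑ r (λ l → A i l * X l))))) ⟩
    r * apply A X i + r * q * c i ≡⟨ alg2 r (apply A X i) q (c i) ⟩
    r * (apply A X i + q * c i) ∎
    where
    open ≡-Reasoning
    alg : ∀ a r x → a * (r * x) ≡ r * (a * x)
    alg = solve-∀
    alg2 : ∀ r a q c → r * a + r * q * c ≡ r * (a + q * c)
    alg2 = solve-∀

  -- The signs of the special simplex: -1 at the vertices 0, e_1, ..., e_{k-1} and 1 at the others.
  -- With them the signed sum of its vertices is m (e_k + ... + e_d).
  half-sign : ∀ {n} → ℕ → Fin n → ℤ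
  half-sign k j with toℕ j ℕ.<? k
  ... | yes _ = - 1ℤ
  ... | no _ = 1ℤ

  half-sign± : ∀ {n} k (j : Fin n) → Sign± (half-sign k j)
  half-sign± k j with toℕ j ℕ.<? k
  ... | yes _ = inj₂ refl
  ... | no _ = inj₁ refl

  half-sign-low : ∀ {n} k (j : Fin n) → toℕ j ℕ.< k → half-sign k j ≡ - 1ℤ
  half-sign-low k j lt with toℕ j ℕ.<? k
  ... | yes _ = refl
  ... | no n = ⊥-elim (n lt)

  half-sign-high : ∀ {n} k (j : Fin n) → ¬ (toℕ j ℕ.< k) → half-sign k j ≡ 1ℤ
  half-sign-high k j nlt with toℕ j ℕ.<? k
  ... | yes lt = ⊥-elim (nlt lt)
  ... | no _ = refl

  half-sign-suc : ∀ {n} k (j : Fin n) → half-sign (suc k) (suc j) ≡ half-sign k j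
  half-sign-suc k j with toℕ j ℕ.<? k
  ... | yes lt = half-sign-low (suc k) (suc j) (ℕ.s≤s lt)
  ... | no n = half-sign-high (suc k) (suc j) (λ { (ℕ.s≤s lt) → n lt })

  ∑-half-sign : ∀ a b → ∑ {a ℕ.+ b} (half-sign a) ≡ ℤ.+ b - ℤ.+ a
  ∑-half-sign zero b = trans (∑-cong {b} (λ j → half-sign-high 0 j (λ ()))) (trans (∑-one b) (sym (ℤ.+-identityʳ (ℤ.+ b))))
  ∑-half-sign (suc a) b = trans (∑-suc {a ℕ.+ b} (half-sign (suc a))) (trans (cong₂ _+_ (half-sign-low {suc (a ℕ.+ b)} (suc a) zero (ℕ.s≤s ℕ.z≤n)) (trans (∑-cong (half-sign-suc {a ℕ.+ b} a)) (∑-half-sign a b)))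
    (trans (alg (ℤ.+ a) (ℤ.+ b)) (cong (λ z → ℤ.+ b - z) (sym (ℤ.pos-+ 1 a)))))
    where
    alg : ∀ a b → - 1ℤ + (b - a) ≡ b - (1ℤ + a)
    alg = solve-∀

  ∑-half-sign₀ : ∀ N k → N ≡ k ℕ.+ k → ∑ {N} (half-sign k) ≡ 0ℤ
  ∑-half-sign₀ _ k refl = trans (∑-half-sign k k) (ℤ.+-inverseʳ (ℤ.+ k))

  -- The special simplex

  -- A global copy of the local `lastCoord`.
  last-coord : ℕ → ℕ → ℕ → ℕ → ℤ
  last-coord d k m i with suc i ℕ.<? k | suc i ℕ.<? d
  ... | yes _ | _ = ℤ.+ 1
  ... | no _ | yes _ = ℤ.+ (m ℕ.∸ 1)
  ... | no _ | no _ = ℤ.+ m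

  specialCoord-last : ∀ d k m j i → j ≢ 0 → j ≡ d → specialCoord d k m j i ≡ last-coord d k m i
  specialCoord-last d k m j i j≢0 j≡d with j ℕ.≟ 0 | j ℕ.≟ d
  ... | yes e | _ = ⊥-elim (j≢0 e)
  ... | no _ | no ne = ⊥-elim (ne j≡d)
  ... | no _ | yes _ with suc i ℕ.<? k | suc i ℕ.<? d
  ...   | yes _ | _ = refl
  ...   | no _ | yes _ = refl
  ...   | no _ | no _ = refl

  specialCoord-zero : ∀ d k m i → specialCoord d k m 0 i ≡ 0ℤ
  specialCoord-zero d k m i with 0 ℕ.≟ d
  ... | yes _ = refl
  ... | no _ = refl

  specialCoord-unit : ∀ d k m j i → suc j ≢ d → i ≡ j → specialCoord d k m (suc j) i ≡ 1ℤ
  specialCoord-unit d k m j i ne e with suc j ℕ.≟ d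
  ... | yes h = ⊥-elim (ne h)
  ... | no _ with suc i ℕ.≟ suc j
  ...   | yes _ = refl
  ...   | no ne' = ⊥-elim (ne' (cong suc e))

  specialCoord-off : ∀ d k m j i → suc j ≢ d → i ≢ j → specialCoord d k m (suc j) i ≡ 0ℤ
  specialCoord-off d k m j i ne ne' with suc j ℕ.≟ d
  ... | yes h = ⊥-elim (ne h)
  ... | no _ with suc i ℕ.≟ suc j
  ...   | yes e = ⊥-elim (ne' (ℕ.suc-injective e))
  ...   | no _ = refl

  module Special (d′ k m : ℕ) (k≤d : k ℕ.≤ suc d′) (1≤m : 1 ℕ.≤ m) where

    private
      d = suc d′
      M = ℤ.+ m
      s : Matrix (suc d) d
      s = entries (specialSimplex d k m)

    top : Fin d
    top = Fin.fromℕ d′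

    s≡ : ∀ j l → s j l ≡ specialCoord d k m (toℕ j) (toℕ l)
    s≡ = entries-fromEntries (λ j l → specialCoord d k m (toℕ j) (toℕ l))

    -- last vertex minus the unit vector e_d
    excess : Fin d → ℤ
    excess l with suc (toℕ l) ℕ.<? k
    ... | yes _ = 1ℤ
    ... | no _ = M - 1ℤ

    -- The vector e_k + ... + e_d, which is the `diff` of the special simplex.
    step : Fin d → ℤ
    step l with suc (toℕ l) ℕ.<? k
    ... | yes _ = 0ℤ
    ... | no _ = 1ℤ

    toℕ≢top : ∀ l → l ≢ top → suc (toℕ l) ℕ.< d
    toℕ≢top l ne = ℕ.s≤s (ℕ.≤∧≢⇒< (ℕ.≤-pred (Fin.toℕ<n l)) (λ e → ne (Fin.toℕ-injective (trans e (sym (Fin.toℕ-fromℕ d′))))))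

    last≡ : ∀ l → last-coord d k m (toℕ l) ≡ δ top l + excess l
    last≡ l with suc (toℕ l) ℕ.<? k | suc (toℕ l) ℕ.<? d
    ... | yes p | _ = trans refl (cong (_+ 1ℤ) (sym (δ-≢ (λ e → ℕ.<⇒≱ p (subst (k ℕ.≤_) (cong suc (trans (sym (Fin.toℕ-fromℕ d′)) (cong toℕ e))) k≤d)))))
    ... | no _ | yes p = trans (M-1 m 1≤m) (trans (sym (ℤ.+-identityˡ (M - 1ℤ))) (cong (_+ (M - 1ℤ)) (sym (δ-≢ (λ e → ℕ.<-irrefl (cong suc (trans (cong toℕ (sym e)) (Fin.toℕ-fromℕ d′))) p)))))
      where
      M-1 : ∀ m → 1 ℕ.≤ m → ℤ.+ (m ℕ.∸ 1) ≡ ℤ.+ m - 1ℤ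
      M-1 (suc n) _ = refl
    ... | no _ | no np = trans (alg M) (cong (_+ (M - 1ℤ)) (sym (trans (cong (λ z → δ z l) (sym l≡)) (δ-refl l))))
      where
      alg : ∀ M → M ≡ 1ℤ + (M - 1ℤ)
      alg = solve-∀
      l≡ : l ≡ top
      l≡ = by (l Fin.≟ top)
        where
        by : Dec (l ≡ top) → l ≡ top
        by (yes e) = e
        by (no ne) = ⊥-elim (np (toℕ≢top l ne))

    vertex≡ : ∀ j l → s (suc j) l ≡ δ j l + δ top j * excess l
    vertex≡ j l = trans (s≡ (suc j) l) (by (j Fin.≟ top) (j Fin.≟ l))
      where
      by : Dec (j ≡ top) → Dec (j ≡ l) → specialCoord d k m (suc (toℕ j)) (toℕ l) ≡ δ j l + δ top j * excess l
      by (yes refl) _ = trans (specialCoord-last d k m (suc (toℕ top)) (toℕ l) (λ ()) (cong suc (Fin.toℕ-fromℕ d′)))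
        (trans (last≡ l) (cong (λ z → δ top l + z) (sym (trans (cong (_* excess l) (δ-refl top)) (ℤ.*-identityˡ (excess l))))))
      by (no ne) (yes refl) = trans (specialCoord-unit d k m (toℕ j) (toℕ j) (λ e → ℕ.<⇒≢ (toℕ≢top j ne) e) refl)
        (sym (cong₂ _+_ (δ-refl j) (trans (cong (_* excess j) (δ-≢ (ne ∘ sym))) (ℤ.*-zeroˡ (excess j)))))
      by (no ne) (no ne') = trans (specialCoord-off d k m (toℕ j) (toℕ l) (λ e → ℕ.<⇒≢ (toℕ≢top j ne) e) (λ e → ne' (Fin.toℕ-injective (sym e))))
        (sym (cong₂ _+_ (δ-≢ ne') (trans (cong (_* excess l) (δ-≢ (ne ∘ sym))) (ℤ.*-zeroˡ (excess l)))))

    combine : ∀ (c : Fin (suc d) → ℤ) (l : Fin d) → ∑ (λ j → c j * s j l) ≡ c (suc l) + c (suc top) * excess l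
    combine c l = begin
      ∑ (λ j → c j * s j l) ≡⟨ ∑-suc (λ j → c j * s j l) ⟩
      c zero * s zero l + ∑ (λ j → c (suc j) * s (suc j) l)
        ≡⟨ cong₂ _+_ (trans (cong (λ z → c zero * z) (trans (s≡ zero l) (specialCoord-zero d k m (toℕ l)))) (ℤ.*-zeroʳ (c zero)))
           (∑-cong (λ j → trans (cong (λ z → c (suc j) * z) (vertex≡ j l)) (alg (c (suc j)) (δ j l) (δ top j) (excess l)))) ⟩
      0ℤ + ∑ (λ j → c (suc j) * δ j l + δ top j * (c (suc j) * excess l)) ≡⟨ ℤ.+-identityˡ _ ⟩
      ∑ (λ j → c (suc j) * δ j l + δ top j * (c (suc j) * excess l)) ≡⟨ ∑-+ (λ j → c (suc j) * δ j l) (λ j → δ top j * (c (suc j) * excess l)) ⟩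
      ∑ (λ j → c (suc j) * δ j l) + ∑ (λ j → δ top j * (c (suc j) * excess l))
        ≡⟨ cong₂ _+_ (trans (∑-cong (λ j → cong (λ z → c (suc j) * z) (δ-sym j l))) (∑-δʳ l (λ j → c (suc j)))) (∑-δ top (λ j → c (suc j) * excess l)) ⟩
      c (suc l) + c (suc top) * excess l ∎
      where
      open ≡-Reasoning
      alg : ∀ c a b e → c * (a + b * e) ≡ c * a + b * (c * e)
      alg = solve-∀

    top-high : ¬ (suc (toℕ top) ℕ.< k)
    top-high lt = ℕ.<⇒≱ lt (subst (k ℕ.≤_) (cong suc (sym (Fin.toℕ-fromℕ d′))) k≤d)

    step-top : step top ≡ 1ℤ
    step-top with suc (toℕ top) ℕ.<? k
    ... | yes p = ⊥-elim (top-high p)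
    ... | no _ = refl

    excess-top : excess top ≡ M - 1ℤ
    excess-top with suc (toℕ top) ℕ.<? k
    ... | yes p = ⊥-elim (top-high p)
    ... | no _ = refl

    signs-combine : ∀ l → half-sign {suc d} k (suc l) + 1ℤ * excess l ≡ M * step l
    signs-combine l with suc (toℕ l) ℕ.<? k
    ... | yes _ = sym (ℤ.*-zeroʳ M)
    ... | no _ = alg M
      where
      alg : ∀ M → 1ℤ + 1ℤ * (M - 1ℤ) ≡ M * 1ℤ
      alg = solve-∀

    signLattice-special : SignLattice M s (half-sign k)
    signLattice-special = record
      { diff = step
      ; diff-eq = λ l → trans (combine (half-sign k) l) (trans (cong (λ z → half-sign {suc d} k (suc l) + z * excess l) (half-sign-high k (suc top) top-high)) (signs-combine l))
      ; affine-independent = independent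
      ; generates = λ x h → coeff x h , x top , coeff-sum x h , rep x h }
      where
      open ≡-Reasoning
      M≢0 : M ≢ 0ℤ
      M≢0 e = ℕ.<⇒≢ 1≤m (sym (ℤ.+-injective e))
      independent : AffinelyIndependent s
      independent c ∑c h = λ { zero → trans (sym c₀) ∑c ; (suc l) → tail l }
        where
        alg : ∀ c M → c + c * (M - 1ℤ) ≡ c * M
        alg = solve-∀
        c-top : c (suc top) ≡ 0ℤ
        c-top = *-cancel-zero (c (suc top)) M M≢0 (trans (sym (alg (c (suc top)) M)) (trans (cong (λ z → c (suc top) + c (suc top) * z) (sym excess-top)) (trans (sym (combine c top)) (h top))))
        tail : ∀ l → c (suc l) ≡ 0ℤ
        tail l = trans (sym (trans (cong (λ z → c (suc l) + z * excess l) c-top) (trans (cong (λ z → c (suc l) + z) (ℤ.*-zeroˡ (excess l))) (ℤ.+-identityʳ (c (suc l)))))) (trans (sym (combine c l)) (h l))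
        c₀ : ∑ c ≡ c zero
        c₀ = trans (∑-suc c) (trans (cong (λ z → c zero + z) (∑-zero tail)) (ℤ.+-identityʳ (c zero)))
      -- Subtracting x_d times `step` makes the last coordinate 0. The last vertex thus gets
      -- coefficient 0, the unit vectors account for the remaining coordinates, and vertex 0 adjusts
      -- the sum.
      coeff : (Fin d → ℤ) → ℤ → Fin (suc d) → ℤ
      coeff x h zero = h - ∑ (λ l → x l - x top * step l)
      coeff x h (suc l) = x l - x top * step l
      alg0 : ∀ a b → a - b + b ≡ a
      alg0 = solve-∀
      coeff-sum : ∀ (x : Fin d → ℤ) h → ∑ (coeff x h) ≡ h
      coeff-sum x h = trans (∑-suc (coeff x h)) (alg0 h (∑ (λ l → x l - x top * step l)))
      rep : ∀ (x : Fin d → ℤ) h l → ∑ (λ j → coeff x h j * s j l) + x top * step l ≡ x l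
      rep x h l = begin
        ∑ (λ j → coeff x h j * s j l) + x top * step l ≡⟨ cong (λ z → z + x top * step l) (combine (coeff x h) l) ⟩
        x l - x top * step l + (x top - x top * step top) * excess l + x top * step l ≡⟨ cong (λ z → x l - x top * step l + (x top - x top * z) * excess l + x top * step l) step-top ⟩
        x l - x top * step l + (x top - x top * 1ℤ) * excess l + x top * step l ≡⟨ alg (x l) (x top) (step l) (excess l) ⟩
        x l ∎
        where
        alg : ∀ a t s e → a - t * s + (t - t * 1ℤ) * e + t * s ≡ a
        alg = solve-∀

  -- Sign lattices and unimodular equivalence

  hull-Represents : ∀ {d n} (V : Vec (ZPt d) n) x {X q} → 0ℤ < q → Represents x X q → InConv V x → InHull (entries V) X q
  hull-Represents V x {X} {q} hq rx h = proj₁ (conv⇒hull V x X q hq rx h)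

  signLattice⇒unimodEquiv : ∀ {d} {m : ℤ} (m≢0 : m ≢ 0ℤ) (V W : Vec (ZPt d) (suc d)) {ε} (∑ε : ∑ ε ≡ 0ℤ) (π : Permutation (suc d) (suc d)) →
    SignLattice m (λ j → entries V (π ⟨$⟩ʳ j)) ε → SignLattice m (entries W) ε → UnimodEquiv V W
  signLattice⇒unimodEquiv {d} m≢0 V W {ε} ∑ε π S S' = U , U⁻¹ , tabulate c , inverse A B U U⁻¹ (entries-fromEntries A) (entries-fromEntries B) (transfer-inverse m≢0 S S' ∑ε)
      , inverse B A U⁻¹ U (entries-fromEntries B) (entries-fromEntries A) (transfer-inverse m≢0 S' S ∑ε) , λ x → forth x , back x
    where
    open ≡-Reasoning
    v = entries V
    w = entries W
    A = Transfer.matrix m≢0 S S' ∑ε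
    B = Transfer.matrix m≢0 S' S ∑ε
    BA : (B ⊡ A) ≈ δ
    BA = transfer-inverse m≢0 S' S ∑ε
    U = fromEntries A
    U⁻¹ = fromEntries B
    v₀ : Fin d → ℤ
    v₀ = v (π ⟨$⟩ʳ zero)
    c c⁻ : Fin d → ℤ
    c i = w zero i - apply A v₀ i
    c⁻ i = - apply B c i
    inverse : ∀ (A B : Matrix d d) (U V : Mat d) → entries U ≈ A → entries V ≈ B → (A ⊡ B) ≈ δ → matMul U V ≡ idMat d
    inverse A B U V eU eV h = entries-injective (λ i j → trans (entries-matMul U V i j) (trans (∑-cong (λ l → cong₂ _*_ (eU i l) (eV l j))) (trans (h i j) (sym (entries-idMat d i j)))))
    vertex-image : ∀ j i → apply A (v (π ⟨$⟩ʳ j)) i + c i ≡ w j i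
    vertex-image j i = trans (alg1 (apply A (v (π ⟨$⟩ʳ j)) i) (w zero i) (apply A v₀ i)) (trans (cong (λ z → z + w zero i) (trans (sym (apply-lin₂ A 1ℤ (- 1ℤ) (v (π ⟨$⟩ʳ j)) v₀ i))
        (trans (apply-cong A (λ l → alg2 (v (π ⟨$⟩ʳ j) l) (v₀ l)) i) (Transfer.edge-image m≢0 S S' ∑ε zero j i)))) (alg3 (w j i) (w zero i)))
      where
      alg1 : ∀ a w b → a + (w - b) ≡ 1ℤ * a + - 1ℤ * b + w
      alg1 = solve-∀
      alg2 : ∀ a b → 1ℤ * a + - 1ℤ * b ≡ a - b
      alg2 = solve-∀
      alg3 : ∀ a b → a - b + b ≡ a
      alg3 = solve-∀
    BAx : ∀ x i → apply B (apply A x) i ≡ x i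
    BAx x i = trans (sym (apply-⊡ B A x i)) (apply-id BA x i)
    vertex-back : ∀ j i → apply B (w (Perm.flip π ⟨$⟩ʳ j)) i + c⁻ i ≡ v j i
    vertex-back j i = begin
      apply B (w j') i + c⁻ i ≡⟨ cong (λ z → z + c⁻ i) (apply-cong B (λ l → trans (sym (vertex-image j' l)) (alg (apply A (v (π ⟨$⟩ʳ j')) l) (c l))) i) ⟩
      apply B (λ l → 1ℤ * apply A (v (π ⟨$⟩ʳ j')) l + 1ℤ * c l) i + c⁻ i ≡⟨ cong (λ z → z + c⁻ i) (apply-lin₂ B 1ℤ 1ℤ (apply A (v (π ⟨$⟩ʳ j'))) c i) ⟩
      1ℤ * apply B (apply A (v (π ⟨$⟩ʳ j'))) i + 1ℤ * apply B c i + - apply B c i ≡⟨ cong (λ z → 1ℤ * z + 1ℤ * apply B c i + - apply B c i) (BAx (v (π ⟨$⟩ʳ j')) i) ⟩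
      1ℤ * v (π ⟨$⟩ʳ j') i + 1ℤ * apply B c i + - apply B c i ≡⟨ alg5 (v (π ⟨$⟩ʳ j') i) (apply B c i) ⟩
      v (π ⟨$⟩ʳ j') i ≡⟨ cong (λ z → v z i) (Perm.inverseʳ π) ⟩
      v j i ∎
      where
      j' = π ⟨$⟩ˡ j
      alg : ∀ a c → a + c ≡ 1ℤ * a + 1ℤ * c
      alg = solve-∀
      alg5 : ∀ x y → 1ℤ * x + 1ℤ * y + - y ≡ x
      alg5 = solve-∀
    image-rep : ∀ x X q → Represents x X q → Represents (affMapQ U (tabulate c) x) (λ i → apply A X i + q * c i) q
    image-rep x X q rx i = trans (represents-affMapQ U (tabulate c) x X q rx i) (cong toQ (cong₂ (λ y z → y + q * z) (∑-cong (λ l → cong (λ z → z * X l) (entries-fromEntries A i l))) (Vec.lookup∘tabulate c i)))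
    forth : ∀ x → InConv V x → InConv W (affMapQ U (tabulate c) x)
    forth x h = let (q , hq , X , rx) = common-denominator x in
      hull⇒conv W (affMapQ U (tabulate c) x) (λ i → apply A X i + q * c i) q hq (image-rep x X q rx) (hull-map A c π vertex-image (hull-Represents V x hq rx h))
    back : ∀ x → InConv W (affMapQ U (tabulate c) x) → InConv V x
    back x h = let (q , hq , X , rx) = common-denominator x in
      hull⇒conv V x X q hq rx (hull-cong (λ i j → refl) (undo X q) (hull-map B c⁻ (Perm.flip π) vertex-back (hull-Represents W (affMapQ U (tabulate c) x) hq (image-rep x X q rx) h)))
      where
      undo : ∀ X q i → apply B (λ i → apply A X i + q * c i) i + q * c⁻ i ≡ X i
      undo X q i = trans (cong (λ z → z + q * c⁻ i) (trans (apply-cong B (λ l → alg (apply A X l) q (c l)) i) (apply-lin₂ B 1ℤ q (apply A X) c i)))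
        (trans (cong (λ z → 1ℤ * z + q * apply B c i + q * - apply B c i) (BAx X i)) (alg2 (X i) q (apply B c i)))
        where
        alg : ∀ a q c → a + q * c ≡ 1ℤ * a + q * c
        alg = solve-∀
        alg2 : ∀ x q y → 1ℤ * x + q * y + q * - y ≡ x
        alg2 = solve-∀

  -- `UnimodEquiv` compares convex hulls and does not match vertices. So the preimages of the
  -- vertices of W are taken as a simplex `V′` of its own: it has the same hull as V and inherits
  -- the sign lattice of W.
  module PullBack {d : ℕ} {m : ℤ} (V W : Vec (ZPt d) (suc d)) {ε : Fin (suc d) → ℤ} (∑ε : ∑ ε ≡ 0ℤ) (S : SignLattice m (entries W) ε) (equiv : UnimodEquiv V W) where
    private
      U = proj₁ equiv
      U⁻¹ = proj₁ (proj₂ equiv)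
      A = entries U
      B = entries U⁻¹
      c = lookup (proj₁ (proj₂ (proj₂ equiv)))
      module S = SignLattice S
      w = entries W
      to-matrix : ∀ X Y → matMul X Y ≡ idMat d → (entries X ⊡ entries Y) ≈ δ
      to-matrix X Y e i j = trans (sym (entries-matMul X Y i j)) (trans (cong (λ Z → entries Z i j) e) (entries-idMat d i j))
      AB : (A ⊡ B) ≈ δ
      AB = to-matrix U U⁻¹ (proj₁ (proj₂ (proj₂ (proj₂ equiv))))
      BA : (B ⊡ A) ≈ δ
      BA = to-matrix U⁻¹ U (proj₁ (proj₂ (proj₂ (proj₂ (proj₂ equiv)))))
      ABx : ∀ x i → apply A (apply B x) i ≡ x i
      ABx x i = trans (sym (apply-⊡ A B x i)) (apply-id AB x i)
      BAx : ∀ x i → apply B (apply A x) i ≡ x i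
      BAx x i = trans (sym (apply-⊡ B A x i)) (apply-id BA x i)
      c⁻ : Fin d → ℤ
      c⁻ i = - apply B c i

    v′ : Matrix (suc d) d
    v′ j i = apply B (w j) i + c⁻ i

    V′ : Vec (ZPt d) (suc d)
    V′ = fromEntries v′

    private
      entries-V′ : entries V′ ≈ v′
      entries-V′ = entries-fromEntries v′

      comb-v′ : ∀ (a : Fin (suc d) → ℤ) (l : Fin d) → ∑ (λ j → a j * v′ j l) ≡ apply B (λ i → ∑ (λ j → a j * w j i)) l + ∑ a * c⁻ l
      comb-v′ a l = trans (∑-cong (λ j → ℤ.*-distribˡ-+ (a j) (apply B (w j) l) (c⁻ l))) (trans (∑-+ (λ j → a j * apply B (w j) l) (λ j → a j * c⁻ l))
        (cong₂ _+_ (sym (apply-linear B _ a w l)) (sym (∑-* (c⁻ l) a))))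

    signLattice′ : SignLattice m (entries V′) ε
    signLattice′ = record
      { diff = apply B S.diff
      ; diff-eq = λ l → trans (∑-cong (λ j → cong (λ z → ε j * z) (entries-V′ j l))) (trans (comb-v′ ε l) (trans (cong₂ (λ x y → x + y * c⁻ l) (trans (apply-cong B S.diff-eq l) (scalar m S.diff l)) ∑ε) (alg (m * apply B S.diff l) (c⁻ l))))
      ; affine-independent = λ a ∑a h → S.affine-independent a ∑a λ i → begin
          ∑ (λ j → a j * w j i) ≡⟨ sym (ABx (λ i → ∑ (λ j → a j * w j i)) i) ⟩
          apply A (apply B (λ i → ∑ (λ j → a j * w j i))) i ≡⟨ apply-cong A (λ l → trans (sym (alg (apply B (λ i → ∑ (λ j → a j * w j i)) l) (c⁻ l))) (trans (cong (λ z → apply B (λ i → ∑ (λ j → a j * w j i)) l + z * c⁻ l) (sym ∑a)) (trans (sym (comb-v′ a l)) (trans (∑-cong (λ j → cong (λ z → a j * z) (sym (entries-V′ j l)))) (h l))))) i ⟩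
          apply A (λ _ → 0ℤ) i ≡⟨ ∑-zero (λ l → ℤ.*-zeroʳ (A i l)) ⟩
          0ℤ ∎
      ; generates = λ x h → let (a , n , ∑a , e) = S.generates (λ i → 1ℤ * apply A x i + h * c i) h in a , n , ∑a , λ l → begin
          ∑ (λ j → a j * entries V′ j l) + n * apply B S.diff l ≡⟨ cong (λ z → z + n * apply B S.diff l) (trans (∑-cong (λ j → cong (λ z → a j * z) (entries-V′ j l))) (comb-v′ a l)) ⟩
          apply B (λ i → ∑ (λ j → a j * w j i)) l + ∑ a * c⁻ l + n * apply B S.diff l ≡⟨ cong (λ z → apply B (λ i → ∑ (λ j → a j * w j i)) l + z * c⁻ l + n * apply B S.diff l) ∑a ⟩
          apply B (λ i → ∑ (λ j → a j * w j i)) l + h * c⁻ l + n * apply B S.diff l ≡⟨ alg3 (apply B (λ i → ∑ (λ j → a j * w j i)) l) (h * c⁻ l) (n * apply B S.diff l) ⟩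
          1ℤ * apply B (λ i → ∑ (λ j → a j * w j i)) l + n * apply B S.diff l + h * c⁻ l ≡⟨ cong (λ z → z + h * c⁻ l) (trans (sym (apply-lin₂ B 1ℤ n (λ i → ∑ (λ j → a j * w j i)) S.diff l)) (apply-cong B (λ i → trans (alg4 (∑ (λ j → a j * w j i)) (n * S.diff i)) (e i)) l)) ⟩
          apply B (λ i → 1ℤ * apply A x i + h * c i) l + h * c⁻ l ≡⟨ cong (λ z → z + h * c⁻ l) (trans (apply-lin₂ B 1ℤ h (apply A x) c l) (cong (λ z → 1ℤ * z + h * apply B c l) (BAx x l))) ⟩
          1ℤ * x l + h * apply B c l + h * - apply B c l ≡⟨ alg5 (x l) h (apply B c l) ⟩
          x l ∎ }
      where
      open ≡-Reasoning
      alg : ∀ a b → a + 0ℤ * b ≡ a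
      alg = solve-∀
      alg3 : ∀ a b c → a + b + c ≡ 1ℤ * a + c + b
      alg3 = solve-∀
      alg4 : ∀ a b → 1ℤ * a + b ≡ a + b
      alg4 = solve-∀
      alg5 : ∀ x h y → 1ℤ * x + h * y + h * - y ≡ x
      alg5 = solve-∀
      alg6 : ∀ a m x → a * (m * x) ≡ m * (a * x)
      alg6 = solve-∀
      scalar : ∀ m (x : Fin d → ℤ) l → apply B (λ i → m * x i) l ≡ m * apply B x l
      scalar m x l = trans (∑-cong (λ i → alg6 (B l i) m (x i))) (sym (*-∑ m (λ i → B l i * x i)))

    private
      image-rep : ∀ x X q → Represents x X q → Represents (affMapQ U (proj₁ (proj₂ (proj₂ equiv))) x) (λ i → apply A X i + q * c i) q
      image-rep x X q rx = represents-affMapQ U (proj₁ (proj₂ (proj₂ equiv))) x X q rx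

      w-image : ∀ j i → apply A (entries V′ (Perm.id ⟨$⟩ʳ j)) i + c i ≡ w j i
      w-image j i = trans (cong (λ z → z + c i) (trans (apply-cong A (λ l → trans (entries-V′ j l) (alg (apply B (w j) l) (apply B c l))) i) (apply-lin₂ A 1ℤ (- 1ℤ) (apply B (w j)) (apply B c) i)))
        (trans (cong₂ (λ x y → 1ℤ * x + - 1ℤ * y + c i) (ABx (w j) i) (ABx c i)) (alg2 (w j i) (c i)))
        where
        alg : ∀ a b → a + - b ≡ 1ℤ * a + - 1ℤ * b
        alg = solve-∀
        alg2 : ∀ a b → 1ℤ * a + - 1ℤ * b + b ≡ a
        alg2 = solve-∀

      v′-back : ∀ j i → apply B (w (Perm.id ⟨$⟩ʳ j)) i + c⁻ i ≡ entries V′ j i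
      v′-back j i = sym (entries-V′ j i)

      undo : ∀ X q i → apply B (λ i → apply A X i + q * c i) i + q * c⁻ i ≡ X i
      undo X q i = trans (cong (λ z → z + q * c⁻ i) (trans (apply-cong B (λ l → alg (apply A X l) q (c l)) i) (apply-lin₂ B 1ℤ q (apply A X) c i)))
        (trans (cong (λ z → 1ℤ * z + q * apply B c i + q * - apply B c i) (BAx X i)) (alg2 (X i) q (apply B c i)))
        where
        alg : ∀ a q c → a + q * c ≡ 1ℤ * a + q * c
        alg = solve-∀
        alg2 : ∀ x q y → 1ℤ * x + q * y + q * - y ≡ x
        alg2 = solve-∀

      hull-equiv : ∀ x → (InConv V x → InConv W (affMapQ U (proj₁ (proj₂ (proj₂ equiv))) x)) × (InConv W (affMapQ U (proj₁ (proj₂ (proj₂ equiv))) x) → InConv V x)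
      hull-equiv = proj₂ (proj₂ (proj₂ (proj₂ (proj₂ equiv))))

    V⇒V′ : ∀ {X q} → 0ℤ < q → InHull (entries V) X q → InHull (entries V′) X q
    V⇒V′ {X} {q} hq h = let (x , rx) = fraction X q hq in
      hull-cong (λ i j → refl) (undo X q) (hull-map B c⁻ Perm.id v′-back (hull-Represents W _ hq (image-rep x X q rx) (proj₁ (hull-equiv x) (hull⇒conv V x X q hq rx h))))

    V′⇒V : ∀ {X q} → 0ℤ < q → InHull (entries V′) X q → InHull (entries V) X q
    V′⇒V {X} {q} hq h = let (x , rx) = fraction X q hq in
      hull-Represents V x hq rx (proj₂ (hull-equiv x) (hull⇒conv W _ (λ i → apply A X i + q * c i) q hq (image-rep x X q rx) (hull-map A c Perm.id w-image h)))

  module Dilate {d n : ℕ} (k : ℕ) (1≤k : 1 ℕ.≤ k) where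
    private
      K = ℤ.+ k
      hK : 0ℤ < K
      hK = ℤ.+<+ 1≤k

    undilate : ∀ (V : Vec (ZPt d) n) {X q} → InHull (entries (dilate k V)) X q → InHull (entries V) X (K * q)
    undilate V {X} {q} (hull r hr W nn sW cW) = hull r hr (λ j → K * W j) (λ j → 0≤-* {K} {W j} (ℤ.<⇒≤ hK) (nn j)) (trans (sym (*-∑ K W)) (trans (cong (λ z → K * z) sW) (alg K r q)))
      (λ l → trans (∑-cong (λ j → trans (alg2 K (W j) (entries V j l)) (cong (λ z → W j * z) (sym (entries-dilate k V j l))))) (cW l))
      where
      alg : ∀ K r q → K * (r * q) ≡ r * (K * q)
      alg = solve-∀
      alg2 : ∀ K w v → K * w * v ≡ w * (K * v)
      alg2 = solve-∀

    redilate : ∀ (V : Vec (ZPt d) n) {X q} → InHull (entries V) X (K * q) → InHull (entries (dilate k V)) X q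
    redilate V {X} {q} (hull r hr W nn sW cW) = hull (r * K) (0<-* hr hK) W nn (trans sW (sym (ℤ.*-assoc r K q)))
      (λ l → trans (∑-cong (λ j → trans (cong (λ z → W j * z) (entries-dilate k V j l)) (alg2 K (W j) (entries V j l)))) (trans (sym (*-∑ K (λ j → W j * entries V j l))) (trans (cong (λ z → K * z) (cW l)) (alg K r (X l)))))
      where
      alg : ∀ K r x → K * (r * x) ≡ r * K * x
      alg = solve-∀
      alg2 : ∀ K w v → w * (K * v) ≡ K * (w * v)
      alg2 = solve-∀

  -- Freudenthal simplices

  gt : ∀ {n} → Fin n → Fin n → ℤ
  gt zero t = 0ℤ
  gt (suc s) zero = 1ℤ
  gt (suc s) (suc t) = gt s t

  gt-01 : ∀ {n} (s t : Fin n) → gt s t ≡ 0ℤ ⊎ gt s t ≡ 1ℤ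
  gt-01 zero t = inj₁ refl
  gt-01 (suc s) zero = inj₂ refl
  gt-01 (suc s) (suc t) = gt-01 s t

  0≤gt : ∀ {n} (s t : Fin n) → 0ℤ ≤ gt s t
  0≤gt zero t = ℤ.≤-refl
  0≤gt (suc s) zero = ℤ.+≤+ ℕ.z≤n
  0≤gt (suc s) (suc t) = 0≤gt s t

  gt≤1 : ∀ {n} (s t : Fin n) → gt s t ≤ 1ℤ
  gt≤1 zero t = ℤ.+≤+ ℕ.z≤n
  gt≤1 (suc s) zero = ℤ.≤-refl
  gt≤1 (suc s) (suc t) = gt≤1 s t

  -- `pinch t` identifies the vertices t and t + 1, so among the positions of the larger simplex
  -- exactly the one between these two is skipped.
  gt-pinch : ∀ {n} (t : Fin (suc n)) (s : Fin (suc (suc n))) (t' : Fin (suc n)) → gt (pinch t s) t' ≡ gt s (punchIn (inject₁ t) t')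
  gt-pinch t zero t' = refl
  gt-pinch zero (suc s) t' = refl
  gt-pinch {suc n} (suc t) (suc s) zero = refl
  gt-pinch {suc n} (suc t) (suc s) (suc t') = gt-pinch t s t'

  -- A code describes a Freudenthal simplex: the j-th level function takes the value b up to some vertex and b + 1 after it.
  data Code : ℕ → Set where
    [] : Code 0
    extend : ∀ {r} → Code r → ℕ → Fin (suc r) → Code (suc r)

  -- A vertex is given by levels, which will be suffix sums, with the last one normalized to 0. A
  -- new level doubles vertex t of the smaller simplex: the two copies agree in the old levels and
  -- have the values b and b + 1 in the new one.
  lev : ∀ {r} → Code r → Fin (suc r) → Fin (suc r) → ℤ
  lev [] s j = 0ℤ
  lev (extend c b t) s zero = ℤ.+ b + gt s (inject₁ t)
  lev (extend c b t) s (suc j) = lev c (pinch t s) j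

  lev-last : ∀ {r} (c : Code r) s → lev c s (fromℕ r) ≡ 0ℤ
  lev-last [] s = refl
  lev-last (extend c b t) s = lev-last c (pinch t s)

  -- Barycentric coordinates: split the t-th weight so that the weights after it sum to φ.
  split : ∀ {r} → Fin (suc r) → ℤ → (Fin (suc r) → ℤ) → Fin (suc (suc r)) → ℤ
  split zero φ w zero = ∑ w - φ
  split zero φ w (suc zero) = φ - ∑ (λ s → w (suc s))
  split zero φ w (suc (suc s)) = w (suc s)
  split {suc r} (suc t) φ w zero = w zero
  split {suc r} (suc t) φ w (suc s) = split t φ (λ s → w (suc s)) s

  -- Pinching merges the two parts of the split weight again.
  split-pinch : ∀ {r} (t : Fin (suc r)) φ w (f : Fin (suc r) → ℤ) → ∑ (λ s → split t φ w s * f (pinch t s)) ≡ ∑ (λ s → w s * f s)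
  split-pinch {r} zero φ w f = begin
    ∑ (λ s → split zero φ w s * f (pinch zero s)) ≡⟨ trans (∑-suc (λ s → split zero φ w s * f (pinch zero s))) (cong (λ z → (∑ w - φ) * f zero + z) (∑-suc (λ s → split zero φ w (suc s) * f s))) ⟩
    (∑ w - φ) * f zero + ((φ - T) * f zero + R) ≡⟨ cong (λ z → (z - φ) * f zero + ((φ - T) * f zero + R)) (∑-suc w) ⟩
    (w zero + T - φ) * f zero + ((φ - T) * f zero + R) ≡⟨ alg (w zero) T φ (f zero) R ⟩
    w zero * f zero + R ≡⟨ sym (∑-suc (λ s → w s * f s)) ⟩
    ∑ (λ s → w s * f s) ∎
    where
    open ≡-Reasoning
    T = ∑ (λ s → w (suc s))
    R = ∑ (λ s → w (suc s) * f (suc s))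
    alg : ∀ a T φ x R → (a + T - φ) * x + ((φ - T) * x + R) ≡ a * x + R
    alg = solve-∀
  split-pinch {suc r} (suc t) φ w f = trans (∑-suc (λ s → split (suc t) φ w s * f (pinch (suc t) s))) (trans (cong (λ z → w zero * f zero + z) (split-pinch t φ (λ s → w (suc s)) (λ s → f (suc s)))) (sym (∑-suc (λ s → w s * f s))))

  split-gt : ∀ {r} (t : Fin (suc r)) φ w → ∑ (λ s → split t φ w s * gt s (inject₁ t)) ≡ φ
  split-gt zero φ w = trans (∑-suc (λ s → split zero φ w s * gt s zero)) (trans (cong₂ _+_ (ℤ.*-zeroʳ (∑ w - φ)) (trans (∑-cong (λ s → ℤ.*-identityʳ (split zero φ w (suc s)))) (∑-suc (λ s → split zero φ w (suc s)))))
    (alg φ (∑ (λ s → w (suc s)))))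
    where
    alg : ∀ φ T → 0ℤ + (φ - T + T) ≡ φ
    alg = solve-∀
  split-gt {suc r} (suc t) φ w = trans (∑-suc (λ s → split (suc t) φ w s * gt s (suc (inject₁ t)))) (trans (cong₂ _+_ (ℤ.*-zeroʳ (w zero)) (split-gt t φ (λ s → w (suc s)))) (ℤ.+-identityˡ φ))

  split-total : ∀ {r} (t : Fin (suc r)) φ w → ∑ (split t φ w) ≡ ∑ w
  split-total t φ w = trans (∑-cong (λ s → sym (ℤ.*-identityʳ (split t φ w s)))) (trans (split-pinch t φ w (λ _ → 1ℤ)) (∑-cong (λ s → ℤ.*-identityʳ (w s))))

  -- Homogeneous barycentric coordinates, with sum τ, of the point with levels z: the first level is
  -- b τ plus the weight beyond its jump, and this determines the splitting.
  weights : ∀ {r} → Code r → ℤ → (Fin (suc r) → ℤ) → Fin (suc r) → ℤ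
  weights [] τ z s = τ
  weights (extend c b t) τ z = split t (z zero - ℤ.+ b * τ) (weights c τ (λ j → z (suc j)))

  weights-total : ∀ {r} (c : Code r) τ z → ∑ (weights c τ z) ≡ τ
  weights-total [] τ z = trans (∑-suc {0} (λ _ → τ)) (trans (cong (λ y → τ + y) ∑-empty) (ℤ.+-identityʳ τ))
  weights-total (extend c b t) τ z = trans (split-total t _ (weights c τ (λ j → z (suc j)))) (weights-total c τ (λ j → z (suc j)))

  weights-lev : ∀ {r} (c : Code r) τ z → z (fromℕ r) ≡ 0ℤ → ∀ j → ∑ (λ s → weights c τ z s * lev c s j) ≡ z j
  weights-lev [] τ z e zero = trans (∑-zero (λ s → ℤ.*-zeroʳ τ)) (sym e)
  weights-lev (extend c b t) τ z e zero = begin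
    ∑ (λ s → W s * (ℤ.+ b + gt s (inject₁ t))) ≡⟨ trans (∑-cong (λ s → trans (ℤ.*-distribˡ-+ (W s) (ℤ.+ b) (gt s (inject₁ t))) (cong (λ y → y + W s * gt s (inject₁ t)) (ℤ.*-comm (W s) (ℤ.+ b))))) (∑-+ (λ s → ℤ.+ b * W s) (λ s → W s * gt s (inject₁ t))) ⟩
    ∑ (λ s → ℤ.+ b * W s) + ∑ (λ s → W s * gt s (inject₁ t)) ≡⟨ cong₂ _+_ (trans (sym (*-∑ (ℤ.+ b) W)) (cong (λ y → ℤ.+ b * y) (weights-total (extend c b t) τ z))) (split-gt t (z zero - ℤ.+ b * τ) (weights c τ (λ j → z (suc j)))) ⟩
    ℤ.+ b * τ + (z zero - ℤ.+ b * τ) ≡⟨ alg (ℤ.+ b * τ) (z zero) ⟩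
    z zero ∎
    where
    open ≡-Reasoning
    W = weights (extend c b t) τ z
    alg : ∀ a b → a + (b - a) ≡ b
    alg = solve-∀
  weights-lev (extend c b t) τ z e (suc j) = trans (split-pinch t (z zero - ℤ.+ b * τ) (weights c τ (λ j → z (suc j))) (λ s → lev c s j)) (weights-lev c τ (λ j → z (suc j)) e j)

  Monotone : ∀ {r} → Code r → Set
  Monotone {r} c = ∀ s (j : Fin r) → lev c s (suc j) ≤ lev c s (inject₁ j)

  -- The smallest admissible splitting position; minimality keeps the levels monotone.
  record Splitting {r} (w : Fin (suc r) → ℤ) (φ : ℤ) : Set where
    field
      at : Fin (suc r)
      nonneg : ∀ s → 0ℤ ≤ split at φ w s
      minimal : ∀ u → ∑ (λ s → w s * gt s u) ≤ φ → ∀ s → gt (pinch at s) u ≤ gt s (inject₁ at)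

  splitting : ∀ {r} (w : Fin (suc r) → ℤ) φ → (∀ s → 0ℤ ≤ w s) → 0ℤ ≤ φ → φ ≤ ∑ w → Splitting w φ
  splitting {r} w φ w≥0 0≤φ φ≤ = by (∑ (λ s → w (suc s)) ℤ.≤? φ)
    where
    first : ∑ (λ s → w (suc s)) ≤ φ → Splitting w φ
    first le = record { at = zero
      ; nonneg = λ { zero → ℤ.i≤j⇒0≤j-i φ≤ ; (suc zero) → ℤ.i≤j⇒0≤j-i le ; (suc (suc s)) → w≥0 (suc s) }
      ; minimal = λ { u _ zero → ℤ.≤-refl ; u _ (suc s) → gt≤1 s u } }
    later : ∀ {r} (w : Fin (suc r) → ℤ) → (∀ s → 0ℤ ≤ w s) → φ < ∑ (λ s → w (suc s)) → Splitting w φ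
    later {zero} w w≥0 lt = ⊥-elim (ℤ.<⇒≱ (subst (φ <_) ∑-empty lt) 0≤φ)
    later {suc r} w w≥0 lt = record { at = suc (Splitting.at S)
      ; nonneg = λ { zero → w≥0 zero ; (suc s) → Splitting.nonneg S s }
      ; minimal = λ { zero le s → ⊥-elim (ℤ.<⇒≱ lt (subst (_≤ φ) (trans (∑-suc (λ s → w s * gt s zero)) (trans (cong₂ _+_ (ℤ.*-zeroʳ (w zero)) (∑-cong (λ s → ℤ.*-identityʳ (w (suc s))))) (ℤ.+-identityˡ _))) le))
                    ; (suc u) le zero → ℤ.≤-refl
                    ; (suc u) le (suc s) → Splitting.minimal S u (subst (_≤ φ) (trans (∑-suc (λ s → w s * gt s (suc u))) (trans (cong (λ z → z + ∑ (λ s → w (suc s) * gt s u)) (ℤ.*-zeroʳ (w zero))) (ℤ.+-identityˡ _))) le) s } }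
      where
      S : Splitting (λ s → w (suc s)) φ
      S = splitting (λ s → w (suc s)) φ (λ s → w≥0 (suc s)) 0≤φ (ℤ.<⇒≤ lt)
    by : Dec (∑ (λ s → w (suc s)) ≤ φ) → Splitting w φ
    by (yes le) = first le
    by (no gt) = later w w≥0 (ℤ.≰⇒> gt)

  -- The interval between consecutive multiples of τ that contains y. At a common endpoint the lower
  -- interval is taken, which `tight` records; so the bases of the levels inherit the order of the
  -- levels.
  record Bracket (k : ℕ) (τ y : ℤ) : Set where
    field
      b : ℕ
      b<k : b ℕ.< k
      lower : ℤ.+ b * τ ≤ y
      upper : y ≤ ℤ.+ suc b * τ
      tight : b ≡ 0 ⊎ ℤ.+ b * τ < y

  bracket : ∀ k τ y → 0ℤ ≤ y → y ≤ ℤ.+ suc k * τ → Bracket (suc k) τ y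
  bracket zero τ y 0≤y le = record { b = 0 ; b<k = ℕ.s≤s ℕ.z≤n ; lower = subst (_≤ y) (sym (ℤ.*-zeroˡ τ)) 0≤y ; upper = le ; tight = inj₁ refl }
  bracket (suc k) τ y 0≤y le = by (y ℤ.≤? ℤ.+ suc k * τ)
    where
    by : Dec (y ≤ ℤ.+ suc k * τ) → Bracket (suc (suc k)) τ y
    by (yes p) = record { b = B.b ; b<k = ℕ.<-trans B.b<k (ℕ.n<1+n (suc k)) ; lower = B.lower ; upper = B.upper ; tight = B.tight }
      where module B = Bracket (bracket k τ y 0≤y p)
    by (no np) = record { b = suc k ; b<k = ℕ.n<1+n (suc k) ; lower = ℤ.<⇒≤ (ℤ.≰⇒> np) ; upper = le ; tight = inj₂ (ℤ.≰⇒> np) }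

  data Bounded (k : ℕ) : ∀ {r} → Code r → Set where
    [] : Bounded k []
    _▹_ : ∀ {r c b t} → Bounded k {r} c → b ℕ.< k → Bounded k (extend c b t)

  -- Besides the cell, the base and the jump of its top level are remembered, because the next level
  -- has to be at least as large at every vertex.
  record Covered (k : ℕ) (τ : ℤ) {r} (z : Fin (suc r) → ℤ) : Set where
    field
      code : Code r
      bounded : Bounded k code
      monotone : Monotone code
      nonneg : ∀ s → 0ℤ ≤ weights code τ z s
      base : ℕ
      turn : Fin (suc r)
      top-level : ∀ s → lev code s zero ≡ ℤ.+ base + gt s turn
      top-value : z zero ≡ ℤ.+ base * τ + ∑ (λ s → weights code τ z s * gt s turn)
      top-tight : base ≡ 0 ⊎ ℤ.+ base * τ < z zero

  cover : ∀ k τ {r} (z : Fin (suc r) → ℤ) → 0ℤ ≤ τ → z (fromℕ r) ≡ 0ℤ → (∀ j → z (suc j) ≤ z (inject₁ j)) → z zero ≤ ℤ.+ suc k * τ → Covered (suc k) τ z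
  cover k τ {zero} z 0≤τ e dec le = record
    { code = [] ; bounded = [] ; monotone = λ s () ; nonneg = λ s → 0≤τ ; base = 0 ; turn = zero
    ; top-level = λ { zero → refl }
    ; top-value = trans e (sym (trans (cong₂ _+_ (ℤ.*-zeroˡ τ) (∑-zero {f = λ (s : Fin 1) → τ * gt s zero} (λ { zero → ℤ.*-zeroʳ τ }))) refl))
    ; top-tight = inj₁ refl }
  cover k τ {suc r} z 0≤τ e dec le = record
    { code = c′ ; bounded = C.bounded Bounded.▹ B.b<k ; monotone = mono ; nonneg = S.nonneg ; base = B.b ; turn = inject₁ S.at
    ; top-level = λ s → refl
    ; top-value = trans (sym (alg (z zero) (ℤ.+ B.b * τ))) (cong (λ y → ℤ.+ B.b * τ + y) (sym (split-gt S.at φ w)))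
    ; top-tight = B.tight }
    where
    z′ : Fin (suc r) → ℤ
    z′ j = z (suc j)
    z′₀≤ : z′ zero ≤ z zero
    z′₀≤ = dec zero
    C₀ : Covered (suc k) τ z′
    C₀ = cover k τ z′ 0≤τ e (λ j → dec (suc j)) (ℤ.≤-trans z′₀≤ le)
    module C = Covered C₀
    w = weights C.code τ z′
    0≤z′ : 0ℤ ≤ z′ zero
    0≤z′ = subst (0ℤ ≤_) (sym C.top-value) (ℤ.+-mono-≤ (0≤-* {ℤ.+ C.base} {τ} (ℤ.+≤+ ℕ.z≤n) 0≤τ) (∑-nonneg (λ s → 0≤-* (C.nonneg s) (0≤gt s C.turn))))
    module B = Bracket (bracket k τ (z zero) (ℤ.≤-trans 0≤z′ z′₀≤) le)
    φ = z zero - ℤ.+ B.b * τ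
    alg : ∀ a b → b + (a - b) ≡ a
    alg = solve-∀
    alg2 : ∀ b τ → (1ℤ + b) * τ - b * τ ≡ τ
    alg2 = solve-∀
    φ≤τ : φ ≤ ∑ w
    φ≤τ = subst (φ ≤_) (trans (trans (cong (λ y → y * τ - ℤ.+ B.b * τ) (ℤ.pos-+ 1 B.b)) (alg2 (ℤ.+ B.b) τ)) (sym (weights-total C.code τ z′))) (ℤ.+-monoˡ-≤ (- (ℤ.+ B.b * τ)) B.upper)
    S₀ : Splitting w φ
    S₀ = splitting w φ C.nonneg (ℤ.i≤j⇒0≤j-i B.lower) φ≤τ
    module S = Splitting S₀
    c′ : Code (suc r)
    c′ = extend C.code B.b S.at
    base≤ : C.base ℕ.≤ B.b
    base≤ = ℕ.≮⇒≥ λ lt → by lt C.top-tight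
      where
      by : B.b ℕ.< C.base → C.base ≡ 0 ⊎ ℤ.+ C.base * τ < z′ zero → ⊥
      by lt (inj₁ e0) = ℕ.<⇒≱ lt (subst (ℕ._≤ B.b) (sym e0) ℕ.z≤n)
      by lt (inj₂ st) = ℤ.<⇒≱ st (ℤ.≤-trans z′₀≤ (ℤ.≤-trans B.upper (ℤ.*-monoʳ-≤-nonNeg τ {{ℤ.nonNegative 0≤τ}} (ℤ.+≤+ lt))))
    -- If the bases differ, the integral values are ordered already. If they are equal, z′ ≤ z says
    -- that the weight beyond `C.turn` is at most φ, and minimality of the splitting position
    -- compares the values at each vertex.
    new-level : ∀ s → lev C.code (pinch S.at s) zero ≤ ℤ.+ B.b + gt s (inject₁ S.at)
    new-level s = subst (_≤ ℤ.+ B.b + gt s (inject₁ S.at)) (sym (C.top-level (pinch S.at s))) (by (ℕ.m≤n⇒m<n∨m≡n base≤))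
      where
      by : C.base ℕ.< B.b ⊎ C.base ≡ B.b → ℤ.+ C.base + gt (pinch S.at s) C.turn ≤ ℤ.+ B.b + gt s (inject₁ S.at)
      by (inj₁ lt) = ℤ.≤-trans (ℤ.+-monoʳ-≤ (ℤ.+ C.base) (gt≤1 (pinch S.at s) C.turn)) (ℤ.≤-trans (subst (_≤ ℤ.+ B.b) (trans (cong ℤ.+_ (ℕ.+-comm 1 C.base)) (ℤ.pos-+ C.base 1)) (ℤ.+≤+ lt))
        (subst (_≤ ℤ.+ B.b + gt s (inject₁ S.at)) (ℤ.+-identityʳ (ℤ.+ B.b)) (ℤ.+-monoʳ-≤ (ℤ.+ B.b) (0≤gt s (inject₁ S.at)))))
      by (inj₂ eq) = ℤ.+-mono-≤ (ℤ.≤-reflexive (cong ℤ.+_ eq)) (S.minimal C.turn (subst (_≤ φ) gap (ℤ.+-monoˡ-≤ (- (ℤ.+ B.b * τ)) z′₀≤)) s)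
        where
        alg3 : ∀ a b → a + b - a ≡ b
        alg3 = solve-∀
        gap : z′ zero - ℤ.+ B.b * τ ≡ ∑ (λ s → w s * gt s C.turn)
        gap = trans (cong₂ (λ x y → x - ℤ.+ y * τ) C.top-value (sym eq)) (alg3 (ℤ.+ C.base * τ) (∑ (λ s → w s * gt s C.turn)))
    mono : Monotone c′
    mono s zero = new-level s
    mono s (suc j) = C.monotone (pinch S.at s) j

  -- The vertex after which the j-th level jumps, in the order of all vertices. The last level is
  -- constant and gets the last vertex, after which none follows.
  pos : ∀ {r} → Code r → Fin (suc r) → Fin (suc r)
  pos [] zero = zero
  pos (extend c b t) zero = inject₁ t
  pos (extend c b t) (suc j) = punchIn (inject₁ t) (pos c j)

  lev-pos : ∀ {r} (c : Code r) s j → lev c s j ≡ lev c zero j + gt s (pos c j)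
  lev-pos [] zero zero = refl
  lev-pos (extend c b t) s zero = cong (λ y → y + gt s (inject₁ t)) (sym (ℤ.+-identityʳ (ℤ.+ b)))
  lev-pos (extend c b t) s (suc j) = trans (lev-pos c (pinch t s) j) (cong₂ _+_ (cong (λ y → lev c y j) refl) (gt-pinch t s (pos c j)))

  pos-surjective : ∀ {r} (c : Code r) p → ∃ λ j → pos c j ≡ p
  pos-surjective [] zero = zero , refl
  pos-surjective (extend c b t) p = by (inject₁ t Fin.≟ p)
    where
    by : Dec (inject₁ t ≡ p) → ∃ λ j → pos (extend c b t) j ≡ p
    by (yes e) = zero , e
    by (no ne) = suc (proj₁ ih) , trans (cong (punchIn (inject₁ t)) (proj₂ ih)) (Fin.punchIn-punchOut ne)
      where ih = pos-surjective c (Fin.punchOut ne)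

  pos-last : ∀ {r} (c : Code r) → pos c (fromℕ r) ≡ fromℕ r
  pos-last [] = refl
  pos-last {suc r} (extend c b t) = trans (cong (punchIn (inject₁ t)) (pos-last c)) (last t)
    where
    last : ∀ {r} (t : Fin (suc r)) → punchIn (inject₁ t) (fromℕ r) ≡ suc (fromℕ r)
    last zero = refl
    last {suc r} (suc t) = cong suc (last t)

  01-step : ℤ → Set
  01-step x = x ≡ 0ℤ ⊎ x ≡ 1ℤ

  step-function : ∀ {r} (g : Fin (suc r) → ℤ) → g (fromℕ r) ≡ 0ℤ → (∀ p q → p Fin.≤ q → 01-step (g p - g q)) → ∃ λ s → ∀ p → g p ≡ gt s p
  step-function {zero} g e h = zero , λ { zero → e }
  step-function {suc r} g e h = by (subst 01-step (g≡ zero) (h zero (fromℕ (suc r)) ℕ.z≤n))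
    where
    g≡ : ∀ q → g q - g (fromℕ (suc r)) ≡ g q
    g≡ q = trans (cong (λ z → g q - z) e) (ℤ.+-identityʳ (g q))
    to-last : ∀ (q : Fin (suc (suc r))) → q Fin.≤ fromℕ (suc r)
    to-last q = subst (toℕ q ℕ.≤_) (sym (Fin.toℕ-fromℕ (suc r))) (ℕ.≤-pred (Fin.toℕ<n q))
    by : 01-step (g zero) → ∃ λ s → ∀ p → g p ≡ gt s p
    by (inj₁ z) = zero , λ q → zero-at q (subst 01-step (g≡ q) (h q (fromℕ (suc r)) (to-last q))) (h zero q ℕ.z≤n)
      where
      zero-at : ∀ q → 01-step (g q) → 01-step (g zero - g q) → g q ≡ 0ℤ
      zero-at q (inj₁ p) _ = p
      zero-at q (inj₂ p) (inj₁ p') = ⊥-elim (contra (trans (cong₂ _-_ (sym z) (sym p)) p'))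
        where
        contra : 0ℤ - 1ℤ ≢ 0ℤ
        contra ()
      zero-at q (inj₂ p) (inj₂ p') = ⊥-elim (contra (trans (cong₂ _-_ (sym z) (sym p)) p'))
        where
        contra : 0ℤ - 1ℤ ≢ 1ℤ
        contra ()
    by (inj₂ o) = let (s , f) = step-function (λ p → g (suc p)) e (λ p q le → h (suc p) (suc q) (ℕ.s≤s le)) in
      suc s , λ { zero → o ; (suc p) → f p }

  -- Arranged by the positions of the jumps, the offsets z j - lev c zero j form a decreasing
  -- function with values 0 and 1, and levels with the same jump have equal offsets. Such a step
  -- function is the offset of a vertex.
  tight⇒vertex : ∀ {r} (c : Code r) (z : Fin (suc r) → ℤ) → z (fromℕ r) ≡ 0ℤ →
    (∀ j j' → pos c j Fin.≤ pos c j' → 01-step ((z j - lev c zero j) - (z j' - lev c zero j'))) → ∃ λ s → ∀ j → z j ≡ lev c s j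
  tight⇒vertex {r} c z z-last h = s , λ j → trans (alg (z j) (lev c zero j)) (trans (cong (λ y → lev c zero j + y) (trans (same j) (f (pos c j)))) (sym (lev-pos c s j)))
    where
    e : Fin (suc r) → ℤ
    e j = z j - lev c zero j
    at : Fin (suc r) → Fin (suc r)
    at p = proj₁ (pos-surjective c p)
    at≡ : ∀ p → pos c (at p) ≡ p
    at≡ p = proj₂ (pos-surjective c p)
    both : ∀ x y → 01-step (x - y) → 01-step (y - x) → x ≡ y
    both x y (inj₁ p) _ = ℤ.i-j≡0⇒i≡j x y p
    both x y (inj₂ p) (inj₁ q) = sym (ℤ.i-j≡0⇒i≡j y x q)
    both x y (inj₂ p) (inj₂ q) = ⊥-elim (contra (trans (sym (cong₂ _+_ p q)) (alg' x y)))
      where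
      contra : 1ℤ + 1ℤ ≢ 0ℤ
      contra ()
      alg' : ∀ x y → (x - y) + (y - x) ≡ 0ℤ
      alg' = solve-∀
    equal-pos : ∀ j j' → pos c j ≡ pos c j' → e j ≡ e j'
    equal-pos j j' eq = both (e j) (e j') (h j j' (ℕ.≤-reflexive (cong toℕ eq))) (h j' j (ℕ.≤-reflexive (cong toℕ (sym eq))))
    same : ∀ j → e j ≡ e (at (pos c j))
    same j = equal-pos j (at (pos c j)) (sym (at≡ (pos c j)))
    g : Fin (suc r) → ℤ
    g p = e (at p)
    g-last : g (fromℕ r) ≡ 0ℤ
    g-last = trans (equal-pos (at (fromℕ r)) (fromℕ r) (trans (at≡ (fromℕ r)) (sym (pos-last c)))) (trans (cong₂ _-_ z-last (lev-last c zero)) refl)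
    sf = step-function g g-last (λ p q le → h (at p) (at q) (subst₂ (λ x y → toℕ x ℕ.≤ toℕ y) (sym (at≡ p)) (sym (at≡ q)) le))
    s = proj₁ sf
    f = proj₂ sf
    alg : ∀ a b → a ≡ b + (a - b)
    alg = solve-∀

  gt-step : ∀ {n} (s p q : Fin n) → (p Fin.≤ q → 01-step (gt s p - gt s q)) × (¬ (p Fin.≤ q) → 01-step (gt s p - gt s q + 1ℤ))
  gt-step zero p q = (λ _ → inj₁ refl) , (λ _ → inj₂ refl)
  gt-step (suc s) zero zero = (λ _ → inj₁ refl) , (λ n → ⊥-elim (n ℕ.z≤n))
  gt-step (suc s) zero (suc q) = (λ _ → by (gt-01 s q)) , (λ n → ⊥-elim (n ℕ.z≤n))
    where
    by : gt s q ≡ 0ℤ ⊎ gt s q ≡ 1ℤ → 01-step (1ℤ - gt s q)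
    by (inj₁ e) = inj₂ (cong (λ z → 1ℤ - z) e)
    by (inj₂ e) = inj₁ (cong (λ z → 1ℤ - z) e)
  gt-step (suc s) (suc p) zero = (λ ()) , (λ _ → by (gt-01 s p))
    where
    by : gt s p ≡ 0ℤ ⊎ gt s p ≡ 1ℤ → 01-step (gt s p - 1ℤ + 1ℤ)
    by (inj₁ e) = inj₁ (cong (λ z → z - 1ℤ + 1ℤ) e)
    by (inj₂ e) = inj₂ (cong (λ z → z - 1ℤ + 1ℤ) e)
  gt-step (suc s) (suc p) (suc q) = (λ { (ℕ.s≤s le) → proj₁ (gt-step s p q) le }) , (λ n → proj₂ (gt-step s p q) (λ le → n (ℕ.s≤s le)))

  -- Suffix sums

  suf : ∀ {n} → (Fin n → ℤ) → Fin (suc n) → ℤ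
  suf w zero = ∑ w
  suf {suc n} w (suc j) = suf (λ i → w (suc i)) j

  suf-last : ∀ {n} (w : Fin n → ℤ) → suf w (fromℕ n) ≡ 0ℤ
  suf-last {zero} w = ∑-empty
  suf-last {suc n} w = suf-last (λ i → w (suc i))

  suf-step : ∀ {n} (w : Fin n → ℤ) j → suf w (inject₁ j) ≡ w j + suf w (suc j)
  suf-step {suc n} w zero = ∑-suc w
  suf-step {suc n} w (suc j) = suf-step (λ i → w (suc i)) j

  suf-injective : ∀ {n} {w w' : Fin n → ℤ} → (∀ a → suf w a ≡ suf w' a) → ∀ j → w j ≡ w' j
  suf-injective {w = w} {w'} h j = trans (alg (w j) (suf w (suc j))) (trans (cong₂ _-_ (trans (sym (suf-step w j)) (trans (h (inject₁ j)) (suf-step w' j))) (h (suc j))) (sym (alg (w' j) (suf w' (suc j)))))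
    where
    alg : ∀ a b → a ≡ a + b - b
    alg = solve-∀

  suf-linear : ∀ {n} p (μ : Fin p → ℤ) (w : Fin p → Fin n → ℤ) a → suf (λ j → ∑ (λ s → μ s * w s j)) a ≡ ∑ (λ s → μ s * suf (w s) a)
  suf-linear p μ w zero = trans (∑-swap (λ j s → μ s * w s j)) (∑-cong (λ s → sym (*-∑ (μ s) (w s))))
  suf-linear {suc n} p μ w (suc a) = suf-linear p μ (λ s j → w s (suc j)) a

  suf-lin₂ : ∀ {n} β γ (w u : Fin n → ℤ) a → suf (λ j → β * w j + γ * u j) a ≡ β * suf w a + γ * suf u a
  suf-lin₂ β γ w u zero = ∑-lin β γ w u
  suf-lin₂ {suc n} β γ w u (suc a) = suf-lin₂ β γ (λ j → w (suc j)) (λ j → u (suc j)) a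

  suf-cong : ∀ {n} {w u : Fin n → ℤ} → (∀ j → w j ≡ u j) → ∀ a → suf w a ≡ suf u a
  suf-cong h zero = ∑-cong h
  suf-cong {suc n} h (suc a) = suf-cong (λ j → h (suc j)) a

  -- A vanishing entry makes two consecutive suffix sums equal, and `pinch i` identifies their
  -- positions.
  suf-punchIn : ∀ {n} (c : Fin (suc n) → ℤ) i → c i ≡ 0ℤ → ∀ a → suf c a ≡ suf (λ j → c (punchIn i j)) (pinch i a)
  suf-punchIn c i e zero = trans (∑-remove i c) (trans (cong (λ z → z + ∑ (λ j → c (punchIn i j))) e) (ℤ.+-identityˡ _))
  suf-punchIn c zero e (suc a) = refl
  suf-punchIn {suc n} c (suc i) e (suc a) = suf-punchIn (λ j → c (suc j)) i e a

  pinch-surjective : ∀ {n} (i : Fin n) p → ∃ λ a → pinch i a ≡ p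
  pinch-surjective zero p = suc p , refl
  pinch-surjective (suc i) zero = zero , refl
  pinch-surjective (suc i) (suc p) = let (a , e) = pinch-surjective i p in suc a , cong suc e

  suf-mono : ∀ {n} (w : Fin n → ℤ) → (∀ j → 0ℤ ≤ w j) → ∀ j → suf w (suc j) ≤ suf w (inject₁ j)
  suf-mono w h j = subst₂ _≤_ (ℤ.+-identityˡ (suf w (suc j))) (sym (suf-step w j)) (ℤ.+-monoˡ-≤ (suf w (suc j)) (h j))

  suf≤total : ∀ {n} (w : Fin n → ℤ) → (∀ j → 0ℤ ≤ w j) → ∀ a → suf w a ≤ ∑ w
  suf≤total w h zero = ℤ.≤-refl
  suf≤total {suc n} w h (suc a) = ℤ.≤-trans (suf≤total (λ j → w (suc j)) (λ j → h (suc j)) a) (subst₂ _≤_ (ℤ.+-identityˡ _) (sym (∑-suc w)) (ℤ.+-monoˡ-≤ (∑ (λ j → w (suc j))) (h zero)))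

  -- The first coordinate is the slack.
  fromLevels : ∀ {r} → ℤ → (Fin (suc r) → ℤ) → Fin (suc r) → ℤ
  fromLevels K z zero = K - z zero
  fromLevels K z (suc j) = z (inject₁ j) - z (suc j)

  suf-differences : ∀ {r} (z : Fin (suc r) → ℤ) → z (fromℕ r) ≡ 0ℤ → ∀ j → suf (λ i → z (inject₁ i) - z (suc i)) j ≡ z j
  suf-differences {zero} z e zero = trans ∑-empty (sym e)
  suf-differences {suc r} z e zero = trans (∑-suc (λ i → z (inject₁ i) - z (suc i))) (trans (cong (λ y → z zero - z (suc zero) + y) (suf-differences (λ j → z (suc j)) e zero)) (alg (z zero) (z (suc zero))))
    where
    alg : ∀ a b → a - b + b ≡ a
    alg = solve-∀
  suf-differences {suc r} z e (suc j) = suf-differences (λ j → z (suc j)) e j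

  suf-fromLevels : ∀ {r} K (z : Fin (suc r) → ℤ) → z (fromℕ r) ≡ 0ℤ → suf (fromLevels K z) zero ≡ K × (∀ j → suf (fromLevels K z) (suc j) ≡ z j)
  suf-fromLevels K z e = trans (∑-suc (fromLevels K z)) (trans (cong (λ y → K - z zero + y) (suf-differences z e zero)) (alg K (z zero))) , suf-differences z e
    where
    alg : ∀ a b → a - b + b ≡ a
    alg = solve-∀

  -- Integral affine functions

  record IsAffine {d} (f : (Fin d → ℤ) → ℤ) : Set where
    field
      slope : Fin d → ℤ
      intercept : ℤ
      affine-eq : ∀ x → f x ≡ ∑ (λ l → slope l * x l) + intercept
  open IsAffine public

  affine-const : ∀ {d} c → IsAffine {d} (λ _ → c)
  affine-const c = record { slope = λ _ → 0ℤ ; intercept = c ; affine-eq = λ x → sym (trans (cong (λ z → z + c) (∑-zero (λ l → ℤ.*-zeroˡ (x l)))) (ℤ.+-identityˡ c)) }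

  affine-lin₂ : ∀ {d} β γ {f g : (Fin d → ℤ) → ℤ} → IsAffine f → IsAffine g → IsAffine (λ x → β * f x + γ * g x)
  affine-lin₂ β γ {f} {g} F G = record
    { slope = λ l → β * slope F l + γ * slope G l
    ; intercept = β * intercept F + γ * intercept G
    ; affine-eq = λ x → trans (cong₂ (λ y z → β * y + γ * z) (affine-eq F x) (affine-eq G x))
        (trans (alg β γ (∑ (λ l → slope F l * x l)) (intercept F) (∑ (λ l → slope G l * x l)) (intercept G))
        (cong (λ z → z + (β * intercept F + γ * intercept G)) (trans (sym (∑-lin β γ (λ l → slope F l * x l) (λ l → slope G l * x l))) (∑-cong (λ l → alg2 β γ (slope F l) (slope G l) (x l)))))) }
    where
    alg : ∀ β γ a c b e → β * (a + c) + γ * (b + e) ≡ β * a + γ * b + (β * c + γ * e)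
    alg = solve-∀
    alg2 : ∀ β γ a b x → β * (a * x) + γ * (b * x) ≡ (β * a + γ * b) * x
    alg2 = solve-∀

  affine-cong : ∀ {d} {f g : (Fin d → ℤ) → ℤ} → IsAffine f → (∀ x → f x ≡ g x) → IsAffine g
  affine-cong F h = record { slope = slope F ; intercept = intercept F ; affine-eq = λ x → trans (sym (h x)) (affine-eq F x) }

  affine-+ : ∀ {d} {f g : (Fin d → ℤ) → ℤ} → IsAffine f → IsAffine g → IsAffine (λ x → f x + g x)
  affine-+ {f = f} {g} F G = affine-cong (affine-lin₂ 1ℤ 1ℤ F G) (λ x → alg (f x) (g x))
    where
    alg : ∀ a b → 1ℤ * a + 1ℤ * b ≡ a + b
    alg = solve-∀

  affine-∑ : ∀ {d n} {f : Fin n → (Fin d → ℤ) → ℤ} → (∀ j → IsAffine (f j)) → IsAffine (λ x → ∑ (λ j → f j x))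
  affine-∑ {n = zero} F = affine-cong (affine-const 0ℤ) (λ x → sym ∑-empty)
  affine-∑ {n = suc n} {f} F = affine-cong (affine-+ (F zero) (affine-∑ (λ j → F (suc j)))) (λ x → sym (∑-suc (λ j → f j x)))

  affine-suf : ∀ {d n} {f : (Fin d → ℤ) → Fin n → ℤ} → (∀ j → IsAffine (λ x → f x j)) → ∀ a → IsAffine (λ x → suf (f x) a)
  affine-suf F zero = affine-∑ F
  affine-suf {n = suc n} F (suc a) = affine-suf (λ j → F (suc j)) a

  affine-point : ∀ {d n} {f : (Fin d → ℤ) → ℤ} (F : IsAffine f) {v : Matrix n d} {X : Fin d → ℤ} {q : ℤ} (H : InHull v X q) →
    ∑ (λ j → weight H j * f (v j)) ≡ scale H * (∑ (λ l → slope F l * X l) + intercept F * q)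
  affine-point {d} {n} {f} F {v} {X} {q} (hull r hr W nn sW cW) = begin
    ∑ (λ j → W j * f (v j)) ≡⟨ ∑-cong (λ j → trans (cong (λ z → W j * z) (affine-eq F (v j))) (trans (ℤ.*-distribˡ-+ (W j) (∑ (λ l → slope F l * v j l)) c) (cong (λ z → z + W j * c) (*-∑ (W j) (λ l → slope F l * v j l))))) ⟩
    ∑ (λ j → ∑ (λ l → W j * (slope F l * v j l)) + W j * c) ≡⟨ ∑-+ (λ j → ∑ (λ l → W j * (slope F l * v j l))) (λ j → W j * c) ⟩
    ∑ (λ j → ∑ (λ l → W j * (slope F l * v j l))) + ∑ (λ j → W j * c) ≡⟨ cong₂ _+_
       (trans (∑-swap (λ j l → W j * (slope F l * v j l))) (∑-cong (λ l → trans (∑-cong (λ j → alg (W j) (slope F l) (v j l))) (trans (sym (*-∑ (slope F l) (λ j → W j * v j l))) (cong (λ z → slope F l * z) (cW l))))))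
       (trans (sym (∑-* c W)) (cong (λ z → z * c) sW)) ⟩
    ∑ (λ l → slope F l * (r * X l)) + r * q * c ≡⟨ cong (λ z → z + r * q * c) (trans (∑-cong (λ l → alg (slope F l) r (X l))) (sym (*-∑ r (λ l → slope F l * X l)))) ⟩
    r * ∑ (λ l → slope F l * X l) + r * q * c ≡⟨ alg2 r (∑ (λ l → slope F l * X l)) q c ⟩
    r * (∑ (λ l → slope F l * X l) + c * q) ∎
    where
    open ≡-Reasoning
    c = intercept F
    alg : ∀ a b c → a * (b * c) ≡ b * (a * c)
    alg = solve-∀
    alg2 : ∀ r x q c → r * x + r * q * c ≡ r * (x + c * q)
    alg2 = solve-∀


  -- Regular subdivisions from integral supporting functions

  record Support {d n} (V : Vec (ZPt d) n) (height : ZPt d → ℤ) (σ : Vec (ZPt d) (suc d)) : Set where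
    field
      form : (Fin d → ℤ) → ℤ
      form-affine : IsAffine form
      touches : ∀ j → form (entries σ j) ≡ height (lookup σ j)
      below : ∀ x → LatticeIn V x → ¬ (∃ λ j → lookup σ j ≡ x) → form (lookup x) < height x

  module Supported {d n} (V : Vec (ZPt d) n) (height : ZPt d → ℤ) (T : List (Vec (ZPt d) (suc d)))
    (support : ∀ {σ} → σ ∈ T → Support V height σ) (lattice : ∀ {σ} → σ ∈ T → ∀ j → LatticeIn V (lookup σ j)) where

    regular : IsRegular V T
    regular = (λ x → toQ (height x)) , λ {σ} σ∈ → let open Support (support σ∈) in
      toQPt (tabulate (slope form-affine)) , toQ (intercept form-affine)
      , (λ j → trans (value form-affine (lookup σ j)) (cong toQ (touches j)))
      , λ x x∈ x∉ → subst (ℚ._< toQ (height x)) (sym (value form-affine x)) (toQ-mono-< (below x x∈ x∉))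
      where
      value : ∀ {f : (Fin d → ℤ) → ℤ} (F : IsAffine f) x → affine (toQPt (tabulate (slope F))) (toQ (intercept F)) x ≡ toQ (f (lookup x))
      value F x = trans (affine-toQ (tabulate (slope F)) (intercept F) x) (cong toQ (trans (cong (λ z → z + intercept F) (∑-cong (λ l → cong (λ z → z * lookup x l) (Vec.lookup∘tabulate (slope F) l)))) (sym (affine-eq F (lookup x)))))

    on-vertices : ∀ {σ τ} → σ ∈ T → (τ∈ : τ ∈ T) → ∀ j → (∃ λ j′ → lookup τ j′ ≡ lookup σ j) ⊎ Support.form (support τ∈) (entries σ j) < height (lookup σ j)
    on-vertices {σ} {τ} σ∈ τ∈ j = by (Fin.any? (λ j′ → lookup τ j′ ≟ᵖ lookup σ j))
      where
      by : Dec (∃ λ j′ → lookup τ j′ ≡ lookup σ j) → (∃ λ j′ → lookup τ j′ ≡ lookup σ j) ⊎ Support.form (support τ∈) (entries σ j) < height (lookup σ j)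
      by (yes p) = inj₁ p
      by (no np) = inj₂ (Support.below (support τ∈) (lookup σ j) (lattice σ∈ j) np)

    below≤ : ∀ {σ τ} → σ ∈ T → (τ∈ : τ ∈ T) → ∀ j → Support.form (support τ∈) (entries σ j) ≤ height (lookup σ j)
    below≤ {σ} {τ} σ∈ τ∈ j = by (on-vertices σ∈ τ∈ j)
      where
      by : (∃ λ j′ → lookup τ j′ ≡ lookup σ j) ⊎ Support.form (support τ∈) (entries σ j) < height (lookup σ j) → Support.form (support τ∈) (entries σ j) ≤ height (lookup σ j)
      by (inj₁ (j′ , e)) = ℤ.≤-reflexive (subst (λ y → Support.form (support τ∈) (lookup y) ≡ height y) e (Support.touches (support τ∈) j′))
      by (inj₂ lt) = ℤ.<⇒≤ lt

    value : ∀ {σ τ} → σ ∈ T → τ ∈ T → (X : Fin d → ℤ) (q : ℤ) → ℤ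
    value {σ} {τ} σ∈ τ∈ X q = ∑ (λ l → slope (Support.form-affine (support τ∈)) l * X l) + intercept (Support.form-affine (support τ∈)) * q

    -- The supporting function of τ is at most that of σ on σ, since it is so at the vertices of σ.
    compare : ∀ {σ τ} (σ∈ : σ ∈ T) (τ∈ : τ ∈ T) {X : Fin d → ℤ} {q : ℤ} → InHull (entries σ) X q → value σ∈ τ∈ X q ≤ value τ∈ σ∈ X q
    compare {σ} {τ} σ∈ τ∈ {X} {q} H = ℤ.*-cancelˡ-≤-pos (value σ∈ τ∈ X q) (value τ∈ σ∈ X q) (scale H) {{ℤ.positive (scale-pos H)}}
      (subst₂ _≤_ (affine-point (Support.form-affine (support τ∈)) H) (affine-point (Support.form-affine (support σ∈)) H)
        (∑-mono (λ j → ℤ.*-monoˡ-≤-nonNeg (weight H j) {{ℤ.nonNegative (weight≥0 H j)}} (subst (Support.form (support τ∈) (entries σ j) ≤_) (sym (Support.touches (support σ∈) j)) (below≤ σ∈ τ∈ j)))))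

    -- `compare` in both directions shows that the two supporting functions agree at a common point.
    -- So a vertex of σ with positive weight lies on the supporting function of τ, and by `below`
    -- only the vertices of τ do. In this way regularity yields that cells meet in common faces.
    common : ∀ {σ τ} (σ∈ : σ ∈ T) (τ∈ : τ ∈ T) {X : Fin d → ℤ} {q : ℤ} (H : InHull (entries σ) X q) → InHull (entries τ) X q → ∀ j → weight H j ≢ 0ℤ → ∃ λ j′ → lookup τ j′ ≡ lookup σ j
    common {σ} {τ} σ∈ τ∈ {X} {q} H H′ j Wj≢0 = by (on-vertices σ∈ τ∈ j)
      where
      W = weight H
      f g : Fin (suc d) → ℤ
      f i = Support.form (support τ∈) (entries σ i)
      g i = Support.form (support σ∈) (entries σ i)
      f≤g : ∀ i → f i ≤ g i
      f≤g i = subst (f i ≤_) (sym (Support.touches (support σ∈) i)) (below≤ σ∈ τ∈ i)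
      eq : value σ∈ τ∈ X q ≡ value τ∈ σ∈ X q
      eq = ℤ.≤-antisym (compare σ∈ τ∈ H) (compare τ∈ σ∈ H′)
      alg : ∀ w a b → w * (a - b) ≡ w * a - w * b
      alg = solve-∀
      gap≡0 : ∀ i → W i * (g i - f i) ≡ 0ℤ
      gap≡0 = ∑≡0⇒≡0 (λ i → 0≤-* (weight≥0 H i) (ℤ.i≤j⇒0≤j-i (f≤g i))) (trans (∑-cong (λ i → alg (W i) (g i) (f i))) (trans (∑-sub (λ i → W i * g i) (λ i → W i * f i))
        (trans (cong₂ _-_ (affine-point (Support.form-affine (support σ∈)) H) (affine-point (Support.form-affine (support τ∈)) H))
          (trans (cong (λ z → scale H * value τ∈ σ∈ X q - scale H * z) eq) (ℤ.+-inverseʳ (scale H * value τ∈ σ∈ X q))))))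
      by : (∃ λ j′ → lookup τ j′ ≡ lookup σ j) ⊎ f j < height (lookup σ j) → ∃ λ j′ → lookup τ j′ ≡ lookup σ j
      by (inj₁ p) = p
      by (inj₂ lt) = ⊥-elim (ℤ.<-irrefl (sym (ℤ.i-j≡0⇒i≡j (g j) (f j) (*-cancel-zero (g j - f j) (W j) Wj≢0 (trans (ℤ.*-comm (g j - f j) (W j)) (gap≡0 j))))) (subst (f j <_) (sym (Support.touches (support σ∈) j)) lt))

    intersect : ∀ {σ τ} → σ ∈ T → τ ∈ T → ∀ x → InConv σ x → InConv τ x → InConvCommon σ τ x
    intersect {σ} {τ} σ∈ τ∈ x h@(w , nn , s , c) h′ = w , nn , s , c , λ j wj≢0 →
        let (j′ , e) = common σ∈ τ∈ (proj₁ H) (proj₁ (conv⇒hull τ x X q hq rx h′)) j (λ z → wj≢0 (zero-weight j z)) in j′ , sym e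
      where
      q = proj₁ (common-denominator x)
      hq = proj₁ (proj₂ (common-denominator x))
      X = proj₁ (proj₂ (proj₂ (common-denominator x)))
      rx = proj₂ (proj₂ (proj₂ (common-denominator x)))
      H = conv⇒hull σ x X q hq rx h
      zero-weight : ∀ j → weight (proj₁ H) j ≡ 0ℤ → lookup w j ≡ 0ℚ
      zero-weight j z = toQ-cancelˡ (0<-* (scale-pos (proj₁ H)) hq) (trans (proj₂ H j) (trans (cong toQ z) (sym (ℚ.*-zeroʳ (toQ (scale (proj₁ H) * q))))))

  transfer-triangulation : ∀ {d n n′} (V : Vec (ZPt d) n) (W : Vec (ZPt d) n′) → (∀ x → InConv V x → InConv W x) → (∀ x → InConv W x → InConv V x) →
    HasRegUnimodTriangulation W → HasRegUnimodTriangulation V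
  transfer-triangulation V W V⇒W W⇒V (T , (cells , cover , inter) , (ω , reg)) = T
    , ((λ σ∈ → VAll.map (λ {x} → W⇒V (toQPt x)) (proj₁ (cells σ∈)) , proj₂ (cells σ∈)) , (λ x x∈ → cover x (V⇒W x x∈)) , inter)
    , (ω , λ σ∈ → let (a , b , eq , lt) = reg σ∈ in a , b , eq , λ x x∈ → lt x (V⇒W (toQPt x) x∈))

  codes : ℕ → ∀ r → List (Code r)
  codes k zero = [] ∷ []
  codes k (suc r) = List.cartesianProductWith (λ c (b , t) → extend c b t) (codes k r) (List.cartesianProduct (List.upTo k) (List.allFin (suc r)))

  codes-complete : ∀ {k r} {c : Code r} → Bounded k c → c ∈ codes k r
  codes-complete [] = here refl
  codes-complete (bs ▹ b<k) = ∈-cartesianProductWith⁺ (λ c (b , t) → extend c b t) (codes-complete bs) (∈-cartesianProduct⁺ (∈-upTo⁺ b<k) (∈-allFin _))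

  gt-last : ∀ {n} (s : Fin (suc n)) → gt s (fromℕ n) ≡ 0ℤ
  gt-last zero = refl
  gt-last {suc n} (suc s) = gt-last s

  lev≤ : ∀ {k r} {c : Code r} → Bounded k c → ∀ s → lev c s zero ≤ ℤ.+ k
  lev≤ [] s = ℤ.+≤+ ℕ.z≤n
  lev≤ {k} (_▹_ {b = b} {t} bs b<k) s = ℤ.≤-trans (ℤ.+-monoʳ-≤ (ℤ.+ b) (gt≤1 s (inject₁ t))) (subst (_≤ ℤ.+ k) (trans (cong ℤ.+_ (ℕ.+-comm 1 b)) (ℤ.pos-+ b 1)) (ℤ.+≤+ b<k))

  -- y² minus the chord of the square function over [t , t + 1]

  gap : ℤ → ℤ → ℤ
  gap y t = (y - t) * (y - t - 1ℤ)

  gap-nonneg : ∀ y t → 0ℤ ≤ gap y t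
  gap-nonneg y t = by (y - t)
    where
    by : ∀ z → 0ℤ ≤ z * (z - 1ℤ)
    by (ℤ.+ zero) = ℤ.≤-refl
    by (ℤ.+ suc n) = 0≤-* {ℤ.+ suc n} {ℤ.+ suc n - 1ℤ} (ℤ.+≤+ ℕ.z≤n) (ℤ.+≤+ ℕ.z≤n)
    by (ℤ.-[1+ n ]) = subst (0ℤ ≤_) (alg (ℤ.-[1+ n ])) (0≤-* {ℤ.+ suc n} {1ℤ + ℤ.+ suc n} (ℤ.+≤+ ℕ.z≤n) (ℤ.+≤+ ℕ.z≤n))
      where
      alg : ∀ z → (- z) * (1ℤ + - z) ≡ z * (z - 1ℤ)
      alg = solve-∀

  gap≡0⇒ : ∀ y t → gap y t ≡ 0ℤ → 01-step (y - t)
  gap≡0⇒ y t e = by (y - t ℤ.≟ 0ℤ)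
    where
    by : Dec (y - t ≡ 0ℤ) → 01-step (y - t)
    by (yes z) = inj₁ z
    by (no nz) = inj₂ (ℤ.i-j≡0⇒i≡j (y - t) 1ℤ (*-cancel-zero (y - t - 1ℤ) (y - t) nz (trans (ℤ.*-comm (y - t - 1ℤ) (y - t)) e)))

  ⇒gap≡0 : ∀ y t → 01-step (y - t) → gap y t ≡ 0ℤ
  ⇒gap≡0 y t (inj₁ e) = trans (cong (λ z → z * (z - 1ℤ)) e) refl
  ⇒gap≡0 y t (inj₂ e) = trans (cong (λ z → z * (z - 1ℤ)) e) refl

  chord : ℤ → ℤ → ℤ
  chord t y = (1ℤ + (t + t)) * y - t * (1ℤ + t)

  square-chord : ∀ y t → y * y ≡ gap y t + chord t y
  square-chord = alg
    where
    alg : ∀ y t → y * y ≡ (y - t) * (y - t - 1ℤ) + ((1ℤ + (t + t)) * y - t * (1ℤ + t))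
    alg = solve-∀

  ∑∑ : ∀ {n} → (Fin n → Fin n → ℤ) → ℤ
  ∑∑ f = ∑ (λ a → ∑ (f a))

  ∑∑-cong : ∀ {n} {f g : Fin n → Fin n → ℤ} → (∀ a b → f a b ≡ g a b) → ∑∑ f ≡ ∑∑ g
  ∑∑-cong h = ∑-cong (λ a → ∑-cong (h a))

  ∑∑-lin : ∀ {n} β γ (f g : Fin n → Fin n → ℤ) → ∑∑ (λ a b → β * f a b + γ * g a b) ≡ β * ∑∑ f + γ * ∑∑ g
  ∑∑-lin β γ f g = trans (∑-cong (λ a → ∑-lin β γ (f a) (g a))) (∑-lin β γ (λ a → ∑ (f a)) (λ a → ∑ (g a)))

  ∑∑-nonneg : ∀ {n} {f : Fin n → Fin n → ℤ} → (∀ a b → 0ℤ ≤ f a b) → 0ℤ ≤ ∑∑ f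
  ∑∑-nonneg h = ∑-nonneg (λ a → ∑-nonneg (h a))

  ∑∑≡0⇒≡0 : ∀ {n} {f : Fin n → Fin n → ℤ} → (∀ a b → 0ℤ ≤ f a b) → ∑∑ f ≡ 0ℤ → ∀ a b → f a b ≡ 0ℤ
  ∑∑≡0⇒≡0 h e a = ∑≡0⇒≡0 (h a) (∑≡0⇒≡0 (λ a → ∑-nonneg (h a)) e a)

  -- The sum of the absolute values, a crude upper bound from which `depth` is chosen.
  bound : ∀ {A : Set} → (A → ℤ) → List A → ℤ
  bound f [] = 0ℤ
  bound f (x ∷ xs) = ℤ.+ ∣ f x ∣ + bound f xs

  0≤bound : ∀ {A : Set} (f : A → ℤ) xs → 0ℤ ≤ bound f xs
  0≤bound f [] = ℤ.≤-refl
  0≤bound f (x ∷ xs) = ℤ.+-mono-≤ (ℤ.+≤+ (ℕ.z≤n {∣ f x ∣})) (0≤bound f xs)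

  ≤bound : ∀ {A : Set} (f : A → ℤ) {x} xs → x ∈ xs → f x ≤ bound f xs
  ≤bound f (x ∷ xs) (here refl) = ℤ.≤-trans (i≤∣i∣ (f x)) (subst (_≤ ℤ.+ ∣ f x ∣ + bound f xs) (ℤ.+-identityʳ (ℤ.+ ∣ f x ∣)) (ℤ.+-monoʳ-≤ (ℤ.+ ∣ f x ∣) (0≤bound f xs)))
    where
    i≤∣i∣ : ∀ i → i ≤ ℤ.+ ∣ i ∣
    i≤∣i∣ (ℤ.+ n) = ℤ.≤-refl
    i≤∣i∣ (ℤ.-[1+ n ]) = ℤ.-≤+
  ≤bound f {y} (x ∷ xs) (there p) = ℤ.≤-trans (≤bound f xs p) (subst (_≤ ℤ.+ ∣ f x ∣ + bound f xs) (ℤ.+-identityˡ (bound f xs)) (ℤ.+-monoˡ-≤ (bound f xs) (ℤ.+≤+ (ℕ.z≤n {∣ f x ∣}))))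

  punchIn-cases : ∀ {n} (i j : Fin (suc n)) → j ≡ i ⊎ ∃ λ j′ → j ≡ punchIn i j′
  punchIn-cases i j = by (i Fin.≟ j)
    where
    by : Dec (i ≡ j) → j ≡ i ⊎ ∃ λ j′ → j ≡ punchIn i j′
    by (yes e) = inj₁ (sym e)
    by (no ne) = inj₂ (Fin.punchOut ne , sym (Fin.punchIn-punchOut ne))

  minimum-on : ∀ {n} (X f : Fin n → ℤ) → (∃ λ j → X j ≡ 1ℤ) → ∃ λ i → X i ≡ 1ℤ × (∀ j → X j ≡ 1ℤ → f i ≤ f j)
  minimum-on {n} X f (j₀ , e₀) = let (i , i∈ , min) = argmin f xs (nonempty (member j₀ e₀)) in
      i , proj₂ (∈-filter⁻ (λ j → X j ℤ.≟ 1ℤ) {xs = List.allFin n} i∈) , λ j e → min (member j e)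
    where
    xs = List.filter (λ j → X j ℤ.≟ 1ℤ) (List.allFin n)
    member : ∀ j → X j ≡ 1ℤ → j ∈ xs
    member j e = ∈-filter⁺ (λ j → X j ℤ.≟ 1ℤ) (∈-allFin j) e
    nonempty : ∀ {A : Set} {x : A} {ys} → x ∈ ys → 1 ℕ.≤ length ys
    nonempty (here _) = ℕ.s≤s ℕ.z≤n
    nonempty (there _) = ℕ.s≤s ℕ.z≤n

  signLattice-cong : ∀ {d m} {s : Matrix (suc d) d} {ε ε′ : Fin (suc d) → ℤ} → (∀ j → ε j ≡ ε′ j) → SignLattice m s ε → SignLattice m s ε′
  signLattice-cong {s = s} h S = record
    { diff = diff
    ; diff-eq = λ l → trans (∑-cong (λ j → cong (λ z → z * s j l) (sym (h j)))) (diff-eq l)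
    ; affine-independent = affine-independent
    ; generates = generates }
    where open SignLattice S

  -- The triangulation of kP for a sign lattice

  module Triangulate {r : ℕ} (k m : ℕ) (1≤k : 1 ℕ.≤ k) (1≤m : 1 ℕ.≤ m) (V : Vec (ZPt (suc (suc r))) (suc (suc (suc r))))
    (A B : Fin (suc (suc (suc r))) → ℤ) (kind : ∀ j → (A j ≡ 1ℤ × B j ≡ 0ℤ) ⊎ (A j ≡ 0ℤ × B j ≡ 1ℤ))
    (∑A : ∑ A ≡ ℤ.+ k) (∑B : ∑ B ≡ ℤ.+ k) (S : SignLattice (ℤ.+ m) (entries V) (λ j → A j - B j)) where

    open SignLattice S

    private
      d N : ℕ
      d = suc (suc r)
      N = suc d
      s : Matrix N d
      s = entries V
      M K : ℤ
      M = ℤ.+ m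
      K = ℤ.+ k
      0<M : 0ℤ < M
      0<M = ℤ.+<+ 1≤m
      0<K : 0ℤ < K
      0<K = ℤ.+<+ 1≤k

    ε : Fin N → ℤ
    ε j = A j - B j

    ∑ε : ∑ ε ≡ 0ℤ
    ∑ε = trans (∑-sub A B) (trans (cong₂ _-_ ∑A ∑B) (ℤ.+-inverseʳ K))

    A-or-B : ∀ j → A j ≡ 1ℤ ⊎ B j ≡ 1ℤ
    A-or-B j = by (kind j)
      where
      by : (A j ≡ 1ℤ × B j ≡ 0ℤ) ⊎ (A j ≡ 0ℤ × B j ≡ 1ℤ) → A j ≡ 1ℤ ⊎ B j ≡ 1ℤ
      by (inj₁ (p , _)) = inj₁ p
      by (inj₂ (_ , p)) = inj₂ p

    A≡1⇒B≡0 : ∀ {j} → A j ≡ 1ℤ → B j ≡ 0ℤ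
    A≡1⇒B≡0 {j} e = by (kind j)
      where
      by : (A j ≡ 1ℤ × B j ≡ 0ℤ) ⊎ (A j ≡ 0ℤ × B j ≡ 1ℤ) → B j ≡ 0ℤ
      by (inj₁ (_ , p)) = p
      by (inj₂ (p , _)) = ⊥-elim (contra (trans (sym p) e))
        where
        contra : 0ℤ ≢ 1ℤ
        contra ()

    B≡1⇒A≡0 : ∀ {j} → B j ≡ 1ℤ → A j ≡ 0ℤ
    B≡1⇒A≡0 {j} e = by (kind j)
      where
      by : (A j ≡ 1ℤ × B j ≡ 0ℤ) ⊎ (A j ≡ 0ℤ × B j ≡ 1ℤ) → A j ≡ 0ℤ
      by (inj₂ (p , _)) = p
      by (inj₁ (_ , p)) = ⊥-elim (contra (trans (sym p) e))
        where
        contra : 0ℤ ≢ 1ℤ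
        contra ()

    A≡0⇒B≡1 : ∀ {j} → A j ≡ 0ℤ → B j ≡ 1ℤ
    A≡0⇒B≡1 {j} e = by (kind j)
      where
      by : (A j ≡ 1ℤ × B j ≡ 0ℤ) ⊎ (A j ≡ 0ℤ × B j ≡ 1ℤ) → B j ≡ 1ℤ
      by (inj₂ (_ , p)) = p
      by (inj₁ (p , _)) = ⊥-elim (contra (trans (sym e) p))
        where
        contra : 0ℤ ≢ 1ℤ
        contra ()

    -- Lattice points are Σ c_j s_j + ν diff, with Σ (c_j + ν ε_j / m) = k.

    at : (Fin N → ℤ) → ℤ → Fin d → ℤ
    at c ν l = ∑ (λ j → c j * s j l) + ν * diff l

    at-lin : ∀ β γ (c u : Fin N → ℤ) ν ξ l → β * at c ν l + γ * at u ξ l ≡ at (λ j → β * c j + γ * u j) (β * ν + γ * ξ) l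
    at-lin β γ c u ν ξ l = trans (alg β γ (∑ (λ j → c j * s j l)) ν (∑ (λ j → u j * s j l)) ξ (diff l))
      (cong (λ z → z + (β * ν + γ * ξ) * diff l) (trans (sym (∑-lin β γ (λ j → c j * s j l) (λ j → u j * s j l))) (∑-cong (λ j → alg2 β γ (c j) (u j) (s j l)))))
      where
      alg : ∀ β γ x ν y ξ D → β * (x + ν * D) + γ * (y + ξ * D) ≡ β * x + γ * y + (β * ν + γ * ξ) * D
      alg = solve-∀
      alg2 : ∀ β γ c u s → β * (c * s) + γ * (u * s) ≡ (β * c + γ * u) * s
      alg2 = solve-∀

    at-cong : ∀ {c u : Fin N → ℤ} {ν ξ} → (∀ j → c j ≡ u j) → ν ≡ ξ → ∀ l → at c ν l ≡ at u ξ l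
    at-cong h e l = cong₂ (λ x y → x + y * diff l) (∑-cong (λ j → cong (λ z → z * s j l) (h j))) e

    at-ε : ∀ l → at ε (- M) l ≡ 0ℤ
    at-ε l = trans (cong (λ z → z + - M * diff l) (diff-eq l)) (alg M (diff l))
      where
      alg : ∀ M D → M * D + - M * D ≡ 0ℤ
      alg = solve-∀

    -- The signed sum of the vertices is m `diff`, so u ε in the coefficients can be traded for u m
    -- in the multiple of `diff`.
    at-shift : ∀ c ν u l → at c ν l ≡ at (λ j → c j + u * ε j) (ν - u * M) l
    at-shift c ν u l = begin
      at c ν l ≡⟨ trans (alg (at c ν l) u) (cong (λ z → 1ℤ * at c ν l + u * z) (sym (at-ε l))) ⟩
      1ℤ * at c ν l + u * at ε (- M) l ≡⟨ at-lin 1ℤ u c ε ν (- M) l ⟩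
      at (λ j → 1ℤ * c j + u * ε j) (1ℤ * ν + u * - M) l ≡⟨ at-cong (λ j → cong (λ z → z + u * ε j) (ℤ.*-identityˡ (c j))) (alg2 ν u M) l ⟩
      at (λ j → c j + u * ε j) (ν - u * M) l ∎
      where
      open ≡-Reasoning
      alg : ∀ a u → a ≡ 1ℤ * a + u * 0ℤ
      alg = solve-∀
      alg2 : ∀ ν u M → 1ℤ * ν + u * - M ≡ ν - u * M
      alg2 = solve-∀

    at-coord : ∀ c ν → IsCoord s M (at c ν) (∑ c) (λ j → M * c j + ν * ε j)
    at-coord c ν = coord
      (trans (∑-lin M ν c ε) (trans (cong (λ z → M * ∑ c + ν * z) ∑ε) (trans (cong (λ z → M * ∑ c + z) (ℤ.*-zeroʳ ν)) (ℤ.+-identityʳ (M * ∑ c)))))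
      λ l → trans (∑-cong (λ j → alg M ν (c j) (ε j) (s j l))) (trans (∑-lin M ν (λ j → c j * s j l) (λ j → ε j * s j l))
        (trans (cong (λ z → M * ∑ (λ j → c j * s j l) + ν * z) (diff-eq l)) (alg2 M ν (∑ (λ j → c j * s j l)) (diff l))))
      where
      alg : ∀ M ν c e s → (M * c + ν * e) * s ≡ M * (c * s) + ν * (e * s)
      alg = solve-∀
      alg2 : ∀ M ν x D → M * x + ν * (M * D) ≡ M * (x + ν * D)
      alg2 = solve-∀

    -- A cell joins two consecutive points Σ_B s_j + ν diff to a Freudenthal simplex of k times
    -- the face without the vertices i ∈ A and l ∈ B.

    Cell : Set
    Cell = Fin N × Fin d × ℕ × Code r

    first second : Cell → Fin N
    first (i , l′ , n , c) = i
    second (i , l′ , n , c) = punchIn i l′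

    place : Fin N → Fin d → (Fin (suc r) → ℤ) → Fin N → ℤ
    place i l′ w = insert i 0ℤ (insert l′ 0ℤ w)

    corner : Cell → Fin (suc r) → Fin N → ℤ
    corner (i , l′ , n , c) t = place i l′ (fromLevels K (lev c t))

    vertex : Cell → Matrix N d
    vertex (i , l′ , n , c) zero = at B (ℤ.+ n)
    vertex (i , l′ , n , c) (suc zero) = at B (ℤ.+ suc n)
    vertex κ (suc (suc t)) = at (corner κ t) 0ℤ

    simplex : Cell → Vec (ZPt d) N
    simplex κ = fromEntries (vertex κ)

    -- The list of codes only bounds the bases. Monotone levels of at most k, which amount to
    -- nonnegative coordinates of the corners, and the kinds of the two omitted vertices are imposed
    -- by filtering.
    Valid : Cell → Set
    Valid (i , l′ , n , c) = A i ≡ 1ℤ × A (punchIn i l′) ≡ 0ℤ × n ℕ.< m × (∀ t → lev c t zero ≤ K) × Monotone c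

    valid? : ∀ κ → Dec (Valid κ)
    valid? (i , l′ , n , c) = (A i ℤ.≟ 1ℤ) ×-dec ((A (punchIn i l′) ℤ.≟ 0ℤ) ×-dec ((n ℕ.<? m) ×-dec
      ((Fin.all? (λ t → lev c t zero ℤ.≤? K)) ×-dec Fin.all? (λ t → Fin.all? (λ j → lev c t (suc j) ℤ.≤? lev c t (inject₁ j))))))

    cells : List Cell
    cells = List.cartesianProduct (List.allFin N) (List.cartesianProduct (List.allFin d) (List.cartesianProduct (List.upTo m) (codes k r)))

    triangulation : List (Vec (ZPt d) N)
    triangulation = List.map simplex (List.filter valid? cells)

    ∈-cells : ∀ i l′ {n c} → n ℕ.< m → Bounded k c → (i , l′ , n , c) ∈ cells
    ∈-cells i l′ n<m bd = ∈-cartesianProduct⁺ (∈-allFin i) (∈-cartesianProduct⁺ (∈-allFin l′) (∈-cartesianProduct⁺ (∈-upTo⁺ n<m) (codes-complete bd)))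

    record Member (σ : Vec (ZPt d) N) : Set where
      field
        cell : Cell
        listed : cell ∈ cells
        valid : Valid cell
        σ≡ : σ ≡ simplex cell

    member : ∀ {σ} → σ ∈ triangulation → Member σ
    member σ∈ = let (κ , κ∈ , e) = ∈-map⁻ simplex σ∈
                    (κ∈cells , ok) = ∈-filter⁻ valid? {xs = cells} κ∈ in
      record { cell = κ ; listed = κ∈cells ; valid = ok ; σ≡ = e }

    module _ (i : Fin N) (l′ : Fin d) where

      place-punch : ∀ w j → place i l′ w (punchIn i (punchIn l′ j)) ≡ w j
      place-punch w j = trans (insert-punchIn i 0ℤ (insert l′ 0ℤ w) (punchIn l′ j)) (insert-punchIn l′ 0ℤ w j)

      place-first : ∀ w → place i l′ w i ≡ 0ℤ
      place-first w = insert-at i 0ℤ (insert l′ 0ℤ w)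

      place-second : ∀ w → place i l′ w (punchIn i l′) ≡ 0ℤ
      place-second w = trans (insert-punchIn i 0ℤ (insert l′ 0ℤ w) l′) (insert-at l′ 0ℤ w)

      coordinatewise : ∀ {P : Fin N → Set} → P i → P (punchIn i l′) → (∀ j → P (punchIn i (punchIn l′ j))) → ∀ j → P j
      coordinatewise {P} pi pl pj j = by (punchIn-cases i j)
        where
        by′ : ∀ j → j ≡ l′ ⊎ (∃ λ j′ → j ≡ punchIn l′ j′) → P (punchIn i j)
        by′ _ (inj₁ refl) = pl
        by′ _ (inj₂ (j′ , refl)) = pj j′
        by : j ≡ i ⊎ (∃ λ j′ → j ≡ punchIn i j′) → P j
        by (inj₁ refl) = pi
        by (inj₂ (j′ , refl)) = by′ j′ (punchIn-cases l′ j′)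

      rest : (Fin N → ℤ) → Fin (suc r) → ℤ
      rest y j = y (punchIn i (punchIn l′ j))

      ∑-rest : ∀ y → y i ≡ 0ℤ → y (punchIn i l′) ≡ 0ℤ → ∑ y ≡ ∑ (rest y)
      ∑-rest y yi yl = trans (∑-remove i y) (trans (cong₂ _+_ yi (trans (∑-remove l′ (λ j → y (punchIn i j))) (cong (λ z → z + ∑ (rest y)) yl))) (alg (∑ (rest y))))
        where
        alg : ∀ x → 0ℤ + (0ℤ + x) ≡ x
        alg = solve-∀

      -- If the entries at the two omitted indices vanish, the N + 1 suffix sums are those of the
      -- other r + 1 entries with two repetitions; ρ records which is which.
      ρ : Fin (suc N) → Fin (suc (suc r))
      ρ a = pinch l′ (pinch i a)

      suf-rest : ∀ y → y i ≡ 0ℤ → y (punchIn i l′) ≡ 0ℤ → ∀ a → suf y a ≡ suf (rest y) (ρ a)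
      suf-rest y yi yl a = trans (suf-punchIn y i yi a) (suf-punchIn (λ j → y (punchIn i j)) l′ yl (pinch i a))

      levels : (Fin N → ℤ) → Fin (suc r) → ℤ
      levels y j = suf (rest y) (suc j)

      -- λ′ is the weight on the segment, μ the part of it at the second endpoint, and τ the weight
      -- on the Freudenthal simplex.
      cell-weights : Code r → ℤ → ℤ → ℤ → (Fin (suc r) → ℤ) → Fin N → ℤ
      cell-weights c λ′ μ τ z zero = λ′ - μ
      cell-weights c λ′ μ τ z (suc zero) = μ
      cell-weights c λ′ μ τ z (suc (suc t)) = weights c τ z t

      cell-weights-total : ∀ c λ′ μ τ z → ∑ (cell-weights c λ′ μ τ z) ≡ λ′ + τ
      cell-weights-total c λ′ μ τ z = trans (∑-suc (cell-weights c λ′ μ τ z)) (trans (cong (λ x → λ′ - μ + x) (trans (∑-suc (λ t → cell-weights c λ′ μ τ z (suc t))) (cong (λ x → μ + x) (weights-total c τ z)))) (alg λ′ μ τ))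
        where
        alg : ∀ l u t → l - u + (u + t) ≡ l + t
        alg = solve-∀

      cell-combination : ∀ n c λ′ μ τ (y : Fin N → ℤ) → y i ≡ 0ℤ → y (punchIn i l′) ≡ 0ℤ → ∑ y ≡ K * τ → ∀ l →
        ∑ (λ t → cell-weights c λ′ μ τ (levels y) t * vertex (i , l′ , n , c) t l) ≡ at (λ j → λ′ * B j + y j) (λ′ * ℤ.+ n + μ) l
      cell-combination n c λ′ μ τ y yi yl ∑y l = begin
        ∑ (λ t → cell-weights c λ′ μ τ z t * vertex κ t l)
          ≡⟨ trans (∑-suc (λ t → cell-weights c λ′ μ τ z t * vertex κ t l)) (cong (λ x → (λ′ - μ) * at B (ℤ.+ n) l + x) (∑-suc (λ t → cell-weights c λ′ μ τ z (suc t) * vertex κ (suc t) l))) ⟩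
        (λ′ - μ) * at B (ℤ.+ n) l + (μ * at B (ℤ.+ suc n) l + ∑ (λ t → W t * at (corner κ t) 0ℤ l))
          ≡⟨ cong (λ x → (λ′ - μ) * at B (ℤ.+ n) l + (μ * at B (ℤ.+ suc n) l + x)) corners ⟩
        (λ′ - μ) * at B (ℤ.+ n) l + (μ * at B (ℤ.+ suc n) l + at y 0ℤ l)
          ≡⟨ cong (λ x → (λ′ - μ) * at B (ℤ.+ n) l + (μ * (∑ (λ j → B j * s j l) + x * diff l) + at y 0ℤ l)) (ℤ.pos-+ 1 n) ⟩
        (λ′ - μ) * at B (ℤ.+ n) l + (μ * (∑ (λ j → B j * s j l) + (1ℤ + ℤ.+ n) * diff l) + at y 0ℤ l)
          ≡⟨ alg λ′ μ (∑ (λ j → B j * s j l)) (ℤ.+ n) (diff l) (∑ (λ j → y j * s j l)) ⟩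
        λ′ * ∑ (λ j → B j * s j l) + 1ℤ * ∑ (λ j → y j * s j l) + (λ′ * ℤ.+ n + μ) * diff l
          ≡⟨ cong (λ x → x + (λ′ * ℤ.+ n + μ) * diff l) (trans (sym (∑-lin λ′ 1ℤ (λ j → B j * s j l) (λ j → y j * s j l))) (∑-cong (λ j → alg2 λ′ (B j) (y j) (s j l)))) ⟩
        at (λ j → λ′ * B j + y j) (λ′ * ℤ.+ n + μ) l ∎
        where
        open ≡-Reasoning
        κ : Cell
        κ = i , l′ , n , c
        z : Fin (suc r) → ℤ
        z = levels y
        W : Fin (suc r) → ℤ
        W = weights c τ z
        alg : ∀ L u x n D y → (L - u) * (x + n * D) + (u * (x + (1ℤ + n) * D) + (y + 0ℤ * D)) ≡ L * x + 1ℤ * y + (L * n + u) * D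
        alg = solve-∀
        alg2 : ∀ L b y s → L * (b * s) + 1ℤ * (y * s) ≡ (L * b + y) * s
        alg2 = solve-∀
        z-last : z (fromℕ r) ≡ 0ℤ
        z-last = suf-last (rest y)
        sums : ∀ a → suf (λ j → ∑ (λ t → W t * fromLevels K (lev c t) j)) a ≡ suf (rest y) a
        sums zero = trans (suf-linear (suc r) W (λ t → fromLevels K (lev c t)) zero) (trans (∑-cong (λ t → cong (λ x → W t * x) (proj₁ (suf-fromLevels K (lev c t) (lev-last c t)))))
          (trans (sym (∑-* K W)) (trans (cong (λ x → x * K) (weights-total c τ z)) (trans (ℤ.*-comm τ K) (trans (sym ∑y) (∑-rest y yi yl))))))
        sums (suc j) = trans (suf-linear (suc r) W (λ t → fromLevels K (lev c t)) (suc j)) (trans (∑-cong (λ t → cong (λ x → W t * x) (proj₂ (suf-fromLevels K (lev c t) (lev-last c t)) j)))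
          (weights-lev c τ z z-last j))
        total-corner : ∀ j → ∑ (λ t → W t * corner κ t j) ≡ y j
        total-corner = coordinatewise
          (trans (∑-zero (λ t → trans (cong (λ x → W t * x) (place-first (fromLevels K (lev c t)))) (ℤ.*-zeroʳ (W t)))) (sym yi))
          (trans (∑-zero (λ t → trans (cong (λ x → W t * x) (place-second (fromLevels K (lev c t)))) (ℤ.*-zeroʳ (W t)))) (sym yl))
          (λ j → trans (∑-cong (λ t → cong (λ x → W t * x) (place-punch (fromLevels K (lev c t)) j))) (suf-injective sums j))
        corners : ∑ (λ t → W t * at (corner κ t) 0ℤ l) ≡ at y 0ℤ l
        corners = begin
          ∑ (λ t → W t * at (corner κ t) 0ℤ l) ≡⟨ ∑-cong (λ t → trans (alg3 (W t) (∑ (λ j → corner κ t j * s j l)) (diff l)) (*-∑ (W t) (λ j → corner κ t j * s j l))) ⟩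
          ∑ (λ t → ∑ (λ j → W t * (corner κ t j * s j l))) ≡⟨ ∑-swap (λ t j → W t * (corner κ t j * s j l)) ⟩
          ∑ (λ j → ∑ (λ t → W t * (corner κ t j * s j l))) ≡⟨ ∑-cong (λ j → trans (∑-cong (λ t → sym (ℤ.*-assoc (W t) (corner κ t j) (s j l)))) (trans (sym (∑-* (s j l) (λ t → W t * corner κ t j))) (cong (λ x → x * s j l) (total-corner j)))) ⟩
          ∑ (λ j → y j * s j l) ≡⟨ alg4 (∑ (λ j → y j * s j l)) (diff l) ⟩
          at y 0ℤ l ∎
          where
          alg3 : ∀ w x D → w * (x + 0ℤ * D) ≡ w * x
          alg3 = solve-∀
          alg4 : ∀ x D → x ≡ x + 0ℤ * D
          alg4 = solve-∀

    -- Every integral vector is an integral combination of the vertices with sum 0: multiples of ε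
    -- and of the indicator of B clear the coefficients at the two omitted vertices, and the weights
    -- of a code are integral for integral levels.
    unimodular : ∀ κ → Valid κ → Unimodular (simplex κ)
    unimodular κ@(i , l′ , n , c) (Ai , Al , _) = trans (cong ∣_∣ (det≡vol (simplex κ))) (generating⇒vol≡1 (entries (simplex κ)) λ z →
      let open Gen z in cell-weights i l′ c λ′ μ (- λ′) (levels i l′ y) , trans (cell-weights-total i l′ c λ′ μ (- λ′) (levels i l′ y)) (ℤ.+-inverseʳ λ′)
        , λ l → trans (∑-cong (λ t → cong (λ x → cell-weights i l′ c λ′ μ (- λ′) (levels i l′ y) t * x) (entries-fromEntries (vertex κ) t l))) (trans (cell-combination i l′ n c λ′ μ (- λ′) y yi yl ∑y l) (rep l)))
      where
      module Gen (z : Fin d → ℤ) where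
        g = generates z 0ℤ
        c₀ : Fin N → ℤ
        c₀ = proj₁ g
        ν₀ u : ℤ
        ν₀ = proj₁ (proj₂ g)
        -- As A i = 1 and B i = 0, the sign ε i is 1, so adding u ε clears the coefficient at i.
        u = - c₀ i
        c₁ : Fin N → ℤ
        c₁ j = c₀ j + u * ε j
        λ′ μ : ℤ
        -- B is 1 at the second omitted vertex and 0 at i, so subtracting λ′ B clears the
        -- coefficient there and keeps that at i equal to 0.
        λ′ = c₁ (punchIn i l′)
        μ = ν₀ - u * M - λ′ * ℤ.+ n
        y : Fin N → ℤ
        y j = c₁ j - λ′ * B j
        alg1 : ∀ c → c + - c * (1ℤ - 0ℤ) ≡ 0ℤ
        alg1 = solve-∀
        alg2 : ∀ L → 0ℤ - L * 0ℤ ≡ 0ℤ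
        alg2 = solve-∀
        alg3 : ∀ L → L - L * 1ℤ ≡ 0ℤ
        alg3 = solve-∀
        c₁i : c₁ i ≡ 0ℤ
        c₁i = trans (cong₂ (λ a b → c₀ i + u * (a - b)) Ai (A≡1⇒B≡0 Ai)) (alg1 (c₀ i))
        yi : y i ≡ 0ℤ
        yi = trans (cong₂ (λ a b → a - λ′ * b) c₁i (A≡1⇒B≡0 Ai)) (alg2 λ′)
        yl : y (punchIn i l′) ≡ 0ℤ
        yl = trans (cong (λ b → λ′ - λ′ * b) (A≡0⇒B≡1 Al)) (alg3 λ′)
        ∑c₁ : ∑ c₁ ≡ 0ℤ
        ∑c₁ = trans (∑-+ c₀ (λ j → u * ε j)) (cong₂ _+_ (proj₁ (proj₂ (proj₂ g))) (trans (sym (*-∑ u ε)) (trans (cong (λ x → u * x) ∑ε) (ℤ.*-zeroʳ u))))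
        ∑y : ∑ y ≡ K * - λ′
        ∑y = trans (∑-sub c₁ (λ j → λ′ * B j)) (trans (cong₂ _-_ ∑c₁ (trans (sym (*-∑ λ′ B)) (cong (λ x → λ′ * x) ∑B))) (alg4 λ′ K))
          where
          alg4 : ∀ L K → 0ℤ - L * K ≡ K * - L
          alg4 = solve-∀
        rep : ∀ l → at (λ j → λ′ * B j + y j) (λ′ * ℤ.+ n + μ) l ≡ z l
        rep l = trans (at-cong (λ j → alg5 (λ′ * B j) (c₁ j)) (alg5 (λ′ * ℤ.+ n) (ν₀ - u * M)) l) (trans (sym (at-shift c₀ ν₀ u l)) (proj₂ (proj₂ (proj₂ g)) l))
          where
          alg5 : ∀ a c → a + (c - a) ≡ c
          alg5 = solve-∀

    bracket′ : ∀ τ y → 0ℤ ≤ y → y ≤ M * τ → Bracket m τ y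
    bracket′ = by m 1≤m
      where
      by : ∀ m → 1 ℕ.≤ m → ∀ τ y → 0ℤ ≤ y → y ≤ ℤ.+ m * τ → Bracket m τ y
      by (suc m′) _ = bracket m′

    cover′ : ∀ τ (z : Fin (suc r) → ℤ) → 0ℤ ≤ τ → z (fromℕ r) ≡ 0ℤ → (∀ j → z (suc j) ≤ z (inject₁ j)) → z zero ≤ K * τ → Covered k τ z
    cover′ = by k 1≤k
      where
      by : ∀ k → 1 ℕ.≤ k → ∀ τ (z : Fin (suc r) → ℤ) → 0ℤ ≤ τ → z (fromℕ r) ≡ 0ℤ → (∀ j → z (suc j) ≤ z (inject₁ j)) → z zero ≤ ℤ.+ k * τ → Covered k τ z
      by (suc k′) _ τ z = cover k′ τ z

    nonempty : ∀ {X : Fin N → ℤ} → (∀ j → X j ≡ 0ℤ ⊎ X j ≡ 1ℤ) → ∑ X ≡ K → ∃ λ j → X j ≡ 1ℤ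
    nonempty {X} h e = by (all-or-some X)
      where
      by : (∀ j → X j ≡ 0ℤ) ⊎ (∃ λ j → X j ≢ 0ℤ) → ∃ λ j → X j ≡ 1ℤ
      by (inj₁ z) = ⊥-elim (ℤ.<-irrefl (trans (sym (∑-zero z)) e) 0<K)
      by (inj₂ (j , ne)) = j , by′ (h j)
        where
        by′ : X j ≡ 0ℤ ⊎ X j ≡ 1ℤ → X j ≡ 1ℤ
        by′ (inj₁ p) = ⊥-elim (ne p)
        by′ (inj₂ p) = p

    A-01 : ∀ j → A j ≡ 0ℤ ⊎ A j ≡ 1ℤ
    A-01 j = by (A-or-B j)
      where
      by : A j ≡ 1ℤ ⊎ B j ≡ 1ℤ → A j ≡ 0ℤ ⊎ A j ≡ 1ℤ
      by (inj₁ p) = inj₂ p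
      by (inj₂ p) = inj₁ (B≡1⇒A≡0 p)

    B-01 : ∀ j → B j ≡ 0ℤ ⊎ B j ≡ 1ℤ
    B-01 j = by (A-or-B j)
      where
      by : A j ≡ 1ℤ ⊎ B j ≡ 1ℤ → B j ≡ 0ℤ ⊎ B j ≡ 1ℤ
      by (inj₁ p) = inj₁ (A≡1⇒B≡0 p)
      by (inj₂ p) = inj₂ p

    -- The cell is found from the smallest coordinates α over A and β over B.
    module Cover {X : Fin d → ℤ} {q : ℤ} (H : InHull (entries (dilate k V)) X q) where
      private
        t : ℤ
        t = scale H
        b : Fin N → ℤ
        b j = K * weight H j
        b≥0 : ∀ j → 0ℤ ≤ b j
        b≥0 j = 0≤-* (ℤ.<⇒≤ 0<K) (weight≥0 H j)
        ∑b : ∑ b ≡ K * (t * q)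
        ∑b = trans (sym (*-∑ K (weight H))) (cong (λ x → K * x) (weight-sum H))
        comb-b : ∀ l → ∑ (λ j → b j * s j l) ≡ t * X l
        comb-b l = trans (∑-cong (λ j → trans (alg K (weight H j) (s j l)) (cong (λ x → weight H j * x) (sym (entries-dilate k V j l))))) (weight-comb H l)
          where
          alg : ∀ K w s → K * w * s ≡ w * (K * s)
          alg = solve-∀
        min-A = minimum-on A b (nonempty A-01 ∑A)
        min-B = minimum-on B b (nonempty B-01 ∑B)
        i l : Fin N
        i = proj₁ min-A
        l = proj₁ min-B
        Ai : A i ≡ 1ℤ
        Ai = proj₁ (proj₂ min-A)
        Bl : B l ≡ 1ℤ
        Bl = proj₁ (proj₂ min-B)
        α β λ′ τ μ : ℤ
        α = b i
        β = b l
        λ′ = α + β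
        τ = t * q - λ′
        -- Removing the minima α on A and β on B keeps the coordinates nonnegative and leaves a
        -- point of the face without i and l.
        y : Fin N → ℤ
        y j = b j - α * A j - β * B j
        off : ∃ λ l′ → l ≡ punchIn i l′
        off = by (punchIn-cases i l)
          where
          contra : 0ℤ ≢ 1ℤ
          contra ()
          by : l ≡ i ⊎ (∃ λ l′ → l ≡ punchIn i l′) → ∃ λ l′ → l ≡ punchIn i l′
          by (inj₁ e) = ⊥-elim (contra (trans (sym (B≡1⇒A≡0 Bl)) (trans (cong A e) Ai)))
          by (inj₂ p) = p
        l′ : Fin d
        l′ = proj₁ off
        l≡ : l ≡ punchIn i l′
        l≡ = proj₂ off
        on-A : ∀ j → A j ≡ 1ℤ → y j ≡ b j - α
        on-A j e = trans (cong₂ (λ x z → b j - α * x - β * z) e (A≡1⇒B≡0 e)) (alg (b j) α β)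
          where
          alg : ∀ b α β → b - α * 1ℤ - β * 0ℤ ≡ b - α
          alg = solve-∀
        on-B : ∀ j → B j ≡ 1ℤ → y j ≡ b j - β
        on-B j e = trans (cong₂ (λ x z → b j - α * x - β * z) (B≡1⇒A≡0 e) e) (alg (b j) α β)
          where
          alg : ∀ b α β → b - α * 0ℤ - β * 1ℤ ≡ b - β
          alg = solve-∀
        y≥0 : ∀ j → 0ℤ ≤ y j
        y≥0 j = by (A-or-B j)
          where
          by : A j ≡ 1ℤ ⊎ B j ≡ 1ℤ → 0ℤ ≤ y j
          by (inj₁ e) = subst (0ℤ ≤_) (sym (on-A j e)) (ℤ.i≤j⇒0≤j-i (proj₂ (proj₂ min-A) j e))
          by (inj₂ e) = subst (0ℤ ≤_) (sym (on-B j e)) (ℤ.i≤j⇒0≤j-i (proj₂ (proj₂ min-B) j e))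
        yi : y i ≡ 0ℤ
        yi = trans (on-A i Ai) (ℤ.+-inverseʳ α)
        yl : y (punchIn i l′) ≡ 0ℤ
        yl = subst (λ x → y x ≡ 0ℤ) l≡ (trans (on-B l Bl) (ℤ.+-inverseʳ β))
        ∑y : ∑ y ≡ K * τ
        ∑y = trans (∑-sub (λ j → b j - α * A j) (λ j → β * B j)) (trans (cong₂ _-_ (∑-sub b (λ j → α * A j)) (sym (*-∑ β B)))
          (trans (cong₂ (λ x z → ∑ b - x - β * z) (trans (sym (*-∑ α A)) (cong (λ x → α * x) ∑A)) ∑B) (trans (cong (λ x → x - α * K - β * K) ∑b) (alg K (t * q) α β))))
          where
          alg : ∀ K T α β → K * T - α * K - β * K ≡ K * (T - (α + β))
          alg = solve-∀
        τ≥0 : 0ℤ ≤ τ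
        τ≥0 = multiple-pos K τ 0<K (subst (0ℤ ≤_) (trans ∑y (ℤ.*-comm K τ)) (∑-nonneg y≥0))
        α≤λ : α ≤ λ′
        α≤λ = subst (_≤ λ′) (ℤ.+-identityʳ α) (ℤ.+-monoʳ-≤ α (b≥0 l))
        -- The removed part α Σ_A s_j + β Σ_B s_j equals λ′ Σ_B s_j + m α `diff`, that is, the point
        -- with parameter m α / λ′ on the line, with weight λ′.
        br : Bracket m λ′ (M * α)
        br = bracket′ λ′ (M * α) (0≤-* (ℤ.<⇒≤ 0<M) (b≥0 i)) (ℤ.*-monoˡ-≤-nonNeg M {{ℤ.nonNegative (ℤ.<⇒≤ 0<M)}} α≤λ)
        n : ℕ
        n = Bracket.b br
        μ = M * α - λ′ * ℤ.+ n
        μ≥0 : 0ℤ ≤ μ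
        μ≥0 = ℤ.i≤j⇒0≤j-i (subst (_≤ M * α) (ℤ.*-comm (ℤ.+ n) λ′) (Bracket.lower br))
        μ≤λ : 0ℤ ≤ λ′ - μ
        μ≤λ = subst (0ℤ ≤_) (trans (cong (λ x → x * λ′ - M * α) (ℤ.pos-+ 1 n)) (alg (ℤ.+ n) λ′ (M * α))) (ℤ.i≤j⇒0≤j-i (Bracket.upper br))
          where
          alg : ∀ n L a → (1ℤ + n) * L - a ≡ L - (a - L * n)
          alg = solve-∀
        z : Fin (suc r) → ℤ
        z = levels i l′ y
        rest≥0 : ∀ j → 0ℤ ≤ rest i l′ y j
        rest≥0 j = y≥0 (punchIn i (punchIn l′ j))
        cov : Covered k τ z
        cov = cover′ τ z τ≥0 (suf-last (rest i l′ y)) (λ j → suf-mono (rest i l′ y) rest≥0 (suc j))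
          (subst (z zero ≤_) (trans (sym (∑-rest i l′ y yi yl)) ∑y) (suf≤total (rest i l′ y) rest≥0 (suc zero)))
        module C = Covered cov
        combined : ∀ l → at (λ j → λ′ * B j + y j) (λ′ * ℤ.+ n + μ) l ≡ t * X l
        combined l = trans (at-cong (λ j → alg1 (α) β (A j) (B j) (b j)) (alg2 (λ′ * ℤ.+ n) M α) l) (trans (sym (at-shift b 0ℤ (- α) l)) (trans (alg3 (∑ (λ j → b j * s j l)) (diff l)) (comb-b l)))
          where
          alg1 : ∀ α β A B b → (α + β) * B + (b - α * A - β * B) ≡ b + - α * (A - B)
          alg1 = solve-∀
          alg2 : ∀ L M α → L + (M * α - L) ≡ 0ℤ - - α * M
          alg2 = solve-∀
          alg3 : ∀ x D → x + 0ℤ * D ≡ x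
          alg3 = solve-∀

      cell : Cell
      cell = i , l′ , n , C.code

      cell-listed : cell ∈ cells
      cell-listed = ∈-cells i l′ (Bracket.b<k br) C.bounded

      cell-valid : Valid cell
      cell-valid = Ai , B≡1⇒A≡0 (subst (λ x → B x ≡ 1ℤ) l≡ Bl) , Bracket.b<k br , lev≤ C.bounded , C.monotone

      in-cell : InHull (entries (simplex cell)) X q
      in-cell = hull t (scale-pos H) (cell-weights i l′ C.code λ′ μ τ z) (λ { zero → μ≤λ ; (suc zero) → μ≥0 ; (suc (suc u)) → C.nonneg u })
        (trans (cell-weights-total i l′ C.code λ′ μ τ z) (alg λ′ (t * q)))
        (λ l → trans (∑-cong (λ u → cong (λ x → cell-weights i l′ C.code λ′ μ τ z u * x) (entries-fromEntries (vertex cell) u l))) (trans (cell-combination i l′ n C.code λ′ μ τ y yi yl ∑y l) (combined l)))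
        where
        alg : ∀ L T → L + (T - L) ≡ T
        alg = solve-∀

    covers : ∀ x → InConv (dilate k V) x → Any (λ σ → InConv σ x) triangulation
    covers x h = lose (∈-map⁺ simplex (∈-filter⁺ valid? C.cell-listed C.cell-valid)) (hull⇒conv (simplex C.cell) x X q hq rx C.in-cell)
      where
      q = proj₁ (common-denominator x)
      hq = proj₁ (proj₂ (common-denominator x))
      X = proj₁ (proj₂ (proj₂ (common-denominator x)))
      rx = proj₂ (proj₂ (proj₂ (common-denominator x)))
      module C = Cover (proj₁ (conv⇒hull (dilate k V) x X q hq rx h))

    -- Lattice points of the dilate

    lattice-at : ∀ c ν → ∑ c ≡ K → (∀ j → 0ℤ ≤ M * c j + ν * ε j) → InHull (entries (dilate k V)) (at c ν) 1ℤ
    lattice-at c ν ∑c nn = coord≥0⇒hull V affine-independent 0<M {at c ν} {1ℤ} {k} 0<K (coord-cong (at-coord c ν) (λ l → refl) (trans ∑c (sym (ℤ.*-identityʳ K))) (λ j → refl)) nn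

    p-nonneg : ∀ ν → ν ℕ.≤ m → ∀ j → 0ℤ ≤ M * B j + ℤ.+ ν * ε j
    p-nonneg ν le j = by (A-or-B j)
      where
      alg1 : ∀ M ν → ν ≡ M * 0ℤ + ν * (1ℤ - 0ℤ)
      alg1 = solve-∀
      alg2 : ∀ M ν → M - ν ≡ M * 1ℤ + ν * (0ℤ - 1ℤ)
      alg2 = solve-∀
      by : A j ≡ 1ℤ ⊎ B j ≡ 1ℤ → 0ℤ ≤ M * B j + ℤ.+ ν * ε j
      by (inj₁ e) = subst (0ℤ ≤_) (trans (alg1 M (ℤ.+ ν)) (cong₂ (λ a b → M * b + ℤ.+ ν * (a - b)) (sym e) (sym (A≡1⇒B≡0 e)))) (ℤ.+≤+ ℕ.z≤n)
      by (inj₂ e) = subst (0ℤ ≤_) (trans (alg2 M (ℤ.+ ν)) (cong₂ (λ a b → M * b + ℤ.+ ν * (a - b)) (sym (B≡1⇒A≡0 e)) (sym e))) (ℤ.i≤j⇒0≤j-i (ℤ.+≤+ le))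

    corner≥0 : ∀ κ → Valid κ → ∀ t j → 0ℤ ≤ corner κ t j
    corner≥0 (i , l′ , n , c) (_ , _ , _ , top , mono) t = coordinatewise i l′ (ℤ.≤-reflexive (sym (place-first i l′ w))) (ℤ.≤-reflexive (sym (place-second i l′ w)))
      (λ j → subst (0ℤ ≤_) (sym (place-punch i l′ w j)) (nn j))
      where
      w = fromLevels K (lev c t)
      nn : ∀ j → 0ℤ ≤ w j
      nn zero = ℤ.i≤j⇒0≤j-i (top t)
      nn (suc j) = ℤ.i≤j⇒0≤j-i (mono t j)

    ∑-corner : ∀ κ t → ∑ (corner κ t) ≡ K
    ∑-corner (i , l′ , n , c) t = trans (∑-rest i l′ (place i l′ w) (place-first i l′ w) (place-second i l′ w)) (trans (∑-cong (place-punch i l′ w)) (proj₁ (suf-fromLevels K (lev c t) (lev-last c t))))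
      where w = fromLevels K (lev c t)

    corner-coord : ∀ (c : Fin N → ℤ) → (∀ j → 0ℤ ≤ c j) → ∀ j → 0ℤ ≤ M * c j + 0ℤ * ε j
    corner-coord c c≥0 j = subst (0ℤ ≤_) (alg (M * c j) (ε j)) (0≤-* {M} {c j} (ℤ.<⇒≤ 0<M) (c≥0 j))
      where
      alg : ∀ a e → a ≡ a + 0ℤ * e
      alg = solve-∀

    vertex-lattice : ∀ κ → Valid κ → ∀ t → InHull (entries (dilate k V)) (vertex κ t) 1ℤ
    vertex-lattice κ@(i , l′ , n , c) ok zero = lattice-at B (ℤ.+ n) ∑B (p-nonneg n (ℕ.<⇒≤ (proj₁ (proj₂ (proj₂ ok)))))
    vertex-lattice κ@(i , l′ , n , c) ok (suc zero) = lattice-at B (ℤ.+ suc n) ∑B (p-nonneg (suc n) (proj₁ (proj₂ (proj₂ ok))))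
    vertex-lattice κ ok (suc (suc t)) = lattice-at (corner κ t) 0ℤ (∑-corner κ t) (corner-coord (corner κ t) (corner≥0 κ ok t))

    simplex-lattice : ∀ κ → Valid κ → ∀ t → LatticeIn (dilate k V) (lookup (simplex κ) t)
    simplex-lattice κ ok t = hull⇒lattice (dilate k V) (lookup (simplex κ) t) (hull-cong (λ i j → refl) (λ l → sym (entries-fromEntries (vertex κ) t l)) (vertex-lattice κ ok t))

    pos-factor : ∀ q → 0ℤ < q * M → 0ℤ < q
    pos-factor q h = ℤ.*-cancelʳ-<-nonNeg M {{ℤ.nonNegative (ℤ.<⇒≤ 0<M)}} (subst (_< q * M) (sym (ℤ.*-zeroˡ M)) h)

    record LineAt (x : ZPt d) (ν : ℕ) : Set where
      constructor line
      field line≡ : ∀ l → lookup x l ≡ at B (ℤ.+ ν) l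
    open LineAt

    record IntegralAt (x : ZPt d) : Set where
      field
        coeff : Fin N → ℤ
        coeff≥0 : ∀ j → 0ℤ ≤ coeff j
        ∑coeff : ∑ coeff ≡ K
        point≡ : ∀ l → lookup x l ≡ at coeff 0ℤ l

    -- Choose the multiple ρ₀ of `diff` with 0 ≤ ρ₀ < m. If ρ₀ > 0, nonnegativity of m c + ρ₀ on A
    -- and of m c - ρ₀ on B rounds to c ≥ 0 and c ≥ 1, so c ≥ B; both have the sum k and therefore
    -- coincide.
    classify : ∀ x → LatticeIn (dilate k V) x → (∃ λ ν → ν ℕ.≤ m × LineAt x ν) ⊎ IntegralAt x
    classify x x∈ = by (ρ₀ ℤ.≟ 0ℤ)
      where
      g = generates (lookup x) K
      c₀ : Fin N → ℤ
      c₀ = proj₁ g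
      ν₀ : ℤ
      ν₀ = proj₁ (proj₂ g)
      dm = divMod ν₀ M 0<M
      u ρ₀ : ℤ
      u = quot dm
      ρ₀ = rem dm
      c : Fin N → ℤ
      c j = c₀ j + u * ε j
      ∑c : ∑ c ≡ K
      ∑c = trans (∑-+ c₀ (λ j → u * ε j)) (trans (cong₂ _+_ (proj₁ (proj₂ (proj₂ g))) (trans (sym (*-∑ u ε)) (trans (cong (λ z → u * z) ∑ε) (ℤ.*-zeroʳ u)))) (ℤ.+-identityʳ K))
      x≡ : ∀ l → lookup x l ≡ at c ρ₀ l
      x≡ l = trans (sym (proj₂ (proj₂ (proj₂ g)) l)) (trans (at-shift c₀ ν₀ u l) (at-cong {c} {c} {ν₀ - u * M} {ρ₀} (λ j → refl) (trans (cong (λ z → z - u * M) (a≡ dm)) (alg ρ₀ (u * M))) l))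
        where
        alg : ∀ a b → a + b - b ≡ a
        alg = solve-∀
      b≥0 : ∀ j → 0ℤ ≤ M * c j + ρ₀ * ε j
      b≥0 = hull⇒coord≥0 V affine-independent 0<M {lookup x} {1ℤ} {k} (coord-cong (at-coord c ρ₀) (λ l → sym (x≡ l)) (trans ∑c (sym (ℤ.*-identityʳ K))) (λ j → refl)) (lattice⇒hull (dilate k V) x x∈)
      by : Dec (ρ₀ ≡ 0ℤ) → (∃ λ ν → ν ℕ.≤ m × LineAt x ν) ⊎ IntegralAt x
      by (yes e) = inj₂ record
        { coeff = c
        ; coeff≥0 = λ j → multiple-pos M (c j) 0<M (subst (0ℤ ≤_) (trans (cong (λ z → M * c j + z * ε j) e) (alg M (c j) (ε j))) (b≥0 j))
        ; ∑coeff = ∑c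
        ; point≡ = λ l → trans (x≡ l) (at-cong {c} {c} {ρ₀} {0ℤ} (λ j → refl) e l) }
        where
        alg : ∀ M c e → M * c + 0ℤ * e ≡ c * M
        alg = solve-∀
      by (no ne) = inj₁ (ν , ν≤m , line (λ l → trans (x≡ l) (at-cong c≡B ρ≡ l)))
        where
        ν = proj₁ (pos-or-zero (0≤rem dm))
        ρ≡ : ρ₀ ≡ ℤ.+ ν
        ρ≡ = proj₂ (pos-or-zero (0≤rem dm))
        ν≤m : ν ℕ.≤ m
        ν≤m = ℤ.drop‿+≤+ (subst (_≤ M) ρ≡ (ℤ.<⇒≤ (rem<D dm)))
        0<ρ : 0ℤ < ρ₀
        0<ρ = ℤ.≤∧≢⇒< (0≤rem dm) (ne ∘ sym)
        excess≥0 : ∀ j → 0ℤ ≤ c j - B j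
        excess≥0 j = by′ (A-or-B j)
          where
          alg1 : ∀ M c → (1ℤ + c) * M ≡ M * c + M
          alg1 = solve-∀
          alg2 : ∀ M c ρ → M * c + ρ * (1ℤ - 0ℤ) ≡ M * c + ρ
          alg2 = solve-∀
          alg3 : ∀ M c ρ → M * c + ρ * (0ℤ - 1ℤ) + ρ ≡ c * M
          alg3 = solve-∀
          by′ : A j ≡ 1ℤ ⊎ B j ≡ 1ℤ → 0ℤ ≤ c j - B j
          by′ (inj₁ e) = ℤ.i≤j⇒0≤j-i (subst (_≤ c j) (sym (A≡1⇒B≡0 e)) (subst (0ℤ ≤_) (pred-suc (c j)) (ℤ.i<j⇒i≤pred[j] (pos-factor (1ℤ + c j) (subst (0ℤ <_) (sym (alg1 M (c j))) (ℤ.≤-<-trans nn (ℤ.+-monoʳ-< (M * c j) (rem<D dm))))))))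
            where
            nn : 0ℤ ≤ M * c j + ρ₀
            nn = subst (0ℤ ≤_) (trans (cong₂ (λ a b → M * c j + ρ₀ * (a - b)) e (A≡1⇒B≡0 e)) (alg2 M (c j) ρ₀)) (b≥0 j)
            pred-suc : ∀ c → ℤ.pred (1ℤ + c) ≡ c
            pred-suc c = ℤ.pred-suc c
          by′ (inj₂ e) = ℤ.i≤j⇒0≤j-i (subst (_≤ c j) (sym e) (ℤ.i<j⇒suc[i]≤j (pos-factor (c j) (subst (0ℤ <_) (trans (cong₂ (λ a b → M * c j + ρ₀ * (a - b) + ρ₀) (B≡1⇒A≡0 e) e) (alg3 M (c j) ρ₀)) (ℤ.+-mono-≤-< (b≥0 j) 0<ρ)))))
        c≡B : ∀ j → c j ≡ B j
        c≡B j = ℤ.i-j≡0⇒i≡j (c j) (B j) (∑≡0⇒≡0 excess≥0 (trans (∑-sub c B) (trans (cong₂ _-_ ∑c ∑B) (ℤ.+-inverseʳ K))) j)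

    -- Coordinates as affine functions on height k

    coord-zero : IsCoord s M (λ _ → 0ℤ) 0ℤ (λ _ → 0ℤ)
    coord-zero = coord (trans (∑-zero {f = λ (j : Fin N) → 0ℤ} (λ j → refl)) (sym (ℤ.*-zeroʳ M))) (λ l → trans (∑-zero (λ j → ℤ.*-zeroˡ (s j l))) (sym (ℤ.*-zeroʳ M)))

    coord-∑ : ∀ {p} (x : Fin p → ℤ) {y : Fin p → Fin d → ℤ} {h : Fin p → ℤ} {b : Fin p → Fin N → ℤ} → (∀ a → IsCoord s M (y a) (h a) (b a)) →
      IsCoord s M (λ l → ∑ (λ a → x a * y a l)) (∑ (λ a → x a * h a)) (λ j → ∑ (λ a → x a * b a j))
    coord-∑ {zero} x C = coord-cong coord-zero (λ l → sym ∑-empty) (sym ∑-empty) (λ j → sym ∑-empty)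
    coord-∑ {suc p} x {y} {h} {b} C = coord-cong (coord-linear (x zero) 1ℤ (C zero) (coord-∑ (λ a → x (suc a)) (λ a → C (suc a))))
      (λ l → trans (cong (λ z → x zero * y zero l + z) (ℤ.*-identityˡ (∑ (λ a → x (suc a) * y (suc a) l)))) (sym (∑-suc (λ a → x a * y a l))))
      (trans (cong (λ z → x zero * h zero + z) (ℤ.*-identityˡ (∑ (λ a → x (suc a) * h (suc a))))) (sym (∑-suc (λ a → x a * h a))))
      (λ j → trans (cong (λ z → x zero * b zero j + z) (ℤ.*-identityˡ (∑ (λ a → x (suc a) * b (suc a) j)))) (sym (∑-suc (λ a → x a * b a j))))

    basis-coords : (Fin d → ℤ) → ℤ → Fin N → ℤ
    basis-coords x h j = M * proj₁ (generates x h) j + proj₁ (proj₂ (generates x h)) * ε j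

    basis-isCoord : ∀ (x : Fin d → ℤ) h → IsCoord s M x h (basis-coords x h)
    basis-isCoord x h = let (c , ν , ∑c , e) = generates x h in coord-cong (at-coord c ν) e ∑c (λ j → refl)

    -- `generates` chooses a representation separately for each vector. Only its choices at the unit
    -- vectors and the origin enter here, which makes the coordinates affine in x by construction.
    coords : (Fin d → ℤ) → Fin N → ℤ
    coords x j = ∑ (λ a → x a * basis-coords (δ a) 0ℤ j) + basis-coords (λ _ → 0ℤ) K j

    coords-isCoord : ∀ (x : Fin d → ℤ) → IsCoord s M x K (coords x)
    coords-isCoord x = coord-cong (coord-linear 1ℤ 1ℤ (coord-∑ x (λ a → basis-isCoord (δ a) 0ℤ)) (basis-isCoord (λ _ → 0ℤ) K))
      (λ l → trans (alg1 (∑ (λ a → x a * δ a l))) (trans (∑-cong (λ a → cong (λ z → x a * z) (δ-sym a l))) (∑-δʳ l x)))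
      (trans (cong (λ z → 1ℤ * z + 1ℤ * K) (∑-zero (λ a → ℤ.*-zeroʳ (x a)))) (alg2 K))
      (λ j → alg3 (∑ (λ a → x a * basis-coords (δ a) 0ℤ j)) (basis-coords (λ _ → 0ℤ) K j))
      where
      alg1 : ∀ x → 1ℤ * x + 1ℤ * 0ℤ ≡ x
      alg1 = solve-∀
      alg2 : ∀ K → 1ℤ * 0ℤ + 1ℤ * K ≡ K
      alg2 = solve-∀
      alg3 : ∀ x y → 1ℤ * x + 1ℤ * y ≡ x + y
      alg3 = solve-∀

    coords-affine : ∀ j → IsAffine (λ x → coords x j)
    coords-affine j = record { slope = λ a → basis-coords (δ a) 0ℤ j ; intercept = basis-coords (λ _ → 0ℤ) K j
      ; affine-eq = λ x → cong (λ z → z + basis-coords (λ _ → 0ℤ) K j) (∑-cong (λ a → ℤ.*-comm (x a) (basis-coords (δ a) 0ℤ j))) }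

    coords-at : ∀ {x : Fin d → ℤ} {c : Fin N → ℤ} {ν} → ∑ c ≡ K → (∀ l → x l ≡ at c ν l) → ∀ j → coords x j ≡ M * c j + ν * ε j
    coords-at {x} {c} {ν} ∑c e = coord-unique affine-independent (coords-isCoord x) (at-coord c ν) e (sym ∑c)

    -- Heights and supporting functions

    -- The affine function of a cell interpolates chords of squares of differences of suffix sums.

    base : Code r → Fin (suc (suc r)) → ℤ
    base c zero = K
    base c (suc j) = lev c zero j

    -- The total K is constant on the cell; the last position, beyond which there is no vertex,
    -- expresses that it does not jump.
    jump : Code r → Fin (suc (suc r)) → Fin (suc r)
    jump c zero = fromℕ r
    jump c (suc j) = pos c j

    level : Code r → Fin (suc r) → Fin (suc (suc r)) → ℤ
    level c t zero = K
    level c t (suc j) = lev c t j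

    level≡ : ∀ c t p → level c t p ≡ base c p + gt t (jump c p)
    level≡ c t zero = trans (sym (ℤ.+-identityʳ K)) (cong (λ z → K + z) (sym (gt-last t)))
    level≡ c t (suc j) = lev-pos c t j

    shift-by : ∀ {p q : Fin (suc r)} → ℤ → Dec (p Fin.≤ q) → ℤ
    shift-by x (yes _) = x
    shift-by x (no _) = x - 1ℤ

    -- The lower end of the unit interval that contains the difference of levels p and q on the
    -- whole cell: if p jumps no later than q, the difference can only rise above that of the bases,
    -- otherwise it can only fall below.
    shift : Code r → Fin (suc (suc r)) → Fin (suc (suc r)) → ℤ
    shift c p q = shift-by (base c p - base c q) (jump c p Fin.≤? jump c q)

    shift-≤ : ∀ c p q → jump c p Fin.≤ jump c q → shift c p q ≡ base c p - base c q
    shift-≤ c p q le = by (jump c p Fin.≤? jump c q)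
      where
      by : ∀ (D : Dec (jump c p Fin.≤ jump c q)) → shift-by (base c p - base c q) D ≡ base c p - base c q
      by (yes _) = refl
      by (no n) = ⊥-elim (n le)

    shift-step : ∀ c t p q → 01-step ((level c t p - level c t q) - shift c p q)
    shift-step c t p q = subst 01-step (cong₂ (λ x y → x - y - shift c p q) (sym (level≡ c t p)) (sym (level≡ c t q))) (by (jump c p Fin.≤? jump c q))
      where
      alg1 : ∀ a g b h → g - h ≡ a + g - (b + h) - (a - b)
      alg1 = solve-∀
      alg2 : ∀ a g b h → g - h + 1ℤ ≡ a + g - (b + h) - (a - b - 1ℤ)
      alg2 = solve-∀
      by : ∀ (D : Dec (jump c p Fin.≤ jump c q)) → 01-step (base c p + gt t (jump c p) - (base c q + gt t (jump c q)) - shift-by (base c p - base c q) D)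
      by (yes le) = subst 01-step (alg1 (base c p) (gt t (jump c p)) (base c q) (gt t (jump c q))) (proj₁ (gt-step t (jump c p) (jump c q)) le)
      by (no n) = subst 01-step (alg2 (base c p) (gt t (jump c p)) (base c q) (gt t (jump c q))) (proj₂ (gt-step t (jump c p) (jump c q)) n)

    spread : (Fin N → ℤ) → Fin (suc N) → Fin (suc N) → ℤ
    spread u a b = suf u a - suf u b

    -- On each face this induces a Freudenthal triangulation. The sum runs over all N + 1 suffix
    -- sums, so it refers to no choice of omitted vertices and the cells over different faces share
    -- one height function.
    Q : (Fin N → ℤ) → ℤ
    Q u = ∑∑ (λ a b → spread u a b * spread u a b)

    turn : Cell → Fin (suc N) → Fin (suc N) → ℤ
    turn (i , l′ , n , c) a b = shift c (ρ i l′ a) (ρ i l′ b)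

    gaps chords : Cell → (Fin N → ℤ) → ℤ
    gaps κ u = ∑∑ (λ a b → gap (spread u a b) (turn κ a b))
    chords κ u = ∑∑ (λ a b → chord (turn κ a b) (spread u a b))

    Q≡ : ∀ κ u → Q u ≡ gaps κ u + chords κ u
    Q≡ κ u = trans (∑∑-cong (λ a b → square-chord (spread u a b) (turn κ a b))) (trans (∑-cong (λ a → ∑-+ (λ b → gap (spread u a b) (turn κ a b)) (λ b → chord (turn κ a b) (spread u a b))))
      (∑-+ (λ a → ∑ (λ b → gap (spread u a b) (turn κ a b))) (λ a → ∑ (λ b → chord (turn κ a b) (spread u a b)))))

    gaps≥0 : ∀ κ u → 0ℤ ≤ gaps κ u
    gaps≥0 κ u = ∑∑-nonneg (λ a b → gap-nonneg (spread u a b) (turn κ a b))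

    suf-corner : ∀ i l′ n c t a → suf (corner (i , l′ , n , c) t) a ≡ level c t (ρ i l′ a)
    suf-corner i l′ n c t a = trans (suf-rest i l′ (place i l′ w) (place-first i l′ w) (place-second i l′ w) a) (trans (suf-cong (place-punch i l′ w) (ρ i l′ a)) (by (ρ i l′ a)))
      where
      w = fromLevels K (lev c t)
      by : ∀ p → suf w p ≡ level c t p
      by zero = proj₁ (suf-fromLevels K (lev c t) (lev-last c t))
      by (suc j) = proj₂ (suf-fromLevels K (lev c t) (lev-last c t)) j

    gaps-corner : ∀ κ t → gaps κ (corner κ t) ≡ 0ℤ
    gaps-corner κ@(i , l′ , n , c) t = ∑-zero (λ a → ∑-zero (λ b → ⇒gap≡0 (spread (corner κ t) a b) (turn κ a b)
      (subst 01-step (cong₂ (λ x y → x - y - turn κ a b) (sym (suf-corner i l′ n c t a)) (sym (suf-corner i l′ n c t b))) (shift-step c t (ρ i l′ a) (ρ i l′ b)))))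

    ρ-surjective : ∀ i l′ p → ∃ λ a → ρ i l′ a ≡ p
    ρ-surjective i l′ p = let (a₁ , e₁) = pinch-surjective l′ p
                              (a₂ , e₂) = pinch-surjective i a₁ in a₂ , trans (cong (pinch l′) e₂) e₁

    -- Nonnegative gaps with sum 0 vanish one by one, so each difference of suffix sums takes an end
    -- value of its unit interval, and `tight⇒vertex` applies.
    gaps≡0⇒corner : ∀ κ (u : Fin N → ℤ) → ∑ u ≡ K → u (first κ) ≡ 0ℤ → u (second κ) ≡ 0ℤ → gaps κ u ≡ 0ℤ → ∃ λ t → ∀ j → u j ≡ corner κ t j
    gaps≡0⇒corner κ@(i , l′ , n , c) u ∑u ui ul g = t , coordinatewise i l′ (trans ui (sym (place-first i l′ w))) (trans ul (sym (place-second i l′ w)))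
        (λ j → trans (suf-injective sums j) (sym (place-punch i l′ w j)))
      where
      each : ∀ a b → gap (spread u a b) (turn κ a b) ≡ 0ℤ
      each = ∑∑≡0⇒≡0 (λ a b → gap-nonneg (spread u a b) (turn κ a b)) g
      z : Fin (suc r) → ℤ
      z = levels i l′ u
      alg : ∀ z z′ a b → z - z′ - (a - b) ≡ z - a - (z′ - b)
      alg = solve-∀
      steps : ∀ j j′ → pos c j Fin.≤ pos c j′ → 01-step ((z j - lev c zero j) - (z j′ - lev c zero j′))
      steps j j′ le = subst 01-step (trans (cong₂ _-_ (cong₂ _-_ (sufa j) (sufa j′)) (trans (cong₂ (shift c) (ρa j) (ρa j′)) (shift-≤ c (suc j) (suc j′) le))) (alg (z j) (z j′) (lev c zero j) (lev c zero j′)))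
          (gap≡0⇒ (spread u (at′ j) (at′ j′)) (turn κ (at′ j) (at′ j′)) (each (at′ j) (at′ j′)))
        where
        at′ : Fin (suc r) → Fin (suc N)
        at′ j = proj₁ (ρ-surjective i l′ (suc j))
        ρa : ∀ j → ρ i l′ (at′ j) ≡ suc j
        ρa j = proj₂ (ρ-surjective i l′ (suc j))
        sufa : ∀ j → suf u (at′ j) ≡ z j
        sufa j = trans (suf-rest i l′ u ui ul (at′ j)) (cong (suf (rest i l′ u)) (ρa j))
      found = tight⇒vertex c z (suf-last (rest i l′ u)) steps
      t = proj₁ found
      w = fromLevels K (lev c t)
      sums : ∀ a → suf (rest i l′ u) a ≡ suf w a
      sums zero = trans (sym (∑-rest i l′ u ui ul)) (trans ∑u (sym (proj₁ (suf-fromLevels K (lev c t) (lev-last c t)))))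
      sums (suc j) = trans (proj₂ found j) (sym (proj₂ (suf-fromLevels K (lev c t) (lev-last c t)) j))

    -- Heights are scaled by m² to be integral: ν² - depth on the line Σ_B s_j + ν diff, and the sum
    -- of the squared differences of suffix sums of the coordinates elsewhere.

    line-excess-A line-excess-B : Cell → ℤ
    line-excess-A κ@(_ , _ , n , _) = chord (ℤ.+ n) M - chords κ A
    line-excess-B κ@(_ , _ , n , _) = chord (ℤ.+ n) 0ℤ - chords κ B

    -- Large enough to push the points of the line below all other lattice points
    depth : ℤ
    depth = 1ℤ + (bound line-excess-A cells + bound line-excess-B cells)

    line-height : ℤ → ℤ
    line-height ν = M * M * (ν * ν - depth)

    line-point : ℕ → ZPt d
    line-point ν = tabulate (at B (ℤ.+ ν))

    OnLine : ZPt d → Set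
    OnLine x = ∃ λ (ν : Fin (suc m)) → line-point (toℕ ν) ≡ x

    on-line? : ∀ x → Dec (OnLine x)
    on-line? x = Fin.any? (λ ν → line-point (toℕ ν) ≟ᵖ x)

    height-by : ∀ x → Dec (OnLine x) → ℤ
    height-by x (yes (ν , _)) = line-height (ℤ.+ toℕ ν)
    height-by x (no _) = Q (coords (lookup x))

    height : ZPt d → ℤ
    height x = height-by x (on-line? x)

    lineAt : ∀ {x} ν → line-point ν ≡ x → LineAt x ν
    lineAt ν refl = line (Vec.lookup∘tabulate (at B (ℤ.+ ν)))

    onLine : ∀ {x ν} → ν ℕ.≤ m → LineAt x ν → OnLine x
    onLine {x} {ν} le h = Fin.fromℕ< (ℕ.s≤s le) , trans (cong line-point (Fin.toℕ-fromℕ< (ℕ.s≤s le))) (lookup-ext (λ l → trans (Vec.lookup∘tabulate (at B (ℤ.+ ν)) l) (sym (line≡ h l))))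

    line-coords : ∀ {x ν} → LineAt x ν → ∀ j → coords (lookup x) j ≡ M * B j + ℤ.+ ν * ε j
    line-coords {x} {ν} h = coords-at {lookup x} {B} {ℤ.+ ν} ∑B (line≡ h)

    coord-on-A : ∀ ν j → A j ≡ 1ℤ → M * B j + ν * ε j ≡ ν
    coord-on-A ν j e = trans (cong₂ (λ a b → M * b + ν * (a - b)) e (A≡1⇒B≡0 e)) (alg M ν)
      where
      alg : ∀ M ν → M * 0ℤ + ν * (1ℤ - 0ℤ) ≡ ν
      alg = solve-∀

    coord-on-B : ∀ ν j → B j ≡ 1ℤ → M * B j + ν * ε j ≡ M - ν
    coord-on-B ν j e = trans (cong₂ (λ a b → M * b + ν * (a - b)) (B≡1⇒A≡0 e) e) (alg M ν)
      where
      alg : ∀ M ν → M * 1ℤ + ν * (0ℤ - 1ℤ) ≡ M - ν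
      alg = solve-∀

    line-unique : ∀ {x ν ξ} → LineAt x ν → LineAt x ξ → ν ≡ ξ
    line-unique {x} {ν} {ξ} h g = let (j , e) = nonempty A-01 ∑A in
      ℤ.+-injective (trans (sym (coord-on-A (ℤ.+ ν) j e)) (trans (sym (line-coords {x} h j)) (trans (line-coords {x} g j) (coord-on-A (ℤ.+ ξ) j e))))

    height-line : ∀ {x ν} → ν ℕ.≤ m → LineAt x ν → height x ≡ line-height (ℤ.+ ν)
    height-line {x} {ν} le h = by (on-line? x)
      where
      by : ∀ D → height-by x D ≡ line-height (ℤ.+ ν)
      by (yes (ξ , e)) = cong (λ z → line-height (ℤ.+ z)) (line-unique {x} {toℕ ξ} {ν} (lineAt (toℕ ξ) e) h)
      by (no n) = ⊥-elim (n (onLine le h))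

    Q-scale : ∀ {b u : Fin N → ℤ} → (∀ j → b j ≡ M * u j) → Q b ≡ M * M * Q u
    Q-scale {b} {u} h = trans (∑∑-cong (λ a a′ → trans (cong₂ (λ x y → (x - y) * (x - y)) (sufb a) (sufb a′)) (alg M (suf u a) (suf u a′))))
        (trans (∑∑-lin (M * M) 0ℤ (λ a a′ → spread u a a′ * spread u a a′) (λ a a′ → 0ℤ)) (alg3 (M * M * Q u) (∑∑ {suc N} (λ _ _ → 0ℤ))))
      where
      alg : ∀ M x y → (M * x - M * y) * (M * x - M * y) ≡ M * M * ((x - y) * (x - y)) + 0ℤ * 0ℤ
      alg = solve-∀
      alg2 : ∀ M x → M * x ≡ M * x + 0ℤ * x
      alg2 = solve-∀
      alg3 : ∀ x y → x + 0ℤ * y ≡ x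
      alg3 = solve-∀
      sufb : ∀ a → suf b a ≡ M * suf u a
      sufb a = trans (suf-cong (λ j → trans (h j) (alg2 M (u j))) a) (trans (suf-lin₂ M 0ℤ u u a) (sym (alg2 M (suf u a))))

    integral-coords : ∀ {x} (I : IntegralAt x) j → coords (lookup x) j ≡ M * IntegralAt.coeff I j
    integral-coords {x} I j = trans (coords-at {lookup x} {IntegralAt.coeff I} {0ℤ} (IntegralAt.∑coeff I) (IntegralAt.point≡ I) j) (alg (M * IntegralAt.coeff I j) (ε j))
      where
      alg : ∀ a e → a + 0ℤ * e ≡ a
      alg = solve-∀

    height-integral : ∀ {x} (I : IntegralAt x) → ¬ OnLine x → height x ≡ M * M * Q (IntegralAt.coeff I)
    height-integral {x} I off = by (on-line? x)
      where
      by : ∀ D → height-by x D ≡ M * M * Q (IntegralAt.coeff I)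
      by (yes p) = ⊥-elim (off p)
      by (no _) = Q-scale (integral-coords I)

    -- The supporting function of a cell

    -- On the line the supporting function has to equal the chord of ν² over [n , n + 1], minus
    -- `depth`, whereas `chords` has other values at the ends ν = 0 and ν = m, which are the
    -- indicators of B and A. The difference is supplied by the coordinates at the omitted vertices,
    -- which are ν and m - ν on the line and 0 at the corners.
    slope-A slope-B : Cell → ℤ
    slope-A κ = line-excess-A κ - depth
    slope-B κ = line-excess-B κ - depth

    -- This is m² `chord t (y / m)`, as the coordinates carry the denominator m.
    scaled-chord : ℤ → ℤ → ℤ
    scaled-chord t y = M * (1ℤ + (t + t)) * y - M * M * (t * (1ℤ + t))

    scaled-chords : Cell → (Fin N → ℤ) → ℤ
    scaled-chords κ b = ∑∑ (λ a a′ → scaled-chord (turn κ a a′) (spread b a a′))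

    form : Cell → (Fin d → ℤ) → ℤ
    form κ x = scaled-chords κ (coords x) + (M * slope-A κ * coords x (first κ) + M * slope-B κ * coords x (second κ))

    form-affine : ∀ κ → IsAffine (form κ)
    form-affine κ = affine-+ (affine-∑ (λ a → affine-∑ (λ a′ → scaled (turn κ a a′) (spread-affine a a′)))) (affine-lin₂ (M * slope-A κ) (M * slope-B κ) (coords-affine (first κ)) (coords-affine (second κ)))
      where
      alg : ∀ x y → 1ℤ * x + - 1ℤ * y ≡ x - y
      alg = solve-∀
      sufs : ∀ a → IsAffine (λ x → suf (coords x) a)
      sufs = affine-suf coords-affine
      spread-affine : ∀ a a′ → IsAffine (λ x → spread (coords x) a a′)
      spread-affine a a′ = affine-cong (affine-lin₂ 1ℤ (- 1ℤ) (sufs a) (sufs a′)) (λ x → alg (suf (coords x) a) (suf (coords x) a′))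
      scaled : ∀ t {f : (Fin d → ℤ) → ℤ} → IsAffine f → IsAffine (λ x → scaled-chord t (f x))
      scaled t {f} F = affine-cong (affine-lin₂ (M * (1ℤ + (t + t))) (- (M * M * (t * (1ℤ + t)))) F (affine-const 1ℤ))
        (λ x → alg3 (M * (1ℤ + (t + t)) * f x) (M * M * (t * (1ℤ + t))))
        where
        alg3 : ∀ a b → a + - b * 1ℤ ≡ a - b
        alg3 = solve-∀

    scaled-chords-mix : ∀ κ {b u v : Fin N → ℤ} β γ → β + γ ≡ M → (∀ j → b j ≡ β * u j + γ * v j) → scaled-chords κ b ≡ M * (β * chords κ u + γ * chords κ v)
    scaled-chords-mix κ {b} {u} {v} β γ e h = trans (∑∑-cong pointwise) (trans (∑∑-lin (M * β) (M * γ) (λ a a′ → chord (turn κ a a′) (spread u a a′)) (λ a a′ → chord (turn κ a a′) (spread v a a′)))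
        (alg2 M β γ (chords κ u) (chords κ v)))
      where
      alg : ∀ M β γ t x y x′ y′ → M * (1ℤ + (t + t)) * (β * x + γ * y - (β * x′ + γ * y′)) - M * (β + γ) * (t * (1ℤ + t)) ≡
        M * β * ((1ℤ + (t + t)) * (x - x′) - t * (1ℤ + t)) + M * γ * ((1ℤ + (t + t)) * (y - y′) - t * (1ℤ + t))
      alg = solve-∀
      alg2 : ∀ M β γ x y → M * β * x + M * γ * y ≡ M * (β * x + γ * y)
      alg2 = solve-∀
      sufb : ∀ a → suf b a ≡ β * suf u a + γ * suf v a
      sufb a = trans (suf-cong h a) (suf-lin₂ β γ u v a)
      pointwise : ∀ a a′ → scaled-chord (turn κ a a′) (spread b a a′) ≡ M * β * chord (turn κ a a′) (spread u a a′) + M * γ * chord (turn κ a a′) (spread v a a′)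
      pointwise a a′ = trans (cong₂ (λ x y → M * (1ℤ + (turn κ a a′ + turn κ a a′)) * (x - y) - M * M * (turn κ a a′ * (1ℤ + turn κ a a′))) (sufb a) (sufb a′))
        (trans (cong (λ z → M * (1ℤ + (turn κ a a′ + turn κ a a′)) * (β * suf u a + γ * suf v a - (β * suf u a′ + γ * suf v a′)) - M * z * (turn κ a a′ * (1ℤ + turn κ a a′))) (sym e))
          (alg M β γ (turn κ a a′) (suf u a) (suf v a) (suf u a′) (suf v a′)))

    form-integral : ∀ κ {x} (I : IntegralAt x) → let c = IntegralAt.coeff I in form κ (lookup x) ≡ M * M * (chords κ c + (slope-A κ * c (first κ) + slope-B κ * c (second κ)))
    form-integral κ {x} I = trans (cong₂ _+_ (scaled-chords-mix κ {coords (lookup x)} {c} {c} M 0ℤ (ℤ.+-identityʳ M) (λ j → trans (integral-coords I j) (alg M (c j))))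
        (cong₂ (λ y z → M * slope-A κ * y + M * slope-B κ * z) (integral-coords I (first κ)) (integral-coords I (second κ))))
        (alg2 M (chords κ c) (slope-A κ) (slope-B κ) (c (first κ)) (c (second κ)))
      where
      c = IntegralAt.coeff I
      alg : ∀ M x → M * x ≡ M * x + 0ℤ * x
      alg = solve-∀
      alg2 : ∀ M e a b x y → M * (M * e + 0ℤ * e) + (M * a * (M * x) + M * b * (M * y)) ≡ M * M * (e + (a * x + b * y))
      alg2 = solve-∀

    form-line : ∀ κ {x ν} → Valid κ → LineAt x ν → form κ (lookup x) ≡ M * M * (chord (ℤ.+ proj₁ (proj₂ (proj₂ κ))) (ℤ.+ ν) - depth)
    form-line κ@(i , l′ , n , c) {x} {ν} (Ai , Al , _) h = trans (cong₂ _+_ (scaled-chords-mix κ {coords (lookup x)} {B} {A} (M - ν′) ν′ (alg1 M ν′) (λ j → trans (line-coords {x} h j) (alg2 M (B j) ν′ (A j))))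
        (cong₂ (λ y z → M * slope-A κ * y + M * slope-B κ * z) (trans (line-coords {x} h i) (coord-on-A ν′ i Ai)) (trans (line-coords {x} h (punchIn i l′)) (coord-on-B ν′ (punchIn i l′) (A≡0⇒B≡1 Al)))))
        (alg3 M ν′ (ℤ.+ n) (chords κ B) (chords κ A) depth)
      where
      ν′ : ℤ
      ν′ = ℤ.+ ν
      alg1 : ∀ M ν → M - ν + ν ≡ M
      alg1 = solve-∀
      alg2 : ∀ M b ν a → M * b + ν * (a - b) ≡ (M - ν) * b + ν * a
      alg2 = solve-∀
      alg3 : ∀ M ν n eB eA D → M * ((M - ν) * eB + ν * eA) + (M * ((1ℤ + (n + n)) * M - n * (1ℤ + n) - eA - D) * ν + M * ((1ℤ + (n + n)) * 0ℤ - n * (1ℤ + n) - eB - D) * (M - ν))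
        ≡ M * M * ((1ℤ + (n + n)) * ν - n * (1ℤ + n) - D)
      alg3 = solve-∀

    excess<0 : ∀ a b c → a ≤ b → 0ℤ ≤ c → a - (1ℤ + (b + c)) < 0ℤ
    excess<0 a b c a≤b 0≤c = ℤ.≤-<-trans (subst (_≤ - 1ℤ) (alg a (b + c)) (ℤ.+-monoʳ-≤ (- 1ℤ) (ℤ.i≤j⇒i-j≤0 (ℤ.≤-trans a≤b (subst (_≤ b + c) (ℤ.+-identityʳ b) (ℤ.+-monoʳ-≤ b 0≤c)))))) ℤ.-<+
      where
      alg : ∀ a x → - 1ℤ + (a - x) ≡ a - (1ℤ + x)
      alg = solve-∀

    slope-A<0 : ∀ {κ} → κ ∈ cells → slope-A κ < 0ℤ
    slope-A<0 {κ} κ∈ = excess<0 (line-excess-A κ) (bound line-excess-A cells) (bound line-excess-B cells) (≤bound line-excess-A cells κ∈) (0≤bound line-excess-B cells)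

    slope-B<0 : ∀ {κ} → κ ∈ cells → slope-B κ < 0ℤ
    slope-B<0 {κ} κ∈ = subst (λ z → line-excess-B κ - (1ℤ + z) < 0ℤ) (ℤ.+-comm (bound line-excess-B cells) (bound line-excess-A cells))
      (excess<0 (line-excess-B κ) (bound line-excess-B cells) (bound line-excess-A cells) (≤bound line-excess-B cells κ∈) (0≤bound line-excess-A cells))

    0<M² : 0ℤ < M * M
    0<M² = 0<-* {M} {M} 0<M 0<M

    scale-< : ∀ {a b} → a < b → M * M * a < M * M * b
    scale-< {a} {b} h = ℤ.*-monoˡ-<-pos (M * M) {{ℤ.positive 0<M²}} h

    positive-gap : ∀ {g} → 0ℤ ≤ g → g ≢ 0ℤ → 0ℤ < g
    positive-gap le ne = ℤ.≤∧≢⇒< le (ne ∘ sym)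

    raise : ∀ {g} e → 0ℤ < g → e < g + e
    raise {g} e h = subst (_< g + e) (ℤ.+-identityˡ e) (ℤ.+-monoˡ-< e h)

    neg-term : ∀ {a x} → a < 0ℤ → 0ℤ ≤ x → a * x ≤ 0ℤ
    neg-term {a} {x} a<0 x≥0 = subst (a * x ≤_) (ℤ.*-zeroˡ x) (ℤ.*-monoʳ-≤-nonNeg x {{ℤ.nonNegative x≥0}} (ℤ.<⇒≤ a<0))

    neg-term-strict : ∀ {a x} → a < 0ℤ → 0ℤ < x → a * x < 0ℤ
    neg-term-strict {a} {x} a<0 x>0 = subst (a * x <_) (ℤ.*-zeroˡ x) (ℤ.*-monoʳ-<-pos x {{ℤ.positive x>0}} a<0)

    lookup-vertex : ∀ κ t {x} → (∀ l → lookup x l ≡ vertex κ t l) → lookup (simplex κ) t ≡ x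
    lookup-vertex κ t {x} h = lookup-ext (λ l → trans (entries-fromEntries (vertex κ) t l) (sym (h l)))

    -- ν² meets its chord over [n , n + 1] at integers only for ν = n and ν = n + 1, and these two
    -- points are vertices of the cell.
    below-line : ∀ κ → Valid κ → ∀ {x ν} → ν ℕ.≤ m → LineAt x ν → ¬ (∃ λ j → lookup (simplex κ) j ≡ x) → form κ (lookup x) < height x
    below-line κ@(i , l′ , n , c) ok {x} {ν} le h off = subst₂ _<_ (sym (form-line κ ok h)) (sym (height-line le h))
        (scale-< (ℤ.+-monoˡ-< (- depth) (subst (chord (ℤ.+ n) (ℤ.+ ν) <_) (sym (square-chord (ℤ.+ ν) (ℤ.+ n))) (raise (chord (ℤ.+ n) (ℤ.+ ν)) (positive-gap (gap-nonneg (ℤ.+ ν) (ℤ.+ n)) (λ e → by (gap≡0⇒ (ℤ.+ ν) (ℤ.+ n) e)))))))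
      where
      alg : ∀ a n → a - n ≡ 1ℤ → a ≡ 1ℤ + n
      alg a n e = trans (alg′ a n) (cong (_+ n) e)
        where
        alg′ : ∀ a n → a ≡ a - n + n
        alg′ = solve-∀
      by : ¬ 01-step (ℤ.+ ν - ℤ.+ n)
      by (inj₁ e) = off (zero , lookup-vertex κ zero (λ l → trans (line≡ h l) (cong (λ z → at B z l) (ℤ.i-j≡0⇒i≡j (ℤ.+ ν) (ℤ.+ n) e))))
      by (inj₂ e) = off (suc zero , lookup-vertex κ (suc zero) (λ l → trans (line≡ h l) (cong (λ z → at B z l) (trans (alg (ℤ.+ ν) (ℤ.+ n) e) (sym (ℤ.pos-+ 1 n))))))

    -- If the point has a positive coefficient at an omitted vertex, the negative slopes push the
    -- form below `chords`, which is at most Q. Otherwise the form equals `chords`, and equality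
    -- with Q would make the point a corner.
    below-integral : ∀ κ → κ ∈ cells → ∀ {x} (I : IntegralAt x) → ¬ OnLine x → ¬ (∃ λ j → lookup (simplex κ) j ≡ x) → form κ (lookup x) < height x
    below-integral κ@(i , l′ , n , c) κ∈ {x} I not-line off = subst₂ _<_ (sym (form-integral κ I)) (sym (height-integral I not-line))
        (scale-< (subst (chords κ u + (a * x₁ + b * x₂) <_) (sym (trans (Q≡ κ u) (ℤ.+-comm (gaps κ u) (chords κ u)))) (ℤ.+-monoʳ-< (chords κ u) (by (x₁ ℤ.≟ 0ℤ) (x₂ ℤ.≟ 0ℤ)))))
      where
      open IntegralAt I renaming (coeff to u; coeff≥0 to u≥0)
      a b x₁ x₂ : ℤ
      a = slope-A κ
      b = slope-B κ
      x₁ = u (first κ)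
      x₂ = u (second κ)
      by : Dec (x₁ ≡ 0ℤ) → Dec (x₂ ≡ 0ℤ) → a * x₁ + b * x₂ < gaps κ u
      by (yes e₁) (yes e₂) = subst (_< gaps κ u) (sym (trans (cong₂ (λ y z → a * y + b * z) e₁ e₂) (alg a b))) (positive-gap (gaps≥0 κ u) λ e →
          let (t , h) = gaps≡0⇒corner κ u ∑coeff e₁ e₂ e in off (suc (suc t) , lookup-vertex κ (suc (suc t)) (λ l → trans (point≡ l) (at-cong {u} {corner κ t} {0ℤ} {0ℤ} h refl l))))
        where
        alg : ∀ a b → a * 0ℤ + b * 0ℤ ≡ 0ℤ
        alg = solve-∀
      by (no ne) _ = ℤ.<-≤-trans (ℤ.+-mono-<-≤ (neg-term-strict {a} {x₁} (slope-A<0 κ∈) (positive-gap (u≥0 (first κ)) ne)) (neg-term {b} {x₂} (slope-B<0 κ∈) (u≥0 (second κ)))) (gaps≥0 κ u)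
      by _ (no ne) = ℤ.<-≤-trans (ℤ.+-mono-≤-< (neg-term {a} {x₁} (slope-A<0 κ∈) (u≥0 (first κ))) (neg-term-strict {b} {x₂} (slope-B<0 κ∈) (positive-gap (u≥0 (second κ)) ne))) (gaps≥0 κ u)

    below : ∀ κ → κ ∈ cells → Valid κ → ∀ x → LatticeIn (dilate k V) x → ¬ (∃ λ j → lookup (simplex κ) j ≡ x) → form κ (lookup x) < height x
    below κ κ∈ ok x x∈ off = by (classify x x∈)
      where
      by : (∃ λ ν → ν ℕ.≤ m × LineAt x ν) ⊎ IntegralAt x → form κ (lookup x) < height x
      by (inj₁ (ν , le , h)) = below-line κ ok le h off
      by (inj₂ I) = by′ (on-line? x)
        where
        by′ : Dec (OnLine x) → form κ (lookup x) < height x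
        by′ (yes (ν , e)) = below-line κ ok (ℕ.≤-pred (Fin.toℕ<n ν)) (lineAt (toℕ ν) e) off
        by′ (no n) = below-integral κ κ∈ I n off

    corner-integral : ∀ κ → Valid κ → ∀ t → IntegralAt (lookup (simplex κ) (suc (suc t)))
    corner-integral κ ok t = record { coeff = corner κ t ; coeff≥0 = corner≥0 κ ok t ; ∑coeff = ∑-corner κ t ; point≡ = entries-fromEntries (vertex κ) (suc (suc t)) }

    -- A point of the line has the coordinates ν and m - ν at the two omitted vertices, and these
    -- cannot both be 0.
    corner-off-line : ∀ κ → Valid κ → ∀ t → ¬ OnLine (lookup (simplex κ) (suc (suc t)))
    corner-off-line κ@(i , l′ , n , c) ok@(Ai , Al , _) t (ν , e) = ℤ.<-irrefl (sym M≡0) 0<M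
      where
      x : ZPt d
      x = lookup (simplex κ) (suc (suc t))
      same : ∀ j → M * B j + ℤ.+ toℕ ν * ε j ≡ M * corner κ t j
      same j = trans (sym (line-coords {x} {toℕ ν} (lineAt (toℕ ν) e) j)) (integral-coords (corner-integral κ ok t) j)
      ν≡0 : ℤ.+ toℕ ν ≡ 0ℤ
      ν≡0 = trans (sym (coord-on-A (ℤ.+ toℕ ν) i Ai)) (trans (same i) (trans (cong (λ z → M * z) (place-first i l′ (fromLevels K (lev c t)))) (ℤ.*-zeroʳ M)))
      M≡0 : M ≡ 0ℤ
      M≡0 = trans (sym (ℤ.+-identityʳ M)) (trans (cong (λ z → M - z) (sym ν≡0)) (trans (sym (coord-on-B (ℤ.+ toℕ ν) (punchIn i l′) (A≡0⇒B≡1 Al)))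
        (trans (same (punchIn i l′)) (trans (cong (λ z → M * z) (place-second i l′ (fromLevels K (lev c t)))) (ℤ.*-zeroʳ M)))))

    touches : ∀ κ → Valid κ → ∀ t → form κ (entries (simplex κ) t) ≡ height (lookup (simplex κ) t)
    touches κ@(i , l′ , n , c) ok zero = trans (form-line κ {lookup (simplex κ) zero} {n} ok at-n) (trans (cong (λ z → M * M * (z - depth)) (alg (ℤ.+ n))) (sym (height-line {lookup (simplex κ) zero} (ℕ.<⇒≤ (proj₁ (proj₂ (proj₂ ok)))) at-n)))
      where
      at-n : LineAt (lookup (simplex κ) zero) n
      at-n = line (entries-fromEntries (vertex κ) zero)
      alg : ∀ n → (1ℤ + (n + n)) * n - n * (1ℤ + n) ≡ n * n
      alg = solve-∀
    touches κ@(i , l′ , n , c) ok (suc zero) = trans (form-line κ {lookup (simplex κ) (suc zero)} {suc n} ok at-n) (trans (cong (λ z → M * M * (z - depth)) chord≡) (sym (height-line {lookup (simplex κ) (suc zero)} (proj₁ (proj₂ (proj₂ ok))) at-n)))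
      where
      at-n : LineAt (lookup (simplex κ) (suc zero)) (suc n)
      at-n = line (entries-fromEntries (vertex κ) (suc zero))
      alg : ∀ n → (1ℤ + (n + n)) * (1ℤ + n) - n * (1ℤ + n) ≡ (1ℤ + n) * (1ℤ + n)
      alg = solve-∀
      chord≡ : chord (ℤ.+ n) (ℤ.+ suc n) ≡ ℤ.+ suc n * ℤ.+ suc n
      chord≡ = subst (λ z → chord (ℤ.+ n) z ≡ z * z) (sym (ℤ.pos-+ 1 n)) (alg (ℤ.+ n))
    touches κ@(i , l′ , n , c) ok (suc (suc t)) = trans (form-integral κ I) (trans (cong (λ z → M * M * z) (trans (cong₂ (λ y z → chords κ u + (slope-A κ * y + slope-B κ * z)) (place-first i l′ (fromLevels K (lev c t))) (place-second i l′ (fromLevels K (lev c t))))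
        (trans (alg (chords κ u) (slope-A κ) (slope-B κ)) (trans (cong (λ z → z + chords κ u) (sym (gaps-corner κ t))) (sym (Q≡ κ u)))))) (sym (height-integral I (corner-off-line κ ok t))))
      where
      I = corner-integral κ ok t
      u = corner κ t
      alg : ∀ e a b → e + (a * 0ℤ + b * 0ℤ) ≡ 0ℤ + e
      alg = solve-∀

    support : ∀ {σ} → σ ∈ triangulation → Support (dilate k V) height σ
    support {σ} σ∈ = subst (Support (dilate k V) height) (sym σ≡) record { form = form cell ; form-affine = form-affine cell ; touches = touches cell valid ; below = below cell listed valid }
      where open Member (member σ∈)

    hasRegUnimodTriangulation : HasRegUnimodTriangulation (dilate k V)
    hasRegUnimodTriangulation = triangulation
      , ((λ σ∈ → all-lookup (lattice σ∈) , unimod σ∈) , covers , λ σ∈ τ∈ → Supported.intersect (dilate k V) height triangulation support lattice σ∈ τ∈)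
      , Supported.regular (dilate k V) height triangulation support lattice
      where
      lattice : ∀ {σ} → σ ∈ triangulation → ∀ j → LatticeIn (dilate k V) (lookup σ j)
      lattice {σ} σ∈ j = subst (λ τ → LatticeIn (dilate k V) (lookup τ j)) (sym σ≡) (simplex-lattice cell valid j)
        where open Member (member σ∈)
      unimod : ∀ {σ} → σ ∈ triangulation → Unimodular σ
      unimod σ∈ = subst Unimodular (sym σ≡) (unimodular cell valid)
        where open Member (member σ∈)
      all-lookup : ∀ {n} {P : ZPt d → Set} {xs : Vec (ZPt d) n} → (∀ j → P (lookup xs j)) → VAll.All P xs
      all-lookup {xs = []} h = VAll.[]
      all-lookup {xs = x ∷ xs} h = h zero VAll.∷ all-lookup (λ j → h (suc j))

  -- The two implications

  -- For m = 2 the residues 1 and m - 1 coincide, so any signs fit and balanced ones are chosen.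
  -- Otherwise b determines the signs, and Σ b = m k with N = 2k gives (m - 2) Σ ε = 0.
  balanced-signs : ∀ {N} k m → 2 ℕ.≤ m → ℤ.+ N ≡ ℤ.+ k + ℤ.+ k → N ≡ k ℕ.+ k → (b : Fin N → ℤ) → ∑ b ≡ ℤ.+ m * ℤ.+ k → (∀ j → b j ≡ 1ℤ ⊎ b j ≡ ℤ.+ m - 1ℤ) →
    ∃ λ (ε : Fin N → ℤ) → (∀ j → Sign± (ε j)) × ∑ ε ≡ 0ℤ × (∀ j → ∃ λ q → b j ≡ ε j + q * ℤ.+ m)
  balanced-signs {N} k m 2≤m N≡K+K N≡2k b ∑b b± = by (m ℕ.≟ 2)
    where
    M K : ℤ
    M = ℤ.+ m
    K = ℤ.+ k
    Goal : Set
    Goal = ∃ λ (ε : Fin N → ℤ) → (∀ j → Sign± (ε j)) × ∑ ε ≡ 0ℤ × (∀ j → ∃ λ q → b j ≡ ε j + q * M)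
    by : Dec (m ≡ 2) → Goal
    by (yes e) = half-sign k , half-sign± k , ∑-half-sign₀ N k N≡2k , λ j → residue (half-sign k j) (half-sign± k j) (one (b j) (b± j))
      where
      one : ∀ x → x ≡ 1ℤ ⊎ x ≡ M - 1ℤ → x ≡ 1ℤ
      one x (inj₁ p) = p
      one x (inj₂ p) = trans p (cong (λ z → ℤ.+ z - 1ℤ) e)
      residue : ∀ {x} y → Sign± y → x ≡ 1ℤ → ∃ λ q → x ≡ y + q * M
      residue y (inj₁ p) h = 0ℤ , trans h (cong (λ z → z + 0ℤ) (sym p))
      residue y (inj₂ p) h = 1ℤ , trans h (sym (trans (cong₂ (λ z w → z + 1ℤ * ℤ.+ w) p e) refl))
    by (no m≢2) = ε , ε± , *-cancel-zero (∑ ε) (M - ℤ.+ 2) M-2≢0 (trans (ℤ.*-comm (∑ ε) (M - ℤ.+ 2)) ∑ε) , residue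
      where
      sign-by : ∀ {x} → x ≡ 1ℤ ⊎ x ≡ M - 1ℤ → ℤ
      sign-by (inj₁ _) = 1ℤ
      sign-by (inj₂ _) = - 1ℤ
      ε : Fin N → ℤ
      ε j = sign-by (b± j)
      ε± : ∀ j → Sign± (ε j)
      ε± j = by′ (b± j)
        where
        by′ : ∀ {x} (p : x ≡ 1ℤ ⊎ x ≡ M - 1ℤ) → Sign± (sign-by p)
        by′ (inj₁ _) = inj₁ refl
        by′ (inj₂ _) = inj₂ refl
      residue : ∀ j → ∃ λ q → b j ≡ ε j + q * M
      residue j = by′ (b± j)
        where
        alg : ∀ M → M - 1ℤ ≡ - 1ℤ + 1ℤ * M
        alg = solve-∀
        by′ : ∀ {x} (p : x ≡ 1ℤ ⊎ x ≡ M - 1ℤ) → ∃ λ q → x ≡ sign-by p + q * M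
        by′ (inj₁ p) = 0ℤ , p
        by′ (inj₂ p) = 1ℤ , trans p (alg M)
      M-2≢0 : M - ℤ.+ 2 ≢ 0ℤ
      M-2≢0 e = m≢2 (ℤ.+-injective (ℤ.i-j≡0⇒i≡j M (ℤ.+ 2) e))
      doubled : ∀ j → (M - ℤ.+ 2) * ε j ≡ M * 1ℤ + - (ℤ.+ 2) * b j
      doubled j = by′ (b± j)
        where
        alg1 : ∀ M → (M - ℤ.+ 2) * 1ℤ ≡ M * 1ℤ + - (ℤ.+ 2) * 1ℤ
        alg1 = solve-∀
        alg2 : ∀ M → (M - ℤ.+ 2) * - 1ℤ ≡ M * 1ℤ + - (ℤ.+ 2) * (M - 1ℤ)
        alg2 = solve-∀
        by′ : ∀ {x} (p : x ≡ 1ℤ ⊎ x ≡ M - 1ℤ) → (M - ℤ.+ 2) * sign-by p ≡ M * 1ℤ + - (ℤ.+ 2) * x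
        by′ (inj₁ p) = trans (alg1 M) (cong (λ z → M * 1ℤ + - (ℤ.+ 2) * z) (sym p))
        by′ (inj₂ p) = trans (alg2 M) (cong (λ z → M * 1ℤ + - (ℤ.+ 2) * z) (sym p))
      ∑ε : (M - ℤ.+ 2) * ∑ ε ≡ 0ℤ
      ∑ε = trans (*-∑ (M - ℤ.+ 2) ε) (trans (∑-cong doubled) (trans (∑-lin M (- (ℤ.+ 2)) (λ _ → 1ℤ) b) (trans (cong₂ (λ x y → M * x + - (ℤ.+ 2) * y) (trans (∑-one N) N≡K+K) ∑b) (alg M K))))
        where
        alg : ∀ M K → M * (K + K) + - (ℤ.+ 2) * (M * K) ≡ 0ℤ
        alg = solve-∀

  lower-half : ∀ {n} → ℕ → Fin n → ℤ
  lower-half k j with toℕ j ℕ.<? k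
  ... | yes _ = 1ℤ
  ... | no _ = 0ℤ

  lower-half-01 : ∀ {n} k (j : Fin n) → lower-half k j ≡ 1ℤ ⊎ lower-half k j ≡ 0ℤ
  lower-half-01 k j with toℕ j ℕ.<? k
  ... | yes _ = inj₁ refl
  ... | no _ = inj₂ refl

  half-sign≡ : ∀ {n} k (j : Fin n) → half-sign k j ≡ 1ℤ - lower-half k j - lower-half k j
  half-sign≡ k j with toℕ j ℕ.<? k
  ... | yes _ = refl
  ... | no _ = refl

  ∑-lower-half : ∀ N k → N ≡ k ℕ.+ k → ∑ {N} (lower-half k) ≡ ℤ.+ k
  ∑-lower-half N k e = *-cancelˡ′ (ℤ.+ 2) (λ ()) (trans (alg (ℤ.+ N) (∑ (lower-half {N} k))) (trans (cong₂ _-_ N≡ (trans (sym sums) (∑-half-sign₀ N k e))) (alg2 (ℤ.+ k))))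
    where
    alg : ∀ N x → ℤ.+ 2 * x ≡ N - (1ℤ * N + - (ℤ.+ 2) * x)
    alg = solve-∀
    alg2 : ∀ k → k + k - 0ℤ ≡ ℤ.+ 2 * k
    alg2 = solve-∀
    alg3 : ∀ x → 1ℤ - x - x ≡ 1ℤ * 1ℤ + - (ℤ.+ 2) * x
    alg3 = solve-∀
    N≡ : ℤ.+ N ≡ ℤ.+ k + ℤ.+ k
    N≡ = trans (cong ℤ.+_ e) (ℤ.pos-+ k k)
    sums : ∑ {N} (half-sign k) ≡ 1ℤ * ℤ.+ N + - (ℤ.+ 2) * ∑ {N} (lower-half k)
    sums = trans (∑-cong (λ j → trans (half-sign≡ k j) (alg3 (lower-half k j)))) (trans (∑-lin 1ℤ (- (ℤ.+ 2)) (λ _ → 1ℤ) (lower-half {N} k)) (cong (λ z → 1ℤ * z + - (ℤ.+ 2) * ∑ (lower-half {N} k)) (∑-one N)))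

  module _ {d : ℕ} (k m : ℕ) (N≡2k : suc d ≡ k ℕ.+ k) (2≤k : 2 ℕ.≤ k) (2≤m : 2 ℕ.≤ m) (P : Vec (ZPt d) (suc d)) where

    private
      M = ℤ.+ m
      1≤k : 1 ℕ.≤ k
      1≤k = ℕ.≤-trans (ℕ.s≤s ℕ.z≤n) 2≤k
      1≤m : 1 ℕ.≤ m
      1≤m = ℕ.≤-trans (ℕ.s≤s ℕ.z≤n) 2≤m
      m≢0 : M ≢ 0ℤ
      m≢0 e = ℕ.<⇒≢ 1≤m (sym (ℤ.+-injective e))
      k≤d : k ℕ.≤ d
      k≤d = ℕ.≤-pred (subst (suc k ℕ.≤_) (sym N≡2k) (ℕ.+-monoˡ-≤ k 1≤k))

    signLattice-specialSimplex : SignLattice M (entries (specialSimplex d k m)) (half-sign k)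
    signLattice-specialSimplex = by d k≤d
      where
      by : ∀ d → k ℕ.≤ d → SignLattice M (entries (specialSimplex d k m)) (half-sign k)
      by zero le = ⊥-elim (ℕ.<⇒≱ 1≤k le)
      by (suc d′) le = Special.signLattice-special d′ k m le 1≤m

    signLattice⇒triangulation : ∀ (V : Vec (ZPt d) (suc d)) → SignLattice M (entries V) (half-sign k) → HasRegUnimodTriangulation (dilate k V)
    signLattice⇒triangulation = by d N≡2k
      where
      -- `Triangulate` takes d in the form r + 2; since k ≥ 2, the cases d = 0 and d = 1 are
      -- excluded.
      4≤2k : 4 ℕ.≤ k ℕ.+ k
      4≤2k = ℕ.+-mono-≤ 2≤k 2≤k
      by : ∀ d → suc d ≡ k ℕ.+ k → ∀ (V : Vec (ZPt d) (suc d)) → SignLattice M (entries V) (half-sign k) → HasRegUnimodTriangulation (dilate k V)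
      by zero e = ⊥-elim (ℕ.<⇒≱ (ℕ.s≤s (ℕ.s≤s ℕ.z≤n)) (subst (4 ℕ.≤_) (sym e) 4≤2k))
      by (suc zero) e = ⊥-elim (ℕ.<⇒≱ (ℕ.s≤s (ℕ.s≤s (ℕ.s≤s ℕ.z≤n))) (subst (4 ℕ.≤_) (sym e) 4≤2k))
      by (suc (suc r)) e V S = Triangulate.hasRegUnimodTriangulation k m 1≤k 1≤m V upper (lower-half k) kind ∑upper (∑-lower-half (suc (suc (suc r))) k e) (signLattice-cong (half-sign≡ k) S)
        where
        upper : Fin (suc (suc (suc r))) → ℤ
        upper j = 1ℤ - lower-half k j
        kind : ∀ j → (upper j ≡ 1ℤ × lower-half k j ≡ 0ℤ) ⊎ (upper j ≡ 0ℤ × lower-half k j ≡ 1ℤ)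
        kind j = by′ (lower-half-01 k j)
          where
          by′ : lower-half k j ≡ 1ℤ ⊎ lower-half k j ≡ 0ℤ → (upper j ≡ 1ℤ × lower-half k j ≡ 0ℤ) ⊎ (upper j ≡ 0ℤ × lower-half k j ≡ 1ℤ)
          by′ (inj₁ p) = inj₂ (cong (λ z → 1ℤ - z) p , p)
          by′ (inj₂ p) = inj₁ (cong (λ z → 1ℤ - z) p , p)
        ∑upper : ∑ upper ≡ ℤ.+ k
        ∑upper = trans (∑-sub (λ _ → 1ℤ) (lower-half k)) (trans (cong₂ _-_ (trans (∑-one (suc (suc (suc r)))) (trans (cong ℤ.+_ e) (ℤ.pos-+ k k))) (∑-lower-half (suc (suc (suc r))) k e)) (alg (ℤ.+ k)))
          where
          alg : ∀ k → k + k - k ≡ k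
          alg = solve-∀

    cyclicLattice : FullDimSimplex P → DeltaIs1PlusMt^k P k m → CyclicLattice (ℤ.+ k) M (entries P)
    cyclicLattice full (L , ehrhart , δP) = Ehrhart′.cyclic k m N≡2k 1≤k 2≤m P (λ e → full (trans (det≡vol P) e)) L ehrhart (proj₁ values) (proj₂ values)
      where values = ehrhart-values d L k m 1≤k δP

    Signed : (Fin (suc d) → ℤ) → Set
    Signed ε = (∀ j → Sign± (ε j)) × ∑ ε ≡ 0ℤ × SignLattice M (entries P) ε

    signed : CyclicLattice (ℤ.+ k) M (entries P) → HasRegUnimodTriangulation (dilate k P) → ∃ Signed
    signed cyc (T , tri , reg) = by (Extremal.signs k m N≡2k 1≤k 2≤m P cyc T tri reg)
      where
      open Classes k m N≡2k 1≤k P cyc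
      by : (∃ λ X → ∀ j → res X j ≡ 1ℤ ⊎ res X j ≡ M - 1ℤ) → ∃ Signed
      by (X , h) = by′ (balanced-signs k m 2≤m N≡K+K N≡2k (res X) (total (isCoord X)) h)
        where
        by′ : (∃ λ (ε : Fin (suc d) → ℤ) → (∀ j → Sign± (ε j)) × ∑ ε ≡ 0ℤ × (∀ j → ∃ λ q → res X j ≡ ε j + q * M)) → ∃ Signed
        by′ (ε , ε± , ∑ε , cong-ε) = ε , ε± , ∑ε , FromSigns.signLattice k m N≡2k 1≤k P cyc X ε ε± ∑ε cong-ε

    signed⇒special : ∃ Signed → UnimodEquiv P (specialSimplex d k m)
    signed⇒special (ε , ε± , ∑ε , S) = by (sign-permutation (suc d) ε (half-sign k) ε± (half-sign± k) (trans ∑ε (sym (∑-half-sign₀ (suc d) k N≡2k))))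
      where
      by : (∃ λ (π : Permutation (suc d) (suc d)) → ∀ j → ε (π ⟨$⟩ʳ j) ≡ half-sign k j) → UnimodEquiv P (specialSimplex d k m)
      by (π , επ) = signLattice⇒unimodEquiv m≢0 P (specialSimplex d k m) {half-sign k} (∑-half-sign₀ (suc d) k N≡2k) π (signLattice-cong επ (permute-signLattice π S)) signLattice-specialSimplex

    triangulation⇒special : FullDimSimplex P → DeltaIs1PlusMt^k P k m → HasRegUnimodTriangulation (dilate k P) → UnimodEquiv P (specialSimplex d k m)
    triangulation⇒special full δP rut = signed⇒special (signed (cyclicLattice full δP) rut)

    special⇒triangulation : UnimodEquiv P (specialSimplex d k m) → HasRegUnimodTriangulation (dilate k P)
    special⇒triangulation equiv = transfer-triangulation (dilate k P) (dilate k PB.V′) (carry (dilate k P) (dilate k PB.V′) forth) (carry (dilate k PB.V′) (dilate k P) back)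
        (signLattice⇒triangulation PB.V′ PB.signLattice′)
      where
      module PB = PullBack P (specialSimplex d k m) (∑-half-sign₀ (suc d) k N≡2k) signLattice-specialSimplex equiv
      module D = Dilate {d} {suc d} k 1≤k
      0<kq : ∀ {q} → 0ℤ < q → 0ℤ < ℤ.+ k * q
      0<kq hq = 0<-* (ℤ.+<+ 1≤k) hq
      forth : ∀ {X : Fin d → ℤ} {q} → 0ℤ < q → InHull (entries (dilate k P)) X q → InHull (entries (dilate k PB.V′)) X q
      forth hq h = D.redilate PB.V′ (PB.V⇒V′ (0<kq hq) (D.undilate P h))
      back : ∀ {X : Fin d → ℤ} {q} → 0ℤ < q → InHull (entries (dilate k PB.V′)) X q → InHull (entries (dilate k P)) X q
      back hq h = D.redilate P (PB.V′⇒V (0<kq hq) (D.undilate PB.V′ h))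
      carry : ∀ (V W : Vec (ZPt d) (suc d)) → (∀ {X : Fin d → ℤ} {q} → 0ℤ < q → InHull (entries V) X q → InHull (entries W) X q) → ∀ x → InConv V x → InConv W x
      carry V W f x h = let (q , hq , X , rx) = common-denominator x in hull⇒conv W x X q hq rx (f hq (hull-Represents V x hq rx h))

  dimension : ∀ k → 1 ℕ.≤ k → suc (2 ℕ.* k ℕ.∸ 1) ≡ k ℕ.+ k
  dimension (suc k) _ = cong (λ z → suc (k ℕ.+ z)) (ℕ.+-identityʳ (suc k))

open import Defs
open import Data.Nat using (ℕ; suc; _≤_; _*_; _∸_)
open import Data.Vec using (Vec)
open import Function.Bundles using (_⇔_; mk⇔)
open import Data.Nat.Properties using (≤-trans; n≤1+n)

mainTheorem1 : (k : ℕ) → 2 ≤ k → (m : ℕ) → 2 ≤ m →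
    (P : Vec (ZPt (2 * k ∸ 1)) (suc (2 * k ∸ 1))) →
    FullDimSimplex P → EmptySimplex P → DeltaIs1PlusMt^k P k m →
    HasRegUnimodTriangulation (dilate k P) ⇔ UnimodEquiv P (specialSimplex (2 * k ∸ 1) k m)
mainTheorem1 k 2≤k m 2≤m P full _ δP =
  mk⇔ (Triangulations.triangulation⇒special k m (Triangulations.dimension k (≤-trans (n≤1+n 1) 2≤k)) 2≤k 2≤m P full δP)
      (Triangulations.special⇒triangulation k m (Triangulations.dimension k (≤-trans (n≤1+n 1) 2≤k)) 2≤k 2≤m P)
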